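{- There exist absolute constants $C,k>0$ such that the following holds for every prime power $q$. Let $A,X\subseteq\mathbb{F}_q^*$ be sets and $K$ be a positive real number. Suppose \[ C(\log q)^kK^{1504}\le |X|,\qquad C(\log q)^k q^{1/4}K^4\le |X|<q^{1/2},\qquad C(\log q)^k q^{1/2}K^{85}\le |A|\le q^{2/3}, \] and $E(A,\xi A)\ge |A|^3/K$ for all $\xi\in X$. Then there exist a subfield $F\subseteq\mathbb{F}_q$ of cardinality $q^{1/3}$, an element $\bar a\in A$, and a two-dimensional vector space $V\subseteq\mathbb{F}_q$ over $F$ such that \[ |(A-\bar a)\cap V|\ \ge\ C^{ -1}(\log q)^{ -k}K^{ -85}|A|. \]
   Context: $\mathbb{F}_q$ is the finite field with $q$ elements, $\mathbb{F}_q^*=\mathbb{F}_q\setminus\{0\}$. For $A\subseteq\mathbb{F}_q$ and $\xi\in\mathbb{F}_q^*$, $E(A,\xi A)=|\{(a_1,a_2,a_3,a_4)\in A^4: a_1-a_2=\xi(a_3-a_4)\}|$. Also $A-\bar a=\{a-\bar a:a\in A\}$. -}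

module Defs where

open import Algebra.Bundles using (CommutativeRing)
import Algebra.Definitions.RawMonoid as RawMonoidDefs
open import Data.Fin.Base as Fin using (Fin)
import Data.Fin.Properties as Fin
open import Data.Fin.Subset as Sub using (Subset; ⁅_⁆; ⋃)
import Data.Fin.Subset.Properties as Sub
import Data.Integer.Base as ℤ
import Data.Integer.Properties as ℤ
open import Data.List.Base using (List; allFin; cartesianProduct; filter; length; map)
open import Data.Nat.Base as ℕ using (ℕ; zero; suc; s≤s; z≤n)
import Data.Nat.Properties as ℕ
open import Data.Nat.Primality using (Prime; prime⇒nonTrivial)
open import Data.Product.Base using (Σ; ∃; ∃₂; _×_; _,_; proj₁; proj₂)
open import Data.Rational.Base as ℚ using (ℚ; mkℚ; 0ℚ; 1ℚ; toℚᵘ)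
import Data.Rational.Properties as ℚ
open import Data.Rational.Unnormalised.Base as ℚᵘ using (mkℚᵘ)
import Data.Rational.Unnormalised.Properties as ℚᵘ
open import Data.Sum.Base using (inj₁; inj₂)
open import Function.Bundles using (Inverse)
open import Level using (0ℓ)
open import Relation.Binary.PropositionalEquality as ≡
  using (_≡_; refl; sym; trans; cong; cong₂; subst)
open import Relation.Nullary using (¬_; Dec; yes; no; contradiction)
open import Relation.Nullary.Decidable using (map′)

-- A nonnegative real number is presented by a set of rational lower
-- bounds and a set of rational upper bounds that come arbitrarily close
-- to each other.  The two sets generate a Dedekind cut; they are not
-- required to be downward, respectively upward, closed.

record ℝ≥0 : Set₁ where
  field
    Lower   : ℚ → Set
    Upper   : ℚ → Set
    nonNeg  : ∀ {a} → Lower a → 0ℚ ℚ.≤ a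
    ordered : ∀ {a b} → Lower a → Upper b → a ℚ.≤ b
    close   : ∀ ε → 0ℚ ℚ.< ε →
              ∃₂ λ a b → Lower a × Upper b × b ℚ.≤ a ℚ.+ ε

open ℝ≥0

infix 4 _≤_ _<_ _≃_

_≤_ : ℝ≥0 → ℝ≥0 → Set
x ≤ y = ∀ {a b} → Lower x a → Upper y b → a ℚ.≤ b

_<_ : ℝ≥0 → ℝ≥0 → Set
x < y = ∃₂ λ b a → Upper x b × Lower y a × b ℚ.< a

_≃_ : ℝ≥0 → ℝ≥0 → Set
x ≃ y = x ≤ y × y ≤ x

record Positive (x : ℝ≥0) : Set where
  constructor mkPositive
  field
    {bound} : ℚ
    isLower : Lower x bound
    0<bound : 0ℚ ℚ.< bound

module ℚ-Order where

  *-monoˡ : ∀ {r p q} → 0ℚ ℚ.≤ r → p ℚ.≤ q → r ℚ.* p ℚ.≤ r ℚ.* q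
  *-monoˡ {r} 0≤r = ℚ.*-monoˡ-≤-nonNeg r {{ℚ.nonNegative 0≤r}}

  *-monoʳ : ∀ {r p q} → 0ℚ ℚ.≤ r → p ℚ.≤ q → p ℚ.* r ℚ.≤ q ℚ.* r
  *-monoʳ {r} 0≤r = ℚ.*-monoʳ-≤-nonNeg r {{ℚ.nonNegative 0≤r}}

  *-mono : ∀ {p q r s} → 0ℚ ℚ.≤ p → 0ℚ ℚ.≤ s → p ℚ.≤ q → r ℚ.≤ s →
           p ℚ.* r ℚ.≤ q ℚ.* s
  *-mono 0≤p 0≤s p≤q r≤s = ℚ.≤-trans (*-monoˡ 0≤p r≤s) (*-monoʳ 0≤s p≤q)

  *-cancelʳ : ∀ {r p q} → 0ℚ ℚ.< r → p ℚ.* r ℚ.≤ q ℚ.* r → p ℚ.≤ q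
  *-cancelʳ {r} 0<r = ℚ.*-cancelʳ-≤-pos r {{ℚ.positive 0<r}}

  0≤* : ∀ {p q} → 0ℚ ℚ.≤ p → 0ℚ ℚ.≤ q → 0ℚ ℚ.≤ p ℚ.* q
  0≤* {p} {q} 0≤p 0≤q = subst (ℚ._≤ p ℚ.* q) (ℚ.*-zeroʳ p) (*-monoˡ 0≤p 0≤q)

  0<* : ∀ {p q} → 0ℚ ℚ.< p → 0ℚ ℚ.< q → 0ℚ ℚ.< p ℚ.* q
  0<* {p} {q} 0<p 0<q =
    ℚ.positive⁻¹ (p ℚ.* q)
      {{ℚ.pos*pos⇒pos p {{ℚ.positive 0<p}} q {{ℚ.positive 0<q}}}}

  0<1 : 0ℚ ℚ.< 1ℚ
  0<1 = ℚ.positive⁻¹ 1ℚ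

  p≤p+q : ∀ {p q} → 0ℚ ℚ.≤ q → p ℚ.≤ p ℚ.+ q
  p≤p+q {p} {q} 0≤q = subst (ℚ._≤ p ℚ.+ q) (ℚ.+-identityʳ p) (ℚ.+-monoʳ-≤ p 0≤q)

  0≤+ : ∀ {p q} → 0ℚ ℚ.≤ p → 0ℚ ℚ.≤ q → 0ℚ ℚ.≤ p ℚ.+ q
  0≤+ 0≤p 0≤q = ℚ.≤-trans 0≤p (p≤p+q 0≤q)

  0<+ : ∀ {p q} → 0ℚ ℚ.≤ p → 0ℚ ℚ.< q → 0ℚ ℚ.< p ℚ.+ q
  0<+ 0≤p 0<q = ℚ.+-mono-≤-< 0≤p 0<q

  recip : ∀ m → 0ℚ ℚ.< m → ∃ λ c → 0ℚ ℚ.< c × c ℚ.* m ≡ 1ℚ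
  recip m 0<m =
    ℚ.1/ m , ℚ.positive⁻¹ (ℚ.1/ m) {{ℚ.1/pos⇒pos m}} , ℚ.*-inverseˡ m
    where instance _ = ℚ.positive 0<m
                   _ = ℚ.pos⇒nonZero m

open ℚ-Order

infixr 8 _^ᵠ_

_^ᵠ_ : ℚ → ℕ → ℚ
p ^ᵠ zero  = 1ℚ
p ^ᵠ suc n = p ℚ.* p ^ᵠ n

fromℕᵠ : ℕ → ℚ
fromℕᵠ n = ℤ.+ n ℚ./ 1

module Fromℕᵠ where

  fromℕᵠ-suc : ∀ n → fromℕᵠ (suc n) ≡ 1ℚ ℚ.+ fromℕᵠ n
  fromℕᵠ-suc n = ℚ.toℚᵘ-injective (begin
    toℚᵘ (fromℕᵠ (suc n))                 ≈⟨ ℚ.toℚᵘ-fromℚᵘ (mkℚᵘ (ℤ.+ suc n) 0) ⟩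
    mkℚᵘ (ℤ.+ suc n) 0                    ≈⟨ ℚᵘ.*≡* (lem (ℤ.+ n)) ⟩
    mkℚᵘ (ℤ.+ 1) 0 ℚᵘ.+ mkℚᵘ (ℤ.+ n) 0    ≈⟨ ℚᵘ.+-congʳ (mkℚᵘ (ℤ.+ 1) 0) (ℚ.toℚᵘ-fromℚᵘ (mkℚᵘ (ℤ.+ n) 0)) ⟨
    toℚᵘ 1ℚ ℚᵘ.+ toℚᵘ (fromℕᵠ n)          ≈⟨ ℚ.toℚᵘ-homo-+ 1ℚ (fromℕᵠ n) ⟨
    toℚᵘ (1ℚ ℚ.+ fromℕᵠ n)                ∎)
    where
    open ℚᵘ.≃-Reasoning
    lem : ∀ z → (ℤ.1ℤ ℤ.+ z) ℤ.* ℤ.1ℤ ≡ (ℤ.1ℤ ℤ.+ z ℤ.* ℤ.1ℤ) ℤ.* ℤ.1ℤ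
    lem z = cong (λ w → (ℤ.1ℤ ℤ.+ w) ℤ.* ℤ.1ℤ) (sym (ℤ.*-identityʳ z))

  0≤fromℕᵠ : ∀ n → 0ℚ ℚ.≤ fromℕᵠ n
  0≤fromℕᵠ zero    = ℚ.≤-refl
  0≤fromℕᵠ (suc n) =
    subst (0ℚ ℚ.≤_) (sym (fromℕᵠ-suc n)) (0≤+ (ℚ.<⇒≤ 0<1) (0≤fromℕᵠ n))

  0<fromℕᵠ : ∀ n → 0ℚ ℚ.< fromℕᵠ (suc n)
  0<fromℕᵠ n = subst (0ℚ ℚ.<_) (trans (ℚ.+-comm (fromℕᵠ n) 1ℚ) (sym (fromℕᵠ-suc n)))
                 (0<+ (0≤fromℕᵠ n) 0<1)

  fromℕᵠ-+ : ∀ m n → fromℕᵠ (m ℕ.+ n) ≡ fromℕᵠ m ℚ.+ fromℕᵠ n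
  fromℕᵠ-+ zero    n = sym (ℚ.+-identityˡ (fromℕᵠ n))
  fromℕᵠ-+ (suc m) n = begin
    fromℕᵠ (suc (m ℕ.+ n))               ≡⟨ fromℕᵠ-suc (m ℕ.+ n) ⟩
    1ℚ ℚ.+ fromℕᵠ (m ℕ.+ n)              ≡⟨ cong (1ℚ ℚ.+_) (fromℕᵠ-+ m n) ⟩
    1ℚ ℚ.+ (fromℕᵠ m ℚ.+ fromℕᵠ n)       ≡⟨ ℚ.+-assoc 1ℚ (fromℕᵠ m) (fromℕᵠ n) ⟨
    1ℚ ℚ.+ fromℕᵠ m ℚ.+ fromℕᵠ n         ≡⟨ cong (ℚ._+ fromℕᵠ n) (fromℕᵠ-suc m) ⟨
    fromℕᵠ (suc m) ℚ.+ fromℕᵠ n          ∎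
    where open ≡.≡-Reasoning

  suc-* : ∀ m p → fromℕᵠ (suc m) ℚ.* p ≡ p ℚ.+ fromℕᵠ m ℚ.* p
  suc-* m p = begin
    fromℕᵠ (suc m) ℚ.* p                 ≡⟨ cong (ℚ._* p) (fromℕᵠ-suc m) ⟩
    (1ℚ ℚ.+ fromℕᵠ m) ℚ.* p              ≡⟨ ℚ.*-distribʳ-+ p 1ℚ (fromℕᵠ m) ⟩
    1ℚ ℚ.* p ℚ.+ fromℕᵠ m ℚ.* p          ≡⟨ cong (ℚ._+ fromℕᵠ m ℚ.* p) (ℚ.*-identityˡ p) ⟩
    p ℚ.+ fromℕᵠ m ℚ.* p                 ∎
    where open ≡.≡-Reasoning

  fromℕᵠ-* : ∀ m n → fromℕᵠ (m ℕ.* n) ≡ fromℕᵠ m ℚ.* fromℕᵠ n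
  fromℕᵠ-* zero    n = sym (ℚ.*-zeroˡ (fromℕᵠ n))
  fromℕᵠ-* (suc m) n = begin
    fromℕᵠ (n ℕ.+ m ℕ.* n)               ≡⟨ fromℕᵠ-+ n (m ℕ.* n) ⟩
    fromℕᵠ n ℚ.+ fromℕᵠ (m ℕ.* n)        ≡⟨ cong (fromℕᵠ n ℚ.+_) (fromℕᵠ-* m n) ⟩
    fromℕᵠ n ℚ.+ fromℕᵠ m ℚ.* fromℕᵠ n   ≡⟨ suc-* m (fromℕᵠ n) ⟨
    fromℕᵠ (suc m) ℚ.* fromℕᵠ n          ∎
    where open ≡.≡-Reasoning

  fromℕᵠ-mono : ∀ {m n} → m ℕ.≤ n → fromℕᵠ m ℚ.≤ fromℕᵠ n
  fromℕᵠ-mono {m} {n} m≤n =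
    subst (fromℕᵠ m ℚ.≤_) (trans (sym (fromℕᵠ-+ m _)) (cong fromℕᵠ (ℕ.m+[n∸m]≡n m≤n)))
      (p≤p+q (0≤fromℕᵠ (n ℕ.∸ m)))

  ≤fromℕᵠ : ∀ p → ∃ λ n → p ℚ.≤ fromℕᵠ n
  ≤fromℕᵠ p@(mkℚ (ℤ.+ k) d _) = k , ℚ.toℚᵘ-cancel-≤ (begin
    mkℚᵘ (ℤ.+ k) d      ≤⟨ ℚᵘ.*≤* (ℤ.*-monoˡ-≤-nonNeg (ℤ.+ k) (ℤ.+≤+ (s≤s (z≤n {d})))) ⟩
    mkℚᵘ (ℤ.+ k) 0      ≃⟨ ℚ.toℚᵘ-fromℚᵘ (mkℚᵘ (ℤ.+ k) 0) ⟨
    toℚᵘ (fromℕᵠ k)     ∎)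
    where open ℚᵘ.≤-Reasoning
  ≤fromℕᵠ p@(mkℚ ℤ.-[1+ k ] d _) = 0 , ℚ.<⇒≤ (ℚ.negative⁻¹ p)

  archimedean : ∀ {ε} p → 0ℚ ℚ.< ε → ∃ λ n → p ℚ.≤ fromℕᵠ n ℚ.* ε
  archimedean {ε} p 0<ε with recip ε 0<ε
  ... | c , 0<c , cε≡1 with ≤fromℕᵠ (p ℚ.* c)
  ...   | n , pc≤n = n , (begin
    p                    ≡⟨ ℚ.*-identityʳ p ⟨
    p ℚ.* 1ℚ             ≡⟨ cong (p ℚ.*_) cε≡1 ⟨
    p ℚ.* (c ℚ.* ε)      ≡⟨ ℚ.*-assoc p c ε ⟨
    p ℚ.* c ℚ.* ε        ≤⟨ *-monoʳ (ℚ.<⇒≤ 0<ε) pc≤n ⟩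
    fromℕᵠ n ℚ.* ε       ∎)
    where open ℚ.≤-Reasoning

  0≤^ : ∀ {p} n → 0ℚ ℚ.≤ p → 0ℚ ℚ.≤ p ^ᵠ n
  0≤^ zero    0≤p = ℚ.<⇒≤ 0<1
  0≤^ (suc n) 0≤p = 0≤* 0≤p (0≤^ n 0≤p)

  0<^ : ∀ {p} n → 0ℚ ℚ.< p → 0ℚ ℚ.< p ^ᵠ n
  0<^ zero    0<p = 0<1
  0<^ (suc n) 0<p = 0<* 0<p (0<^ n 0<p)

  ^-mono : ∀ {p q} n → 0ℚ ℚ.≤ p → p ℚ.≤ q → p ^ᵠ n ℚ.≤ q ^ᵠ n
  ^-mono zero    0≤p p≤q = ℚ.≤-refl
  ^-mono (suc n) 0≤p p≤q =
    *-mono 0≤p (0≤^ n (ℚ.≤-trans 0≤p p≤q)) p≤q (^-mono n 0≤p p≤q)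

  ^-mono-< : ∀ {p q} n → 0ℚ ℚ.≤ p → p ℚ.< q → p ^ᵠ suc n ℚ.< q ^ᵠ suc n
  ^-mono-< {p} {q} n 0≤p p<q = ℚ.≤-<-trans
    (*-monoˡ 0≤p (^-mono n 0≤p (ℚ.<⇒≤ p<q)))
    (ℚ.*-monoˡ-<-pos (q ^ᵠ n) {{ℚ.positive (0<^ n (ℚ.≤-<-trans 0≤p p<q))}} p<q)

  1≤^ : ∀ {p} n → 1ℚ ℚ.≤ p → 1ℚ ℚ.≤ p ^ᵠ n
  1≤^ zero    1≤p = ℚ.≤-refl
  1≤^ (suc n) 1≤p = *-mono {1ℚ} {_} {1ℚ} (ℚ.<⇒≤ 0<1)
    (0≤^ n (ℚ.≤-trans (ℚ.<⇒≤ 0<1) 1≤p)) 1≤p (1≤^ n 1≤p)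

open Fromℕᵠ

ι : ℕ → ℝ≥0
ι n .Lower a                  = a ≡ fromℕᵠ n
ι n .Upper b                  = b ≡ fromℕᵠ n
ι n .nonNeg refl              = 0≤fromℕᵠ n
ι n .ordered refl refl        = ℚ.≤-refl
ι n .close ε 0<ε              =
  fromℕᵠ n , fromℕᵠ n , refl , refl , p≤p+q (ℚ.<⇒≤ 0<ε)

module ProductLemmas where

  +-*-+ : ∀ a b d → (a ℚ.+ d) ℚ.* (b ℚ.+ d) ≡ a ℚ.* b ℚ.+ d ℚ.* (a ℚ.+ (b ℚ.+ d))
  +-*-+ a b d = begin
    (a ℚ.+ d) ℚ.* (b ℚ.+ d)                        ≡⟨ ℚ.*-distribʳ-+ (b ℚ.+ d) a d ⟩
    a ℚ.* (b ℚ.+ d) ℚ.+ d ℚ.* (b ℚ.+ d)            ≡⟨ cong (ℚ._+ d ℚ.* (b ℚ.+ d)) (ℚ.*-distribˡ-+ a b d) ⟩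
    a ℚ.* b ℚ.+ a ℚ.* d ℚ.+ d ℚ.* (b ℚ.+ d)        ≡⟨ ℚ.+-assoc (a ℚ.* b) (a ℚ.* d) (d ℚ.* (b ℚ.+ d)) ⟩
    a ℚ.* b ℚ.+ (a ℚ.* d ℚ.+ d ℚ.* (b ℚ.+ d))      ≡⟨ cong (λ t → a ℚ.* b ℚ.+ (t ℚ.+ d ℚ.* (b ℚ.+ d))) (ℚ.*-comm a d) ⟩
    a ℚ.* b ℚ.+ (d ℚ.* a ℚ.+ d ℚ.* (b ℚ.+ d))      ≡⟨ cong (a ℚ.* b ℚ.+_) (ℚ.*-distribˡ-+ d a (b ℚ.+ d)) ⟨
    a ℚ.* b ℚ.+ d ℚ.* (a ℚ.+ (b ℚ.+ d))            ∎
    where open ≡.≡-Reasoning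

open ProductLemmas

infixl 7 _*_

_*_ : ℝ≥0 → ℝ≥0 → ℝ≥0
(x * y) .Lower c = ∃₂ λ a b → Lower x a × Lower y b × c ≡ a ℚ.* b
(x * y) .Upper c = ∃₂ λ a b → Upper x a × Upper y b × c ≡ a ℚ.* b
(x * y) .nonNeg (a , b , la , lb , refl) = 0≤* (nonNeg x la) (nonNeg y lb)
(x * y) .ordered (a , b , la , lb , refl) (c , d , uc , ud , refl) =
  *-mono (nonNeg x la) (ℚ.≤-trans (nonNeg y lb) b≤d) (ordered x la uc) b≤d
  where b≤d = ordered y lb ud
(x * y) .close ε 0<ε
  with _ , u₀ , l₀ , U₀ , _ ← close x 1ℚ 0<1
  with _ , v₀ , m₀ , V₀ , _ ← close y 1ℚ 0<1
  with 0≤u₀ ← ℚ.≤-trans (nonNeg x l₀) (ordered x l₀ U₀)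
  with 0≤v₀ ← ℚ.≤-trans (nonNeg y m₀) (ordered y m₀ V₀)
  with r , 0<r , rM≡1 ← recip (u₀ ℚ.+ (v₀ ℚ.+ 1ℚ)) (0<+ 0≤u₀ (0<+ 0≤v₀ 0<1))
  = product
  where
  M = u₀ ℚ.+ (v₀ ℚ.+ 1ℚ)
  δ = (ε ℚ.* r) ℚ.⊓ 1ℚ
  0<δ : 0ℚ ℚ.< δ
  0<δ with ℚ.⊓-sel (ε ℚ.* r) 1ℚ
  ... | inj₁ eq = subst (0ℚ ℚ.<_) (sym eq) (0<* 0<ε 0<r)
  ... | inj₂ eq = subst (0ℚ ℚ.<_) (sym eq) 0<1
  0≤δ = ℚ.<⇒≤ 0<δ
  δM≤ε : δ ℚ.* M ℚ.≤ ε
  δM≤ε = begin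
    δ ℚ.* M               ≤⟨ *-monoʳ (0≤+ 0≤u₀ (0≤+ 0≤v₀ (ℚ.<⇒≤ 0<1))) (ℚ.p⊓q≤p (ε ℚ.* r) 1ℚ) ⟩
    ε ℚ.* r ℚ.* M         ≡⟨ ℚ.*-assoc ε r M ⟩
    ε ℚ.* (r ℚ.* M)       ≡⟨ cong (ε ℚ.*_) rM≡1 ⟩
    ε ℚ.* 1ℚ              ≡⟨ ℚ.*-identityʳ ε ⟩
    ε                     ∎
    where open ℚ.≤-Reasoning
  product : ∃₂ λ c d → Lower (x * y) c × Upper (x * y) d × d ℚ.≤ c ℚ.+ ε
  product
    with a , u , la , uu , u≤a+δ ← close x δ 0<δ
    with b , v , lb , uv , v≤b+δ ← close y δ 0<δ
    = a ℚ.* b , u ℚ.* v , (a , b , la , lb , refl) , (u , v , uu , uv , refl) , (begin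
    u ℚ.* v                                   ≤⟨ *-mono (ℚ.≤-trans (nonNeg x la) (ordered x la uu)) (0≤+ (nonNeg y lb) 0≤δ) u≤a+δ v≤b+δ ⟩
    (a ℚ.+ δ) ℚ.* (b ℚ.+ δ)                   ≡⟨ +-*-+ a b δ ⟩
    a ℚ.* b ℚ.+ δ ℚ.* (a ℚ.+ (b ℚ.+ δ))       ≤⟨ ℚ.+-monoʳ-≤ (a ℚ.* b) (*-monoˡ 0≤δ (ℚ.+-mono-≤ (ordered x la U₀) (ℚ.+-mono-≤ (ordered y lb V₀) (ℚ.p⊓q≤q (ε ℚ.* r) 1ℚ)))) ⟩
    a ℚ.* b ℚ.+ δ ℚ.* M                       ≤⟨ ℚ.+-monoʳ-≤ (a ℚ.* b) δM≤ε ⟩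
    a ℚ.* b ℚ.+ ε                             ∎)
    where open ℚ.≤-Reasoning

infixr 8 _^_

_^_ : ℝ≥0 → ℕ → ℝ≥0
x ^ zero  = ι 1
x ^ suc n = x * x ^ n

module InverseLemmas where

  greater : ∀ x a b → Lower x a → Lower x b → ∃ λ l → Lower x l × a ℚ.≤ l × b ℚ.≤ l
  greater x a b la lb with ℚ.≤-total a b
  ... | inj₁ a≤b = b , lb , a≤b , ℚ.≤-refl
  ... | inj₂ b≤a = a , la , ℚ.≤-refl , b≤a

open InverseLemmas

infix 9 _⁻¹

_⁻¹ : (x : ℝ≥0) {{_ : Positive x}} → ℝ≥0
(x ⁻¹) .Lower c = 0ℚ ℚ.≤ c × ∃ λ u → Upper x u × c ℚ.* u ℚ.≤ 1ℚ
(x ⁻¹) .Upper c = 0ℚ ℚ.≤ c × ∃ λ l → Lower x l × 1ℚ ℚ.≤ c ℚ.* l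
(x ⁻¹) .nonNeg  = proj₁
_⁻¹ x {{mkPositive l₀ 0<l₀}} .ordered (0≤c , u , U , cu≤1) (0≤d , l , L , 1≤dl) =
  *-cancelʳ (ℚ.<-≤-trans 0<l₀ (ordered x l₀ U))
    (ℚ.≤-trans cu≤1 (ℚ.≤-trans 1≤dl (*-monoˡ 0≤d (ordered x L U))))
_⁻¹ x {{mkPositive {a} l₀ 0<a}} .close ε 0<ε
  with b , u , L , U , u≤b+δ ← close x (ε ℚ.* (a ℚ.* a)) (0<* 0<ε (0<* 0<a 0<a))
  with c , 0<c , cu≡1 ← recip u (ℚ.<-≤-trans 0<a (ordered x l₀ U))
  with l , L′ , a≤l , b≤l ← greater x a b l₀ L
  with d , 0<d , dl≡1 ← recip l (ℚ.<-≤-trans 0<a a≤l)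
  = c , d , (ℚ.<⇒≤ 0<c , u , U , ℚ.≤-reflexive cu≡1)
          , (ℚ.<⇒≤ 0<d , l , L′ , ℚ.≤-reflexive (sym dl≡1))
          , *-cancelʳ (0<* (ℚ.<-≤-trans 0<a (ordered x l₀ U)) (ℚ.<-≤-trans 0<a a≤l)) (begin
    d ℚ.* (u ℚ.* l)                               ≡⟨ cong (d ℚ.*_) (ℚ.*-comm u l) ⟩
    d ℚ.* (l ℚ.* u)                               ≡⟨ ℚ.*-assoc d l u ⟨
    d ℚ.* l ℚ.* u                                 ≡⟨ cong (ℚ._* u) dl≡1 ⟩
    1ℚ ℚ.* u                                      ≡⟨ ℚ.*-identityˡ u ⟩
    u                                             ≤⟨ bound l L′ a≤l b≤l U u≤b+δ ⟩
    l ℚ.+ ε ℚ.* (u ℚ.* l)                         ≡⟨ cong (ℚ._+ ε ℚ.* (u ℚ.* l)) (ℚ.*-identityˡ l) ⟨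
    1ℚ ℚ.* l ℚ.+ ε ℚ.* (u ℚ.* l)                  ≡⟨ cong (λ t → t ℚ.* l ℚ.+ ε ℚ.* (u ℚ.* l)) cu≡1 ⟨
    c ℚ.* u ℚ.* l ℚ.+ ε ℚ.* (u ℚ.* l)             ≡⟨ cong (ℚ._+ ε ℚ.* (u ℚ.* l)) (ℚ.*-assoc c u l) ⟩
    c ℚ.* (u ℚ.* l) ℚ.+ ε ℚ.* (u ℚ.* l)           ≡⟨ ℚ.*-distribʳ-+ (u ℚ.* l) c ε ⟨
    (c ℚ.+ ε) ℚ.* (u ℚ.* l)                       ∎)
  where
  open ℚ.≤-Reasoning
  bound : ∀ {b u} l → Lower x l → a ℚ.≤ l → b ℚ.≤ l → Upper x u →
          u ℚ.≤ b ℚ.+ ε ℚ.* (a ℚ.* a) → u ℚ.≤ l ℚ.+ ε ℚ.* (u ℚ.* l)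
  bound l L′ a≤l b≤l U u≤b+δ = ℚ.≤-trans u≤b+δ
    (ℚ.+-mono-≤ b≤l (*-monoˡ (ℚ.<⇒≤ 0<ε)
      (*-mono (ℚ.<⇒≤ 0<a) (ℚ.≤-trans (ℚ.<⇒≤ 0<a) a≤l) (ordered x l₀ U) a≤l)))

infixl 7 _/_

_/_ : (x y : ℝ≥0) {{_ : Positive y}} → ℝ≥0
x / y = x * y ⁻¹

module RootLemmas where

  ^-cancel-≤ : ∀ {a b} n → 0ℚ ℚ.≤ b → a ^ᵠ suc n ℚ.≤ b ^ᵠ suc n → a ℚ.≤ b
  ^-cancel-≤ {a} {b} n 0≤b aⁿ≤bⁿ =
    ℚ.≮⇒≥ (λ b<a → ℚ.<-irrefl refl (ℚ.<-≤-trans (^-mono-< n 0≤b b<a) aⁿ≤bⁿ))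

  search : ∀ {P : ℕ → Set} → (∀ j → Dec (P j)) → P 0 →
           ∀ J → ¬ P J → ∃ λ j → P j × ¬ P (suc j)
  search P? P0 zero    ¬P0 = contradiction P0 ¬P0
  search P? P0 (suc J) ¬P with P? J
  ... | yes PJ = J , PJ , ¬P
  ... | no ¬PJ = search P? P0 J ¬PJ

  <^ : ∀ {Q z} n → 0ℚ ℚ.≤ Q → 1ℚ ℚ.+ Q ℚ.≤ z → Q ℚ.< z ^ᵠ suc n
  <^ {Q} {z} n 0≤Q 1+Q≤z = begin-strict
    Q                    ≡⟨ ℚ.+-identityˡ Q ⟨
    0ℚ ℚ.+ Q             <⟨ ℚ.+-monoˡ-< Q 0<1 ⟩
    1ℚ ℚ.+ Q             ≤⟨ 1+Q≤z ⟩
    z                    ≡⟨ ℚ.*-identityʳ z ⟨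
    z ℚ.* 1ℚ             ≤⟨ *-monoˡ (ℚ.≤-trans (ℚ.<⇒≤ 0<1) 1≤z) (1≤^ n 1≤z) ⟩
    z ^ᵠ suc n           ∎
    where
    open ℚ.≤-Reasoning
    1≤z = ℚ.≤-trans (p≤p+q 0≤Q) 1+Q≤z

  approximateRoot : ∀ {Q ε} n → 0ℚ ℚ.≤ Q → 0ℚ ℚ.< ε →
    ∃ λ a → 0ℚ ℚ.≤ a × a ^ᵠ suc n ℚ.≤ Q × Q ℚ.≤ (a ℚ.+ ε) ^ᵠ suc n
  approximateRoot {Q} {ε} n 0≤Q 0<ε =
    let J , 1+Q≤Jε    = archimedean (1ℚ ℚ.+ Q) 0<ε
        j , Pj , ¬Pj+1 = search {P} (λ j → (fromℕᵠ j ℚ.* ε) ^ᵠ suc n ℚ.≤? Q) P0 J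
                           (λ PJ → ℚ.<-irrefl refl (ℚ.<-≤-trans (<^ n 0≤Q 1+Q≤Jε) PJ))
    in fromℕᵠ j ℚ.* ε , 0≤* (0≤fromℕᵠ j) (ℚ.<⇒≤ 0<ε) , Pj ,
       subst (λ z → Q ℚ.≤ z ^ᵠ suc n) (trans (suc-* j ε) (ℚ.+-comm ε (fromℕᵠ j ℚ.* ε)))
         (ℚ.<⇒≤ (ℚ.≰⇒> ¬Pj+1))
    where
    P : ℕ → Set
    P j = (fromℕᵠ j ℚ.* ε) ^ᵠ suc n ℚ.≤ Q
    P0 : P 0
    P0 = subst (ℚ._≤ Q)
      (sym (trans (cong (ℚ._* (fromℕᵠ 0 ℚ.* ε) ^ᵠ n) (ℚ.*-zeroˡ ε)) (ℚ.*-zeroˡ ((fromℕᵠ 0 ℚ.* ε) ^ᵠ n)))) 0≤Q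

open RootLemmas

infix 9 _^[_/_]

-- q ^[ p / n ] is the n-th root of q ^ p.

_^[_/_] : ℕ → ℕ → (n : ℕ) .{{_ : ℕ.NonZero n}} → ℝ≥0
(q ^[ p / n ]) .Lower a = 0ℚ ℚ.≤ a × a ^ᵠ n ℚ.≤ fromℕᵠ (q ℕ.^ p)
(q ^[ p / n ]) .Upper b = 0ℚ ℚ.≤ b × fromℕᵠ (q ℕ.^ p) ℚ.≤ b ^ᵠ n
(q ^[ p / n ]) .nonNeg  = proj₁
(q ^[ p / suc n ]) .ordered (0≤a , aⁿ≤Q) (0≤b , Q≤bⁿ) =
  ^-cancel-≤ n 0≤b (ℚ.≤-trans aⁿ≤Q Q≤bⁿ)
(q ^[ p / suc n ]) .close ε 0<ε =
  let a , 0≤a , aⁿ≤Q , Q≤bⁿ = approximateRoot {fromℕᵠ (q ℕ.^ p)} {ε} n (0≤fromℕᵠ (q ℕ.^ p)) 0<ε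
  in a , a ℚ.+ ε , (0≤a , aⁿ≤Q) , (0≤+ 0≤a (ℚ.<⇒≤ 0<ε) , Q≤bⁿ) , ℚ.≤-refl {a ℚ.+ ε}

-- harmonic s k = 1/(s+1) + 1/(s+2) + ... + 1/(s+k)

harmonic : ℕ → ℕ → ℚ
harmonic s zero    = 0ℚ
harmonic s (suc k) = ℤ.+ 1 ℚ./ suc s ℚ.+ harmonic (suc s) k

module HarmonicLemmas where

  1/suc : ℕ → ℚ
  1/suc n = ℤ.+ 1 ℚ./ suc n

  suc*1/suc : ∀ n → fromℕᵠ (suc n) ℚ.* 1/suc n ≡ 1ℚ
  suc*1/suc n = ℚ.toℚᵘ-injective (begin
    toℚᵘ (fromℕᵠ (suc n) ℚ.* 1/suc n)         ≈⟨ ℚ.toℚᵘ-homo-* (fromℕᵠ (suc n)) (1/suc n) ⟩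
    toℚᵘ (fromℕᵠ (suc n)) ℚᵘ.* toℚᵘ (1/suc n) ≈⟨ ℚᵘ.*-cong (ℚ.toℚᵘ-fromℚᵘ (mkℚᵘ (ℤ.+ suc n) 0)) (ℚ.toℚᵘ-fromℚᵘ (mkℚᵘ (ℤ.+ 1) n)) ⟩
    mkℚᵘ (ℤ.+ suc n) 0 ℚᵘ.* mkℚᵘ (ℤ.+ 1) n    ≈⟨ ℚᵘ.*-inverseʳ (mkℚᵘ (ℤ.+ suc n) 0) ⟩
    toℚᵘ 1ℚ                                   ∎)
    where open ℚᵘ.≃-Reasoning

  0<1/suc : ∀ n → 0ℚ ℚ.< 1/suc n
  0<1/suc n = ℚ.positive⁻¹ (1/suc n) {{ℚ.normalize-pos 1 (suc n)}}

  1/suc-least : ∀ n {p} → 1ℚ ℚ.≤ fromℕᵠ (suc n) ℚ.* p → 1/suc n ℚ.≤ p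
  1/suc-least n {p} 1≤np = begin
    1/suc n                                 ≡⟨ ℚ.*-identityʳ (1/suc n) ⟨
    1/suc n ℚ.* 1ℚ                          ≤⟨ *-monoˡ (ℚ.<⇒≤ (0<1/suc n)) 1≤np ⟩
    1/suc n ℚ.* (fromℕᵠ (suc n) ℚ.* p)      ≡⟨ ℚ.*-assoc (1/suc n) (fromℕᵠ (suc n)) p ⟨
    1/suc n ℚ.* fromℕᵠ (suc n) ℚ.* p        ≡⟨ cong (ℚ._* p) (trans (ℚ.*-comm (1/suc n) (fromℕᵠ (suc n))) (suc*1/suc n)) ⟩
    1ℚ ℚ.* p                                ≡⟨ ℚ.*-identityˡ p ⟩
    p                                       ∎
    where open ℚ.≤-Reasoning

  1/suc-anti : ∀ {m n} → m ℕ.≤ n → 1/suc n ℚ.≤ 1/suc m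
  1/suc-anti {m} {n} m≤n = 1/suc-least n (ℚ.≤-trans
    (ℚ.≤-reflexive (sym (suc*1/suc m)))
    (*-monoʳ (ℚ.<⇒≤ (0<1/suc m)) (fromℕᵠ-mono (s≤s m≤n))))

  -- suc (scale n s) = suc n * suc s
  scale : ℕ → ℕ → ℕ
  scale n s = s ℕ.+ n ℕ.* suc s

  scale-suc : ∀ n s → scale n (suc s) ≡ suc n ℕ.+ scale n s
  scale-suc n s =
    trans (cong ℕ.pred (ℕ.*-suc (suc n) (suc s))) (ℕ.+-suc n (scale n s))

  scale-comm : ∀ m n → scale m n ≡ scale n m
  scale-comm m n = cong ℕ.pred (ℕ.*-comm (suc m) (suc n))

  suc*1/scale : ∀ n s → fromℕᵠ (suc n) ℚ.* 1/suc (scale n s) ≡ 1/suc s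
  suc*1/scale n s = begin
    N ℚ.* R                          ≡⟨ ℚ.*-identityʳ (N ℚ.* R) ⟨
    N ℚ.* R ℚ.* 1ℚ                   ≡⟨ cong (N ℚ.* R ℚ.*_) (suc*1/suc s) ⟨
    N ℚ.* R ℚ.* (S ℚ.* 1/suc s)      ≡⟨ ℚ.*-assoc (N ℚ.* R) S (1/suc s) ⟨
    N ℚ.* R ℚ.* S ℚ.* 1/suc s        ≡⟨ cong (ℚ._* 1/suc s) lem ⟩
    1ℚ ℚ.* 1/suc s                   ≡⟨ ℚ.*-identityˡ (1/suc s) ⟩
    1/suc s                          ∎
    where
    open ≡.≡-Reasoning
    N = fromℕᵠ (suc n)
    S = fromℕᵠ (suc s)
    R = 1/suc (scale n s)
    lem : N ℚ.* R ℚ.* S ≡ 1ℚ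
    lem = begin
      N ℚ.* R ℚ.* S                      ≡⟨ ℚ.*-assoc N R S ⟩
      N ℚ.* (R ℚ.* S)                    ≡⟨ cong (N ℚ.*_) (ℚ.*-comm R S) ⟩
      N ℚ.* (S ℚ.* R)                    ≡⟨ ℚ.*-assoc N S R ⟨
      N ℚ.* S ℚ.* R                      ≡⟨ cong (ℚ._* R) (fromℕᵠ-* (suc n) (suc s)) ⟨
      fromℕᵠ (suc (scale n s)) ℚ.* R     ≡⟨ suc*1/suc (scale n s) ⟩
      1ℚ                                 ∎

  0≤harmonic : ∀ s k → 0ℚ ℚ.≤ harmonic s k
  0≤harmonic s zero    = ℚ.≤-refl
  0≤harmonic s (suc k) = 0≤+ (ℚ.<⇒≤ (0<1/suc s)) (0≤harmonic (suc s) k)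

  harmonic-+ : ∀ s k l → harmonic s (k ℕ.+ l) ≡ harmonic s k ℚ.+ harmonic (k ℕ.+ s) l
  harmonic-+ s zero    l = sym (ℚ.+-identityˡ (harmonic s l))
  harmonic-+ s (suc k) l = begin
    1/suc s ℚ.+ harmonic (suc s) (k ℕ.+ l)
      ≡⟨ cong (1/suc s ℚ.+_) (harmonic-+ (suc s) k l) ⟩
    1/suc s ℚ.+ (harmonic (suc s) k ℚ.+ harmonic (k ℕ.+ suc s) l)
      ≡⟨ ℚ.+-assoc (1/suc s) (harmonic (suc s) k) (harmonic (k ℕ.+ suc s) l) ⟨
    1/suc s ℚ.+ harmonic (suc s) k ℚ.+ harmonic (k ℕ.+ suc s) l
      ≡⟨ cong (λ t → 1/suc s ℚ.+ harmonic (suc s) k ℚ.+ harmonic t l) (ℕ.+-suc k s) ⟩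
    1/suc s ℚ.+ harmonic (suc s) k ℚ.+ harmonic (suc k ℕ.+ s) l
      ∎
    where open ≡.≡-Reasoning

  harmonic-≥ : ∀ s n t → n ℕ.+ s ℕ.≤ suc t → fromℕᵠ n ℚ.* 1/suc t ℚ.≤ harmonic s n
  harmonic-≥ s zero    t _ = ℚ.≤-reflexive (ℚ.*-zeroˡ (1/suc t))
  harmonic-≥ s (suc n) t n+s≤t = ℚ.≤-trans (ℚ.≤-reflexive (suc-* n (1/suc t)))
    (ℚ.+-mono-≤ (1/suc-anti (ℕ.≤-trans (ℕ.m≤n+m s n) (ℕ.s≤s⁻¹ n+s≤t)))
      (harmonic-≥ (suc s) n t (subst (ℕ._≤ suc t) (sym (ℕ.+-suc n s)) n+s≤t)))

  harmonic-≤ : ∀ s n t → t ℕ.≤ s → harmonic s n ℚ.≤ fromℕᵠ n ℚ.* 1/suc t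
  harmonic-≤ s zero    t _ = ℚ.≤-reflexive (sym (ℚ.*-zeroˡ (1/suc t)))
  harmonic-≤ s (suc n) t t≤s = ℚ.≤-trans
    (ℚ.+-mono-≤ (1/suc-anti t≤s) (harmonic-≤ (suc s) n t (ℕ.m≤n⇒m≤1+n t≤s)))
    (ℚ.≤-reflexive (sym (suc-* n (1/suc t))))

  refine-lower : ∀ n s k → harmonic s k ℚ.≤ harmonic (suc n ℕ.* s) (k ℕ.* suc n)
  refine-lower n s zero    = ℚ.≤-refl
  refine-lower n s (suc k) = begin
    1/suc s ℚ.+ harmonic (suc s) k
      ≤⟨ ℚ.+-mono-≤ block (refine-lower n (suc s) k) ⟩
    harmonic (suc n ℕ.* s) (suc n) ℚ.+ harmonic (suc n ℕ.* suc s) (k ℕ.* suc n)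
      ≡⟨ cong (λ t → harmonic (suc n ℕ.* s) (suc n) ℚ.+ harmonic t (k ℕ.* suc n)) (ℕ.*-suc (suc n) s) ⟩
    harmonic (suc n ℕ.* s) (suc n) ℚ.+ harmonic (suc n ℕ.+ suc n ℕ.* s) (k ℕ.* suc n)
      ≡⟨ harmonic-+ (suc n ℕ.* s) (suc n) (k ℕ.* suc n) ⟨
    harmonic (suc n ℕ.* s) (suc n ℕ.+ k ℕ.* suc n)
      ∎
    where
    open ℚ.≤-Reasoning
    block : 1/suc s ℚ.≤ harmonic (suc n ℕ.* s) (suc n)
    block = ℚ.≤-trans (ℚ.≤-reflexive (sym (suc*1/scale n s)))
      (harmonic-≥ (suc n ℕ.* s) (suc n) (scale n s) (ℕ.≤-reflexive (sym (ℕ.*-suc (suc n) s))))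

  refine-upper : ∀ n s k → harmonic (scale n s) (k ℕ.* suc n) ℚ.≤ harmonic s k
  refine-upper n s zero    = ℚ.≤-refl
  refine-upper n s (suc k) = begin
    harmonic (scale n s) (suc n ℕ.+ k ℕ.* suc n)
      ≡⟨ harmonic-+ (scale n s) (suc n) (k ℕ.* suc n) ⟩
    harmonic (scale n s) (suc n) ℚ.+ harmonic (suc n ℕ.+ scale n s) (k ℕ.* suc n)
      ≡⟨ cong (λ t → harmonic (scale n s) (suc n) ℚ.+ harmonic t (k ℕ.* suc n)) (scale-suc n s) ⟨
    harmonic (scale n s) (suc n) ℚ.+ harmonic (scale n (suc s)) (k ℕ.* suc n)
      ≤⟨ ℚ.+-mono-≤ block (refine-upper n (suc s) k) ⟩
    1/suc s ℚ.+ harmonic (suc s) k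
      ∎
    where
    open ℚ.≤-Reasoning
    block : harmonic (scale n s) (suc n) ℚ.≤ 1/suc s
    block = ℚ.≤-trans (harmonic-≤ (scale n s) (suc n) (scale n s) ℕ.≤-refl)
      (ℚ.≤-reflexive (suc*1/scale n s))

  harmonic-anti : ∀ s k → harmonic (suc s) k ℚ.≤ harmonic s k
  harmonic-anti s zero    = ℚ.≤-refl
  harmonic-anti s (suc k) =
    ℚ.+-mono-≤ (1/suc-anti (ℕ.n≤1+n s)) (harmonic-anti (suc s) k)

  harmonic-mono : ∀ s k → harmonic s k ℚ.≤ harmonic s (suc k)
  harmonic-mono s zero    = 0≤harmonic s 1
  harmonic-mono s (suc k) = ℚ.+-monoʳ-≤ (1/suc s) (harmonic-mono (suc s) k)

  harmonic-ordered : ∀ K m n →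
    harmonic (suc m) (K ℕ.* suc m) ℚ.≤ harmonic n (K ℕ.* suc n)
  harmonic-ordered K m n = begin
    harmonic (suc m) (K ℕ.* suc m)                       ≤⟨ refine-lower n (suc m) (K ℕ.* suc m) ⟩
    harmonic (suc (scale n m)) (K ℕ.* suc m ℕ.* suc n)   ≤⟨ harmonic-anti (scale n m) (K ℕ.* suc m ℕ.* suc n) ⟩
    harmonic (scale n m) (K ℕ.* suc m ℕ.* suc n)         ≡⟨ cong₂ harmonic (scale-comm n m) swap ⟩
    harmonic (scale m n) (K ℕ.* suc n ℕ.* suc m)         ≤⟨ refine-upper m n (K ℕ.* suc n) ⟩
    harmonic n (K ℕ.* suc n)                             ∎
    where
    open ℚ.≤-Reasoning
    swap : K ℕ.* suc m ℕ.* suc n ≡ K ℕ.* suc n ℕ.* suc m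
    swap = trans (ℕ.*-assoc K (suc m) (suc n))
      (trans (cong (K ℕ.*_) (ℕ.*-comm (suc m) (suc n))) (sym (ℕ.*-assoc K (suc n) (suc m))))

  harmonic-close : ∀ s k → harmonic s k ℚ.≤ harmonic (suc s) k ℚ.+ 1/suc s
  harmonic-close s k = ℚ.≤-trans (harmonic-mono s k)
    (ℚ.≤-reflexive (ℚ.+-comm (1/suc s) (harmonic (suc s) k)))

open HarmonicLemmas

-- log q is the integral of dx/x from 1 to q.  Its lower and upper bounds
-- are the Riemann sums for the partitions of [1, q] into intervals of
-- length 1/n, where n = suc m:
--   1/(n+1) + ... + 1/(qn)  ≤  log q  ≤  1/n + ... + 1/(qn-1).
-- (For q = 0 this gives the junk value 0.)

log : ℕ → ℝ≥0
log q .Lower a = ∃ λ m → a ≡ harmonic (suc m) (ℕ.pred q ℕ.* suc m)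
log q .Upper b = ∃ λ m → b ≡ harmonic m (ℕ.pred q ℕ.* suc m)
log q .nonNeg (m , refl) = 0≤harmonic (suc m) (ℕ.pred q ℕ.* suc m)
log q .ordered (m , refl) (n , refl) = harmonic-ordered (ℕ.pred q) m n
log q .close ε 0<ε =
  let m , 1≤mε = archimedean 1ℚ 0<ε
      k        = ℕ.pred q ℕ.* suc m
      1≤[1+m]ε = ℚ.≤-trans 1≤mε (*-monoʳ (ℚ.<⇒≤ 0<ε) (fromℕᵠ-mono (ℕ.n≤1+n m)))
  in harmonic (suc m) k , harmonic m k , (m , refl) , (m , refl) ,
     ℚ.≤-trans (harmonic-close m k)
       (ℚ.+-monoʳ-≤ (harmonic (suc m) k) (1/suc-least m 1≤[1+m]ε))

record PrimePower (q : ℕ) : Set where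
  field
    base                : ℕ
    exponent            : ℕ
    prime               : Prime base
    {{exponentNonZero}} : ℕ.NonZero exponent
    isPower             : q ≡ base ℕ.^ exponent

module PrimePowerLemmas where

  1<primePower : ∀ {q} → PrimePower q → 1 ℕ.< q
  1<primePower record { base = p ; exponent = suc n ; prime = pr ; isPower = refl } =
    ℕ.<-≤-trans 1<p (subst (ℕ._≤ p ℕ.^ suc n) (ℕ.*-identityʳ p)
      (ℕ.*-monoʳ-≤ p (ℕ.m^n>0 p n)))
    where
    1<p : 1 ℕ.< p
    1<p = ℕ.nonTrivial⇒n>1 p {{prime⇒nonTrivial pr}}
    instance _ = ℕ.>-nonZero (ℕ.<-trans (s≤s z≤n) 1<p)

  log-pos : ∀ {q} → 1 ℕ.< q → Positive (log q)
  log-pos {suc (suc q)} _ = mkPositive {bound = harmonic 1 (suc q ℕ.* 1)} (0 , refl)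
    (ℚ.<-≤-trans (0<1/suc 1) (p≤p+q (0≤harmonic 2 (q ℕ.* 1))))
  log-pos {suc zero} (s≤s ())

open PrimePowerLemmas

instance
  log-positive : ∀ {q} {{_ : PrimePower q}} → Positive (log q)
  log-positive {{pp}} = log-pos (1<primePower pp)

record FiniteField (q : ℕ) : Set₁ where
  field
    commutativeRing : CommutativeRing 0ℓ 0ℓ

  open CommutativeRing commutativeRing public
    renaming (_*_ to infixl 7 _·_; sym to ≈-sym; trans to ≈-trans)

  field
    0≉1         : ¬ (0# ≈ 1#)
    inverse     : ∀ x → ¬ (x ≈ 0#) → ∃ λ y → x · y ≈ 1#
    enumeration : Inverse setoid (≡.setoid (Fin q))

  open Inverse enumeration public
    using (to; from; to-cong; inverseʳ) renaming (strictlyInverseʳ to from-to)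

-- Subsets of the field with q elements are subsets of Fin q, by way of
-- the enumeration.

module Subsets {q : ℕ} (𝔽 : FiniteField q) where

  open FiniteField 𝔽
  open RawMonoidDefs +-rawMonoid using (sum)

  infix 4 _∈_ _≈?_

  _∈_ : Carrier → Subset q → Set
  x ∈ S = to x Sub.∈ S

  _≈?_ : ∀ x y → Dec (x ≈ y)
  x ≈? y = map′ injective to-cong (to x Fin.≟ to y)
    where
    injective : to x ≡ to y → x ≈ y
    injective eq = ≈-trans (≈-sym (from-to x)) (inverseʳ eq)

  elements : Subset q → List Carrier
  elements S = map from (filter (Sub._∈? S) (allFin q))

  ExcludesZero : Subset q → Set
  ExcludesZero S = ¬ (0# ∈ S)

  -- E(A, ξA).  The list elements A has no repetitions, so each quadruple
  -- of A⁴ is counted once.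
  energy : Subset q → Carrier → ℕ
  energy A ξ = length (filter equation?
    (cartesianProduct as (cartesianProduct as (cartesianProduct as as))))
    where
    as = elements A
    equation? : ((a₁ , a₂ , a₃ , a₄) : Carrier × Carrier × Carrier × Carrier) →
                Dec (a₁ - a₂ ≈ ξ · (a₃ - a₄))
    equation? (a₁ , a₂ , a₃ , a₄) = a₁ - a₂ ≈? ξ · (a₃ - a₄)

  infixl 6 _⊖_

  -- A ⊖ ā is the set of all a - ā with a ∈ A.
  _⊖_ : Subset q → Carrier → Subset q
  A ⊖ ā = ⋃ (map (λ a → ⁅ to (a - ā) ⁆) (elements A))

  record IsSubfield (F : Subset q) : Set where
    field
      0∈F            : 0# ∈ F
      1∈F            : 1# ∈ F
      +-closed       : ∀ {x y} → x ∈ F → y ∈ F → x + y ∈ F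
      neg-closed     : ∀ {x} → x ∈ F → - x ∈ F
      ·-closed       : ∀ {x y} → x ∈ F → y ∈ F → x · y ∈ F
      inverse-closed : ∀ {x y} → x ∈ F → x · y ≈ 1# → y ∈ F

  record IsSubspace (F V : Subset q) : Set where
    field
      0∈V       : 0# ∈ V
      +-closed  : ∀ {v w} → v ∈ V → w ∈ V → v + w ∈ V
      ·-closed  : ∀ {c v} → c ∈ F → v ∈ V → c · v ∈ V

  record IsBasis (F V : Subset q) {d : ℕ} (e : Fin d → Carrier) : Set where
    field
      e∈V         : ∀ i → e i ∈ V
      independent : ∀ (c : Fin d → Carrier) → (∀ i → c i ∈ F) → sum (λ i → c i · e i) ≈ 0# →
                    ∀ i → c i ≈ 0#
      spanning    : ∀ {v} → v ∈ V →
                    ∃ λ (c : Fin d → Carrier) → (∀ i → c i ∈ F) × v ≈ sum (λ i → c i · e i)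

  record HasDimension (F V : Subset q) (d : ℕ) : Set where
    field
      isSubspace : IsSubspace F V
      basis      : Fin d → Carrier
      isBasis    : IsBasis F V basis

-- Schoen's form of the Balog-Szemerédi-Gowers theorem (for some s, few pairs of A ∩ (B + s)
-- have an unpopular difference), applied to A and ξA, gives A_ξ = ξB_ξ + s_ξ with A_ξ, B_ξ ⊆ A
-- and A_ξ - A_ξ small.  By pigeonhole there are ξ₀ and a large X′ ⊆ X such that all the dilates
-- by θ ∈ X₁ = X′/ξ₀ nearly fix one set H with H - H + H small.  The z with |H - zH| ≤ κᶜ |H|
-- behave like a field, up to the growth of c.
--
-- Let Q be the set of the ratios (x₁ - x₂)/(x₃ - x₄) over X₁.  If Q is not closed under z ↦ z + 1
-- and under multiplication by X₁, then some r ∉ Q is built from few elements of X₁, and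
-- |X₁ + rX₁| = |X₁|² > q^(1/2) makes every z ≠ 0 a ratio over X₁ + rX₁.  Then E(A, zA) is large
-- for all z, contradicting the value of its sum over z.  Hence Q is a proper subfield F, and
-- |F|⁴ > q because |X₁| ≤ |F|.
--
-- Two applications of Cauchy-Schwarz, to differences and then to ratios of the elements of X′,
-- show that E(A, zA) is large on average over z ∈ F.  For an F-hyperplane W this bounds from below
-- the second moment over y of the number of (a, b) ∈ A² with y(a - b) ∈ W, so that for some
-- y ≠ 0 a translate of y⁻¹W contains a proportion K⁻⁴ of A.  If q = |F|², then W is a line with
-- fewer elements than that; so q = |F|³ and y⁻¹W is the plane.
module Submission where

-- Refining twice serves two ends. The first pass gives sets with few differences. The second, of
-- the central set against itself, gives an H any two of whose elements are joined through some
-- point by popular differences; this bounds H - H + H, which makes sums of good z good. Exponents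
-- add up under products and cost 20 more under sums, so r must stay within boundedly many
-- operations of X₁: hence closure is tested under such simple operations.
--
-- X′ itself need not lie in F, only ratios of its differences do: hence two Cauchy-Schwarz steps.
-- They average over F with the weight E(X′, zX′), which is at least |X′|⁴ / |F| on F with a small
-- total excess, so the uniform average is large too.
--
-- The second moment sees this average because yd ∈ W implies yzd ∈ W for z ∈ F: two nonzero
-- F-dependent differences lie in y⁻¹W for |W| values of y, two independent ones for |W| / |F|.
--
-- Real numbers occur only at the end, where K is rounded up to a natural number.

module Combinatorics where

  open import Algebra.Bundles using (CommutativeRing; RawRing)
  import Algebra.Morphism.RingMonomorphism
  open import Algebra.Morphism.Structures using (module RingMorphisms)
  import Algebra.Properties.AbelianGroup
  import Algebra.Properties.Group
  import Algebra.Properties.Ring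
  import Algebra.Properties.Semiring.Mult.TCOptimised
  import Algebra.Solver.Ring
  open import Algebra.Solver.Ring.AlmostCommutativeRing
  open import Algebra.Structures using (IsCommutativeRing)
  open import Data.Bool.Base using (Bool; true; false; _∧_; not) renaming (T to IsTrue)
  import Data.Bool.Properties as Bool
  open import Data.Empty using (⊥; ⊥-elim)
  open import Data.Fin.Base using (Fin; zero; suc)
  import Data.Fin.Permutation as Perm
  import Data.Fin.Properties as Fin
  open import Data.Maybe.Base using (just; nothing)
  open import Data.Nat.Base
  open import Data.Nat.DivMod using (m/n*n≤m; m*n/n≡m; /-monoˡ-≤)
  open import Data.Nat.Properties
  open import Data.Nat.Tactic.RingSolver using (solve-∀)
  open import Data.Product.Base using (Σ; ∃; ∃₂; _×_; _,_; proj₁; proj₂)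
  open import Data.Sum.Base using (_⊎_; inj₁; inj₂)
  open import Function.Base using (_∘_; id)
  open import Level using (0ℓ)
  open import Relation.Binary.Definitions using (WeaklyDecidable)
  open import Relation.Binary.PropositionalEquality
  import Relation.Binary.Reasoning.Setoid
  open import Relation.Nullary using (¬_; Dec; yes; no; does; contradiction)
  open import Relation.Nullary.Decidable using (⌊_⌋; _×-dec_; ¬?)

  -- Sums, indicators and cardinalities over finite types.

  module FiniteSums where

    open import Algebra.Properties.Semiring.Sum +-*-semiring
      using (sum; sum-cong-≗; ∑-distrib-+; ∑-comm; sum-permute; *-distribˡ-sum; *-distribʳ-sum)

    opaque

      -- Sealed, so that nested sums are compared by their summands and never unfold into recursions
      -- over `Fin n`.
      ∑ : ∀ {n} → (Fin n → ℕ) → ℕ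
      ∑ = sum

      ∑-suc : ∀ {n} (f : Fin (suc n) → ℕ) → ∑ f ≡ f zero + ∑ (f ∘ suc)
      ∑-suc f = refl

      ∑-nil : (f : Fin 0 → ℕ) → ∑ f ≡ 0
      ∑-nil f = refl

      ∑-cong : ∀ {n} {f g : Fin n → ℕ} → (∀ x → f x ≡ g x) → ∑ f ≡ ∑ g
      ∑-cong = sum-cong-≗

      ∑-mono : ∀ {n} {f g : Fin n → ℕ} → (∀ x → f x ≤ g x) → ∑ f ≤ ∑ g
      ∑-mono {zero}  h = z≤n
      ∑-mono {suc n} h = +-mono-≤ (h zero) (∑-mono (h ∘ suc))

      ∑-mono-< : ∀ {n} {f g : Fin n → ℕ} → (∀ x → f x ≤ g x) → ∀ a → f a < g a → ∑ f < ∑ g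
      ∑-mono-< h zero    lt = +-mono-<-≤ lt (∑-mono (h ∘ suc))
      ∑-mono-< h (suc a) lt = +-mono-≤-< (h zero) (∑-mono-< (h ∘ suc) a lt)

      ∑-swap : ∀ {m n} (f : Fin m → Fin n → ℕ) →
               ∑ (λ i → ∑ (λ j → f i j)) ≡ ∑ (λ j → ∑ (λ i → f i j))
      ∑-swap = ∑-comm

      ∑-+ : ∀ {n} (f g : Fin n → ℕ) → ∑ (λ x → f x + g x) ≡ ∑ f + ∑ g
      ∑-+ = ∑-distrib-+

      ∑-*ˡ : ∀ {n} c (f : Fin n → ℕ) → ∑ (λ x → c * f x) ≡ c * ∑ f
      ∑-*ˡ c f = sym (*-distribˡ-sum c f)

      ∑-*ʳ : ∀ {n} c (f : Fin n → ℕ) → ∑ (λ x → f x * c) ≡ ∑ f * c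
      ∑-*ʳ c f = sym (*-distribʳ-sum c f)

      ∑-const : ∀ n c → ∑ {n} (λ _ → c) ≡ n * c
      ∑-const zero    c = refl
      ∑-const (suc n) c = cong (c +_) (∑-const n c)

      ∑-bij : ∀ {n} (f : Fin n → ℕ) (π ρ : Fin n → Fin n) →
              (∀ x → π (ρ x) ≡ x) → (∀ x → ρ (π x) ≡ x) → ∑ (λ x → f (π x)) ≡ ∑ f
      ∑-bij f π ρ πρ ρπ = sym (sum-permute f (Perm.permutation π ρ πρ ρπ))

      f≤∑ : ∀ {n} (f : Fin n → ℕ) a → f a ≤ ∑ f
      f≤∑ f zero    = m≤m+n (f zero) _
      f≤∑ f (suc a) = ≤-trans (f≤∑ (f ∘ suc) a) (m≤n+m _ (f zero))

      ∑-at : ∀ {n} (a : Fin n) (f : Fin n → ℕ) → (∀ x → x ≢ a → f x ≡ 0) → ∑ f ≡ f a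
      ∑-at {suc n} zero f h = trans
        (cong (f zero +_) (trans (∑-cong (λ x → h (suc x) λ ())) (trans (∑-const n 0) (*-zeroʳ n))))
        (+-identityʳ (f zero))
      ∑-at (suc a) f h = cong₂ _+_ (h zero λ ())
        (∑-at a (f ∘ suc) (λ x x≢a → h (suc x) (x≢a ∘ Fin.suc-injective)))

    ∑-zero : ∀ {n} (f : Fin n → ℕ) → (∀ x → f x ≡ 0) → ∑ f ≡ 0
    ∑-zero {n} f h = trans (∑-cong h) (trans (∑-const n 0) (*-zeroʳ n))

    -- The averaging principle behind every choice below. Strictness matters: side conditions are
    -- put into both summands as an indicator factor, and a strict inequality at the point found
    -- forces that factor to be 1.
    ∑-< : ∀ {n} (f g : Fin n → ℕ) → ∑ f < ∑ g → ∃ λ x → f x < g x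
    ∑-< f g lt with Fin.any? (λ x → f x <? g x)
    ... | yes p = p
    ... | no ¬p = contradiction (∑-mono (λ x → ≮⇒≥ (λ h → ¬p (x , h)))) (<⇒≱ lt)

    ∑-positive : ∀ {n} (f : Fin n → ℕ) → 0 < ∑ f → ∃ λ x → 0 < f x
    ∑-positive {n} f h =
      ∑-< (λ _ → 0) f (subst (_< ∑ f) (sym (∑-zero {n} (λ _ → 0) (λ _ → refl))) h)

    ∑-*-∑ : ∀ {m n} (f : Fin m → ℕ) (g : Fin n → ℕ) →
            ∑ f * ∑ g ≡ ∑ (λ x → ∑ (λ y → f x * g y))
    ∑-*-∑ f g = trans (sym (∑-*ʳ (∑ g) f)) (∑-cong (λ x → sym (∑-*ˡ (f x) g)))

    2ab≤a²+b² : ∀ a b → 2 * (a * b) ≤ a * a + b * b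
    2ab≤a²+b² a b with ≤-total a b
    ... | inj₁ a≤b with d , refl ← m≤n⇒∃[o]m+o≡n a≤b =
      ≤-trans (m≤m+n (2 * (a * (a + d))) (d * d)) (≤-reflexive (lem a d))
      where lem : ∀ a d → 2 * (a * (a + d)) + d * d ≡ a * a + (a + d) * (a + d)
            lem = solve-∀
    ... | inj₂ b≤a with d , refl ← m≤n⇒∃[o]m+o≡n b≤a =
      ≤-trans (m≤m+n (2 * ((b + d) * b)) (d * d)) (≤-reflexive (lem b d))
      where lem : ∀ b d → 2 * ((b + d) * b) + d * d ≡ (b + d) * (b + d) + b * b
            lem = solve-∀

    -- Lagrange's argument without subtraction: both sides are doubled and expanded over pairs (x ,
    -- y), and 2ab ≤ a² + b² is applied to a = f x g y and b = f y g x.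
    cauchy : ∀ {n} (f g : Fin n → ℕ) →
             ∑ (λ x → f x * g x) * ∑ (λ x → f x * g x) ≤ ∑ (λ x → f x * f x) * ∑ (λ x → g x * g x)
    cauchy f g = *-cancelˡ-≤ 2 (begin
      2 * (∑ fg * ∑ fg)                                  ≡⟨ cong (2 *_) (∑-*-∑ fg fg) ⟩
      2 * ∑ (λ x → ∑ (λ y → fg x * fg y))                ≡⟨ ∑-*ˡ 2 (λ x → ∑ (λ y → fg x * fg y)) ⟨
      ∑ (λ x → 2 * ∑ (λ y → fg x * fg y))                ≤⟨ ∑-mono (λ x → ≤-trans (≤-reflexive (sym (∑-*ˡ 2 (λ y → fg x * fg y)))) (∑-mono (pt x))) ⟩
      ∑ (λ x → ∑ (λ y → ff x * gg y + ff y * gg x))      ≡⟨ ∑-cong (λ x → ∑-+ (λ y → ff x * gg y) (λ y → ff y * gg x)) ⟩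
      ∑ (λ x → ∑ (λ y → ff x * gg y) + ∑ (λ y → ff y * gg x))
        ≡⟨ ∑-+ (λ x → ∑ (λ y → ff x * gg y)) (λ x → ∑ (λ y → ff y * gg x)) ⟩
      ∑ (λ x → ∑ (λ y → ff x * gg y)) + ∑ (λ x → ∑ (λ y → ff y * gg x))
        ≡⟨ cong₂ _+_ (sym (∑-*-∑ ff gg)) (trans (∑-swap (λ x y → ff y * gg x)) (sym (∑-*-∑ ff gg))) ⟩
      ∑ ff * ∑ gg + ∑ ff * ∑ gg                          ≡⟨ lem (∑ ff * ∑ gg) ⟩
      2 * (∑ ff * ∑ gg)                                  ∎)
      where
      open ≤-Reasoning
      fg = λ x → f x * g x
      ff = λ x → f x * f x
      gg = λ x → g x * g x
      lem : ∀ a → a + a ≡ 2 * a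
      lem = solve-∀
      e₁ : ∀ a b c d → 2 * (a * b * (c * d)) ≡ 2 * ((a * d) * (c * b))
      e₁ = solve-∀
      e₂ : ∀ a b c d → (a * d) * (a * d) + (c * b) * (c * b) ≡ (a * a) * (d * d) + (c * c) * (b * b)
      e₂ = solve-∀
      pt : ∀ x y → 2 * (fg x * fg y) ≤ ff x * gg y + ff y * gg x
      pt x y = subst₂ _≤_ (sym (e₁ (f x) (g x) (f y) (g y))) (e₂ (f x) (g x) (f y) (g y))
                 (2ab≤a²+b² (f x * g y) (f y * g x))

    𝟙 : Bool → ℕ
    𝟙 true  = 1
    𝟙 false = 0

    𝟙≤1 : ∀ b → 𝟙 b ≤ 1
    𝟙≤1 true  = ≤-refl
    𝟙≤1 false = z≤n

    𝟙-idem : ∀ b → 𝟙 b * 𝟙 b ≡ 𝟙 b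
    𝟙-idem true  = refl
    𝟙-idem false = refl

    𝟙-∧ : ∀ b c → 𝟙 (b ∧ c) ≡ 𝟙 b * 𝟙 c
    𝟙-∧ true  c = sym (+-identityʳ (𝟙 c))
    𝟙-∧ false c = refl

    𝟙-split : ∀ b → 𝟙 b + 𝟙 (not b) ≡ 1
    𝟙-split true  = refl
    𝟙-split false = refl

    𝟙-true : ∀ {b} → b ≡ true → 𝟙 b ≡ 1
    𝟙-true = cong 𝟙

    𝟙-positive : ∀ {b} → 0 < 𝟙 b → b ≡ true
    𝟙-positive {true} _ = refl

    𝟙-mono : ∀ {b c} → (b ≡ true → c ≡ true) → 𝟙 b ≤ 𝟙 c
    𝟙-mono {true}  h rewrite h refl = ≤-refl
    𝟙-mono {false} h = z≤n

    𝟙*-≤ : ∀ {b x y} → (b ≡ true → x ≤ y) → 𝟙 b * x ≤ y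
    𝟙*-≤ {true} {x} h = subst (_≤ _) (sym (+-identityʳ x)) (h refl)
    𝟙*-≤ {false}    h = z≤n

    𝟙*-mono : ∀ {b x y} → (b ≡ true → x ≤ y) → 𝟙 b * x ≤ 𝟙 b * y
    𝟙*-mono {true}  h = +-monoˡ-≤ 0 (h refl)
    𝟙*-mono {false} h = z≤n

    𝟙*-cong : ∀ {b x y} → (b ≡ true → x ≡ y) → 𝟙 b * x ≡ 𝟙 b * y
    𝟙*-cong {true}  h = cong (_+ 0) (h refl)
    𝟙*-cong {false} h = refl

    𝟙*≤ : ∀ b x → 𝟙 b * x ≤ x
    𝟙*≤ b x = 𝟙*-≤ {b} (λ _ → ≤-refl)

    ∧-true : ∀ {b c} → b ∧ c ≡ true → b ≡ true × c ≡ true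
    ∧-true {true} {true} _ = refl , refl

    ∧-intro : ∀ {b c} → b ≡ true → c ≡ true → b ∧ c ≡ true
    ∧-intro refl refl = refl

    FinSet : ℕ → Set
    FinSet n = Fin n → Bool

    infix 4 _∈_

    _∈_ : ∀ {n} → Fin n → FinSet n → Set
    x ∈ S = S x ≡ true

    _∩_ : ∀ {n} → FinSet n → FinSet n → FinSet n
    (S ∩ S′) x = S x ∧ S′ x

    card : ∀ {n} → FinSet n → ℕ
    card S = ∑ (λ x → 𝟙 (S x))

    card-mono : ∀ {n} {S S′ : FinSet n} → (∀ x → x ∈ S → x ∈ S′) → card S ≤ card S′
    card-mono h = ∑-mono (λ x → 𝟙-mono (h x))

    card≤n : ∀ {n} (S : FinSet n) → card S ≤ n
    card≤n {n} S = ≤-trans (∑-mono (λ x → 𝟙≤1 (S x)))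
      (≤-reflexive (trans (∑-const n 1) (*-identityʳ n)))

    card-positive : ∀ {n} {S : FinSet n} {x} → x ∈ S → 0 < card S
    card-positive {S = S} {x} x∈S =
      ≤-trans (≤-reflexive (sym (𝟙-true x∈S))) (f≤∑ (λ y → 𝟙 (S y)) x)

    card-∃ : ∀ {n} {S : FinSet n} → 0 < card S → ∃ λ x → x ∈ S
    card-∃ {S = S} h with x , p ← ∑-positive (λ y → 𝟙 (S y)) h = x , 𝟙-positive p

    -- A point outside S with image in S would make the indicator of S strictly smaller in sum than
    -- its composite with π, although a bijection leaves the sum unchanged.
    card-stable : ∀ {n} (S : FinSet n) (π ρ : Fin n → Fin n) → (∀ x → π (ρ x) ≡ x) → (∀ x → ρ (π x) ≡ x) →
                  (∀ x → x ∈ S → π x ∈ S) → ∀ x → π x ∈ S → x ∈ S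
    card-stable S π ρ πρ ρπ h x πx∈S with S x in eq
    ... | true  = refl
    ... | false = contradiction (∑-bij (λ y → 𝟙 (S y)) π ρ πρ ρπ) (≢-sym (<⇒≢
      (∑-mono-< (λ y → 𝟙-mono (h y)) x (≤-reflexive (trans (cong (suc ∘ 𝟙) eq) (sym (𝟙-true πx∈S)))))))

    decided : ∀ {P : Set} (P? : Dec P) → ⌊ P? ⌋ ≡ true → P
    decided (yes p) _ = p

    decide : ∀ {P : Set} (P? : Dec P) → P → ⌊ P? ⌋ ≡ true
    decide (yes _) _ = refl
    decide (no ¬p) p = contradiction p ¬p

    stable : ∀ b → ¬ ¬ (b ≡ true) → b ≡ true
    stable true  _ = refl
    stable false h = contradiction (λ ()) h

    undecided : ∀ {P : Set} (P? : Dec P) → not ⌊ P? ⌋ ≡ true → ¬ P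
    undecided (no ¬p) _ = ¬p

    opaque

      some : ∀ {n} → FinSet n → Bool
      some S = ⌊ Fin.any? (λ x → S x Bool.≟ true) ⌋

      some-elim : ∀ {n} {S : FinSet n} → some S ≡ true → ∃ λ x → x ∈ S
      some-elim = decided (Fin.any? _)

      some-intro : ∀ {n} (S : FinSet n) x → x ∈ S → some S ≡ true
      some-intro S x x∈S = decide (Fin.any? _) (x , x∈S)

    ∑-≟ : ∀ {n} (a : Fin n) (f : Fin n → ℕ) → ∑ (λ x → 𝟙 ⌊ x Fin.≟ a ⌋ * f x) ≡ f a
    ∑-≟ a f = trans (∑-at a (λ x → 𝟙 ⌊ x Fin.≟ a ⌋ * f x) off) (trans (cong (λ b → 𝟙 b * f a) (decide (a Fin.≟ a) refl)) (+-identityʳ (f a)))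
      where
      off : ∀ x → x ≢ a → 𝟙 ⌊ x Fin.≟ a ⌋ * f x ≡ 0
      off x x≢a with x Fin.≟ a
      ... | yes p = contradiction p x≢a
      ... | no  _ = refl

    two-members : ∀ {n} {S : FinSet n} → 1 < card S → ∃₂ λ x y → x ∈ S × y ∈ S × x ≢ y
    two-members {S = S} 1<S with card-∃ {S = S} (<-trans (s≤s z≤n) 1<S)
    ... | x , x∈S with Fin.any? (λ y → (S y Bool.≟ true) ×-dec ¬? (x Fin.≟ y))
    ...   | yes (y , y∈S , x≢y) = x , y , x∈S , y∈S , x≢y
    ...   | no none = contradiction (≤-trans (≤-reflexive (∑-at x (λ y → 𝟙 (S y)) off)) (𝟙≤1 (S x))) (<⇒≱ 1<S)
      where
      off : ∀ y → y ≢ x → 𝟙 (S y) ≡ 0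
      off y y≢x with S y in eq
      ... | true  = contradiction (y , eq , ≢-sym y≢x) none
      ... | false = refl

    ≤ᵇ-true : ∀ {m n} → (m ≤ᵇ n) ≡ true → m ≤ n
    ≤ᵇ-true {m} {n} h = ≤ᵇ⇒≤ m n (subst IsTrue (sym h) _)

    ≤ᵇ-intro : ∀ {m n} → m ≤ n → (m ≤ᵇ n) ≡ true
    ≤ᵇ-intro {m} {n} h with m ≤ᵇ n | ≤⇒≤ᵇ h
    ... | true | _ = refl

    ≤ᵇ-false : ∀ {m n} → not (m ≤ᵇ n) ≡ true → n < m
    ≤ᵇ-false {m} {n} h = ≰⇒> λ m≤n → contra (≤ᵇ-intro m≤n) h
      where contra : ∀ {b} → b ≡ true → not b ≡ true → ⊥
            contra refl ()

  open FiniteSums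

  -- The coefficients of the solver are formal differences (a , b) = a - b of
  -- natural numbers, so that it can cancel terms in an arbitrary ring.
  module DifferenceSolver (R : CommutativeRing 0ℓ 0ℓ) where

    private
      module R = CommutativeRing R
      open R using (_≈_; 0#; 1#)
        renaming (_+_ to _+ᴿ_; _*_ to _*ᴿ_; -_ to -ᴿ_; _-_ to _-ᴿ_)
      open Algebra.Properties.Ring R.ring using (x[y-z]≈xy-xz; [y-z]x≈yx-zx)
      open Algebra.Properties.Group R.+-group using (ε⁻¹≈ε; ⁻¹-anti-homo-//)
      open Algebra.Properties.AbelianGroup R.+-abelianGroup using (⁻¹-∙-comm)
      open Algebra.Properties.Semiring.Mult.TCOptimised R.semiring
        using (×-homo-+; ×1-homo-*) renaming (_×_ to _×ᴿ_)
      open Relation.Binary.Reasoning.Setoid R.setoid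

      ⟦_⟧ : ℕ × ℕ → R.Carrier
      ⟦ a , b ⟧ = a ×ᴿ 1# -ᴿ b ×ᴿ 1#

      differences : RawRing 0ℓ 0ℓ
      differences = record
        { Carrier = ℕ × ℕ
        ; _≈_     = _≡_
        ; _+_     = λ (a , b) (c , d) → a + c , b + d
        ; _*_     = λ (a , b) (c , d) → a * c + b * d , a * d + b * c
        ; -_      = λ (a , b) → b , a
        ; 0#      = 0 , 0
        ; 1#      = 1 , 0
        }

      interchange : ∀ a b c d → (a +ᴿ b) +ᴿ (c +ᴿ d) ≈ (a +ᴿ c) +ᴿ (b +ᴿ d)
      interchange a b c d = begin
        (a +ᴿ b) +ᴿ (c +ᴿ d)   ≈⟨ R.+-assoc a b (c +ᴿ d) ⟩
        a +ᴿ (b +ᴿ (c +ᴿ d))   ≈⟨ R.+-congˡ (R.+-assoc b c d) ⟨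
        a +ᴿ ((b +ᴿ c) +ᴿ d)   ≈⟨ R.+-congˡ (R.+-congʳ (R.+-comm b c)) ⟩
        a +ᴿ ((c +ᴿ b) +ᴿ d)   ≈⟨ R.+-congˡ (R.+-assoc c b d) ⟩
        a +ᴿ (c +ᴿ (b +ᴿ d))   ≈⟨ R.+-assoc a c (b +ᴿ d) ⟨
        (a +ᴿ c) +ᴿ (b +ᴿ d)   ∎

      +-minus-+ : ∀ a b c d → (a +ᴿ b) -ᴿ (c +ᴿ d) ≈ (a -ᴿ c) +ᴿ (b -ᴿ d)
      +-minus-+ a b c d = R.trans (R.+-congˡ (R.sym (⁻¹-∙-comm c d))) (interchange a b (-ᴿ c) (-ᴿ d))

      +-homo : ∀ x y → ⟦ RawRing._+_ differences x y ⟧ ≈ ⟦ x ⟧ +ᴿ ⟦ y ⟧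
      +-homo (a , b) (c , d) = R.trans
        (R.+-cong (×-homo-+ 1# a c) (R.-‿cong (×-homo-+ 1# b d)))
        (+-minus-+ (a ×ᴿ 1#) (c ×ᴿ 1#) (b ×ᴿ 1#) (d ×ᴿ 1#))

      *-homo : ∀ x y → ⟦ RawRing._*_ differences x y ⟧ ≈ ⟦ x ⟧ *ᴿ ⟦ y ⟧
      *-homo (a , b) (c , d) = begin
        (a * c + b * d) ×ᴿ 1# -ᴿ (a * d + b * c) ×ᴿ 1#
          ≈⟨ R.+-cong (split a c b d) (R.-‿cong (split a d b c)) ⟩
        (A *ᴿ C +ᴿ B *ᴿ D) -ᴿ (A *ᴿ D +ᴿ B *ᴿ C)     ≈⟨ +-minus-+ (A *ᴿ C) (B *ᴿ D) (A *ᴿ D) (B *ᴿ C) ⟩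
        (A *ᴿ C -ᴿ A *ᴿ D) +ᴿ (B *ᴿ D -ᴿ B *ᴿ C)     ≈⟨ R.+-congˡ (⁻¹-anti-homo-// (B *ᴿ C) (B *ᴿ D)) ⟨
        (A *ᴿ C -ᴿ A *ᴿ D) -ᴿ (B *ᴿ C -ᴿ B *ᴿ D)     ≈⟨ R.+-cong (x[y-z]≈xy-xz A C D) (R.-‿cong (x[y-z]≈xy-xz B C D)) ⟨
        A *ᴿ (C -ᴿ D) -ᴿ B *ᴿ (C -ᴿ D)               ≈⟨ [y-z]x≈yx-zx (C -ᴿ D) A B ⟨
        (A -ᴿ B) *ᴿ (C -ᴿ D)                         ∎
        where
        A = a ×ᴿ 1#
        B = b ×ᴿ 1#
        C = c ×ᴿ 1#
        D = d ×ᴿ 1#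
        split : ∀ a c b d → (a * c + b * d) ×ᴿ 1# ≈ (a ×ᴿ 1#) *ᴿ (c ×ᴿ 1#) +ᴿ (b ×ᴿ 1#) *ᴿ (d ×ᴿ 1#)
        split a c b d = R.trans (×-homo-+ 1# (a * c) (b * d)) (R.+-cong (×1-homo-* a c) (×1-homo-* b d))

      morphism : differences -Raw-AlmostCommutative⟶ fromCommutativeRing R
      morphism = record
        { ⟦_⟧    = ⟦_⟧
        ; +-homo = +-homo
        ; *-homo = *-homo
        ; -‿homo = λ (a , b) → R.sym (⁻¹-anti-homo-// (a ×ᴿ 1#) (b ×ᴿ 1#))
        ; 0-homo = R.-‿inverseʳ 0#
        ; 1-homo = R.trans (R.+-congˡ ε⁻¹≈ε) (R.+-identityʳ 1#)
        }

      cross : ∀ a b c d → a + d ≡ c + b → ⟦ a , b ⟧ ≈ ⟦ c , d ⟧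
      cross a b c d eq = begin
        A -ᴿ B                       ≈⟨ R.+-identityʳ (A -ᴿ B) ⟨
        (A -ᴿ B) +ᴿ 0#               ≈⟨ R.+-congˡ (R.-‿inverseʳ D) ⟨
        (A -ᴿ B) +ᴿ (D -ᴿ D)         ≈⟨ +-minus-+ A D B D ⟨
        (A +ᴿ D) -ᴿ (B +ᴿ D)         ≈⟨ R.+-cong same (R.-‿cong (R.+-comm B D)) ⟩
        (C +ᴿ B) -ᴿ (D +ᴿ B)         ≈⟨ +-minus-+ C B D B ⟩
        (C -ᴿ D) +ᴿ (B -ᴿ B)         ≈⟨ R.+-congˡ (R.-‿inverseʳ B) ⟩
        (C -ᴿ D) +ᴿ 0#               ≈⟨ R.+-identityʳ (C -ᴿ D) ⟩
        C -ᴿ D                       ∎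
        where
        A = a ×ᴿ 1#
        B = b ×ᴿ 1#
        C = c ×ᴿ 1#
        D = d ×ᴿ 1#
        same : A +ᴿ D ≈ C +ᴿ B
        same = R.trans (R.sym (×-homo-+ 1# a d)) (R.trans (R.reflexive (cong (_×ᴿ 1#) eq)) (×-homo-+ 1# c b))

      compare? : WeaklyDecidable (Induced-equivalence morphism)
      compare? (a , b) (c , d) with a + d ≟ c + b
      ... | yes eq = just (cross a b c d eq)
      ... | no  _  = nothing

    open Algebra.Solver.Ring differences (fromCommutativeRing R) morphism compare? public
      using (solve; _:=_; _:+_; _:*_; _:-_; :-_)

  -- Fields carried by `Fin q`, difference sets and representation counts.

  record FieldOn (q : ℕ) : Set where
    infixl 6 _⊕_ _⊝_
    infixl 7 _⊙_
    infix 8 ⊖_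
    infix 9 _⁻¹
    field
      _⊕_ _⊙_           : Fin q → Fin q → Fin q
      ⊖_ _⁻¹            : Fin q → Fin q
      0F 1F             : Fin q
      isCommutativeRing : IsCommutativeRing _≡_ _⊕_ _⊙_ ⊖_ 0F 1F
      0≢1               : 0F ≢ 1F
      *-inverseʳ        : ∀ {x} → x ≢ 0F → x ⊙ x ⁻¹ ≡ 1F

    _⊝_ : Fin q → Fin q → Fin q
    x ⊝ y = x ⊕ ⊖ y

    commutativeRing : CommutativeRing 0ℓ 0ℓ
    commutativeRing = record { isCommutativeRing = isCommutativeRing }

  module Additive {q : ℕ} (𝔽 : FieldOn q) where

    open FieldOn 𝔽
    open CommutativeRing commutativeRing public
      using ()
      renaming (+-comm to ⊕-comm; +-assoc to ⊕-assoc; *-comm to ⊙-comm; *-assoc to ⊙-assoc;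
                +-identityˡ to ⊕-identityˡ; +-identityʳ to ⊕-identityʳ;
                *-identityˡ to ⊙-identityˡ; *-identityʳ to ⊙-identityʳ;
                -‿inverseˡ to ⊖-inverseˡ; -‿inverseʳ to ⊖-inverseʳ;
                zeroˡ to ⊙-zeroˡ; zeroʳ to ⊙-zeroʳ; distribˡ to ⊙-distribˡ; distribʳ to ⊙-distribʳ)
    open DifferenceSolver commutativeRing public

    ⊝⊕-cancel : ∀ x y → x ⊝ y ⊕ y ≡ x
    ⊝⊕-cancel = solve 2 (λ x y → x :- y :+ y := x) refl

    ⊕⊝-cancel : ∀ x y → x ⊕ y ⊝ y ≡ x
    ⊕⊝-cancel = solve 2 (λ x y → x :+ y :- y := x) refl

    ⊝-⊝-cancel : ∀ x y → x ⊝ (x ⊝ y) ≡ y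
    ⊝-⊝-cancel = solve 2 (λ x y → x :- (x :- y) := y) refl

    ⊝-swap : ∀ x y → ⊖ (x ⊝ y) ≡ y ⊝ x
    ⊝-swap = solve 2 (λ x y → :- (x :- y) := y :- x) refl

    ⊖-involutive : ∀ x → ⊖ ⊖ x ≡ x
    ⊖-involutive = solve 1 (λ x → :- :- x := x) refl

    ∑-translate : ∀ a (f : Fin q → ℕ) → ∑ (λ x → f (x ⊕ a)) ≡ ∑ f
    ∑-translate a f = ∑-bij f (_⊕ a) (_⊝ a) (λ x → ⊝⊕-cancel x a) (λ x → ⊕⊝-cancel x a)

    ∑-untranslate : ∀ a (f : Fin q → ℕ) → ∑ (λ x → f (x ⊝ a)) ≡ ∑ f
    ∑-untranslate a f = ∑-bij f (_⊝ a) (_⊕ a) (λ x → ⊕⊝-cancel x a) (λ x → ⊝⊕-cancel x a)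

    ∑-reflect : ∀ a (f : Fin q → ℕ) → ∑ (λ x → f (a ⊝ x)) ≡ ∑ f
    ∑-reflect a f = ∑-bij f (a ⊝_) (a ⊝_) (⊝-⊝-cancel a) (⊝-⊝-cancel a)

    ∑-negate : (f : Fin q → ℕ) → ∑ (λ x → f (⊖ x)) ≡ ∑ f
    ∑-negate f = ∑-bij f ⊖_ ⊖_ ⊖-involutive ⊖-involutive

    *-inverseˡ : ∀ {u} → u ≢ 0F → u ⁻¹ ⊙ u ≡ 1F
    *-inverseˡ {u} u≢0 = trans (⊙-comm (u ⁻¹) u) (*-inverseʳ u≢0)

    ⁻¹⊙-cancel : ∀ {u} → u ≢ 0F → ∀ x → u ⁻¹ ⊙ (u ⊙ x) ≡ x
    ⁻¹⊙-cancel {u} u≢0 x = trans (sym (⊙-assoc (u ⁻¹) u x))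
      (trans (cong (_⊙ x) (*-inverseˡ u≢0)) (⊙-identityˡ x))

    ⊙⁻¹-cancel : ∀ {u} → u ≢ 0F → ∀ x → u ⊙ (u ⁻¹ ⊙ x) ≡ x
    ⊙⁻¹-cancel {u} u≢0 x = trans (sym (⊙-assoc u (u ⁻¹) x))
      (trans (cong (_⊙ x) (*-inverseʳ u≢0)) (⊙-identityˡ x))

    ∑-dilate : ∀ {u} → u ≢ 0F → (f : Fin q → ℕ) → ∑ (λ x → f (u ⊙ x)) ≡ ∑ f
    ∑-dilate {u} u≢0 f = ∑-bij f (u ⊙_) (u ⁻¹ ⊙_) (⊙⁻¹-cancel u≢0) (⁻¹⊙-cancel u≢0)

    ∑-undilate : ∀ {u} → u ≢ 0F → (f : Fin q → ℕ) → ∑ (λ x → f (u ⁻¹ ⊙ x)) ≡ ∑ f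
    ∑-undilate {u} u≢0 f = ∑-bij f (u ⁻¹ ⊙_) (u ⊙_) (⁻¹⊙-cancel u≢0) (⊙⁻¹-cancel u≢0)

    diff : FinSet q → FinSet q → FinSet q
    diff A B e = some λ b → B b ∧ A (e ⊕ b)

    diff-intro : ∀ (A B : FinSet q) {a b} → a ∈ A → b ∈ B → (a ⊝ b) ∈ diff A B
    diff-intro A B {a} {b} a∈A b∈B = some-intro (λ c → B c ∧ A (a ⊝ b ⊕ c)) b
      (∧-intro b∈B (subst (_∈ A) (sym (⊝⊕-cancel a b)) a∈A))

    diff-elim : ∀ (A B : FinSet q) {e} → e ∈ diff A B → ∃₂ λ a b → a ∈ A × b ∈ B × e ≡ a ⊝ b
    diff-elim A B {e} e∈ with some-elim {S = λ c → B c ∧ A (e ⊕ c)} e∈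
    ... | b , h with ∧-true {B b} h
    ...   | b∈B , a∈A = e ⊕ b , b , a∈A , b∈B , sym (⊕⊝-cancel e b)

    diff-∀ : ∀ (A B : FinSet q) (P : Fin q → Set) → (∀ {a b} → a ∈ A → b ∈ B → P (a ⊝ b)) →
             ∀ e → e ∈ diff A B → P e
    diff-∀ A B P h e e∈ with diff-elim A B e∈
    ... | a , b , a∈A , b∈B , refl = h a∈A b∈B

    diff-mono : ∀ {A A′ B B′ : FinSet q} → (∀ x → x ∈ A → x ∈ A′) → (∀ x → x ∈ B → x ∈ B′) →
                ∀ e → e ∈ diff A B → e ∈ diff A′ B′
    diff-mono {A} {A′} {B} {B′} hA hB =
      diff-∀ A B (_∈ diff A′ B′) (λ {a} {b} a∈A b∈B → diff-intro A′ B′ (hA a a∈A) (hB b b∈B))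

    conv : FinSet q → FinSet q → Fin q → ℕ
    conv P Q e = ∑ λ s → 𝟙 (P s) * 𝟙 (Q (e ⊝ s))

    ∑-conv : ∀ P Q → ∑ (conv P Q) ≡ card P * card Q
    ∑-conv P Q = begin
      ∑ (λ e → ∑ λ s → 𝟙 (P s) * 𝟙 (Q (e ⊝ s)))    ≡⟨ ∑-swap (λ e s → 𝟙 (P s) * 𝟙 (Q (e ⊝ s))) ⟩
      ∑ (λ s → ∑ λ e → 𝟙 (P s) * 𝟙 (Q (e ⊝ s)))    ≡⟨ ∑-cong (λ s → trans (∑-*ˡ (𝟙 (P s)) (λ e → 𝟙 (Q (e ⊝ s)))) (cong (𝟙 (P s) *_) (∑-untranslate s (λ x → 𝟙 (Q x))))) ⟩
      ∑ (λ s → 𝟙 (P s) * card Q)                   ≡⟨ ∑-*ʳ (card Q) (λ s → 𝟙 (P s)) ⟩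
      card P * card Q                              ∎
      where open ≡-Reasoning

    -- Double counting: all elements together have only |P||Q| representations as a sum from P and
    -- Q. Most difference sets below are bounded in this way, by producing many representations of
    -- each of their elements.
    conv-bound : ∀ S P Q c k → (∀ e → e ∈ S → c ≤ k * conv P Q e) →
                 card S * c ≤ k * (card P * card Q)
    conv-bound S P Q c k h = begin
      card S * c                    ≡⟨ ∑-*ʳ c (λ e → 𝟙 (S e)) ⟨
      ∑ (λ e → 𝟙 (S e) * c)         ≤⟨ ∑-mono (λ e → 𝟙*-≤ (h e)) ⟩
      ∑ (λ e → k * conv P Q e)      ≡⟨ ∑-*ˡ k (conv P Q) ⟩
      k * ∑ (conv P Q)              ≡⟨ cong (k *_) (∑-conv P Q) ⟩
      k * (card P * card Q)         ∎
      where open ≤-Reasoning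

    conv₃ : FinSet q → FinSet q → FinSet q → Fin q → ℕ
    conv₃ P Q R e = ∑ λ s → 𝟙 (P s) * conv Q R (e ⊝ s)

    conv₃-bound : ∀ S P Q R c k → (∀ e → e ∈ S → c ≤ k * conv₃ P Q R e) →
                  card S * c ≤ k * (card P * (card Q * card R))
    conv₃-bound S P Q R c k h = begin
      card S * c                    ≡⟨ ∑-*ʳ c (λ e → 𝟙 (S e)) ⟨
      ∑ (λ e → 𝟙 (S e) * c)         ≤⟨ ∑-mono (λ e → 𝟙*-≤ (h e)) ⟩
      ∑ (λ e → k * conv₃ P Q R e)   ≡⟨ ∑-*ˡ k (conv₃ P Q R) ⟩
      k * ∑ (conv₃ P Q R)           ≡⟨ cong (k *_) (∑-swap (λ e s → 𝟙 (P s) * conv Q R (e ⊝ s))) ⟩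
      k * ∑ (λ s → ∑ λ e → 𝟙 (P s) * conv Q R (e ⊝ s))
        ≡⟨ cong (k *_) (∑-cong (λ s → trans (∑-*ˡ (𝟙 (P s)) (λ e → conv Q R (e ⊝ s)))
             (cong (𝟙 (P s) *_) (trans (∑-untranslate s (conv Q R)) (∑-conv Q R))))) ⟩
      k * ∑ (λ s → 𝟙 (P s) * (card Q * card R))
        ≡⟨ cong (k *_) (∑-*ʳ (card Q * card R) (λ s → 𝟙 (P s))) ⟩
      k * (card P * (card Q * card R))  ∎
      where open ≤-Reasoning

  -- Popular differences and the Balog-Szemerédi-Gowers refinement.

  module Refining {q : ℕ} (𝔽 : FieldOn q) where

    open FieldOn 𝔽
    open Additive 𝔽

    opaque
      -- A difference is popular when it has at least n / (L K) representations. The value 4 · 8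
      -- leaves, for the shift chosen below, fewer than W² / 8 pairs with an unpopular difference.
      -- `L³` collects the numerical factors in the bound on |A′ - A′|; it is not the cube of `L`.
      L L³ : ℕ
      L  = 32
      L³ = 8192

      L≡ : L ≡ 4 * 8
      L≡ = refl

      L³≡ : 4 * 2 * L * L ≡ L³
      L³≡ = refl

    corr : FinSet q → Fin q → ℕ
    corr B d = ∑ λ b → 𝟙 (B b) * 𝟙 (B (b ⊕ d))

    popular : ℕ → ℕ → FinSet q → FinSet q
    popular K n B d = n ≤ᵇ L * K * corr B d

    shared : FinSet q → FinSet q → Fin q → FinSet q
    shared A B s x = A x ∧ B (x ⊝ s)

    meet : FinSet q → FinSet q → Fin q → ℕ
    meet A B s = card (shared A B s)

    -- The solutions of a₁ - b₁ = a₂ - b₂ are sorted by their common value s. For B = ξA with ξ ≠ 0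
    -- this is E(A, ξA).
    energy : FinSet q → FinSet q → ℕ
    energy A B = ∑ λ s → meet A B s * meet A B s

    ∑-meet : ∀ A B → ∑ (meet A B) ≡ card A * card B
    ∑-meet A B = begin
      ∑ (λ s → ∑ λ x → 𝟙 (A x ∧ B (x ⊝ s)))         ≡⟨ ∑-swap (λ s x → 𝟙 (A x ∧ B (x ⊝ s))) ⟩
      ∑ (λ x → ∑ λ s → 𝟙 (A x ∧ B (x ⊝ s)))         ≡⟨ ∑-cong (λ x → trans (∑-cong (λ s → 𝟙-∧ (A x) (B (x ⊝ s)))) (trans (∑-*ˡ (𝟙 (A x)) (λ s → 𝟙 (B (x ⊝ s)))) (cong (𝟙 (A x) *_) (∑-reflect x (λ y → 𝟙 (B y)))))) ⟩
      ∑ (λ x → 𝟙 (A x) * card B)                    ≡⟨ ∑-*ʳ (card B) (λ x → 𝟙 (A x)) ⟩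
      card A * card B                               ∎
      where open ≡-Reasoning

    ∑-corr : ∀ B → ∑ (corr B) ≡ card B * card B
    ∑-corr B = begin
      ∑ (λ d → ∑ λ b → 𝟙 (B b) * 𝟙 (B (b ⊕ d)))     ≡⟨ ∑-swap (λ d b → 𝟙 (B b) * 𝟙 (B (b ⊕ d))) ⟩
      ∑ (λ b → ∑ λ d → 𝟙 (B b) * 𝟙 (B (b ⊕ d)))     ≡⟨ ∑-cong (λ b → trans (∑-*ˡ (𝟙 (B b)) (λ d → 𝟙 (B (b ⊕ d)))) (cong (𝟙 (B b) *_) (trans (∑-cong (λ d → cong (𝟙 ∘ B) (⊕-comm b d))) (∑-translate b (λ x → 𝟙 (B x)))))) ⟩
      ∑ (λ b → 𝟙 (B b) * card B)                    ≡⟨ ∑-*ʳ (card B) (λ b → 𝟙 (B b)) ⟩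
      card B * card B                               ∎
      where open ≡-Reasoning

    ∑-shifts : ∀ B x y → ∑ (λ s → 𝟙 (B (x ⊝ s)) * 𝟙 (B (y ⊝ s))) ≡ corr B (x ⊝ y)
    ∑-shifts B x y = trans (∑-cong pt) (∑-reflect y (λ b → 𝟙 (B b) * 𝟙 (B (b ⊕ (x ⊝ y)))))
      where
      e : ∀ x y s → y ⊝ s ⊕ (x ⊝ y) ≡ x ⊝ s
      e = solve 3 (λ x y s → y :- s :+ (x :- y) := x :- s) refl
      pt : ∀ s → 𝟙 (B (x ⊝ s)) * 𝟙 (B (y ⊝ s)) ≡ 𝟙 (B (y ⊝ s)) * 𝟙 (B (y ⊝ s ⊕ (x ⊝ y)))
      pt s = trans (*-comm (𝟙 (B (x ⊝ s))) _) (cong (λ z → 𝟙 (B (y ⊝ s)) * 𝟙 (B z)) (sym (e x y s)))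

    -- Markov's inequality: the counts `corr B` add up to n².
    card-popular : ∀ K n B → card B ≡ n → 0 < n → card (popular K n B) ≤ L * K * n
    card-popular K n B refl 0<n = *-cancelʳ-≤ _ _ n {{>-nonZero 0<n}} (begin
      card (popular K n B) * n                      ≡⟨ ∑-*ʳ n (λ d → 𝟙 (popular K n B d)) ⟨
      ∑ (λ d → 𝟙 (popular K n B d) * n)             ≤⟨ ∑-mono (λ d → 𝟙*-≤ (≤ᵇ-true {n})) ⟩
      ∑ (λ d → L * K * corr B d)                   ≡⟨ ∑-*ˡ (L * K) (corr B) ⟩
      L * K * ∑ (corr B)                           ≡⟨ cong (L * K *_) (∑-corr B) ⟩
      L * K * (n * n)                              ≡⟨ *-assoc (L * K) n n ⟨
      L * K * n * n                                ∎)
      where open ≤-Reasoning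

    -- `small` is the usual conclusion. `linked` is kept as well, because the later bound for H - H
    -- + H uses the popular differences themselves and not only the size of A′ - A′.
    record Refinement (A B : FinSet q) (n K : ℕ) : Set where
      field
        shift  : Fin q
        A′     : FinSet q
        A′⊆A   : ∀ x → x ∈ A′ → x ∈ A
        A′⊆B   : ∀ x → x ∈ A′ → (x ⊝ shift) ∈ B
        large  : n ≤ 8 * K * card A′
        small  : card (diff A′ A′) ≤ L³ * (K * K * K) * n
        linked : ∀ {x x′} → x ∈ A′ → x′ ∈ A′ →
                 ∃ λ y → (x ⊝ y) ∈ popular K n B × (x′ ⊝ y) ∈ popular K n B

    -- A difference that is not popular lies in few of the sets A ∩ (B + s), because
    -- x and y belong to B + s for only corr B (x ⊝ y) shifts s.  Hence for some s almost
    -- all differences of the large set A ∩ (B + s) are popular.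
    module _ (A B : FinSet q) (n K : ℕ) (|A|≡n : card A ≡ n) (|B|≡n : card B ≡ n)
             (0<n : 0 < n) (hyp : n * n * n ≤ K * energy A B) where

      private
        pop : FinSet q
        pop = popular K n B

        bad : Fin q → Fin q → ℕ
        bad s x = ∑ λ y → 𝟙 (shared A B s y) * 𝟙 (not (pop (x ⊝ y)))

        allBad : Fin q → ℕ
        allBad s = ∑ λ x → 𝟙 (shared A B s x) * bad s x

        regroup : ∀ a b c d e → (a * b) * ((c * d) * e) ≡ a * (c * e) * (b * d)
        regroup = solve-∀

        pairs : ∀ x y → L * K * ∑ (λ s → 𝟙 (shared A B s x) * (𝟙 (shared A B s y) * 𝟙 (not (pop (x ⊝ y))))) ≤
                        𝟙 (A x) * (𝟙 (A y) * n)
        pairs x y = begin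
          L * K * ∑ (λ s → 𝟙 (shared A B s x) * (𝟙 (shared A B s y) * 𝟙 np))
            ≡⟨ cong (L * K *_) (∑-cong (λ s → trans (cong₂ (λ u v → u * (v * 𝟙 np)) (𝟙-∧ (A x) (B (x ⊝ s))) (𝟙-∧ (A y) (B (y ⊝ s))))
                 (regroup (𝟙 (A x)) (𝟙 (B (x ⊝ s))) (𝟙 (A y)) (𝟙 (B (y ⊝ s))) (𝟙 np)))) ⟩
          L * K * ∑ (λ s → 𝟙 (A x) * (𝟙 (A y) * 𝟙 np) * (𝟙 (B (x ⊝ s)) * 𝟙 (B (y ⊝ s))))
            ≡⟨ cong (L * K *_) (trans (∑-*ˡ (𝟙 (A x) * (𝟙 (A y) * 𝟙 np)) (λ s → 𝟙 (B (x ⊝ s)) * 𝟙 (B (y ⊝ s)))) (cong (𝟙 (A x) * (𝟙 (A y) * 𝟙 np) *_) (∑-shifts B x y))) ⟩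
          L * K * (𝟙 (A x) * (𝟙 (A y) * 𝟙 np) * corr B (x ⊝ y))
            ≡⟨ e (L * K) (𝟙 (A x)) (𝟙 (A y)) (𝟙 np) (corr B (x ⊝ y)) ⟩
          𝟙 (A x) * (𝟙 (A y) * (𝟙 np * (L * K * corr B (x ⊝ y))))
            ≤⟨ *-monoʳ-≤ (𝟙 (A x)) (*-monoʳ-≤ (𝟙 (A y)) (𝟙*-≤ {np} (λ h → <⇒≤ (≤ᵇ-false {n} h)))) ⟩
          𝟙 (A x) * (𝟙 (A y) * n)  ∎
          where
          open ≤-Reasoning
          np = not (pop (x ⊝ y))
          e : ∀ k a b c d → k * (a * (b * c) * d) ≡ a * (b * (c * (k * d)))
          e = solve-∀

        few-bad : ∑ (λ s → L * K * allBad s) ≤ n * n * n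
        few-bad = begin
          ∑ (λ s → L * K * allBad s)                    ≡⟨ ∑-*ˡ (L * K) allBad ⟩
          L * K * ∑ (λ s → ∑ λ x → 𝟙 (shared A B s x) * bad s x)
            ≡⟨ cong (L * K *_) (∑-cong (λ s → ∑-cong (λ x → sym (∑-*ˡ (𝟙 (shared A B s x)) (λ y → 𝟙 (shared A B s y) * 𝟙 (not (pop (x ⊝ y)))))))) ⟩
          L * K * ∑ (λ s → ∑ λ x → ∑ λ y → F s x y)      ≡⟨ cong (L * K *_) (∑-swap (λ s x → ∑ λ y → F s x y)) ⟩
          L * K * ∑ (λ x → ∑ λ s → ∑ λ y → F s x y)      ≡⟨ cong (L * K *_) (∑-cong (λ x → ∑-swap (λ s y → F s x y))) ⟩
          L * K * ∑ (λ x → ∑ λ y → ∑ λ s → F s x y)      ≡⟨ ∑-*ˡ (L * K) (λ x → ∑ λ y → ∑ λ s → F s x y) ⟨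
          ∑ (λ x → L * K * ∑ λ y → ∑ λ s → F s x y)      ≡⟨ ∑-cong (λ x → ∑-*ˡ (L * K) (λ y → ∑ λ s → F s x y)) ⟨
          ∑ (λ x → ∑ λ y → L * K * ∑ λ s → F s x y)      ≤⟨ ∑-mono (λ x → ∑-mono (pairs x)) ⟩
          ∑ (λ x → ∑ λ y → 𝟙 (A x) * (𝟙 (A y) * n))      ≡⟨ ∑-*-∑ (λ x → 𝟙 (A x)) (λ y → 𝟙 (A y) * n) ⟨
          card A * ∑ (λ y → 𝟙 (A y) * n)                 ≡⟨ cong (card A *_) (∑-*ʳ n (λ y → 𝟙 (A y))) ⟩
          card A * (card A * n)                          ≡⟨ cong (λ a → a * (a * n)) |A|≡n ⟩
          n * (n * n)                                    ≡⟨ *-assoc n n n ⟨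
          n * n * n                                      ∎
          where
          open ≤-Reasoning
          F : Fin q → Fin q → Fin q → ℕ
          F s x y = 𝟙 (shared A B s x) * (𝟙 (shared A B s y) * 𝟙 (not (pop (x ⊝ y))))

        w : Fin q → ℕ
        w = meet A B

        -- One inequality carries both requirements: the first summand forces |A ∩ (B + s)| > n /
        -- 4K, the second leaves few unpopular pairs. Summed over s, the left side is at most 2n³
        -- and the right side at least 4n³.
        choice : ∃ λ s → n * w s + L * K * allBad s < 4 * K * (w s * w s)
        choice = ∑-< _ _ (begin-strict
          ∑ (λ s → n * w s + L * K * allBad s)           ≡⟨ ∑-+ (λ s → n * w s) (λ s → L * K * allBad s) ⟩
          ∑ (λ s → n * w s) + ∑ (λ s → L * K * allBad s) ≤⟨ +-mono-≤ (≤-reflexive ∑w) few-bad ⟩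
          n * n * n + n * n * n                           <⟨ double (n * n * n) (>-nonZero⁻¹ (n * n * n)) ⟩
          4 * (n * n * n)                                 ≤⟨ *-monoʳ-≤ 4 hyp ⟩
          4 * (K * energy A B)                            ≡⟨ *-assoc 4 K (energy A B) ⟨
          4 * K * energy A B                              ≡⟨ ∑-*ˡ (4 * K) (λ s → w s * w s) ⟨
          ∑ (λ s → 4 * K * (w s * w s))                   ∎)
          where
          open ≤-Reasoning
          instance
            n≢0 : NonZero n
            n≢0 = >-nonZero 0<n
            nn≢0 : NonZero (n * n)
            nn≢0 = m*n≢0 n n
            nnn≢0 : NonZero (n * n * n)
            nnn≢0 = m*n≢0 (n * n) n
          ∑w : ∑ (λ s → n * w s) ≡ n * n * n
          ∑w = trans (∑-*ˡ n w) (trans (cong (n *_) (trans (∑-meet A B) (cong₂ _*_ |A|≡n |B|≡n))) (sym (*-assoc n n n)))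
          double : ∀ m → 0 < m → m + m < 4 * m
          double m 0<m = subst (m + m <_) (e m) (m<m+n (m + m) (≤-trans 0<m (m≤m+n m m)))
            where e : ∀ m → (m + m) + (m + m) ≡ 4 * m
                  e = solve-∀

        module Chosen (s₀ : Fin q)
          (chosen : n * w s₀ + L * K * allBad s₀ < 4 * K * (w s₀ * w s₀)) where

          W : ℕ
          W = w s₀

          S : FinSet q
          S = shared A B s₀

          4KW : n * W < 4 * K * (W * W)
          4KW = ≤-<-trans (m≤m+n (n * W) _) (chosen)

          0<W : 0 < W
          0<W = n≢0⇒n>0 λ W≡0 → n≮0 (subst (λ v → n * v < 4 * K * (v * v)) W≡0 4KW |> zero-right)
            where
            _|>_ : ∀ {X Y : Set} → X → (X → Y) → Y
            x |> f = f x
            zero-right : n * 0 < 4 * K * 0 → n * 0 < 0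
            zero-right = subst (n * 0 <_) (*-zeroʳ (4 * K))

          n<4KW : n < 4 * K * W
          n<4KW = *-cancelʳ-< W n (4 * K * W) (subst (n * W <_) (sym (*-assoc (4 * K) W W)) 4KW)

          8bad<W² : 8 * allBad s₀ < W * W
          8bad<W² = *-cancelˡ-< (4 * K) (8 * allBad s₀) (W * W) (begin-strict
            4 * K * (8 * allBad s₀)      ≡⟨ trans (e K (allBad s₀)) (cong (λ l → l * K * allBad s₀) (sym L≡)) ⟩
            L * K * allBad s₀           ≤⟨ m≤n+m _ (n * W) ⟩
            n * W + L * K * allBad s₀   <⟨ chosen ⟩
            4 * K * (W * W)              ∎)
            where
            open ≤-Reasoning
            e : ∀ k x → 4 * k * (8 * x) ≡ 4 * 8 * k * x
            e = solve-∀

          good? : Fin q → Bool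
          good? x = 4 * bad s₀ x ≤ᵇ W

          G rest : FinSet q
          G x = S x ∧ good? x
          rest x = S x ∧ not (good? x)

          W-split : W ≡ card G + card rest
          W-split = trans (∑-cong pt) (∑-+ (λ x → 𝟙 (G x)) (λ x → 𝟙 (rest x)))
            where
            pt : ∀ x → 𝟙 (S x) ≡ 𝟙 (G x) + 𝟙 (rest x)
            pt x with S x | good? x
            ... | false | _     = refl
            ... | true  | true  = refl
            ... | true  | false = refl

          -- Markov again: each element of `rest` has an unpopular difference with more than W / 4
          -- elements of S, and there are fewer than W² / 8 such pairs.
          rest-few : 2 * card rest < W
          rest-few = *-cancelʳ-< W (2 * card rest) W (begin-strict
            2 * card rest * W                    ≡⟨ *-assoc 2 (card rest) W ⟩
            2 * (card rest * W)                  ≡⟨ cong (2 *_) (∑-*ʳ W (λ x → 𝟙 (rest x))) ⟨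
            2 * ∑ (λ x → 𝟙 (rest x) * W)         ≤⟨ *-monoʳ-≤ 2 (∑-mono pt) ⟩
            2 * ∑ (λ x → 4 * (𝟙 (S x) * bad s₀ x)) ≡⟨ cong (2 *_) (∑-*ˡ 4 (λ x → 𝟙 (S x) * bad s₀ x)) ⟩
            2 * (4 * allBad s₀)                  ≡⟨ *-assoc 2 4 (allBad s₀) ⟨
            8 * allBad s₀                        <⟨ 8bad<W² ⟩
            W * W                                ∎)
            where
            open ≤-Reasoning
            pt : ∀ x → 𝟙 (rest x) * W ≤ 4 * (𝟙 (S x) * bad s₀ x)
            pt x with S x
            ... | false = z≤n
            ... | true  = ≤-trans (𝟙*-≤ {not (good? x)} (λ h → <⇒≤ (≤ᵇ-false {4 * bad s₀ x} h)))
                            (≤-reflexive (cong (4 *_) (sym (+-identityʳ (bad s₀ x)))))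

          W<2G : W < 2 * card G
          W<2G = +-cancelʳ-< W W (2 * card G) (begin-strict
            W + W                             ≡⟨ cong₂ _+_ W-split W-split ⟩
            card G + card rest + (card G + card rest) ≡⟨ e (card G) (card rest) ⟩
            2 * card G + 2 * card rest        <⟨ +-monoʳ-< (2 * card G) rest-few ⟩
            2 * card G + W                    ∎)
            where
            open ≤-Reasoning
            e : ∀ a b → a + b + (a + b) ≡ 2 * a + 2 * b
            e = solve-∀

          common : Fin q → Fin q → ℕ
          common x x′ = ∑ λ y → 𝟙 (S y) * (𝟙 (pop (x ⊝ y)) * 𝟙 (pop (x′ ⊝ y)))

          -- Each of x and x′ is bad with at most W / 4 elements of S, so half of S serves both.
          W≤2common : ∀ {x x′} → x ∈ G → x′ ∈ G → W ≤ 2 * common x x′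
          W≤2common {x} {x′} x∈G x′∈G = +-cancelʳ-≤ W W (2 * common x x′) (begin
            W + W                                        ≡⟨ e₁ W ⟩
            2 * W                                        ≤⟨ *-monoʳ-≤ 2 W≤ ⟩
            2 * (common x x′ + (bad s₀ x + bad s₀ x′))   ≡⟨ e₂ (common x x′) (bad s₀ x) (bad s₀ x′) ⟩
            2 * common x x′ + (2 * bad s₀ x + 2 * bad s₀ x′) ≤⟨ +-monoʳ-≤ (2 * common x x′) halves ⟩
            2 * common x x′ + W                          ∎)
            where
            open ≤-Reasoning
            e₁ : ∀ a → a + a ≡ 2 * a
            e₁ = solve-∀
            e₂ : ∀ a b c → 2 * (a + (b + c)) ≡ 2 * a + (2 * b + 2 * c)
            e₂ = solve-∀
            e₃ : ∀ b c → 2 * (2 * b + 2 * c) ≡ 4 * b + 4 * c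
            e₃ = solve-∀
            few : ∀ {x} → x ∈ G → 4 * bad s₀ x ≤ W
            few {x} h = ≤ᵇ-true {4 * bad s₀ x} (proj₂ (∧-true {S x} h))
            halves : 2 * bad s₀ x + 2 * bad s₀ x′ ≤ W
            halves = *-cancelˡ-≤ 2 (begin
              2 * (2 * bad s₀ x + 2 * bad s₀ x′)   ≡⟨ e₃ (bad s₀ x) (bad s₀ x′) ⟩
              4 * bad s₀ x + 4 * bad s₀ x′         ≤⟨ +-mono-≤ (few x∈G) (few x′∈G) ⟩
              W + W                                ≡⟨ e₁ W ⟩
              2 * W                                ∎)
            triple : ∀ b c d → 𝟙 b ≤ 𝟙 b * (𝟙 c * 𝟙 d) + (𝟙 b * 𝟙 (not c) + 𝟙 b * 𝟙 (not d))
            triple false _     _     = z≤n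
            triple true  true  true  = s≤s z≤n
            triple true  true  false = s≤s z≤n
            triple true  false true  = s≤s z≤n
            triple true  false false = s≤s z≤n
            W≤ : W ≤ common x x′ + (bad s₀ x + bad s₀ x′)
            W≤ = begin
              W  ≤⟨ ∑-mono (λ y → triple (S y) (pop (x ⊝ y)) (pop (x′ ⊝ y))) ⟩
              ∑ (λ y → f y + (g y + h y))   ≡⟨ ∑-+ f (λ y → g y + h y) ⟩
              ∑ f + ∑ (λ y → g y + h y)     ≡⟨ cong (∑ f +_) (∑-+ g h) ⟩
              ∑ f + (∑ g + ∑ h)             ∎
              where
              f g h : Fin q → ℕ
              f y = 𝟙 (S y) * (𝟙 (pop (x ⊝ y)) * 𝟙 (pop (x′ ⊝ y)))
              g y = 𝟙 (S y) * 𝟙 (not (pop (x ⊝ y)))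
              h y = 𝟙 (S y) * 𝟙 (not (pop (x′ ⊝ y)))

          pop⁻ : FinSet q
          pop⁻ d = pop (⊖ d)

          -- Every common y gives x - x′ = (x - y) - (x′ - y); `pop⁻` carries the sign.
          rep : ∀ {x x′} → x ∈ G → x′ ∈ G → W ≤ 2 * conv pop pop⁻ (x ⊝ x′)
          rep {x} {x′} x∈G x′∈G = ≤-trans (W≤2common x∈G x′∈G) (*-monoʳ-≤ 2 (begin
            common x x′                                         ≤⟨ ∑-mono (λ y → 𝟙*≤ (S y) _) ⟩
            ∑ (λ y → 𝟙 (pop (x ⊝ y)) * 𝟙 (pop (x′ ⊝ y)))        ≡⟨ ∑-cong (λ y → cong (λ z → 𝟙 (pop (x ⊝ y)) * 𝟙 (pop z)) (sym (e₁ x x′ y))) ⟩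
            ∑ (λ y → 𝟙 (pop (x ⊝ y)) * 𝟙 (pop⁻ (x ⊝ x′ ⊝ (x ⊝ y)))) ≡⟨ ∑-reflect x (λ s → 𝟙 (pop s) * 𝟙 (pop⁻ (x ⊝ x′ ⊝ s))) ⟩
            conv pop pop⁻ (x ⊝ x′)                              ∎))
            where
            open ≤-Reasoning
            e₁ : ∀ x x′ y → ⊖ (x ⊝ x′ ⊝ (x ⊝ y)) ≡ x′ ⊝ y
            e₁ = solve 3 (λ x x′ y → :- (x :- x′ :- (x :- y)) := x′ :- y) refl

          reps : ∀ e → e ∈ diff G G → W ≤ 2 * conv pop pop⁻ e
          reps = diff-∀ G G (λ e → W ≤ 2 * conv pop pop⁻ e) rep

          |diff| : card (diff G G) ≤ L³ * (K * K * K) * n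
          |diff| = *-cancelʳ-≤ (card (diff G G)) (L³ * (K * K * K) * n) n {{>-nonZero 0<n}} (begin
            D * n                                        ≤⟨ *-monoʳ-≤ D (<⇒≤ n<4KW) ⟩
            D * (4 * K * W)                              ≡⟨ e₁ D K W ⟩
            4 * K * (D * W)                              ≤⟨ *-monoʳ-≤ (4 * K) (conv-bound (diff G G) pop pop⁻ W 2 reps) ⟩
            4 * K * (2 * (card pop * card pop⁻))         ≡⟨ cong (λ p → 4 * K * (2 * (card pop * p))) (∑-negate (λ d → 𝟙 (pop d))) ⟩
            4 * K * (2 * (card pop * card pop))          ≤⟨ *-monoʳ-≤ (4 * K) (*-monoʳ-≤ 2 (*-mono-≤ |pop| |pop|)) ⟩
            4 * K * (2 * ((L * K * n) * (L * K * n)))  ≡⟨ trans (e₂ 4 2 L K n) (cong (λ l → l * (K * K * K) * n * n) L³≡) ⟩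
            L³ * (K * K * K) * n * n                   ∎)
            where
            open ≤-Reasoning
            D = card (diff G G)
            |pop| = card-popular K n B |B|≡n 0<n
            e₁ : ∀ d k w → d * (4 * k * w) ≡ 4 * k * (d * w)
            e₁ = solve-∀
            e₂ : ∀ a b c k n → a * k * (b * ((c * k * n) * (c * k * n))) ≡ a * b * c * c * (k * k * k) * n * n
            e₂ = solve-∀

          result : Refinement A B n K
          result = record
            { shift  = s₀
            ; A′     = G
            ; A′⊆A   = λ x h → proj₁ (∧-true {A x} (proj₁ (∧-true {S x} h)))
            ; A′⊆B   = λ x h → proj₂ (∧-true {A x} (proj₁ (∧-true {S x} h)))
            ; large  = ≤-trans (<⇒≤ n<4KW) (≤-trans (*-monoʳ-≤ (4 * K) (<⇒≤ W<2G)) (≤-reflexive (e K (card G))))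
            ; small  = |diff|
            ; linked = link
            }
            where
            e : ∀ k g → 4 * k * (2 * g) ≡ 8 * k * g
            e = solve-∀
            link : ∀ {x x′} → x ∈ G → x′ ∈ G → ∃ λ y → (x ⊝ y) ∈ pop × (x′ ⊝ y) ∈ pop
            link {x} {x′} x∈G x′∈G =
              let y , h = ∑-positive (λ y → 𝟙 (S y) * (𝟙 (pop (x ⊝ y)) * 𝟙 (pop (x′ ⊝ y))))
                            (*-cancelˡ-< 2 0 _ (≤-trans 0<W (W≤2common x∈G x′∈G)))
                  p , p′ = pos (𝟙 (pop (x ⊝ y))) (proj₂ (pos (𝟙 (S y)) h))
              in y , 𝟙-positive p , 𝟙-positive p′
              where
              pos : ∀ a {b} → 0 < a * b → 0 < a × 0 < b
              pos (suc a) {suc b} _ = s≤s z≤n , s≤s z≤n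
              pos (suc a) {zero}  h = contradiction (subst (0 <_) (*-zeroʳ a) h) n≮0

      refine : Refinement A B n K
      refine = Chosen.result (proj₁ choice) (proj₂ choice)

  -- Many large rectangles in A × A: one meets many others.

  module Pigeonhole where

    cauchy-𝟙 : ∀ {n} (S : FinSet n) (f : Fin n → ℕ) →
               ∑ (λ x → 𝟙 (S x) * f x) * ∑ (λ x → 𝟙 (S x) * f x) ≤ card S * ∑ (λ x → f x * f x)
    cauchy-𝟙 S f = ≤-trans (cauchy (λ x → 𝟙 (S x)) f)
      (*-monoˡ-≤ _ (≤-reflexive (∑-cong (λ x → 𝟙-idem (S x)))))

    -- By Cauchy-Schwarz over A × A, the mean of |(P ξ × R ξ) ∩ (P ζ × R ζ)| over ξ, ζ ∈ X is
    -- at least 1/c times the mean of |P ξ × R ξ|.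
    module _ {n : ℕ} (A X : FinSet n) (P R : Fin n → FinSet n) (c : ℕ)
      (0<A : 0 < card A) (0<X : 0 < card X)
      (P⊆A : ∀ {ξ} → ξ ∈ X → ∀ a → a ∈ P ξ → a ∈ A)
      (R⊆A : ∀ {ξ} → ξ ∈ X → ∀ b → b ∈ R ξ → b ∈ A)
      (dense : ∀ {ξ} → ξ ∈ X → card A * card A ≤ c * (card (P ξ) * card (R ξ)))
      where

      private
        a N : ℕ
        a = card A
        N = card X

        M : Fin n → ℕ
        M ξ = card (P ξ) * card (R ξ)

        ov : Fin n → Fin n → ℕ
        ov ξ ζ = card (P ξ ∩ P ζ) * card (R ξ ∩ R ζ)

        χ : Fin n → Fin n → Fin n → ℕ
        χ ξ x y = 𝟙 (X ξ) * (𝟙 (P ξ x) * 𝟙 (R ξ y))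

        count : Fin n → Fin n → ℕ
        count x y = ∑ λ ξ → χ ξ x y

        total : ℕ
        total = ∑ λ ξ → 𝟙 (X ξ) * M ξ

        overlapping : ℕ
        overlapping = ∑ λ ξ → 𝟙 (X ξ) * ∑ λ ζ → 𝟙 (X ζ) * ov ξ ζ

        -- As P ξ and R ξ lie in A, the indicators of A may be inserted for free. They confine the
        -- Cauchy-Schwarz inequality to the a² points of A × A.
        total≡ : total ≡ ∑ λ x → 𝟙 (A x) * ∑ λ y → 𝟙 (A y) * count x y
        total≡ = begin
          ∑ (λ ξ → 𝟙 (X ξ) * M ξ)
            ≡⟨ ∑-cong (λ ξ → trans (cong (𝟙 (X ξ) *_) (∑-*-∑ (λ x → 𝟙 (P ξ x)) (λ y → 𝟙 (R ξ y))))
                 (trans (sym (∑-*ˡ (𝟙 (X ξ)) (λ x → ∑ λ y → 𝟙 (P ξ x) * 𝟙 (R ξ y))))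
                   (∑-cong (λ x → sym (∑-*ˡ (𝟙 (X ξ)) (λ y → 𝟙 (P ξ x) * 𝟙 (R ξ y))))))) ⟩
          ∑ (λ ξ → ∑ λ x → ∑ λ y → χ ξ x y)      ≡⟨ ∑-swap (λ ξ x → ∑ λ y → χ ξ x y) ⟩
          ∑ (λ x → ∑ λ ξ → ∑ λ y → χ ξ x y)      ≡⟨ ∑-cong (λ x → ∑-swap (λ ξ y → χ ξ x y)) ⟩
          ∑ (λ x → ∑ λ y → count x y)            ≡⟨ ∑-cong (λ x → ∑-cong (λ y → inside x y)) ⟩
          ∑ (λ x → ∑ λ y → 𝟙 (A x) * (𝟙 (A y) * count x y))
            ≡⟨ ∑-cong (λ x → ∑-*ˡ (𝟙 (A x)) (λ y → 𝟙 (A y) * count x y)) ⟩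
          ∑ (λ x → 𝟙 (A x) * ∑ λ y → 𝟙 (A y) * count x y)  ∎
          where
          open ≡-Reasoning
          absorb : ∀ b c d {e f} → (b ≡ true → c ≡ true → e ≡ true) → (b ≡ true → d ≡ true → f ≡ true) →
                   𝟙 b * (𝟙 c * 𝟙 d) ≡ 𝟙 e * (𝟙 f * (𝟙 b * (𝟙 c * 𝟙 d)))
          absorb false c     d     {e} {f} _ _ = sym (trans (cong (𝟙 e *_) (*-zeroʳ (𝟙 f))) (*-zeroʳ (𝟙 e)))
          absorb true  false d     {e} {f} _ _ = sym (trans (cong (𝟙 e *_) (*-zeroʳ (𝟙 f))) (*-zeroʳ (𝟙 e)))
          absorb true  true  false {e} {f} _ _ = sym (trans (cong (𝟙 e *_) (*-zeroʳ (𝟙 f))) (*-zeroʳ (𝟙 e)))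
          absorb true  true  true  h k rewrite h refl refl | k refl refl = refl
          inside : ∀ x y → count x y ≡ 𝟙 (A x) * (𝟙 (A y) * count x y)
          inside x y = trans (∑-cong (λ ξ → absorb (X ξ) (P ξ x) (R ξ y) (λ h → P⊆A h x) (λ h → R⊆A h y)))
            (trans (∑-*ˡ (𝟙 (A x)) (λ ξ → 𝟙 (A y) * χ ξ x y)) (cong (𝟙 (A x) *_) (∑-*ˡ (𝟙 (A y)) (λ ξ → χ ξ x y))))

        overlapping≡ : ∑ (λ x → ∑ λ y → count x y * count x y) ≡ overlapping
        overlapping≡ = begin
          ∑ (λ x → ∑ λ y → count x y * count x y)
            ≡⟨ ∑-cong (λ x → ∑-cong (λ y → ∑-*-∑ (λ ξ → χ ξ x y) (λ ζ → χ ζ x y))) ⟩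
          ∑ (λ x → ∑ λ y → ∑ λ ξ → ∑ λ ζ → T ξ ζ x y)  ≡⟨ ∑-cong (λ x → ∑-swap (λ y ξ → ∑ λ ζ → T ξ ζ x y)) ⟩
          ∑ (λ x → ∑ λ ξ → ∑ λ y → ∑ λ ζ → T ξ ζ x y)  ≡⟨ ∑-swap (λ x ξ → ∑ λ y → ∑ λ ζ → T ξ ζ x y) ⟩
          ∑ (λ ξ → ∑ λ x → ∑ λ y → ∑ λ ζ → T ξ ζ x y)  ≡⟨ ∑-cong (λ ξ → ∑-cong (λ x → ∑-swap (λ y ζ → T ξ ζ x y))) ⟩
          ∑ (λ ξ → ∑ λ x → ∑ λ ζ → ∑ λ y → T ξ ζ x y)  ≡⟨ ∑-cong (λ ξ → ∑-swap (λ x ζ → ∑ λ y → T ξ ζ x y)) ⟩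
          ∑ (λ ξ → ∑ λ ζ → ∑ λ x → ∑ λ y → T ξ ζ x y)  ≡⟨ ∑-cong (λ ξ → trans (∑-cong (λ ζ → one ξ ζ)) (∑-*ˡ (𝟙 (X ξ)) (λ ζ → 𝟙 (X ζ) * ov ξ ζ))) ⟩
          overlapping  ∎
          where
          open ≡-Reasoning
          T : Fin n → Fin n → Fin n → Fin n → ℕ
          T ξ ζ x y = χ ξ x y * χ ζ x y
          shuffle : ∀ x₁ x₂ p₁ p₂ r₁ r₂ → x₁ * (p₁ * r₁) * (x₂ * (p₂ * r₂)) ≡ x₁ * x₂ * ((p₁ * p₂) * (r₁ * r₂))
          shuffle = solve-∀
          one : ∀ ξ ζ → ∑ (λ x → ∑ λ y → T ξ ζ x y) ≡ 𝟙 (X ξ) * (𝟙 (X ζ) * ov ξ ζ)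
          one ξ ζ = begin
            ∑ (λ x → ∑ λ y → T ξ ζ x y)
              ≡⟨ ∑-cong (λ x → ∑-cong (λ y → trans (shuffle (𝟙 (X ξ)) (𝟙 (X ζ)) (𝟙 (P ξ x)) (𝟙 (P ζ x)) (𝟙 (R ξ y)) (𝟙 (R ζ y)))
                   (cong₂ (λ u v → 𝟙 (X ξ) * 𝟙 (X ζ) * (u * v)) (sym (𝟙-∧ (P ξ x) (P ζ x))) (sym (𝟙-∧ (R ξ y) (R ζ y)))))) ⟩
            ∑ (λ x → ∑ λ y → k * (p x * r y))      ≡⟨ ∑-cong (λ x → ∑-*ˡ k (λ y → p x * r y)) ⟩
            ∑ (λ x → k * ∑ λ y → p x * r y)        ≡⟨ ∑-*ˡ k (λ x → ∑ λ y → p x * r y) ⟩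
            k * ∑ (λ x → ∑ λ y → p x * r y)        ≡⟨ cong (k *_) (∑-*-∑ p r) ⟨
            k * ov ξ ζ                             ≡⟨ *-assoc (𝟙 (X ξ)) (𝟙 (X ζ)) (ov ξ ζ) ⟩
            𝟙 (X ξ) * (𝟙 (X ζ) * ov ξ ζ)           ∎
            where
            k = 𝟙 (X ξ) * 𝟙 (X ζ)
            p r : Fin n → ℕ
            p x = 𝟙 ((P ξ ∩ P ζ) x)
            r y = 𝟙 ((R ξ ∩ R ζ) y)

        -- `cauchy-𝟙` once for each coordinate; the squares of `count` add up to the sizes of all
        -- pairwise intersections.
        total²≤ : total * total ≤ a * a * overlapping
        total²≤ = begin
          total * total                                          ≡⟨ cong₂ _*_ total≡ total≡ ⟩
          ∑ (λ x → 𝟙 (A x) * C x) * ∑ (λ x → 𝟙 (A x) * C x)      ≤⟨ cauchy-𝟙 A C ⟩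
          a * ∑ (λ x → C x * C x)                                ≤⟨ *-monoʳ-≤ a (∑-mono (λ x → cauchy-𝟙 A (count x))) ⟩
          a * ∑ (λ x → a * ∑ λ y → count x y * count x y)        ≡⟨ cong (a *_) (∑-*ˡ a (λ x → ∑ λ y → count x y * count x y)) ⟩
          a * (a * ∑ λ x → ∑ λ y → count x y * count x y)        ≡⟨ *-assoc a a _ ⟨
          a * a * ∑ (λ x → ∑ λ y → count x y * count x y)        ≡⟨ cong (a * a *_) overlapping≡ ⟩
          a * a * overlapping                                    ∎
          where
          open ≤-Reasoning
          C : Fin n → ℕ
          C x = ∑ λ y → 𝟙 (A y) * count x y

        instance
          a≢0 : NonZero a
          a≢0 = >-nonZero 0<A
          aa≢0 : NonZero (a * a)
          aa≢0 = m*n≢0 a a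

        N*total≤ : N * total ≤ c * overlapping
        N*total≤ = *-cancelˡ-≤ (a * a) (begin
          a * a * (N * total)            ≡⟨ e₁ (a * a) N total ⟩
          N * (a * a) * total            ≤⟨ *-monoˡ-≤ total Naa≤ ⟩
          c * total * total              ≡⟨ *-assoc c total total ⟩
          c * (total * total)            ≤⟨ *-monoʳ-≤ c total²≤ ⟩
          c * (a * a * overlapping)      ≡⟨ e₂ c (a * a) overlapping ⟩
          a * a * (c * overlapping)      ∎)
          where
          open ≤-Reasoning
          e₁ : ∀ x y z → x * (y * z) ≡ y * x * z
          e₁ = solve-∀
          e₂ : ∀ x y z → x * (y * z) ≡ y * (x * z)
          e₂ = solve-∀
          Naa≤ : N * (a * a) ≤ c * total
          Naa≤ = begin
            N * (a * a)                         ≡⟨ ∑-*ʳ (a * a) (λ ξ → 𝟙 (X ξ)) ⟨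
            ∑ (λ ξ → 𝟙 (X ξ) * (a * a))         ≤⟨ ∑-mono (λ ξ → 𝟙*-mono {X ξ} dense) ⟩
            ∑ (λ ξ → 𝟙 (X ξ) * (c * M ξ))       ≡⟨ ∑-cong (λ ξ → e₂ (𝟙 (X ξ)) c (M ξ)) ⟩
            ∑ (λ ξ → c * (𝟙 (X ξ) * M ξ))       ≡⟨ ∑-*ˡ c (λ ξ → 𝟙 (X ξ) * M ξ) ⟩
            c * total                           ∎

        O : Fin n → ℕ
        O ξ = ∑ λ ζ → 𝟙 (X ζ) * ov ξ ζ

        -- The `suc` adds |X| > 0 to the right side and makes the comparison of sums strict; the
        -- factor 𝟙 (X ξ) ensures that the ξ found lies in X.
        centre : ∃ λ ξ → 𝟙 (X ξ) * (N * M ξ) < 𝟙 (X ξ) * suc (c * O ξ)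
        centre = ∑-< _ _ (begin-strict
          ∑ (λ ξ → 𝟙 (X ξ) * (N * M ξ))                   ≡⟨ ∑-cong (λ ξ → e (𝟙 (X ξ)) N (M ξ)) ⟩
          ∑ (λ ξ → N * (𝟙 (X ξ) * M ξ))                   ≡⟨ ∑-*ˡ N (λ ξ → 𝟙 (X ξ) * M ξ) ⟩
          N * total                                       ≤⟨ N*total≤ ⟩
          c * overlapping                                 <⟨ m<n+m (c * overlapping) 0<X ⟩
          N + c * overlapping                             ≡⟨ cong (N +_) (∑-*ˡ c (λ ξ → 𝟙 (X ξ) * O ξ)) ⟨
          N + ∑ (λ ξ → c * (𝟙 (X ξ) * O ξ))               ≡⟨ ∑-+ (λ ξ → 𝟙 (X ξ)) (λ ξ → c * (𝟙 (X ξ) * O ξ)) ⟨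
          ∑ (λ ξ → 𝟙 (X ξ) + c * (𝟙 (X ξ) * O ξ))         ≡⟨ ∑-cong (λ ξ → e′ (𝟙 (X ξ)) c (O ξ)) ⟩
          ∑ (λ ξ → 𝟙 (X ξ) * suc (c * O ξ))               ∎)
          where
          open ≤-Reasoning
          e : ∀ x y z → x * (y * z) ≡ y * (x * z)
          e = solve-∀
          e′ : ∀ x y z → x + y * (x * z) ≡ x * suc (y * z)
          e′ = solve-∀

      record Star : Set where
        field
          ξ₀         : Fin n
          ξ₀∈X       : ξ₀ ∈ X
          X′         : FinSet n
          X′⊆X       : ∀ ξ → ξ ∈ X′ → ξ ∈ X
          large      : card X ≤ 2 * c * card X′
          overlapped : ∀ {ξ} → ξ ∈ X′ → card (P ξ₀) * card (R ξ₀) ≤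
                       2 * c * (card (P ξ₀ ∩ P ξ) * card (R ξ₀ ∩ R ξ))

      private
        module Centre (ξ₀ : Fin n) (ξ₀∈X : ξ₀ ∈ X) (NM≤ : N * M ξ₀ ≤ c * O ξ₀) where

          X′ : FinSet n
          X′ ξ = X ξ ∧ (M ξ₀ ≤ᵇ 2 * c * ov ξ₀ ξ)

          ov≤M : ∀ ξ → ov ξ₀ ξ ≤ M ξ₀
          ov≤M ξ = *-mono-≤ (card-mono (λ x h → proj₁ (∧-true {P ξ₀ x} h)))
                            (card-mono (λ x h → proj₁ (∧-true {R ξ₀ x} h)))

          0<M : 0 < M ξ₀
          0<M = n≢0⇒n>0 λ M≡0 → <⇒≱ (>-nonZero⁻¹ (a * a))
            (≤-trans (dense ξ₀∈X) (≤-reflexive (trans (cong (c *_) M≡0) (*-zeroʳ c))))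

          pt : ∀ ξ → 2 * c * (𝟙 (X ξ) * ov ξ₀ ξ) ≤ 2 * c * M ξ₀ * 𝟙 (X′ ξ) + M ξ₀ * 𝟙 (X ξ)
          pt ξ with X ξ
          ... | false = ≤-trans (≤-reflexive (*-zeroʳ (2 * c))) z≤n
          ... | true with M ξ₀ ≤ᵇ 2 * c * ov ξ₀ ξ in eq
          ...   | true  = ≤-trans (*-monoʳ-≤ (2 * c) (≤-trans (≤-reflexive (*-identityˡ (ov ξ₀ ξ))) (ov≤M ξ)))
                            (≤-trans (≤-reflexive (sym (*-identityʳ (2 * c * M ξ₀)))) (m≤m+n _ (M ξ₀ * 1)))
          ...   | false = ≤-trans (≤-trans (≤-reflexive (cong (2 * c *_) (*-identityˡ (ov ξ₀ ξ))))
                            (<⇒≤ (≤ᵇ-false {M ξ₀} (cong not eq))))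
                            (≤-trans (≤-reflexive (sym (*-identityʳ (M ξ₀)))) (m≤n+m (M ξ₀ * 1) (2 * c * M ξ₀ * 0)))

          -- The ξ below the threshold contribute at most N M / 2c to O ξ₀ ≥ N M / c, with M = M ξ₀.
          -- The other half comes from X′, where each ξ contributes at most M.
          large : N ≤ 2 * c * card X′
          large = *-cancelʳ-≤ N (2 * c * card X′) (M ξ₀) {{>-nonZero 0<M}} (+-cancelʳ-≤ (N * M ξ₀) (N * M ξ₀) (2 * c * card X′ * M ξ₀) (begin
            N * M ξ₀ + N * M ξ₀                     ≡⟨ e₁ (N * M ξ₀) ⟩
            2 * (N * M ξ₀)                          ≤⟨ *-monoʳ-≤ 2 NM≤ ⟩
            2 * (c * O ξ₀)                          ≡⟨ *-assoc 2 c (O ξ₀) ⟨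
            2 * c * O ξ₀                            ≡⟨ ∑-*ˡ (2 * c) (λ ξ → 𝟙 (X ξ) * ov ξ₀ ξ) ⟨
            ∑ (λ ξ → 2 * c * (𝟙 (X ξ) * ov ξ₀ ξ))   ≤⟨ ∑-mono pt ⟩
            ∑ (λ ξ → 2 * c * M ξ₀ * 𝟙 (X′ ξ) + M ξ₀ * 𝟙 (X ξ))
              ≡⟨ trans (∑-+ (λ ξ → 2 * c * M ξ₀ * 𝟙 (X′ ξ)) (λ ξ → M ξ₀ * 𝟙 (X ξ)))
                   (cong₂ _+_ (∑-*ˡ (2 * c * M ξ₀) (λ ξ → 𝟙 (X′ ξ))) (∑-*ˡ (M ξ₀) (λ ξ → 𝟙 (X ξ)))) ⟩
            2 * c * M ξ₀ * card X′ + M ξ₀ * N       ≡⟨ e₂ (2 * c) (M ξ₀) (card X′) N ⟩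
            2 * c * card X′ * M ξ₀ + N * M ξ₀       ∎))
            where
            open ≤-Reasoning
            e₁ : ∀ x → x + x ≡ 2 * x
            e₁ = solve-∀
            e₂ : ∀ c m x n → c * m * x + m * n ≡ c * x * m + n * m
            e₂ = solve-∀

          result : Star
          result = record
            { ξ₀ = ξ₀ ; ξ₀∈X = ξ₀∈X ; X′ = X′ ; large = large
            ; X′⊆X = λ ξ h → proj₁ (∧-true {X ξ} h)
            ; overlapped = λ {ξ} h → ≤ᵇ-true {M ξ₀} (proj₂ (∧-true {X ξ} h))
            }

      star : Star
      star = Centre.result ξ₀ ξ₀∈X (strip (subst (λ b → 𝟙 b * (N * M ξ₀) < 𝟙 b * suc (c * O ξ₀)) ξ₀∈X (proj₂ centre)))
        where
        ξ₀ = proj₁ centre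
        member : ∀ b {x y} → 𝟙 b * x < 𝟙 b * y → b ≡ true
        member true  _ = refl
        ξ₀∈X : ξ₀ ∈ X
        ξ₀∈X = member (X ξ₀) (proj₂ centre)
        strip : ∀ {x y} → 1 * x < 1 * suc y → x ≤ y
        strip {x} {y} h = s≤s⁻¹ (subst₂ _<_ (*-identityˡ x) (*-identityˡ (suc y)) h)

  -- Extraction of a set H nearly fixed by many dilations.

  module Extraction {q : ℕ} (𝔽 : FieldOn q) where

    open FieldOn 𝔽
    open Additive 𝔽
    open Refining 𝔽
    open Pigeonhole

    dil : Fin q → FinSet q → FinSet q
    dil ξ A x = A (ξ ⁻¹ ⊙ x)

    card-dil : ∀ {ξ} → ξ ≢ 0F → ∀ A → card (dil ξ A) ≡ card A
    card-dil ξ≢0 A = ∑-undilate ξ≢0 (λ x → 𝟙 (A x))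

    -- A - uB
    dilDiff : Fin q → FinSet q → FinSet q → FinSet q
    dilDiff u A B e = some λ b → B b ∧ A (e ⊕ u ⊙ b)

    dilDiff-intro : ∀ u (A B : FinSet q) {a b} → a ∈ A → b ∈ B → (a ⊝ u ⊙ b) ∈ dilDiff u A B
    dilDiff-intro u A B {a} {b} a∈A b∈B = some-intro (λ c → B c ∧ A (a ⊝ u ⊙ b ⊕ u ⊙ c)) b
      (∧-intro b∈B (subst (_∈ A) (sym (⊝⊕-cancel a (u ⊙ b))) a∈A))

    dilDiff-∀ : ∀ u (A B : FinSet q) (P : Fin q → Set) → (∀ {a b} → a ∈ A → b ∈ B → P (a ⊝ u ⊙ b)) →
                ∀ e → e ∈ dilDiff u A B → P e
    dilDiff-∀ u A B P h e e∈ =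
      let b , p     = some-elim {S = λ c → B c ∧ A (e ⊕ u ⊙ c)} e∈
          b∈B , a∈A = ∧-true {B b} p
      in subst P (⊕⊝-cancel e (u ⊙ b)) (h a∈A b∈B)

    -- Cauchy-Schwarz on the support: all |A||B| pairs have their difference in A - B.
    energy-lower : ∀ A B → card A * card B * (card A * card B) ≤ card (diff A B) * energy A B
    energy-lower A B = begin
      card A * card B * (card A * card B)            ≡⟨ cong₂ _*_ (sym m) (sym m) ⟩
      ∑ (λ s → 𝟙 (diff A B s) * meet A B s) * ∑ (λ s → 𝟙 (diff A B s) * meet A B s)
                                                     ≤⟨ cauchy-𝟙 (diff A B) (meet A B) ⟩
      card (diff A B) * energy A B                   ∎
      where
      open ≤-Reasoning
      support : ∀ b x → (0 < x → b ≡ true) → 𝟙 b * x ≡ x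
      support true  x       h = *-identityˡ x
      support false zero    h = refl
      support false (suc x) h with h (s≤s z≤n)
      ... | ()
      meets : ∀ s → 0 < meet A B s → s ∈ diff A B
      meets s h =
        let x , p     = card-∃ {S = shared A B s} h
            x∈A , y∈B = ∧-true {A x} p
        in subst (_∈ diff A B) (⊝-⊝-cancel x s) (diff-intro A B x∈A y∈B)
      m : ∑ (λ s → 𝟙 (diff A B s) * meet A B s) ≡ card A * card B
      m = trans (∑-cong (λ s → support (diff A B s) (meet A B s) (meets s))) (∑-meet A B)

    corr-⊖ : ∀ B d → corr B (⊖ d) ≡ corr B d
    corr-⊖ B d = trans (sym (∑-translate d (λ b → 𝟙 (B b) * 𝟙 (B (b ⊕ ⊖ d))))) (∑-cong λ b →
      trans (*-comm (𝟙 (B (b ⊕ d))) _) (cong (λ z → 𝟙 (B z) * 𝟙 (B (b ⊕ d))) (⊕⊝-cancel b d)))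

    -- Each of the representations d₁ = b₁ - c₁ and d₂ = b₂ - c₂ by elements of A gives
    -- a + d₁ + d₂ = (a - c₁) + (b₁ - c₂) + b₂.
    telescope : ∀ A {a d₁ d₂} → a ∈ A →
                corr A d₁ * corr A d₂ ≤ conv₃ (diff A A) (diff A A) A (a ⊕ d₁ ⊕ d₂)
    telescope A {a} {d₁} {d₂} a∈A = begin
      corr A d₁ * corr A d₂
        ≡⟨ ∑-*ʳ (corr A d₂) (λ c → 𝟙 (A c) * 𝟙 (A (c ⊕ d₁))) ⟨
      ∑ (λ c → 𝟙 (A c) * 𝟙 (A (c ⊕ d₁)) * corr A d₂)
        ≤⟨ ∑-mono first ⟩
      ∑ (λ c → 𝟙 (D (a ⊝ c)) * conv D A (a ⊕ d₁ ⊕ d₂ ⊝ (a ⊝ c)))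
        ≡⟨ ∑-reflect a (λ s → 𝟙 (D s) * conv D A (a ⊕ d₁ ⊕ d₂ ⊝ s)) ⟩
      conv₃ D D A (a ⊕ d₁ ⊕ d₂)  ∎
      where
      open ≤-Reasoning
      D = diff A A
      e₁ : ∀ a c d₁ d₂ → a ⊕ d₁ ⊕ d₂ ⊝ (a ⊝ c) ≡ c ⊕ d₁ ⊕ d₂
      e₁ = solve 4 (λ a c d₁ d₂ → a :+ d₁ :+ d₂ :- (a :- c) := c :+ d₁ :+ d₂) refl
      e₂ : ∀ b c d → b ⊕ d ⊝ (b ⊝ c) ≡ c ⊕ d
      e₂ = solve 3 (λ b c d → b :+ d :- (b :- c) := c :+ d) refl
      second : ∀ {b} → b ∈ A → corr A d₂ ≤ conv D A (b ⊕ d₂)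
      second {b} b∈A = begin
        ∑ (λ c → 𝟙 (A c) * 𝟙 (A (c ⊕ d₂)))              ≤⟨ ∑-mono (λ c → *-mono-≤ (𝟙-mono {A c} (λ c∈A → diff-intro A A b∈A c∈A)) (≤-reflexive (cong (λ z → 𝟙 (A z)) (sym (e₂ b c d₂))))) ⟩
        ∑ (λ c → 𝟙 (D (b ⊝ c)) * 𝟙 (A (b ⊕ d₂ ⊝ (b ⊝ c)))) ≡⟨ ∑-reflect b (λ s → 𝟙 (D s) * 𝟙 (A (b ⊕ d₂ ⊝ s))) ⟩
        conv D A (b ⊕ d₂)                              ∎
      first : ∀ c → 𝟙 (A c) * 𝟙 (A (c ⊕ d₁)) * corr A d₂ ≤ 𝟙 (D (a ⊝ c)) * conv D A (a ⊕ d₁ ⊕ d₂ ⊝ (a ⊝ c))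
      first c = begin
        𝟙 (A c) * 𝟙 (A (c ⊕ d₁)) * corr A d₂      ≡⟨ *-assoc (𝟙 (A c)) (𝟙 (A (c ⊕ d₁))) (corr A d₂) ⟩
        𝟙 (A c) * (𝟙 (A (c ⊕ d₁)) * corr A d₂)    ≤⟨ *-mono-≤ (𝟙-mono {A c} (λ c∈A → diff-intro A A a∈A c∈A)) (𝟙*-≤ {A (c ⊕ d₁)} second) ⟩
        𝟙 (D (a ⊝ c)) * conv D A (c ⊕ d₁ ⊕ d₂)    ≡⟨ cong (λ z → 𝟙 (D (a ⊝ c)) * conv D A z) (e₁ a c d₁ d₂) ⟨
        𝟙 (D (a ⊝ c)) * conv D A (a ⊕ d₁ ⊕ d₂ ⊝ (a ⊝ c)) ∎

    -- Δ bounds |A₀ - A₀| / |A₀| for the central set A₀ = A_ξ₀. All bounds carry the factor 8 Δ |H|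
    -- since the second refinement gives |A₀| ≤ 8 Δ |H|.
    record Core (A X : FinSet q) (n K : ℕ) : Set where
      Δ : ℕ
      Δ = 8 * L³ * (K * K * K * K)
      field
        ξ₀      : Fin q
        ξ₀∈X    : ξ₀ ∈ X
        X′      : FinSet q
        X′⊆X    : ∀ ξ → ξ ∈ X′ → ξ ∈ X
        X′-size : card X ≤ 2 * (64 * (K * K)) * card X′
        H       : FinSet q
        H⊆A     : ∀ x → x ∈ H → x ∈ A
        H-size  : n ≤ 8 * K * (8 * Δ * card H)
        unit    : card (diff H H) ≤ Δ * (8 * Δ * card H)
        dilates : ∀ {ξ} → ξ ∈ X′ →
                  card (dilDiff (ξ₀ ⁻¹ ⊙ ξ) H H) ≤ 2 * (64 * (K * K)) * (Δ * Δ * Δ) * (8 * Δ * card H)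
        triple  : card (diff H (diff H H)) ≤ L * L * (Δ * Δ * Δ * Δ) * (8 * Δ * card H)

    module _ (A X : FinSet q) (n K : ℕ) (|A|≡n : card A ≡ n) (0<n : 0 < n) (0<X : 0 < card X)
             (0∉X : ∀ {ξ} → ξ ∈ X → ξ ≢ 0F)
             (hyp : ∀ {ξ} → ξ ∈ X → n * n * n ≤ K * energy A (dil ξ A)) where

      private
        Δ : ℕ
        Δ = 8 * L³ * (K * K * K * K)

        Part : Fin q → Set
        Part ξ = Σ (FinSet q) λ P → Σ (Fin q) λ s → (ξ ∈ X →
          (∀ a → a ∈ P → a ∈ A) × (∀ a → a ∈ P → (a ⊝ s) ∈ dil ξ A) ×
          n ≤ 8 * K * card P × card (diff P P) ≤ L³ * (K * K * K) * n)

        part : ∀ ξ → Part ξ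
        part ξ = choose (X ξ Bool.≟ true)
          where
          choose : Dec (ξ ∈ X) → Part ξ
          -- Dummy values: the properties are claimed only for ξ in X.
          choose (no ξ∉X) = X , ξ , λ ξ∈X → contradiction ξ∈X ξ∉X
          choose (yes ξ∈X) = A′ , shift , λ _ → A′⊆A , A′⊆B , large , small
            where open Refinement (refine A (dil ξ A) n K |A|≡n (trans (card-dil (0∉X ξ∈X) A) |A|≡n) 0<n (hyp ξ∈X))

        P : Fin q → FinSet q
        P ξ = proj₁ (part ξ)

        sh : Fin q → Fin q
        sh ξ = proj₁ (proj₂ (part ξ))

        -- For ξ ≠ 0 this is ξ⁻¹(P ξ - s), the subset B_ξ of A with A_ξ = ξB_ξ + s, where s is the
        -- shift of ξ.
        R : Fin q → FinSet q
        R ξ b = P ξ (ξ ⊙ b ⊕ sh ξ)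

        P⊆A : ∀ {ξ} → ξ ∈ X → ∀ a → a ∈ P ξ → a ∈ A
        P⊆A {ξ} ξ∈X = proj₁ (proj₂ (proj₂ (part ξ)) ξ∈X)

        R⊆A : ∀ {ξ} → ξ ∈ X → ∀ b → b ∈ R ξ → b ∈ A
        R⊆A {ξ} ξ∈X b h = subst (_∈ A) (trans (cong (ξ ⁻¹ ⊙_) (⊕⊝-cancel (ξ ⊙ b) (sh ξ))) (⁻¹⊙-cancel (0∉X ξ∈X) b))
          (proj₁ (proj₂ (proj₂ (proj₂ (part ξ)) ξ∈X)) (ξ ⊙ b ⊕ sh ξ) h)

        P-large : ∀ {ξ} → ξ ∈ X → n ≤ 8 * K * card (P ξ)
        P-large {ξ} ξ∈X = proj₁ (proj₂ (proj₂ (proj₂ (proj₂ (part ξ)) ξ∈X)))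

        P-small : ∀ {ξ} → ξ ∈ X → card (diff (P ξ) (P ξ)) ≤ L³ * (K * K * K) * n
        P-small {ξ} ξ∈X = proj₂ (proj₂ (proj₂ (proj₂ (proj₂ (part ξ)) ξ∈X)))

        |R| : ∀ {ξ} → ξ ∈ X → card (R ξ) ≡ card (P ξ)
        |R| {ξ} ξ∈X = trans (∑-dilate (0∉X ξ∈X) (λ x → 𝟙 (P ξ (x ⊕ sh ξ)))) (∑-translate (sh ξ) (λ x → 𝟙 (P ξ x)))

        dense : ∀ {ξ} → ξ ∈ X → card A * card A ≤ 64 * (K * K) * (card (P ξ) * card (R ξ))
        dense {ξ} ξ∈X = begin
          card A * card A                                  ≡⟨ cong₂ _*_ |A|≡n |A|≡n ⟩
          n * n                                            ≤⟨ *-mono-≤ (P-large ξ∈X) (P-large ξ∈X) ⟩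
          8 * K * card (P ξ) * (8 * K * card (P ξ))        ≡⟨ e 8 K (card (P ξ)) ⟩
          64 * (K * K) * (card (P ξ) * card (P ξ))         ≡⟨ cong (λ r → 64 * (K * K) * (card (P ξ) * r)) (|R| ξ∈X) ⟨
          64 * (K * K) * (card (P ξ) * card (R ξ))         ∎
          where
          open ≤-Reasoning
          e : ∀ c k p → c * k * p * (c * k * p) ≡ c * c * (k * k) * (p * p)
          e = solve-∀

        S : Star A X P R (64 * (K * K)) (subst (0 <_) (sym |A|≡n) 0<n) 0<X P⊆A R⊆A dense
        S = star A X P R (64 * (K * K)) (subst (0 <_) (sym |A|≡n) 0<n) 0<X P⊆A R⊆A dense

      module Centred (ξ₀ : Fin q) (ξ₀∈X : ξ₀ ∈ X) where

        A₀ : FinSet q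
        A₀ = P ξ₀

        m : ℕ
        m = card A₀

        n≤8Km : n ≤ 8 * K * m
        n≤8Km = P-large ξ₀∈X

        P-small′ : ∀ {ξ} → ξ ∈ X → card (diff (P ξ) (P ξ)) ≤ Δ * m
        P-small′ ξ∈X = ≤-trans (P-small ξ∈X) (≤-trans (*-monoʳ-≤ (L³ * (K * K * K)) n≤8Km) (≤-reflexive (e L³ 8 K m)))
          where e : ∀ l c k m → l * (k * k * k) * (c * k * m) ≡ c * l * (k * k * k * k) * m
                e = solve-∀

        0<m : 0 < m
        0<m = n≢0⇒n>0 λ m≡0 → <⇒≱ 0<n (≤-trans n≤8Km (≤-reflexive (trans (cong (8 * K *_) m≡0) (*-zeroʳ (8 * K)))))

        instance
          m≢0 : NonZero m
          m≢0 = >-nonZero 0<m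
          mm≢0 : NonZero (m * m)
          mm≢0 = m*n≢0 m m

        ξ₀≢0 : ξ₀ ≢ 0F
        ξ₀≢0 = 0∉X ξ₀∈X

        -- With θ = ξ / ξ₀, every p in A₀ ∩ P ξ and r in R ξ₀ ∩ R ξ give a - θa′ = (a - p) + (p -
        -- ξr) + (ξr - θa′). The terms lie in A₀ - A₀, in a translate of P ξ - P ξ, and in a dilated
        -- translate of A₀ - A₀: multiplied by ξ₀ / ξ, the last becomes ξ₀r - a′, and ξ₀r lies in a
        -- translate of A₀.
        chain : ∀ {ξ} → ξ ∈ X → card (dilDiff (ξ₀ ⁻¹ ⊙ ξ) A₀ A₀) * (card (A₀ ∩ P ξ) * card (R ξ₀ ∩ R ξ)) ≤
                Δ * Δ * Δ * (m * m * m)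
        chain {ξ} ξ∈X = begin
          card (dilDiff θ A₀ A₀) * (card (A₀ ∩ P ξ) * card (R ξ₀ ∩ R ξ))
            ≤⟨ conv₃-bound (dilDiff θ A₀ A₀) Z₁ Z₂ Z₃ _ 1 (dilDiff-∀ θ A₀ A₀ _ (λ {a} {a′} a∈ a′∈ → ≤-trans (rep a∈ a′∈) (≤-reflexive (sym (*-identityˡ _))))) ⟩
          1 * (card Z₁ * (card Z₂ * card Z₃))
            ≡⟨ cong₂ (λ z₂ z₃ → 1 * (card Z₁ * (z₂ * z₃))) (∑-untranslate (sh ξ) (λ x → 𝟙 (diff (P ξ) (P ξ) x))) |Z₃| ⟩
          1 * (card Z₁ * (card (diff (P ξ) (P ξ)) * card Z₁))
            ≤⟨ *-monoʳ-≤ 1 (*-mono-≤ (P-small′ ξ₀∈X) (*-mono-≤ (P-small′ ξ∈X) (P-small′ ξ₀∈X))) ⟩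
          1 * (Δ * m * (Δ * m * (Δ * m)))     ≡⟨ e Δ m ⟩
          Δ * Δ * Δ * (m * m * m)             ∎
          where
          open ≤-Reasoning
          e : ∀ d m → 1 * (d * m * (d * m * (d * m))) ≡ d * d * d * (m * m * m)
          e = solve-∀
          ξ≢0 : ξ ≢ 0F
          ξ≢0 = 0∉X ξ∈X
          θ : Fin q
          θ = ξ₀ ⁻¹ ⊙ ξ
          Pc Rc Z₁ Z₂ Z₃ : FinSet q
          Pc = A₀ ∩ P ξ
          Rc = R ξ₀ ∩ R ξ
          Z₁ = diff A₀ A₀
          Z₂ t = diff (P ξ) (P ξ) (t ⊝ sh ξ)
          Z₃ x = diff A₀ A₀ (ξ₀ ⊙ (ξ ⁻¹ ⊙ x) ⊕ sh ξ₀)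
          |Z₃| : card Z₃ ≡ card Z₁
          |Z₃| = trans (∑-undilate ξ≢0 (λ x → 𝟙 (diff A₀ A₀ (ξ₀ ⊙ x ⊕ sh ξ₀))))
                   (trans (∑-dilate ξ₀≢0 (λ x → 𝟙 (diff A₀ A₀ (x ⊕ sh ξ₀)))) (∑-translate (sh ξ₀) (λ x → 𝟙 (diff A₀ A₀ x))))
          e₂ : ∀ p y s → p ⊝ y ⊝ s ≡ p ⊝ (y ⊕ s)
          e₂ = solve 3 (λ p y s → p :- y :- s := p :- (y :+ s)) refl
          e₃ : ∀ a p y z → a ⊝ z ⊝ (a ⊝ p) ⊝ (p ⊝ y) ≡ y ⊝ z
          e₃ = solve 4 (λ a p y z → a :- z :- (a :- p) :- (p :- y) := y :- z) refl
          e₄ : ∀ ξ₀ η ξ r i a s → ξ₀ ⊙ (η ⊙ (ξ ⊙ r ⊝ i ⊙ ξ ⊙ a)) ⊕ s ≡ ξ₀ ⊙ (η ⊙ (ξ ⊙ r)) ⊕ s ⊝ ξ₀ ⊙ (i ⊙ (η ⊙ (ξ ⊙ a)))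
          e₄ = solve 7 (λ ξ₀ η ξ r i a s → ξ₀ :* (η :* (ξ :* r :- i :* ξ :* a)) :+ s := ξ₀ :* (η :* (ξ :* r)) :+ s :- ξ₀ :* (i :* (η :* (ξ :* a)))) refl
          last : ∀ {a r} → a ∈ A₀ → r ∈ R ξ₀ → (ξ ⊙ r ⊝ θ ⊙ a) ∈ Z₃
          last {a} {r} a∈ r∈ = subst (_∈ diff A₀ A₀)
            (sym (trans (e₄ ξ₀ (ξ ⁻¹) ξ r (ξ₀ ⁻¹) a (sh ξ₀))
              (cong₂ (λ u v → ξ₀ ⊙ u ⊕ sh ξ₀ ⊝ v) (⁻¹⊙-cancel ξ≢0 r)
                (trans (⊙⁻¹-cancel ξ₀≢0 _) (⁻¹⊙-cancel ξ≢0 a)))))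
            (diff-intro A₀ A₀ r∈ a∈)
          inner : ∀ {a a′ p} → a′ ∈ A₀ → p ∈ P ξ → card Rc ≤ conv Z₂ Z₃ (a ⊝ θ ⊙ a′ ⊝ (a ⊝ p))
          inner {a} {a′} {p} a′∈ p∈ = begin
            ∑ (λ r → 𝟙 (Rc r))
              ≤⟨ ∑-mono (λ r → ≤-trans (𝟙-mono {Rc r} (both r)) (≤-reflexive (𝟙-∧ (Z₂ (p ⊝ ξ ⊙ r)) _))) ⟩
            ∑ (λ r → 𝟙 (Z₂ (p ⊝ ξ ⊙ r)) * 𝟙 (Z₃ (t ⊝ (p ⊝ ξ ⊙ r))))
              ≡⟨ ∑-dilate ξ≢0 (λ y → 𝟙 (Z₂ (p ⊝ y)) * 𝟙 (Z₃ (t ⊝ (p ⊝ y)))) ⟩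
            ∑ (λ y → 𝟙 (Z₂ (p ⊝ y)) * 𝟙 (Z₃ (t ⊝ (p ⊝ y))))
              ≡⟨ ∑-reflect p (λ y → 𝟙 (Z₂ y) * 𝟙 (Z₃ (t ⊝ y))) ⟩
            conv Z₂ Z₃ t  ∎
            where
            t : Fin q
            t = a ⊝ θ ⊙ a′ ⊝ (a ⊝ p)
            both : ∀ r → r ∈ Rc → Z₂ (p ⊝ ξ ⊙ r) ∧ Z₃ (t ⊝ (p ⊝ ξ ⊙ r)) ≡ true
            both r h =
              let r∈₀ , r∈ = ∧-true {R ξ₀ r} h
              in ∧-intro (subst (_∈ diff (P ξ) (P ξ)) (sym (e₂ p (ξ ⊙ r) (sh ξ))) (diff-intro (P ξ) (P ξ) p∈ r∈))
                         (subst (_∈ Z₃) (sym (e₃ a p (ξ ⊙ r) (θ ⊙ a′))) (last a′∈ r∈₀))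
          rep : ∀ {a a′} → a ∈ A₀ → a′ ∈ A₀ → card Pc * card Rc ≤ conv₃ Z₁ Z₂ Z₃ (a ⊝ θ ⊙ a′)
          rep {a} {a′} a∈ a′∈ = begin
            card Pc * card Rc                   ≡⟨ ∑-*ʳ (card Rc) (λ p → 𝟙 (Pc p)) ⟨
            ∑ (λ p → 𝟙 (Pc p) * card Rc)        ≤⟨ ∑-mono pt ⟩
            ∑ (λ p → 𝟙 (Z₁ (a ⊝ p)) * conv Z₂ Z₃ (a ⊝ θ ⊙ a′ ⊝ (a ⊝ p)))
              ≡⟨ ∑-reflect a (λ s → 𝟙 (Z₁ s) * conv Z₂ Z₃ (a ⊝ θ ⊙ a′ ⊝ s)) ⟩
            conv₃ Z₁ Z₂ Z₃ (a ⊝ θ ⊙ a′)         ∎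
            where
            pt : ∀ p → 𝟙 (Pc p) * card Rc ≤ 𝟙 (Z₁ (a ⊝ p)) * conv Z₂ Z₃ (a ⊝ θ ⊙ a′ ⊝ (a ⊝ p))
            pt p = ≤-trans (𝟙*-mono {Pc p} (λ h → inner {a} a′∈ (proj₂ (∧-true {A₀ p} h))))
                     (*-monoˡ-≤ _ (𝟙-mono {Pc p} (λ h → diff-intro A₀ A₀ a∈ (proj₁ (∧-true {A₀ p} h)))))

        dilates₀ : ∀ {ξ} → ξ ∈ X → m * m ≤ 2 * (64 * (K * K)) * (card (A₀ ∩ P ξ) * card (R ξ₀ ∩ R ξ)) →
                   card (dilDiff (ξ₀ ⁻¹ ⊙ ξ) A₀ A₀) ≤ 2 * (64 * (K * K)) * (Δ * Δ * Δ) * m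
        dilates₀ {ξ} ξ∈X h = *-cancelʳ-≤ _ _ (m * m) (begin
          D * (m * m)                            ≤⟨ *-monoʳ-≤ D h ⟩
          D * (c * pr)                           ≡⟨ e₁ D c pr ⟩
          c * (D * pr)                           ≤⟨ *-monoʳ-≤ c (chain ξ∈X) ⟩
          c * (Δ * Δ * Δ * (m * m * m))          ≡⟨ e₂ c (Δ * Δ * Δ) m ⟩
          c * (Δ * Δ * Δ) * m * (m * m)          ∎)
          where
          open ≤-Reasoning
          D = card (dilDiff (ξ₀ ⁻¹ ⊙ ξ) A₀ A₀)
          c = 2 * (64 * (K * K))
          pr = card (A₀ ∩ P ξ) * card (R ξ₀ ∩ R ξ)
          e₁ : ∀ a b c → a * (b * c) ≡ b * (a * c)
          e₁ = solve-∀
          e₂ : ∀ c d m → c * (d * (m * m * m)) ≡ c * d * m * (m * m)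
          e₂ = solve-∀

        energy₀ : m * m * m ≤ Δ * energy A₀ A₀
        energy₀ = *-cancelʳ-≤ _ _ m (begin
          m * m * m * m                          ≡⟨ *-assoc (m * m) m m ⟩
          m * m * (m * m)                        ≤⟨ energy-lower A₀ A₀ ⟩
          card (diff A₀ A₀) * energy A₀ A₀       ≤⟨ *-monoˡ-≤ _ (P-small′ ξ₀∈X) ⟩
          Δ * m * energy A₀ A₀                   ≡⟨ e Δ m (energy A₀ A₀) ⟩
          Δ * energy A₀ A₀ * m                   ∎)
          where
          open ≤-Reasoning
          e : ∀ a b c → a * b * c ≡ a * c * b
          e = solve-∀

        -- A₀ has few differences and therefore large energy with itself, so it can be refined
        -- against itself; what this gains is the property `linked`.
        second : Refinement A₀ A₀ m Δ
        second = refine A₀ A₀ m Δ refl refl 0<m energy₀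

        open Refinement second using () renaming (A′ to H; A′⊆A to H⊆A₀; large to m≤8ΔH; linked to H-linked)

        -- a - (x - y) = a + (y - z) - (x - z), where z links x and y. Both differences on the right
        -- have at least m / (LΔ) representations in A₀, and `telescope` turns each pair of these
        -- into a representation of a - (x - y) by A₀ - A₀, A₀ - A₀ and A₀.
        triple₀ : card (diff H (diff H H)) ≤ L * L * (Δ * Δ * Δ * Δ) * m
        triple₀ = *-cancelʳ-≤ _ _ (m * m) (begin
          card (diff H (diff H H)) * (m * m)
            ≤⟨ conv₃-bound (diff H (diff H H)) (diff A₀ A₀) (diff A₀ A₀) A₀ (m * m) (L * Δ * (L * Δ))
                 (diff-∀ H (diff H H) _ (λ {a} {d} a∈ d∈ → outer a∈ d d∈)) ⟩
          L * Δ * (L * Δ) * (card (diff A₀ A₀) * (card (diff A₀ A₀) * m))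
            ≤⟨ *-monoʳ-≤ (L * Δ * (L * Δ)) (*-mono-≤ (P-small′ ξ₀∈X) (*-monoˡ-≤ m (P-small′ ξ₀∈X))) ⟩
          L * Δ * (L * Δ) * (Δ * m * (Δ * m * m))      ≡⟨ e L Δ m ⟩
          L * L * (Δ * Δ * Δ * Δ) * m * (m * m)        ∎)
          where
          open ≤-Reasoning
          e : ∀ l d m → l * d * (l * d) * (d * m * (d * m * m)) ≡ l * l * (d * d * d * d) * m * (m * m)
          e = solve-∀
          e₁ : ∀ a x y z → a ⊕ (y ⊝ z) ⊕ ⊖ (x ⊝ z) ≡ a ⊝ (x ⊝ y)
          e₁ = solve 4 (λ a x y z → a :+ (y :- z) :+ :- (x :- z) := a :- (x :- y)) refl
          e₂ : ∀ a b c d → a * b * (c * d) ≡ a * c * (b * d)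
          e₂ = solve-∀
          outer : ∀ {a} → a ∈ H → ∀ d → d ∈ diff H H →
                  m * m ≤ L * Δ * (L * Δ) * conv₃ (diff A₀ A₀) (diff A₀ A₀) A₀ (a ⊝ d)
          outer {a} a∈H = diff-∀ H H _ λ {x} {y} x∈H y∈H →
            let z , px , py = H-linked x∈H y∈H
            in begin
              m * m                                          ≤⟨ *-mono-≤ (≤ᵇ-true {m} py) (≤ᵇ-true {m} px) ⟩
              L * Δ * corr A₀ (y ⊝ z) * (L * Δ * corr A₀ (x ⊝ z)) ≡⟨ e₂ (L * Δ) (corr A₀ (y ⊝ z)) (L * Δ) (corr A₀ (x ⊝ z)) ⟩
              L * Δ * (L * Δ) * (corr A₀ (y ⊝ z) * corr A₀ (x ⊝ z)) ≡⟨ cong (λ c → L * Δ * (L * Δ) * (corr A₀ (y ⊝ z) * c)) (corr-⊖ A₀ (x ⊝ z)) ⟨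
              L * Δ * (L * Δ) * (corr A₀ (y ⊝ z) * corr A₀ (⊖ (x ⊝ z)))
                ≤⟨ *-monoʳ-≤ (L * Δ * (L * Δ)) (telescope A₀ (H⊆A₀ a a∈H)) ⟩
              L * Δ * (L * Δ) * conv₃ (diff A₀ A₀) (diff A₀ A₀) A₀ (a ⊕ (y ⊝ z) ⊕ ⊖ (x ⊝ z))
                ≡⟨ cong (λ t → L * Δ * (L * Δ) * conv₃ (diff A₀ A₀) (diff A₀ A₀) A₀ t) (e₁ a x y z) ⟩
              L * Δ * (L * Δ) * conv₃ (diff A₀ A₀) (diff A₀ A₀) A₀ (a ⊝ (x ⊝ y)) ∎

        module _ (X′ : FinSet q) (X′⊆X : ∀ ξ → ξ ∈ X′ → ξ ∈ X)
                 (X′-size : card X ≤ 2 * (64 * (K * K)) * card X′)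
                 (overlapped : ∀ {ξ} → ξ ∈ X′ → card A₀ * card (R ξ₀) ≤
                               2 * (64 * (K * K)) * (card (A₀ ∩ P ξ) * card (R ξ₀ ∩ R ξ))) where

          result : Core A X n K
          result = record
            { ξ₀ = ξ₀ ; ξ₀∈X = ξ₀∈X ; X′ = X′ ; X′⊆X = X′⊆X ; X′-size = X′-size ; H = H
            ; H⊆A = λ x x∈H → P⊆A ξ₀∈X x (H⊆A₀ x x∈H)
            ; H-size = ≤-trans n≤8Km (*-monoʳ-≤ (8 * K) m≤8ΔH)
            ; unit = ≤-trans (card-mono (diff-mono {H} {A₀} {H} {A₀} H⊆A₀ H⊆A₀))
                       (≤-trans (P-small′ ξ₀∈X) (*-monoʳ-≤ Δ m≤8ΔH))
            ; dilates = λ {ξ} ξ∈X′ → ≤-trans (card-mono (dilDiff-∀ (ξ₀ ⁻¹ ⊙ ξ) H H (_∈ dilDiff (ξ₀ ⁻¹ ⊙ ξ) A₀ A₀)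
                          (λ a∈ b∈ → dilDiff-intro (ξ₀ ⁻¹ ⊙ ξ) A₀ A₀ (H⊆A₀ _ a∈) (H⊆A₀ _ b∈))))
                        (≤-trans (dilates₀ (X′⊆X ξ ξ∈X′) (subst (λ r → card A₀ * r ≤ 2 * (64 * (K * K)) * (card (A₀ ∩ P ξ) * card (R ξ₀ ∩ R ξ))) (|R| ξ₀∈X) (overlapped ξ∈X′)))
                          (*-monoʳ-≤ (2 * (64 * (K * K)) * (Δ * Δ * Δ)) m≤8ΔH))
            ; triple = ≤-trans triple₀ (*-monoʳ-≤ (L * L * (Δ * Δ * Δ * Δ)) m≤8ΔH)
            }

      core : Core A X n K
      core = Centred.result ξ₀ ξ₀∈X X′ X′⊆X large overlapped
        where open Star S

  -- How |H - zH| behaves under the field operations on z.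

  module Calculus {q : ℕ} (𝔽 : FieldOn q) where

    open FieldOn 𝔽
    open Additive 𝔽
    open Refining 𝔽
    open Extraction 𝔽

    energy-mono : ∀ {A A′ B B′ : FinSet q} → (∀ x → x ∈ A → x ∈ A′) → (∀ x → x ∈ B → x ∈ B′) →
                  energy A B ≤ energy A′ B′
    energy-mono {A} {A′} {B} {B′} hA hB = ∑-mono λ s → *-mono-≤ (le s) (le s)
      where
      le : ∀ s → meet A B s ≤ meet A′ B′ s
      le s = card-mono λ x h → let p , p′ = ∧-true {A x} h in ∧-intro (hA x p) (hB (x ⊝ s) p′)

    ⁻¹-nonzero : ∀ {u} → u ≢ 0F → u ⁻¹ ≢ 0F
    ⁻¹-nonzero {u} u≢0 eq = 0≢1 (trans (sym (trans (cong (u ⊙_) eq) (⊙-zeroʳ u))) (*-inverseʳ u≢0))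

    ⁻¹-unique : ∀ {u v} → u ≢ 0F → u ⊙ v ≡ 1F → v ≡ u ⁻¹
    ⁻¹-unique {u} {v} u≢0 eq = trans (sym (⁻¹⊙-cancel u≢0 v)) (trans (cong (u ⁻¹ ⊙_) eq) (⊙-identityʳ (u ⁻¹)))

    ⊙-nonzero : ∀ {u v} → u ≢ 0F → v ≢ 0F → u ⊙ v ≢ 0F
    ⊙-nonzero {u} {v} u≢0 v≢0 eq = v≢0 (trans (sym (⁻¹⊙-cancel u≢0 v)) (trans (cong (u ⁻¹ ⊙_) eq) (⊙-zeroʳ (u ⁻¹))))

    ⊝-nonzero : ∀ {x y} → x ≢ y → x ⊝ y ≢ 0F
    ⊝-nonzero {x} {y} x≢y eq = x≢y (trans (sym (⊝⊕-cancel x y)) (trans (cong (_⊕ y) eq) (⊕-identityˡ y)))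

    module _ (H : FinSet q) where

      D : Fin q → ℕ
      D z = card (dilDiff z H H)

      private
        ℓ : ℕ
        ℓ = card H

        Tr : FinSet q
        Tr = diff H (diff H H)

      -- Ruzsa's triangle inequality: a - zwb = (a - zt) + z(t - wb) for every t in H.
      D-⊙ : ∀ {z} → z ≢ 0F → ∀ w → D (z ⊙ w) * ℓ ≤ D z * D w
      D-⊙ {z} z≢0 w = begin
        D (z ⊙ w) * ℓ                 ≤⟨ conv-bound (dilDiff (z ⊙ w) H H) (dilDiff z H H) Q ℓ 1
                                           (dilDiff-∀ (z ⊙ w) H H _ (λ a∈ b∈ → ≤-trans (rep a∈ b∈) (≤-reflexive (sym (*-identityˡ _))))) ⟩
        1 * (D z * card Q)            ≡⟨ *-identityˡ _ ⟩
        D z * card Q                  ≡⟨ cong (D z *_) (∑-undilate z≢0 (λ x → 𝟙 (dilDiff w H H x))) ⟩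
        D z * D w                     ∎
        where
        open ≤-Reasoning
        Q : FinSet q
        Q x = dilDiff w H H (z ⁻¹ ⊙ x)
        e : ∀ a b z w t → a ⊝ z ⊙ w ⊙ b ⊝ (a ⊝ z ⊙ t) ≡ z ⊙ (t ⊝ w ⊙ b)
        e = solve 5 (λ a b z w t → a :- z :* w :* b :- (a :- z :* t) := z :* (t :- w :* b)) refl
        rep : ∀ {a b} → a ∈ H → b ∈ H → ℓ ≤ conv (dilDiff z H H) Q (a ⊝ z ⊙ w ⊙ b)
        rep {a} {b} a∈ b∈ = begin
          ∑ (λ t → 𝟙 (H t))
            ≤⟨ ∑-mono (λ t → ≤-trans (𝟙-mono {H t} (both t)) (≤-reflexive (𝟙-∧ (dilDiff z H H (a ⊝ z ⊙ t)) _))) ⟩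
          ∑ (λ t → 𝟙 (dilDiff z H H (a ⊝ z ⊙ t)) * 𝟙 (Q (v ⊝ (a ⊝ z ⊙ t))))
            ≡⟨ ∑-dilate z≢0 (λ y → 𝟙 (dilDiff z H H (a ⊝ y)) * 𝟙 (Q (v ⊝ (a ⊝ y)))) ⟩
          ∑ (λ y → 𝟙 (dilDiff z H H (a ⊝ y)) * 𝟙 (Q (v ⊝ (a ⊝ y))))
            ≡⟨ ∑-reflect a (λ y → 𝟙 (dilDiff z H H y) * 𝟙 (Q (v ⊝ y))) ⟩
          conv (dilDiff z H H) Q v ∎
          where
          v : Fin q
          v = a ⊝ z ⊙ w ⊙ b
          both : ∀ t → t ∈ H → dilDiff z H H (a ⊝ z ⊙ t) ∧ Q (v ⊝ (a ⊝ z ⊙ t)) ≡ true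
          both t t∈ = ∧-intro (dilDiff-intro z H H a∈ t∈)
            (subst (_∈ dilDiff w H H) (sym (trans (cong (z ⁻¹ ⊙_) (e a b z w t)) (⁻¹⊙-cancel z≢0 _)))
              (dilDiff-intro w H H t∈ b∈))

      D-0 : D 0F ≤ ℓ
      D-0 = card-mono (dilDiff-∀ 0F H H (_∈ H) (λ {a} {b} a∈ _ → subst (_∈ H) (sym (e a b)) a∈))
        where
        e : ∀ a b → a ⊝ 0F ⊙ b ≡ a
        e a b = trans (cong (a ⊝_) (⊙-zeroˡ b)) (trans (sym (⊕-identityˡ _)) (trans (⊕-comm 0F _) (⊝⊕-cancel a 0F)))

      D-1 : D 1F ≤ card (diff H H)
      D-1 = card-mono (dilDiff-∀ 1F H H (_∈ diff H H) (λ {a} {b} a∈ b∈ →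
        subst (λ t → (a ⊝ t) ∈ diff H H) (sym (⊙-identityˡ b)) (diff-intro H H a∈ b∈)))

      -- H - z⁻¹H = -z⁻¹(H - zH).
      D-⁻¹ : ∀ {z} → z ≢ 0F → D (z ⁻¹) ≤ D z
      D-⁻¹ {z} z≢0 = begin
        D (z ⁻¹)              ≤⟨ card-mono (dilDiff-∀ (z ⁻¹) H H (_∈ Q) (λ {a} {b} a∈ b∈ →
                                   subst (_∈ dilDiff z H H) (sym (e₂ a b)) (dilDiff-intro z H H b∈ a∈))) ⟩
        card Q                ≡⟨ ∑-dilate z≢0 (λ x → 𝟙 (dilDiff z H H (⊖ x))) ⟩
        card (λ x → dilDiff z H H (⊖ x)) ≡⟨ ∑-negate (λ x → 𝟙 (dilDiff z H H x)) ⟩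
        D z                   ∎
        where
        open ≤-Reasoning
        Q : FinSet q
        Q x = dilDiff z H H (⊖ (z ⊙ x))
        e : ∀ a b z y → ⊖ (z ⊙ (a ⊝ y ⊙ b)) ≡ z ⊙ (y ⊙ b) ⊝ z ⊙ a
        e = solve 4 (λ a b z y → :- (z :* (a :- y :* b)) := z :* (y :* b) :- z :* a) refl
        e₂ : ∀ a b → ⊖ (z ⊙ (a ⊝ z ⁻¹ ⊙ b)) ≡ b ⊝ z ⊙ a
        e₂ a b = trans (e a b z (z ⁻¹)) (cong (_⊝ z ⊙ a) (⊙⁻¹-cancel z≢0 b))

      private
        shifted : ∀ {f : Fin q → Fin q} (S Q : FinSet q) → (∀ w → w ∈ H → f w ∈ S) →
                  (g : Fin q → Fin q) → (∀ w → w ∈ H → g (f w) ∈ Q) → ∀ w →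
                  𝟙 (H w) ≤ 𝟙 (S (f w)) * 𝟙 (Q (g (f w)))
        shifted {f} S Q h g k w = ≤-trans (𝟙-mono {H w} (λ w∈ → ∧-intro (h w w∈) (k w w∈))) (≤-reflexive (𝟙-∧ (S (f w)) _))

        -- e = (w₁ - x) ± (w₂ - y) + (e - (w₁ - x) ∓ (w₂ - y)) for all w₁, w₂ ∈ H.
        two-shifts : ∀ (P Q R : FinSet q) {x y e} →
          (∀ w → w ∈ H → (w ⊝ x) ∈ P) → (∀ w → w ∈ H → (w ⊝ y) ∈ Q) →
          (∀ w w′ → w ∈ H → w′ ∈ H → (e ⊝ (w ⊝ x) ⊝ (w′ ⊝ y)) ∈ R) →
          ℓ * ℓ ≤ conv₃ P Q R e
        two-shifts P Q R {x} {y} {e} hP hQ hR = begin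
          ℓ * ℓ                              ≡⟨ ∑-*ʳ ℓ (λ w → 𝟙 (H w)) ⟨
          ∑ (λ w → 𝟙 (H w) * ℓ)              ≤⟨ ∑-mono outer ⟩
          ∑ (λ w → 𝟙 (P (w ⊝ x)) * conv Q R (e ⊝ (w ⊝ x)))
            ≡⟨ ∑-untranslate x (λ s → 𝟙 (P s) * conv Q R (e ⊝ s)) ⟩
          conv₃ P Q R e                      ∎
          where
          open ≤-Reasoning
          inner : ∀ w → w ∈ H → ℓ ≤ conv Q R (e ⊝ (w ⊝ x))
          inner w w∈ = begin
            ∑ (λ w′ → 𝟙 (H w′))   ≤⟨ ∑-mono (shifted {_⊝ y} Q R hQ (e ⊝ (w ⊝ x) ⊝_) (λ w′ w′∈ → hR w w′ w∈ w′∈)) ⟩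
            ∑ (λ w′ → 𝟙 (Q (w′ ⊝ y)) * 𝟙 (R (e ⊝ (w ⊝ x) ⊝ (w′ ⊝ y))))
              ≡⟨ ∑-untranslate y (λ t → 𝟙 (Q t) * 𝟙 (R (e ⊝ (w ⊝ x) ⊝ t))) ⟩
            conv Q R (e ⊝ (w ⊝ x)) ∎
          outer : ∀ w → 𝟙 (H w) * ℓ ≤ 𝟙 (P (w ⊝ x)) * conv Q R (e ⊝ (w ⊝ x))
          outer w = ≤-trans (𝟙*-mono {H w} (inner w)) (*-monoˡ-≤ _ (𝟙-mono {H w} (hP w)))

      -- a - (u + v)b = (w - ub) + (w′ - vb) - (w - (a - w′)) for all w, w′ in H, which makes ℓ²
      -- representations.
      D-⊕ : ∀ u v → D (u ⊕ v) * (ℓ * ℓ) ≤ D u * (D v * card Tr)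
      D-⊕ u v = begin
        D (u ⊕ v) * (ℓ * ℓ)
          ≤⟨ conv₃-bound (dilDiff (u ⊕ v) H H) (dilDiff u H H) (dilDiff v H H) Tr⁻ (ℓ * ℓ) 1
               (dilDiff-∀ (u ⊕ v) H H _ (λ {a} {b} a∈ b∈ → ≤-trans (two-shifts (dilDiff u H H) (dilDiff v H H) Tr⁻
                 (λ w w∈ → dilDiff-intro u H H w∈ b∈) (λ w w∈ → dilDiff-intro v H H w∈ b∈)
                 (λ w w′ w∈ w′∈ → subst (_∈ Tr) (sym (e a b u v w w′)) (diff-intro H (diff H H) w∈ (diff-intro H H a∈ w′∈))))
                 (≤-reflexive (sym (*-identityˡ _))))) ⟩
        1 * (D u * (D v * card Tr⁻))    ≡⟨ *-identityˡ _ ⟩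
        D u * (D v * card Tr⁻)          ≡⟨ cong (λ t → D u * (D v * t)) (∑-negate (λ x → 𝟙 (Tr x))) ⟩
        D u * (D v * card Tr)           ∎
        where
        open ≤-Reasoning
        Tr⁻ : FinSet q
        Tr⁻ x = Tr (⊖ x)
        e : ∀ a b u v w w′ → ⊖ (a ⊝ (u ⊕ v) ⊙ b ⊝ (w ⊝ u ⊙ b) ⊝ (w′ ⊝ v ⊙ b)) ≡ w ⊝ (a ⊝ w′)
        e = solve 6 (λ a b u v w w′ → :- (a :- (u :+ v) :* b :- (w :- u :* b) :- (w′ :- v :* b)) := w :- (a :- w′)) refl

      -- a - (u - v)b = (w - ub) - (w′ - vb) + (a - (w - w′)) for all w, w′ in H. The second term
      -- enters with a minus sign, hence the reflected set S.
      D-⊝ : ∀ u v → D (u ⊝ v) * (ℓ * ℓ) ≤ D u * (D v * card Tr)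
      D-⊝ u v = begin
        D (u ⊝ v) * (ℓ * ℓ)
          ≤⟨ conv₃-bound (dilDiff (u ⊝ v) H H) (dilDiff u H H) S Tr (ℓ * ℓ) 1
               (dilDiff-∀ (u ⊝ v) H H _ (λ {a} {b} a∈ b∈ → ≤-trans (rep a∈ b∈) (≤-reflexive (sym (*-identityˡ _))))) ⟩
        1 * (D u * (card S * card Tr))  ≡⟨ *-identityˡ _ ⟩
        D u * (card S * card Tr)        ≡⟨ cong (λ t → D u * (t * card Tr)) (∑-negate (λ x → 𝟙 (dilDiff v H H x))) ⟩
        D u * (D v * card Tr)           ∎
        where
        open ≤-Reasoning
        S : FinSet q
        S x = dilDiff v H H (⊖ x)
        e : ∀ a b u v w w′ → a ⊝ (u ⊝ v) ⊙ b ⊝ (w ⊝ u ⊙ b) ⊝ (v ⊙ b ⊝ w′) ≡ a ⊝ (w ⊝ w′)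
        e = solve 6 (λ a b u v w w′ → a :- (u :- v) :* b :- (w :- u :* b) :- (v :* b :- w′) := a :- (w :- w′)) refl
        rep : ∀ {a b} → a ∈ H → b ∈ H → ℓ * ℓ ≤ conv₃ (dilDiff u H H) S Tr (a ⊝ (u ⊝ v) ⊙ b)
        rep {a} {b} a∈ b∈ = begin
          ℓ * ℓ                              ≡⟨ ∑-*ʳ ℓ (λ w → 𝟙 (H w)) ⟨
          ∑ (λ w → 𝟙 (H w) * ℓ)              ≤⟨ ∑-mono outer ⟩
          ∑ (λ w → 𝟙 (dilDiff u H H (w ⊝ u ⊙ b)) * conv S Tr (t ⊝ (w ⊝ u ⊙ b)))
            ≡⟨ ∑-untranslate (u ⊙ b) (λ s → 𝟙 (dilDiff u H H s) * conv S Tr (t ⊝ s)) ⟩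
          conv₃ (dilDiff u H H) S Tr t       ∎
          where
          t : Fin q
          t = a ⊝ (u ⊝ v) ⊙ b
          inner : ∀ w → w ∈ H → ℓ ≤ conv S Tr (t ⊝ (w ⊝ u ⊙ b))
          inner w w∈ = begin
            ∑ (λ w′ → 𝟙 (H w′))
              ≤⟨ ∑-mono (shifted {λ w′ → v ⊙ b ⊝ w′} S Tr
                   (λ w′ w′∈ → subst (_∈ dilDiff v H H) (sym (⊝-swap (v ⊙ b) w′)) (dilDiff-intro v H H w′∈ b∈))
                   (t ⊝ (w ⊝ u ⊙ b) ⊝_)
                   (λ w′ w′∈ → subst (_∈ Tr) (sym (e a b u v w w′)) (diff-intro H (diff H H) a∈ (diff-intro H H w∈ w′∈)))) ⟩
            ∑ (λ w′ → 𝟙 (S (v ⊙ b ⊝ w′)) * 𝟙 (Tr (t ⊝ (w ⊝ u ⊙ b) ⊝ (v ⊙ b ⊝ w′))))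
              ≡⟨ ∑-reflect (v ⊙ b) (λ s → 𝟙 (S s) * 𝟙 (Tr (t ⊝ (w ⊝ u ⊙ b) ⊝ s))) ⟩
            conv S Tr (t ⊝ (w ⊝ u ⊙ b))  ∎
          outer : ∀ w → 𝟙 (H w) * ℓ ≤ 𝟙 (dilDiff u H H (w ⊝ u ⊙ b)) * conv S Tr (t ⊝ (w ⊝ u ⊙ b))
          outer w = ≤-trans (𝟙*-mono {H w} (inner w)) (*-monoˡ-≤ _ (𝟙-mono {H w} (λ w∈ → dilDiff-intro u H H w∈ b∈)))

      energy-dilate : ∀ {z} → z ≢ 0F → ℓ * ℓ * (ℓ * ℓ) ≤ D z * energy H (dil z H)
      energy-dilate {z} z≢0 = begin
        ℓ * ℓ * (ℓ * ℓ)                                    ≡⟨ cong (λ t → ℓ * t * (ℓ * t)) (card-dil z≢0 H) ⟨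
        ℓ * card (dil z H) * (ℓ * card (dil z H))          ≤⟨ energy-lower H (dil z H) ⟩
        card (diff H (dil z H)) * energy H (dil z H)       ≤⟨ *-monoˡ-≤ _ (card-mono (diff-∀ H (dil z H) (_∈ dilDiff z H H) (λ {a} {b} a∈ b∈ →
                                                                subst (λ t → (a ⊝ t) ∈ dilDiff z H H) (⊙⁻¹-cancel z≢0 b) (dilDiff-intro z H H a∈ b∈)))) ⟩
        D z * energy H (dil z H)                           ∎
        where open ≤-Reasoning

    -- Good c z says that |H - zH| ≤ κᶜ |H|; the set of good z is almost a field.
    module Goodness (H : FinSet q) (κ : ℕ) (0<κ : 0 < κ) (0<ℓ : 0 < card H)
                    (triple : card (diff H (diff H H)) ≤ κ ^ 20 * card H) where

      private
        ℓ : ℕ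
        ℓ = card H

        instance
          κ≢0 : NonZero κ
          κ≢0 = >-nonZero 0<κ
          ℓ≢0 : NonZero ℓ
          ℓ≢0 = >-nonZero 0<ℓ
          ℓℓ≢0 : NonZero (ℓ * ℓ)
          ℓℓ≢0 = m*n≢0 ℓ ℓ

      record Good (c : ℕ) (z : Fin q) : Set where
        constructor good
        field bound : D H z ≤ κ ^ c * ℓ

      weaken : ∀ {c c′ z} → c ≤ c′ → Good c z → Good c′ z
      weaken c≤c′ (good h) = good (≤-trans h (*-monoˡ-≤ ℓ (^-monoʳ-≤ κ c≤c′)))

      good-0 : ∀ {c} → Good c 0F
      good-0 {c} = good (≤-trans (D-0 H) (≤-trans (≤-reflexive (sym (*-identityˡ ℓ))) (*-monoˡ-≤ ℓ (m^n>0 κ c))))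

      good-⊙ : ∀ {c c′ z w} → Good c z → Good c′ w → Good (c + c′) (z ⊙ w)
      good-⊙ {c} {c′} {z} {w} (good p) (good p′) with z Fin.≟ 0F
      ... | yes refl = subst (Good (c + c′)) (sym (⊙-zeroˡ w)) good-0
      ... | no z≢0 = good (*-cancelʳ-≤ _ _ ℓ (begin
        D H (z ⊙ w) * ℓ             ≤⟨ D-⊙ H z≢0 w ⟩
        D H z * D H w               ≤⟨ *-mono-≤ p p′ ⟩
        κ ^ c * ℓ * (κ ^ c′ * ℓ)    ≡⟨ e (κ ^ c) (κ ^ c′) ℓ ⟩
        κ ^ c * κ ^ c′ * ℓ * ℓ      ≡⟨ cong (λ t → t * ℓ * ℓ) (^-distribˡ-+-* κ c c′) ⟨
        κ ^ (c + c′) * ℓ * ℓ        ∎))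
        where
        open ≤-Reasoning
        e : ∀ a b l → a * l * (b * l) ≡ a * b * l * l
        e = solve-∀

      good-⁻¹ : ∀ {c z} → z ≢ 0F → Good c z → Good c (z ⁻¹)
      good-⁻¹ z≢0 (good p) = good (≤-trans (D-⁻¹ H z≢0) p)

      private
        sums : ∀ {c c′ u v z} → D H z * (ℓ * ℓ) ≤ D H u * (D H v * card (diff H (diff H H))) →
               Good c u → Good c′ v → Good (c + c′ + 20) z
        sums {c} {c′} {u} {v} {z} h (good p) (good p′) = good (*-cancelʳ-≤ _ _ (ℓ * ℓ) (begin
          D H z * (ℓ * ℓ)                                   ≤⟨ h ⟩
          D H u * (D H v * card (diff H (diff H H)))        ≤⟨ *-mono-≤ p (*-mono-≤ p′ triple) ⟩
          κ ^ c * ℓ * (κ ^ c′ * ℓ * (κ ^ 20 * ℓ))           ≡⟨ e (κ ^ c) (κ ^ c′) (κ ^ 20) ℓ ⟩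
          κ ^ c * κ ^ c′ * κ ^ 20 * ℓ * (ℓ * ℓ)             ≡⟨ cong (λ t → t * ℓ * (ℓ * ℓ)) powers ⟩
          κ ^ (c + c′ + 20) * ℓ * (ℓ * ℓ)                   ∎))
          where
          open ≤-Reasoning
          e : ∀ a b c l → a * l * (b * l * (c * l)) ≡ a * b * c * l * (l * l)
          e = solve-∀
          powers : κ ^ c * κ ^ c′ * κ ^ 20 ≡ κ ^ (c + c′ + 20)
          powers = trans (cong (_* κ ^ 20) (sym (^-distribˡ-+-* κ c c′))) (sym (^-distribˡ-+-* κ (c + c′) 20))

      -- The extra 20 is the exponent in |H - H + H| ≤ κ²⁰ |H|, spent once for every sum or
      -- difference.
      good-⊕ : ∀ {c c′ u v} → Good c u → Good c′ v → Good (c + c′ + 20) (u ⊕ v)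
      good-⊕ {u = u} {v} = sums {u = u} {v} (D-⊕ H u v)

      good-⊝ : ∀ {c c′ u v} → Good c u → Good c′ v → Good (c + c′ + 20) (u ⊝ v)
      good-⊝ {u = u} {v} = sums {u = u} {v} (D-⊝ H u v)

      good-energy : ∀ {c z} → z ≢ 0F → Good c z → ℓ * ℓ * ℓ ≤ κ ^ c * energy H (dil z H)
      good-energy {c} {z} z≢0 (good p) = *-cancelʳ-≤ _ _ ℓ (begin
        ℓ * ℓ * ℓ * ℓ                        ≡⟨ *-assoc (ℓ * ℓ) ℓ ℓ ⟩
        ℓ * ℓ * (ℓ * ℓ)                      ≤⟨ energy-dilate H z≢0 ⟩
        D H z * energy H (dil z H)           ≤⟨ *-monoˡ-≤ _ p ⟩
        κ ^ c * ℓ * energy H (dil z H)       ≡⟨ e (κ ^ c) ℓ (energy H (dil z H)) ⟩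
        κ ^ c * energy H (dil z H) * ℓ       ∎)
        where
        open ≤-Reasoning
        e : ∀ a b c → a * b * c ≡ a * c * b
        e = solve-∀

  -- Ratios of differences: a subfield or a pivot.

  module Quotients {q : ℕ} (𝔽 : FieldOn q) where

    open FieldOn 𝔽
    open Additive 𝔽
    open Calculus 𝔽 using (⁻¹-nonzero; ⊙-nonzero; ⊝-nonzero)

    record Subfield (F : FinSet q) : Set where
      field
        0∈   : 0F ∈ F
        1∈   : 1F ∈ F
        ⊕-cl : ∀ {x y} → x ∈ F → y ∈ F → (x ⊕ y) ∈ F
        ⊖-cl : ∀ {x} → x ∈ F → (⊖ x) ∈ F
        ⊙-cl : ∀ {x y} → x ∈ F → y ∈ F → (x ⊙ y) ∈ F
        ⁻¹-cl : ∀ {x} → x ≢ 0F → x ∈ F → (x ⁻¹) ∈ F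

    -- The quotients (x₁ - x₂) / (x₃ - x₄) of differences of elements of X.
    ratios : FinSet q → FinSet q
    ratios X z = some λ d → (diff X X d ∧ not ⌊ d Fin.≟ 0F ⌋) ∧ diff X X (z ⊙ d)

    module _ (X : FinSet q) where

      ratio-intro : ∀ {z d} → d ∈ diff X X → d ≢ 0F → (z ⊙ d) ∈ diff X X → z ∈ ratios X
      ratio-intro {z} {d} d∈ d≢0 zd∈ =
        some-intro (λ d → (diff X X d ∧ not ⌊ d Fin.≟ 0F ⌋) ∧ diff X X (z ⊙ d)) d
          (∧-intro (∧-intro d∈ (differ (d Fin.≟ 0F))) zd∈)
        where
        differ : (d? : Dec (d ≡ 0F)) → not ⌊ d? ⌋ ≡ true
        differ (yes d≡0) = contradiction d≡0 d≢0
        differ (no _)    = refl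

      ratio-elim : ∀ {z} → z ∈ ratios X → ∃ λ d → d ∈ diff X X × d ≢ 0F × (z ⊙ d) ∈ diff X X
      ratio-elim {z} z∈ =
        let d , h      = some-elim {S = λ d → (diff X X d ∧ not ⌊ d Fin.≟ 0F ⌋) ∧ diff X X (z ⊙ d)} z∈
            dh , zd∈   = ∧-true {diff X X d ∧ not ⌊ d Fin.≟ 0F ⌋} h
            d∈ , d≢0   = ∧-true {diff X X d} dh
        in d , d∈ , undecided (d Fin.≟ 0F) d≢0 , zd∈

      -- The set of z with z + Q ⊆ Q, for the set Q of ratios, is an additive group, stable
      -- under multiplication by elements of X, hence by their differences and by Q.
      -- It contains 1, so it contains Q; and Q contains 0, so it equals Q.
      module Closed (∌0 : ∀ {x} → x ∈ X → x ≢ 0F)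
                    {x₁ x₂ : Fin q} (x₁∈ : x₁ ∈ X) (x₂∈ : x₂ ∈ X) (x₁≢x₂ : x₁ ≢ x₂)
                    (+1-closed : ∀ {z} → z ∈ ratios X → (z ⊕ 1F) ∈ ratios X)
                    (X-closed : ∀ {x z} → x ∈ X → z ∈ ratios X → (x ⊙ z) ∈ ratios X) where

        private
          Q per : FinSet q
          Q = ratios X
          per w = not (some λ z → Q z ∧ not (Q (w ⊕ z)))

          per-intro : ∀ {w} → (∀ {z} → z ∈ Q → (w ⊕ z) ∈ Q) → w ∈ per
          per-intro {w} h with some (λ z → Q z ∧ not (Q (w ⊕ z))) in eq
          ... | false = refl
          ... | true  =
            let z , p   = some-elim {S = λ z → Q z ∧ not (Q (w ⊕ z))} eq
                z∈ , ∉ = ∧-true {Q z} p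
            in contradiction (trans (sym (cong not (h z∈))) ∉) λ ()

          per-elim : ∀ {w z} → w ∈ per → z ∈ Q → (w ⊕ z) ∈ Q
          per-elim {w} {z} w∈ z∈ with Q (w ⊕ z) in eq
          ... | true  = refl
          ... | false = contradiction (trans (sym (cong not (some-intro (λ z → Q z ∧ not (Q (w ⊕ z))) z
                          (∧-intro z∈ (cong not eq))))) w∈) λ ()

          per-⊕ : ∀ {u v} → u ∈ per → v ∈ per → (u ⊕ v) ∈ per
          per-⊕ {u} {v} u∈ v∈ = per-intro λ {z} z∈ →
            subst (_∈ Q) (sym (⊕-assoc u v z)) (per-elim u∈ (per-elim v∈ z∈))

          per-⊖ : ∀ {u} → u ∈ per → (⊖ u) ∈ per
          per-⊖ {u} u∈ = per-intro λ {z} z∈ →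
            card-stable Q (u ⊕_) (⊖ u ⊕_) (e₁ u) (e₂ u) (λ _ → per-elim u∈) (⊖ u ⊕ z)
              (subst (_∈ Q) (sym (e₁ u z)) z∈)
            where
            e₁ : ∀ u z → u ⊕ (⊖ u ⊕ z) ≡ z
            e₁ = solve 2 (λ u z → u :+ (:- u :+ z) := z) refl
            e₂ : ∀ u z → ⊖ u ⊕ (u ⊕ z) ≡ z
            e₂ = solve 2 (λ u z → :- u :+ (u :+ z) := z) refl

          unscale : ∀ S {a} → a ≢ 0F → (∀ x → x ∈ S → (a ⊙ x) ∈ S) → ∀ {x} → x ∈ S → (a ⁻¹ ⊙ x) ∈ S
          unscale S {a} a≢0 h {x} x∈ =
            card-stable S (a ⊙_) (a ⁻¹ ⊙_) (⊙⁻¹-cancel a≢0) (⁻¹⊙-cancel a≢0) h (a ⁻¹ ⊙ x)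
              (subst (_∈ S) (sym (⊙⁻¹-cancel a≢0 x)) x∈)

          -- xw + z = x(w + x⁻¹z), and x⁻¹z stays in Q because multiplication by x permutes the
          -- finite set Q.
          per-X : ∀ {x w} → x ∈ X → w ∈ per → (x ⊙ w) ∈ per
          per-X {x} {w} x∈ w∈ = per-intro λ {z} z∈ →
            subst (_∈ Q) (trans (⊙-distribˡ x w (x ⁻¹ ⊙ z)) (cong (x ⊙ w ⊕_) (⊙⁻¹-cancel (∌0 x∈) z)))
              (X-closed x∈ (per-elim w∈ (unscale Q (∌0 x∈) (λ _ → X-closed x∈) z∈)))

          per-diff : ∀ {w} → w ∈ per → ∀ d → d ∈ diff X X → (d ⊙ w) ∈ per
          per-diff {w} w∈ = diff-∀ X X (λ d → (d ⊙ w) ∈ per) λ {x} {y} x∈ y∈ →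
            subst (_∈ per) (e x y w) (per-⊕ (per-X x∈ w∈) (per-⊖ (per-X y∈ w∈)))
            where
            e : ∀ x y w → x ⊙ w ⊕ ⊖ (y ⊙ w) ≡ (x ⊝ y) ⊙ w
            e = solve 3 (λ x y w → x :* w :+ :- (y :* w) := (x :- y) :* w) refl

          per-Q : ∀ {z w} → z ∈ Q → w ∈ per → (z ⊙ w) ∈ per
          per-Q {z} {w} z∈ w∈ =
            let d , d∈ , d≢0 , zd∈ = ratio-elim z∈
            in subst (_∈ per) (trans (cong (d ⁻¹ ⊙_) (e z d w)) (⁻¹⊙-cancel d≢0 (z ⊙ w)))
                 (unscale per d≢0 (λ v v∈ → per-diff v∈ d d∈) (per-diff w∈ (z ⊙ d) zd∈))
            where
            e : ∀ z d w → z ⊙ d ⊙ w ≡ d ⊙ (z ⊙ w)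
            e = solve 3 (λ z d w → z :* d :* w := d :* (z :* w)) refl

          Q⊆per : ∀ {z} → z ∈ Q → z ∈ per
          Q⊆per {z} z∈ = subst (_∈ per) (⊙-identityʳ z)
            (per-Q z∈ (per-intro λ {y} y∈ → subst (_∈ Q) (⊕-comm y 1F) (+1-closed y∈)))

          d₀∈ : (x₁ ⊝ x₂) ∈ diff X X
          d₀∈ = diff-intro X X x₁∈ x₂∈

          0∈Q : 0F ∈ Q
          0∈Q = ratio-intro d₀∈ (⊝-nonzero x₁≢x₂)
            (subst (_∈ diff X X) (trans (⊖-inverseʳ x₁) (sym (⊙-zeroˡ (x₁ ⊝ x₂)))) (diff-intro X X x₁∈ x₁∈))

          per⊆Q : ∀ {z} → z ∈ per → z ∈ Q
          per⊆Q {z} z∈ = subst (_∈ Q) (⊕-identityʳ z) (per-elim z∈ 0∈Q)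

        subfield : Subfield (ratios X)
        subfield = record
          { 0∈    = 0∈Q
          ; 1∈    = ratio-intro d₀∈ (⊝-nonzero x₁≢x₂) (subst (_∈ diff X X) (sym (⊙-identityˡ _)) d₀∈)
          ; ⊕-cl  = λ x∈ y∈ → per-elim (Q⊆per x∈) y∈
          ; ⊖-cl  = λ x∈ → per⊆Q (per-⊖ (Q⊆per x∈))
          ; ⊙-cl  = λ x∈ y∈ → per⊆Q (per-Q x∈ (Q⊆per y∈))
          ; ⁻¹-cl = λ {x} x≢0 x∈ →
              let d , d∈ , d≢0 , xd∈ = ratio-elim x∈
              in ratio-intro xd∈ (⊙-nonzero x≢0 d≢0) (subst (_∈ diff X X) (sym (⁻¹⊙-cancel x≢0 d)) d∈)
          }

      -- Records how r arises from a ratio by one operation, which is what bounds its exponent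
      -- later.
      data Step (r : Fin q) : Set where
        by-one : ∀ {z} → z ∈ ratios X → r ≡ z ⊕ 1F → Step r
        by-X   : ∀ {x z} → x ∈ X → z ∈ ratios X → r ≡ x ⊙ z → Step r

      -- The two closure conditions of `Closed` are decidable on a finite set, and a failure of
      -- either is a pivot.
      subfield-or-pivot : (∀ {x} → x ∈ X → x ≢ 0F) → ∀ {x₁ x₂} → x₁ ∈ X → x₂ ∈ X → x₁ ≢ x₂ →
                          Subfield (ratios X) ⊎ ∃ λ r → Step r × ¬ (r ∈ ratios X)
      subfield-or-pivot ∌0 x₁∈ x₂∈ x₁≢x₂ = decide-one (Fin.any? λ z → (Q z Bool.≟ true) ×-dec ¬? (Q (z ⊕ 1F) Bool.≟ true))
        where
        Q : FinSet q
        Q = ratios X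
        Result : Set
        Result = Subfield (ratios X) ⊎ ∃ λ r → Step r × ¬ (r ∈ ratios X)
        decide-X : (∀ {z} → z ∈ Q → (z ⊕ 1F) ∈ Q) →
                   Dec (∃ λ x → ∃ λ z → (x ∈ X × z ∈ Q) × ¬ ((x ⊙ z) ∈ Q)) → Result
        decide-X _ (yes (x , z , (x∈ , z∈) , ∉)) = inj₂ (x ⊙ z , by-X x∈ z∈ refl , ∉)
        decide-X h (no none) = inj₁ (Closed.subfield ∌0 x₁∈ x₂∈ x₁≢x₂ h
          (λ {x} {z} x∈ z∈ → stable (Q (x ⊙ z)) (λ ∉ → none (x , z , (x∈ , z∈) , ∉))))
        decide-one : Dec (∃ λ z → z ∈ Q × ¬ ((z ⊕ 1F) ∈ Q)) → Result
        decide-one (yes (z , z∈ , ∉)) = inj₂ (z ⊕ 1F , by-one z∈ refl , ∉)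
        decide-one (no none) = decide-X (λ {z} z∈ → stable (Q (z ⊕ 1F)) (λ ∉ → none (z , z∈ , ∉)))
          (Fin.any? λ x → Fin.any? λ z → ((X x Bool.≟ true) ×-dec (Q z Bool.≟ true)) ×-dec ¬? (Q (x ⊙ z) Bool.≟ true))

      -- X + rX
      span : Fin q → FinSet q
      span r v = some λ y → X y ∧ X (v ⊝ r ⊙ y)

      span-elim : ∀ {r v} → v ∈ span r → ∃₂ λ x y → x ∈ X × y ∈ X × v ≡ x ⊕ r ⊙ y
      span-elim {r} {v} v∈ =
        let y , h   = some-elim {S = λ y → X y ∧ X (v ⊝ r ⊙ y)} v∈
            y∈ , x∈ = ∧-true {X y} h
        in v ⊝ r ⊙ y , y , x∈ , y∈ , sym (⊝⊕-cancel v (r ⊙ y))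

      -- (x , y) ↦ x + ry is injective on X × X: x + ry = x′ + ry′ with y ≠ y′ would exhibit r as
      -- the ratio (x′ - x) / (y - y′).
      card-span : ∀ {r} → ¬ (r ∈ ratios X) → card X * card X ≤ card (span r)
      card-span {r} r∉ = begin
        card X * card X                                       ≡⟨ ∑-*ʳ (card X) (λ y → 𝟙 (X y)) ⟨
        ∑ (λ y → 𝟙 (X y) * card X)                            ≡⟨ ∑-cong (λ y → trans (cong (𝟙 (X y) *_) (sym (∑-untranslate (r ⊙ y) (λ x → 𝟙 (X x))))) (sym (∑-*ˡ (𝟙 (X y)) (λ v → 𝟙 (X (v ⊝ r ⊙ y)))))) ⟩
        ∑ (λ y → ∑ λ v → 𝟙 (X y) * 𝟙 (X (v ⊝ r ⊙ y)))         ≡⟨ ∑-swap (λ y v → 𝟙 (X y) * 𝟙 (X (v ⊝ r ⊙ y))) ⟩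
        ∑ (λ v → ∑ λ y → 𝟙 (X y) * 𝟙 (X (v ⊝ r ⊙ y)))         ≤⟨ ∑-mono (λ v → ≤-trans (≤-reflexive (∑-cong (λ y → sym (𝟙-∧ (X y) _)))) (once v)) ⟩
        ∑ (λ v → 𝟙 (span r v))                                ∎
        where
        open ≤-Reasoning
        e : ∀ v r y y′ → v ⊝ r ⊙ y′ ⊝ (v ⊝ r ⊙ y) ≡ r ⊙ (y ⊝ y′)
        e = solve 4 (λ v r y y′ → v :- r :* y′ :- (v :- r :* y) := r :* (y :- y′)) refl
        clash : ∀ v → 1 < card (λ y → X y ∧ X (v ⊝ r ⊙ y)) → r ∈ ratios X
        clash v h =
          let y , y′ , p , p′ , y≢y′ = two-members {S = λ y → X y ∧ X (v ⊝ r ⊙ y)} h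
              y∈ , x∈    = ∧-true {X y} p
              y′∈ , x′∈  = ∧-true {X y′} p′
          in ratio-intro (diff-intro X X y∈ y′∈) (⊝-nonzero y≢y′)
               (subst (_∈ diff X X) (e v r y y′) (diff-intro X X x′∈ x∈))
        once : ∀ v → card (λ y → X y ∧ X (v ⊝ r ⊙ y)) ≤ 𝟙 (span r v)
        once v with card (λ y → X y ∧ X (v ⊝ r ⊙ y)) in eq
        ... | zero  = z≤n
        ... | suc zero =
          let y , y∈ = card-∃ {S = λ y → X y ∧ X (v ⊝ r ⊙ y)} (≤-reflexive (sym eq))
          in ≤-reflexive (sym (𝟙-true (some-intro (λ y → X y ∧ X (v ⊝ r ⊙ y)) y y∈)))
        ... | suc (suc m) = contradiction (clash v (subst (1 <_) (sym eq) (s≤s (s≤s z≤n)))) r∉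

    -- S × S has more than q elements, so (a , b) ↦ a + zb takes some value twice, and the two b
    -- differ there.
    quotients-cover : ∀ S → q < card S * card S → ∀ z →
      ∃₂ λ a a′ → ∃₂ λ b b′ → (a ∈ S × a′ ∈ S) × (b ∈ S × b′ ∈ S) × b ≢ b′ × a ⊝ a′ ≡ z ⊙ (b′ ⊝ b)
    quotients-cover S q< z =
      let v , h                  = ∑-< (λ _ → 1) (λ v → card (T v)) (subst₂ _<_ (sym (trans (∑-const q 1) (*-identityʳ q))) (sym count) q<)
          b , b′ , p , p′ , b≢b′ = two-members {S = T v} h
          b∈ , a∈                = ∧-true {S b} p
          b′∈ , a′∈              = ∧-true {S b′} p′
      in v ⊝ z ⊙ b , v ⊝ z ⊙ b′ , b , b′ , (a∈ , a′∈) , (b∈ , b′∈) , b≢b′ , e v z b b′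
      where
      T : Fin q → FinSet q
      T v b = S b ∧ S (v ⊝ z ⊙ b)
      e : ∀ v z b b′ → v ⊝ z ⊙ b ⊝ (v ⊝ z ⊙ b′) ≡ z ⊙ (b′ ⊝ b)
      e = solve 4 (λ v z b b′ → v :- z :* b :- (v :- z :* b′) := z :* (b′ :- b)) refl
      count : ∑ (λ v → card (T v)) ≡ card S * card S
      count = begin
        ∑ (λ v → ∑ λ b → 𝟙 (T v b))                     ≡⟨ ∑-swap (λ v b → 𝟙 (T v b)) ⟩
        ∑ (λ b → ∑ λ v → 𝟙 (T v b))                     ≡⟨ ∑-cong (λ b → trans (∑-cong (λ v → 𝟙-∧ (S b) _)) (trans (∑-*ˡ (𝟙 (S b)) (λ v → 𝟙 (S (v ⊝ z ⊙ b)))) (cong (𝟙 (S b) *_) (∑-untranslate (z ⊙ b) (λ x → 𝟙 (S x)))))) ⟩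
        ∑ (λ b → 𝟙 (S b) * card S)                      ≡⟨ ∑-*ʳ (card S) (λ b → 𝟙 (S b)) ⟩
        card S * card S                                 ∎
        where open ≡-Reasoning

  -- Energies of A with its dilates, and their sum.

  module Energies {q : ℕ} (𝔽 : FieldOn q) where

    open FieldOn 𝔽
    open Additive 𝔽
    open Refining 𝔽
    open Extraction 𝔽
    open Calculus 𝔽

    -- The number of solutions in A of a₁ - a₂ = u (a₃ - a₄).
    solutions : FinSet q → Fin q → ℕ
    solutions A u = ∑ λ d → corr A d * corr A (u ⊙ d)

    ∑-pairs : ∀ (A : FinSet q) (g : Fin q → ℕ) →
              ∑ (λ x → ∑ λ y → 𝟙 (A x) * (𝟙 (A y) * g (x ⊝ y))) ≡ ∑ λ d → corr A d * g d
    ∑-pairs A g = begin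
      ∑ (λ x → ∑ λ y → 𝟙 (A x) * (𝟙 (A y) * g (x ⊝ y)))     ≡⟨ ∑-swap (λ x y → 𝟙 (A x) * (𝟙 (A y) * g (x ⊝ y))) ⟩
      ∑ (λ y → ∑ λ x → 𝟙 (A x) * (𝟙 (A y) * g (x ⊝ y)))     ≡⟨ ∑-cong (λ y → trans (sym (∑-translate y (λ x → 𝟙 (A x) * (𝟙 (A y) * g (x ⊝ y))))) (∑-cong (pt y))) ⟩
      ∑ (λ y → ∑ λ d → 𝟙 (A y) * 𝟙 (A (y ⊕ d)) * g d)       ≡⟨ ∑-swap (λ y d → 𝟙 (A y) * 𝟙 (A (y ⊕ d)) * g d) ⟩
      ∑ (λ d → ∑ λ y → 𝟙 (A y) * 𝟙 (A (y ⊕ d)) * g d)       ≡⟨ ∑-cong (λ d → ∑-*ʳ (g d) (λ y → 𝟙 (A y) * 𝟙 (A (y ⊕ d)))) ⟩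
      ∑ (λ d → corr A d * g d)                              ∎
      where
      open ≡-Reasoning
      e : ∀ a b c → a * (b * c) ≡ b * a * c
      e = solve-∀
      pt : ∀ y d → 𝟙 (A (d ⊕ y)) * (𝟙 (A y) * g (d ⊕ y ⊝ y)) ≡ 𝟙 (A y) * 𝟙 (A (y ⊕ d)) * g d
      pt y d = trans (cong₂ (λ u v → 𝟙 (A u) * (𝟙 (A y) * g v)) (⊕-comm d y) (⊕⊝-cancel d y)) (e (𝟙 (A (y ⊕ d))) (𝟙 (A y)) (g d))

    energy≡ : ∀ A B → energy A B ≡ ∑ λ d → corr A d * corr B d
    energy≡ A B = begin
      ∑ (λ s → meet A B s * meet A B s)
        ≡⟨ ∑-cong (λ s → ∑-*-∑ (λ x → 𝟙 (shared A B s x)) (λ y → 𝟙 (shared A B s y))) ⟩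
      ∑ (λ s → ∑ λ x → ∑ λ y → 𝟙 (shared A B s x) * 𝟙 (shared A B s y))
        ≡⟨ ∑-swap (λ s x → ∑ λ y → 𝟙 (shared A B s x) * 𝟙 (shared A B s y)) ⟩
      ∑ (λ x → ∑ λ s → ∑ λ y → 𝟙 (shared A B s x) * 𝟙 (shared A B s y))
        ≡⟨ ∑-cong (λ x → ∑-swap (λ s y → 𝟙 (shared A B s x) * 𝟙 (shared A B s y))) ⟩
      ∑ (λ x → ∑ λ y → ∑ λ s → 𝟙 (shared A B s x) * 𝟙 (shared A B s y))
        ≡⟨ ∑-cong (λ x → ∑-cong (λ y → pt x y)) ⟩
      ∑ (λ x → ∑ λ y → 𝟙 (A x) * (𝟙 (A y) * corr B (x ⊝ y)))   ≡⟨ ∑-pairs A (corr B) ⟩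
      ∑ (λ d → corr A d * corr B d)  ∎
      where
      open ≡-Reasoning
      e : ∀ a b c d → a * b * (c * d) ≡ a * c * (b * d)
      e = solve-∀
      pt : ∀ x y → ∑ (λ s → 𝟙 (shared A B s x) * 𝟙 (shared A B s y)) ≡ 𝟙 (A x) * (𝟙 (A y) * corr B (x ⊝ y))
      pt x y = begin
        ∑ (λ s → 𝟙 (shared A B s x) * 𝟙 (shared A B s y))
          ≡⟨ ∑-cong (λ s → trans (cong₂ _*_ (𝟙-∧ (A x) (B (x ⊝ s))) (𝟙-∧ (A y) (B (y ⊝ s)))) (e (𝟙 (A x)) _ (𝟙 (A y)) _)) ⟩
        ∑ (λ s → 𝟙 (A x) * 𝟙 (A y) * (𝟙 (B (x ⊝ s)) * 𝟙 (B (y ⊝ s))))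
          ≡⟨ ∑-*ˡ (𝟙 (A x) * 𝟙 (A y)) (λ s → 𝟙 (B (x ⊝ s)) * 𝟙 (B (y ⊝ s))) ⟩
        𝟙 (A x) * 𝟙 (A y) * ∑ (λ s → 𝟙 (B (x ⊝ s)) * 𝟙 (B (y ⊝ s)))
          ≡⟨ cong (𝟙 (A x) * 𝟙 (A y) *_) (∑-shifts B x y) ⟩
        𝟙 (A x) * 𝟙 (A y) * corr B (x ⊝ y)   ≡⟨ *-assoc (𝟙 (A x)) (𝟙 (A y)) _ ⟩
        𝟙 (A x) * (𝟙 (A y) * corr B (x ⊝ y)) ∎

    corr-dil : ∀ {z} → z ≢ 0F → ∀ A d → corr (dil z A) d ≡ corr A (z ⁻¹ ⊙ d)
    corr-dil {z} z≢0 A d = trans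
      (∑-cong (λ b → cong (λ t → 𝟙 (A (z ⁻¹ ⊙ b)) * 𝟙 (A t)) (⊙-distribˡ (z ⁻¹) b d)))
      (∑-undilate z≢0 (λ b → 𝟙 (A b) * 𝟙 (A (b ⊕ z ⁻¹ ⊙ d))))

    energy-dil : ∀ {z} → z ≢ 0F → ∀ A → energy A (dil z A) ≡ solutions A (z ⁻¹)
    energy-dil z≢0 A = trans (energy≡ A (dil _ A)) (∑-cong (λ d → cong (corr A d *_) (corr-dil z≢0 A d)))

    solutions-⁻¹ : ∀ {u} → u ≢ 0F → ∀ A → solutions A (u ⁻¹) ≡ solutions A u
    solutions-⁻¹ {u} u≢0 A = trans (sym (∑-dilate u≢0 (λ d → corr A d * corr A (u ⁻¹ ⊙ d))))
      (∑-cong (λ d → trans (*-comm (corr A (u ⊙ d)) _) (cong (λ t → corr A t * corr A (u ⊙ d)) (⁻¹⊙-cancel u≢0 d))))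

    corr-0 : ∀ A → corr A 0F ≡ card A
    corr-0 A = ∑-cong (λ b → trans (cong (λ t → 𝟙 (A b) * 𝟙 (A t)) (⊕-identityʳ b)) (𝟙-idem (A b)))

    corr≤card : ∀ A d → corr A d ≤ card A
    corr≤card A d = ∑-mono (λ b → ≤-trans (*-monoʳ-≤ (𝟙 (A b)) (𝟙≤1 (A (b ⊕ d)))) (≤-reflexive (*-identityʳ (𝟙 (A b)))))

    -- The difference d = 0 contributes n · qn. For d ≠ 0 the products ud run through the whole
    -- field, so that d contributes corr(d) · n².
    ∑-solutions : ∀ A → ∑ (solutions A) ≤ q * (card A * card A) + card A * card A * (card A * card A)
    ∑-solutions A = begin
      ∑ (λ u → ∑ λ d → corr A d * corr A (u ⊙ d))      ≡⟨ ∑-swap (λ u d → corr A d * corr A (u ⊙ d)) ⟩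
      ∑ (λ d → ∑ λ u → corr A d * corr A (u ⊙ d))      ≡⟨ ∑-cong (λ d → ∑-*ˡ (corr A d) (λ u → corr A (u ⊙ d))) ⟩
      ∑ (λ d → corr A d * ∑ λ u → corr A (u ⊙ d))      ≤⟨ ∑-mono pt ⟩
      ∑ (λ d → 𝟙 ⌊ d Fin.≟ 0F ⌋ * (q * (n * n)) + corr A d * (n * n))
        ≡⟨ ∑-+ (λ d → 𝟙 ⌊ d Fin.≟ 0F ⌋ * (q * (n * n))) (λ d → corr A d * (n * n)) ⟩
      ∑ (λ d → 𝟙 ⌊ d Fin.≟ 0F ⌋ * (q * (n * n))) + ∑ (λ d → corr A d * (n * n))
        ≡⟨ cong₂ _+_ (∑-≟ 0F (λ _ → q * (n * n))) (trans (∑-*ʳ (n * n) (corr A)) (cong (_* (n * n)) (∑-corr A))) ⟩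
      q * (n * n) + n * n * (n * n)  ∎
      where
      open ≤-Reasoning
      n : ℕ
      n = card A
      e : ∀ a q → a * (q * a) ≡ 1 * (q * (a * a))
      e = solve-∀
      pt : ∀ d → corr A d * ∑ (λ u → corr A (u ⊙ d)) ≤ 𝟙 ⌊ d Fin.≟ 0F ⌋ * (q * (n * n)) + corr A d * (n * n)
      pt d with d Fin.≟ 0F
      ... | yes refl = begin
        corr A 0F * ∑ (λ u → corr A (u ⊙ 0F))   ≡⟨ cong₂ _*_ (corr-0 A) (trans (∑-cong (λ u → trans (cong (corr A) (⊙-zeroʳ u)) (corr-0 A))) (∑-const q n)) ⟩
        n * (q * n)                             ≡⟨ e n q ⟩
        1 * (q * (n * n))                       ≤⟨ m≤m+n _ _ ⟩
        1 * (q * (n * n)) + corr A 0F * (n * n) ∎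
      ... | no d≢0 = ≤-reflexive (cong (corr A d *_) (trans (∑-cong (λ u → cong (corr A) (⊙-comm u d)))
                       (trans (∑-dilate d≢0 (corr A)) (∑-corr A))))

    few-large : ∀ A c → 0 < c → (∀ {z} → z ≢ 0F → card A * card A * card A ≤ c * energy A (dil z A)) →
                q * (card A * card A * card A) ≤ c * (q * (card A * card A) + card A * card A * (card A * card A))
    few-large A c 0<c h = begin
      q * (n * n * n)                                  ≡⟨ ∑-const q (n * n * n) ⟨
      ∑ {q} (λ _ → n * n * n)                          ≤⟨ ∑-mono pt ⟩
      ∑ (λ u → c * solutions A u)                      ≡⟨ ∑-*ˡ c (solutions A) ⟩
      c * ∑ (solutions A)                              ≤⟨ *-monoʳ-≤ c (∑-solutions A) ⟩
      c * (q * (n * n) + n * n * (n * n))              ∎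
      where
      open ≤-Reasoning
      n : ℕ
      n = card A
      instance
        c≢0 : NonZero c
        c≢0 = >-nonZero 0<c
      pt : ∀ u → n * n * n ≤ c * solutions A u
      pt u with u Fin.≟ 0F
      ... | yes refl = ≤-trans (≤-reflexive (sym (trans
              (∑-cong (λ d → cong (corr A d *_) (trans (cong (corr A) (⊙-zeroˡ d)) (corr-0 A))))
              (trans (∑-*ʳ n (corr A)) (cong (_* n) (∑-corr A)))))) (m≤n*m _ c)
      ... | no u≢0 = ≤-trans (h u≢0) (≤-reflexive (cong (c *_) (trans (energy-dil u≢0 A) (solutions-⁻¹ u≢0 A))))

    -- 2c ≤ n absorbs the term cq and leaves q ≤ 2cn. For c > 0, cubing gives q³ ≤ 8c³n³ < 64c³q² ≤
    -- q³.
    few-large-contradiction : ∀ q n c → 0 < n → 2 * c ≤ n → n * n * n < 8 * (q * q) → 64 * (c * c * c) ≤ q →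
                              ¬ (q * (n * n * n) ≤ c * (q * (n * n) + n * n * (n * n)))
    few-large-contradiction q n c 0<n 2c≤n n³<8q² 64c³≤q h = <⇒≱ (below (c * c * c) 64c³≤q)
      (≤-trans (*-mono-≤ (*-mono-≤ q≤2cn q≤2cn) q≤2cn) (≤-reflexive (e₄ c n)))
      where
      open ≤-Reasoning
      instance
        n≢0 : NonZero n
        n≢0 = >-nonZero 0<n
        nn≢0 : NonZero (n * n)
        nn≢0 = m*n≢0 n n
      e₁ : ∀ q n → q * n * (n * n) ≡ q * (n * n * n)
      e₁ = solve-∀
      e₂ : ∀ c q n → c * (q * (n * n) + n * n * (n * n)) ≡ (c * q + c * (n * n)) * (n * n)
      e₂ = solve-∀
      e₃ : ∀ c n → 2 * c * n * n ≡ 2 * (c * (n * n))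
      e₃ = solve-∀
      e₄ : ∀ c n → 2 * c * n * (2 * c * n) * (2 * c * n) ≡ 8 * (c * c * c) * (n * n * n)
      e₄ = solve-∀
      qn≤ : q * n ≤ c * q + c * (n * n)
      qn≤ = *-cancelʳ-≤ _ _ (n * n) (subst₂ _≤_ (sym (e₁ q n)) (e₂ c q n) h)
      q≤2cn : q ≤ 2 * c * n
      q≤2cn = *-cancelʳ-≤ q (2 * c * n) n (+-cancelˡ-≤ (q * n) _ _ (begin
        q * n + q * n                       ≡⟨ cong (q * n +_) (+-identityʳ (q * n)) ⟨
        2 * (q * n)                         ≤⟨ *-monoʳ-≤ 2 qn≤ ⟩
        2 * (c * q + c * (n * n))           ≡⟨ *-distribˡ-+ 2 (c * q) (c * (n * n)) ⟩
        2 * (c * q) + 2 * (c * (n * n))     ≡⟨ cong₂ _+_ (sym (*-assoc 2 c q)) (sym (e₃ c n)) ⟩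
        2 * c * q + 2 * c * n * n           ≤⟨ +-monoˡ-≤ (2 * c * n * n) (*-monoˡ-≤ q 2c≤n) ⟩
        n * q + 2 * c * n * n               ≡⟨ cong (_+ 2 * c * n * n) (*-comm n q) ⟩
        q * n + 2 * c * n * n               ∎))
      0<q : 0 < q
      0<q = n≢0⇒n>0 λ { refl → n≮0 n³<8q² }
      instance
        q≢0 : NonZero q
        q≢0 = >-nonZero 0<q
        qq≢0 : NonZero (q * q)
        qq≢0 = m*n≢0 q q
      below : ∀ d → 64 * d ≤ q → 8 * d * (n * n * n) < q * q * q
      below zero      _     = >-nonZero⁻¹ (q * q * q) {{m*n≢0 (q * q) q}}
      below d@(suc _) 64d≤q = begin-strict
        8 * d * (n * n * n)       <⟨ *-monoʳ-< (8 * d) {{m*n≢0 8 d}} n³<8q² ⟩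
        8 * d * (8 * (q * q))     ≡⟨ e₅ d (q * q) ⟩
        q * q * (64 * d)          ≤⟨ *-monoʳ-≤ (q * q) 64d≤q ⟩
        q * q * q                 ∎
        where
        e₅ : ∀ d s → 8 * d * (8 * s) ≡ s * (64 * d)
        e₅ = solve-∀

  -- Bookkeeping in powers of κ, and the subfield F.

  module Structure {q : ℕ} (𝔽 : FieldOn q) where

    open FieldOn 𝔽
    open Additive 𝔽
    open Refining 𝔽
    open Extraction 𝔽
    open Calculus 𝔽
    open Quotients 𝔽
    open Energies 𝔽

    *-^ : ∀ m n k → (m * n) ^ k ≡ m ^ k * n ^ k
    *-^ m n zero    = refl
    *-^ m n (suc k) = trans (cong (m * n *_) (*-^ m n k)) (e m n (m ^ k) (n ^ k))
      where e : ∀ a b c d → a * b * (c * d) ≡ a * c * (b * d)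
            e = solve-∀

    private
      -- The `pow` identities collect the powers of K in the bounds of `Core`. The `const`
      -- inequalities bound the remaining numerical factor by the same power of 32, so that a pure
      -- power of κ = 32 K results.
      pow₅ : ∀ k c d l → c * k * (c * (d * (k * k * k * k)) * l) ≡ c * c * d * (k * (k * (k * (k * (k * 1))))) * l
      pow₅ = solve-∀
      pow₈ : ∀ k c d l → (d * (k * k * k * k)) * (c * (d * (k * k * k * k)) * l) ≡ c * d * d * (k * (k * (k * (k * (k * (k * (k * (k * 1)))))))) * l
      pow₈ = solve-∀
      pow₁₆ : ∀ k a b c → a * (k * k * (k * k) * (k * k * (k * k))) * (b * (c * (k * k)) * (b * (c * (k * k))) * (b * (c * (k * k)) * (b * (c * (k * k)))))
              ≡ a * (b * c * (b * c) * (b * c * (b * c))) * (k * (k * (k * (k * (k * (k * (k * (k * (k * (k * (k * (k * (k * (k * (k * (k * 1))))))))))))))))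
      pow₁₆ = solve-∀
      pow₁₆′ : ∀ k a b c {d} → a * (b * c * (b * c) * (b * c * (b * c))) ≡ d →
               a * (k * k * (k * k) * (k * k * (k * k))) * (b * (c * (k * k)) * (b * (c * (k * k))) * (b * (c * (k * k)) * (b * (c * (k * k)))))
               ≡ d * k ^ 16
      pow₁₆′ k a b c refl = pow₁₆ k a b c
      pow₁₈ : ∀ k a b c d l → a * (b * (k * k)) * (d * (k * k * k * k) * (d * (k * k * k * k)) * (d * (k * k * k * k))) * (c * (d * (k * k * k * k)) * l)
              ≡ a * b * c * (d * d * d * d) * (k * (k * (k * (k * (k * (k * (k * (k * (k * (k * (k * (k * (k * (k * (k * (k * (k * (k * 1)))))))))))))))))) * l
      pow₁₈ = solve-∀
      pow₂₀ : ∀ k b c d l → b * b * (d * (k * k * k * k) * (d * (k * k * k * k)) * (d * (k * k * k * k)) * (d * (k * k * k * k))) * (c * (d * (k * k * k * k)) * l)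
              ≡ b * b * c * (d * d * d * d * d) * (k * (k * (k * (k * (k * (k * (k * (k * (k * (k * (k * (k * (k * (k * (k * (k * (k * (k * (k * (k * 1)))))))))))))))))))) * l
      pow₂₀ = solve-∀

      opaque
        unfolding L

        const₅ : 8 * 8 * (8 * L³) ≤ 32 ^ 5
        const₅ = ≤ᵇ⇒≤ _ _ _
        const₈ : 8 * (8 * L³) * (8 * L³) ≤ 32 ^ 8
        const₈ = ≤ᵇ⇒≤ _ _ _
        c₁₆ : ℕ
        c₁₆ = 64 * (2 * 64 * (2 * 64) * (2 * 64 * (2 * 64)))
        c₁₆≡ : 64 * (2 * 64 * (2 * 64) * (2 * 64 * (2 * 64))) ≡ c₁₆
        c₁₆≡ = refl
        const₁₆ : c₁₆ ≤ 32 ^ 16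
        const₁₆ = ≤ᵇ⇒≤ _ _ _
        const₁₈ : 2 * 64 * 8 * (8 * L³ * (8 * L³) * (8 * L³) * (8 * L³)) ≤ 32 ^ 18
        const₁₈ = ≤ᵇ⇒≤ _ _ _
        const₂₀ : L * L * 8 * (8 * L³ * (8 * L³) * (8 * L³) * (8 * L³) * (8 * L³)) ≤ 32 ^ 20
        const₂₀ = ≤ᵇ⇒≤ _ _ _

      absorb : ∀ K {κ} → κ ≡ 32 * K → ∀ c e l → c ≤ 32 ^ e → c * K ^ e * l ≤ κ ^ e * l
      absorb K refl c e l c≤ = *-monoˡ-≤ l (≤-trans (*-monoˡ-≤ (K ^ e) c≤) (≤-reflexive (sym (*-^ 32 K e))))

      below : ∀ {a b} {_ : IsTrue (a ≤ᵇ b)} → a ≤ b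
      below {a} {b} {h} = ≤ᵇ⇒≤ a b h

      fits : ∀ K {κ} → κ ≡ 32 * K →
             64 * (K * K * (K * K) * (K * K * (K * K))) *
             (2 * (64 * (K * K)) * (2 * (64 * (K * K))) * (2 * (64 * (K * K)) * (2 * (64 * (K * K))))) ≤ κ ^ 16
      fits K {κ} κ≡ = begin
        64 * (K * K * (K * K) * (K * K * (K * K))) *
        (2 * (64 * (K * K)) * (2 * (64 * (K * K))) * (2 * (64 * (K * K)) * (2 * (64 * (K * K)))))
                                  ≡⟨ pow₁₆′ K 64 2 64 c₁₆≡ ⟩
        c₁₆ * K ^ 16              ≡⟨ *-identityʳ (c₁₆ * K ^ 16) ⟨
        c₁₆ * K ^ 16 * 1          ≤⟨ absorb K κ≡ c₁₆ 16 1 const₁₆ ⟩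
        κ ^ 16 * 1                ≡⟨ *-identityʳ (κ ^ 16) ⟩
        κ ^ 16                    ∎
        where open ≤-Reasoning

      -- Passing from |X| = N to |X′| = x costs c⁴. The factor s that survives will be 64K⁸, from
      -- which 8K⁴|F| ≤ |X′|² is derived later.
      pull : ∀ q s c k N x → s * (c * c * (c * c)) ≤ k → q * k < N * N * (N * N) → N ≤ c * x →
             q * s < x * x * (x * x)
      pull q s c k N x s≤k k<N N≤cx = *-cancelʳ-< (c * c * (c * c)) (q * s) (x * x * (x * x)) (begin-strict
        q * s * (c * c * (c * c))             ≡⟨ *-assoc q s _ ⟩
        q * (s * (c * c * (c * c)))           ≤⟨ *-monoʳ-≤ q s≤k ⟩
        q * k                                 <⟨ k<N ⟩
        N * N * (N * N)                       ≤⟨ *-mono-≤ (*-mono-≤ N≤cx N≤cx) (*-mono-≤ N≤cx N≤cx) ⟩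
        c * x * (c * x) * (c * x * (c * x))   ≡⟨ e c x ⟩
        x * x * (x * x) * (c * c * (c * c))   ∎)
        where
        open ≤-Reasoning
        e : ∀ c x → c * x * (c * x) * (c * x * (c * x)) ≡ x * x * (x * x) * (c * c * (c * c))
        e = solve-∀

      q≤q*[64*t] : ∀ q s → 0 < s → q ≤ q * (64 * s)
      q≤q*[64*t] q s 0<s = m≤m*n q (64 * s) {{m*n≢0 64 s {{_}} {{>-nonZero 0<s}}}}

    -- Stated for X′ and not for X′ / ξ₀: ratios of differences do not change under dilation, so F
    -- is the same, while the energies are known at the elements of X′.
    record Outcome (A X : FinSet q) (K : ℕ) : Set where
      field
        X′      : FinSet q
        X′⊆X    : ∀ ξ → ξ ∈ X′ → ξ ∈ X
        X′-size : q * (64 * (K * K * (K * K) * (K * K * (K * K)))) < card X′ * card X′ * (card X′ * card X′)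
        F       : FinSet q
        F-field : Subfield F
        proper  : ∃ λ e → ¬ (e ∈ F)
        F-large : card X′ ≤ card F
        aligned : ∀ {x₁ x₂ x₃ x₄} → x₁ ∈ X′ → x₂ ∈ X′ → x₃ ∈ X′ → x₄ ∈ X′ → x₃ ≢ x₄ →
                  ∃ λ z → z ∈ F × x₁ ⊝ x₂ ≡ z ⊙ (x₃ ⊝ x₄)

    module _ (A X : FinSet q) (n K κ : ℕ) (κ≡ : κ ≡ 32 * K) (0<K : 0 < K) (|A|≡n : card A ≡ n)
             (0∉X : ∀ {ξ} → ξ ∈ X → ξ ≢ 0F)
             (X-large : κ ^ 1504 ≤ card X)
             (X-large′ : q * κ ^ 16 < card X * card X * (card X * card X))
             (X-small : card X * card X < q)
             (A-large : q * κ ^ 170 < n * n)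
             (A-small : n * n * n < 8 * (q * q))
             (energies : ∀ {ξ} → ξ ∈ X → n * n * n ≤ K * energy A (dil ξ A))
             where

      private
        0<κ : 0 < κ
        0<κ = subst (0 <_) (sym κ≡) (*-mono-≤ {1} {32} (s≤s z≤n) 0<K)

        instance
          κ≢0 : NonZero κ
          κ≢0 = >-nonZero 0<κ

        0<n : 0 < n
        0<n = n≢0⇒n>0 λ { refl → n≮0 A-large }

        0<X : 0 < card X
        0<X = ≤-trans (m^n>0 κ 1504) X-large

        c₀ : Core A X n K
        c₀ = core A X n K |A|≡n 0<n 0<X 0∉X energies

      open Core c₀ using (ξ₀; ξ₀∈X; X′; X′⊆X; H; H⊆A)

      private
        module C = Core c₀

        ℓ : ℕ
        ℓ = card H

        d₀ : ℕ
        d₀ = 8 * L³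

        n≤ : n ≤ κ ^ 5 * ℓ
        n≤ = ≤-trans C.H-size (≤-trans (≤-reflexive (pow₅ K 8 d₀ ℓ)) (absorb K κ≡ (8 * 8 * d₀) 5 ℓ const₅))

        0<ℓ : 0 < ℓ
        0<ℓ = n≢0⇒n>0 λ ℓ≡0 → <⇒≱ 0<n (≤-trans n≤ (≤-reflexive (trans (cong (κ ^ 5 *_) ℓ≡0) (*-zeroʳ (κ ^ 5)))))

      open Goodness H κ 0<κ 0<ℓ
        (≤-trans C.triple (≤-trans (≤-reflexive (pow₂₀ K L 8 d₀ ℓ)) (absorb K κ≡ (L * L * 8 * (d₀ * d₀ * d₀ * d₀ * d₀)) 20 ℓ const₂₀)))

      private
        ξ₀≢0 : ξ₀ ≢ 0F
        ξ₀≢0 = 0∉X ξ₀∈X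

        X₁ : FinSet q
        X₁ x = X′ (ξ₀ ⊙ x)

        |X₁| : card X₁ ≡ card X′
        |X₁| = ∑-dilate ξ₀≢0 (λ x → 𝟙 (X′ x))

        x : ℕ
        x = card X′

        X₁∌0 : ∀ {y} → y ∈ X₁ → y ≢ 0F
        X₁∌0 y∈ refl = 0∉X (X′⊆X _ y∈) (⊙-zeroʳ ξ₀)

        good-1 : Good 18 1F
        good-1 = weaken {8} below (good (≤-trans (D-1 H) (≤-trans C.unit
          (≤-trans (≤-reflexive (pow₈ K 8 d₀ ℓ)) (absorb K κ≡ (8 * d₀ * d₀) 8 ℓ const₈)))))

        good-X : ∀ {y} → y ∈ X₁ → Good 18 y
        good-X {y} y∈ = subst (Good 18) (⁻¹⊙-cancel ξ₀≢0 y) (good (≤-trans (C.dilates y∈)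
          (≤-trans (≤-reflexive (pow₁₈ K 2 64 8 d₀ ℓ)) (absorb K κ≡ (2 * 64 * 8 * (d₀ * d₀ * d₀ * d₀)) 18 ℓ const₁₈))))

        -- 56 = 18 + 18 + 20; a ratio of two differences then has exponent 112 = 56 + 56.
        good-diff : ∀ d → d ∈ diff X₁ X₁ → Good 56 d
        good-diff = diff-∀ X₁ X₁ (Good 56) λ y∈ y′∈ → good-⊝ {18} {18} (good-X y∈) (good-X y′∈)

        good-ratio : ∀ {z} → z ∈ ratios X₁ → Good 112 z
        good-ratio {z} z∈ =
          let d , d∈ , d≢0 , zd∈ = ratio-elim X₁ z∈
          in subst (Good 112) (trans (⊙-comm (z ⊙ d) (d ⁻¹)) (trans (cong (d ⁻¹ ⊙_) (⊙-comm z d)) (⁻¹⊙-cancel d≢0 z)))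
               (good-⊙ {56} {56} (good-diff (z ⊙ d) zd∈) (good-⁻¹ d≢0 (good-diff d d∈)))

        -- 150 = 112 + 18 + 20 for z + 1, where 1 is good by the bound on |H - H|; for a product xz,
        -- 18 + 112 is enough.
        good-step : ∀ {r} → Step X₁ r → Good 150 r
        good-step (by-one z∈ refl)   = good-⊕ {112} {18} (good-ratio z∈) good-1
        good-step (by-X y∈ z∈ refl)  = weaken {130} below (good-⊙ {18} {112} (good-X y∈) (good-ratio z∈))

        κ^≤q : κ ^ 3008 ≤ q
        κ^≤q = begin
          κ ^ (1504 + 1504)       ≡⟨ ^-distribˡ-+-* κ 1504 1504 ⟩
          κ ^ 1504 * κ ^ 1504     ≤⟨ *-mono-≤ X-large X-large ⟩
          card X * card X         <⟨ X-small ⟩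
          q                       ∎
          where open ≤-Reasoning

        32≤κ : 32 ≤ κ
        32≤κ = subst (32 ≤_) (sym κ≡) (m≤m*n 32 K {{>-nonZero 0<K}})

        -- As H ⊆ A and n ≤ κ⁵ℓ, energies pass from H to A at a loss of κ¹⁵, and 579 = 15 + 564. If
        -- all z were good, the sum of the energies would be too large: the exponent 3 · 579 + 2
        -- that the contradiction needs is below 3008, and κ³⁰⁰⁸ ≤ q.
        not-all-good : ¬ (∀ {z} → z ≢ 0F → Good 564 z)
        not-all-good all = few-large-contradiction q n c 0<n 2c≤n A-small 64c³≤q
          (subst (λ m → q * (m * m * m) ≤ c * (q * (m * m) + m * m * (m * m))) |A|≡n
            (few-large A c (m^n>0 κ 579) λ {z} z≢0 → subst (λ m → m * m * m ≤ c * energy A (dil z A)) (sym |A|≡n) (large z≢0)))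
          where
          open ≤-Reasoning
          c : ℕ
          c = κ ^ 579
          e₁ : ∀ k l → k * l * (k * l) * (k * l) ≡ k * k * k * (l * l * l)
          e₁ = solve-∀
          cube : ∀ e → κ ^ e * κ ^ e * κ ^ e ≡ κ ^ (e + e + e)
          cube e = trans (cong (_* κ ^ e) (sym (^-distribˡ-+-* κ e e))) (sym (^-distribˡ-+-* κ (e + e) e))
          large : ∀ {z} → z ≢ 0F → n * n * n ≤ c * energy A (dil z A)
          large {z} z≢0 = begin
            n * n * n                                        ≤⟨ *-mono-≤ (*-mono-≤ n≤ n≤) n≤ ⟩
            κ ^ 5 * ℓ * (κ ^ 5 * ℓ) * (κ ^ 5 * ℓ)            ≡⟨ e₁ (κ ^ 5) ℓ ⟩
            κ ^ 5 * κ ^ 5 * κ ^ 5 * (ℓ * ℓ * ℓ)              ≡⟨ cong (_* (ℓ * ℓ * ℓ)) (cube 5) ⟩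
            κ ^ 15 * (ℓ * ℓ * ℓ)                             ≤⟨ *-monoʳ-≤ (κ ^ 15) (good-energy z≢0 (all z≢0)) ⟩
            κ ^ 15 * (κ ^ 564 * energy H (dil z H))          ≡⟨ *-assoc (κ ^ 15) (κ ^ 564) (energy H (dil z H)) ⟨
            κ ^ 15 * κ ^ 564 * energy H (dil z H)            ≡⟨ cong (_* energy H (dil z H)) (^-distribˡ-+-* κ 15 564) ⟨
            κ ^ 579 * energy H (dil z H)                     ≤⟨ *-monoʳ-≤ (κ ^ 579) (energy-mono {H} {A} {dil z H} {dil z A} H⊆A (λ y → H⊆A (z ⁻¹ ⊙ y))) ⟩
            κ ^ 579 * energy A (dil z A)                     ∎
          64c³≤q : 64 * (c * c * c) ≤ q
          64c³≤q = begin
            64 * (c * c * c)                     ≤⟨ *-monoˡ-≤ (c * c * c) (≤-trans (below {64} {1024}) (*-mono-≤ 32≤κ 32≤κ)) ⟩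
            κ * κ * (c * c * c)                  ≡⟨ cong (κ * κ *_) (cube 579) ⟩
            κ * κ * κ ^ 1737                     ≡⟨ *-assoc κ κ (κ ^ 1737) ⟩
            κ ^ 1739                             ≤⟨ ^-monoʳ-≤ κ (below {1739} {3008}) ⟩
            κ ^ 3008                             ≤⟨ κ^≤q ⟩
            q                                    ∎
          2c≤n : 2 * c ≤ n
          2c≤n = ≮⇒≥ λ n<2c → <⇒≱ A-large (begin
            n * n                                ≤⟨ *-mono-≤ (<⇒≤ n<2c) (<⇒≤ n<2c) ⟩
            2 * c * (2 * c)                      ≡⟨ e₂ c ⟩
            4 * (c * c)                          ≤⟨ *-monoˡ-≤ (c * c) (≤-trans (below {4} {32}) 32≤κ) ⟩
            κ * (c * c)                          ≡⟨ cong (κ *_) (^-distribˡ-+-* κ 579 579) ⟨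
            κ ^ 1159                             ≤⟨ ^-monoʳ-≤ κ (below {1159} {3008}) ⟩
            κ ^ 3008                             ≤⟨ κ^≤q ⟩
            q                                    ≤⟨ m≤m*n q (κ ^ 170) {{m^n≢0 κ 170}} ⟩
            q * κ ^ 170                          ∎)
            where
            e₂ : ∀ c → 2 * c * (2 * c) ≡ 4 * (c * c)
            e₂ = solve-∀

        x-large : q * (64 * (K * K * (K * K) * (K * K * (K * K)))) < x * x * (x * x)
        x-large = pull q (64 * (K * K * (K * K) * (K * K * (K * K)))) (2 * (64 * (K * K))) (κ ^ 16) (card X) x (fits K κ≡) X-large′ C.X′-size

        q<x⁴ : q < x * x * (x * x)
        q<x⁴ = ≤-<-trans (q≤q*[64*t] q _ (*-mono-≤ (*-mono-≤ 0<K² 0<K²) (*-mono-≤ 0<K² 0<K²))) x-large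
          where
          0<K² : 0 < K * K
          0<K² = *-mono-≤ 0<K 0<K

        1<x : 1 < x
        1<x = ≰⇒> λ x≤1 → <⇒≱ q<x⁴ (≤-trans (*-mono-≤ (*-mono-≤ x≤1 x≤1) (*-mono-≤ x≤1 x≤1))
          (≤-trans (m^n>0 κ 3008) κ^≤q))

        -- A difference in X₁ + rX₁ is (y₁ - y₃) + r(y₂ - y₄) with exponent 282 = 56 + (150 + 56) +
        -- 20. Every z ≠ 0 is a ratio of two of them, whence 564 = 2 · 282.
        pivot : ∀ {r} → Step X₁ r → ¬ (r ∈ ratios X₁) → ∀ {z} → z ≢ 0F → Good 564 z
        pivot {r} step r∉ {z} z≢0 =
          let a , a′ , b , b′ , (a∈ , a′∈) , (b∈ , b′∈) , b≢b′ , eq = quotients-cover (span X₁ r) big z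
              δ≢0 = ⊝-nonzero (≢-sym b≢b′)
          in subst (Good 564) (trans (cong (_⊙ (b′ ⊝ b) ⁻¹) eq) (cancel δ≢0))
               (good-⊙ {282} {282} (good-Y a∈ a′∈) (good-⁻¹ δ≢0 (good-Y b′∈ b∈)))
          where
          cancel : ∀ {z δ} → δ ≢ 0F → z ⊙ δ ⊙ δ ⁻¹ ≡ z
          cancel {z} {δ} δ≢0 = trans (⊙-assoc z δ (δ ⁻¹)) (trans (cong (z ⊙_) (*-inverseʳ δ≢0)) (⊙-identityʳ z))
          big : q < card (span X₁ r) * card (span X₁ r)
          big = <-≤-trans q<x⁴ (≤-trans (≤-reflexive (cong (λ y → y * y * (y * y)) (sym |X₁|)))
                  (*-mono-≤ (card-span X₁ r∉) (card-span X₁ r∉)))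
          e : ∀ r y₁ y₂ y₃ y₄ → y₁ ⊕ r ⊙ y₂ ⊝ (y₃ ⊕ r ⊙ y₄) ≡ (y₁ ⊝ y₃) ⊕ r ⊙ (y₂ ⊝ y₄)
          e = solve 5 (λ r y₁ y₂ y₃ y₄ → y₁ :+ r :* y₂ :- (y₃ :+ r :* y₄) := (y₁ :- y₃) :+ r :* (y₂ :- y₄)) refl
          good-Y : ∀ {a b} → a ∈ span X₁ r → b ∈ span X₁ r → Good 282 (a ⊝ b)
          good-Y a∈ b∈ =
            let y₁ , y₂ , y₁∈ , y₂∈ , eq  = span-elim X₁ a∈
                y₃ , y₄ , y₃∈ , y₄∈ , eq′ = span-elim X₁ b∈
            in subst (Good 282) (sym (trans (cong₂ _⊝_ eq eq′) (e r y₁ y₂ y₃ y₄)))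
                 (good-⊕ {56} {206} (good-⊝ {18} {18} (good-X y₁∈) (good-X y₃∈))
                   (good-⊙ {150} {56} (good-step step) (good-⊝ {18} {18} (good-X y₂∈) (good-X y₄∈))))

        outcome-field : Subfield (ratios X₁) → ∀ {y₁ y₂} → y₁ ∈ X₁ → y₂ ∈ X₁ → y₁ ≢ y₂ → Outcome A X K
        outcome-field F-field {y₁} {y₂} y₁∈ y₂∈ y₁≢y₂ = record
          { X′ = X′ ; X′⊆X = X′⊆X ; X′-size = x-large ; F = F ; F-field = F-field
          ; proper = proper (Fin.any? λ e → ¬? (F e Bool.≟ true))
          -- y ↦ (y - y₂) / (y₁ - y₂) embeds X₁ in F.
          ; F-large = begin
              x                                 ≡⟨ |X₁| ⟨
              card X₁                           ≤⟨ card-mono inside ⟩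
              card (λ y → F (δ ⁻¹ ⊙ (y ⊝ y₂)))  ≡⟨ ∑-untranslate y₂ (λ y → 𝟙 (F (δ ⁻¹ ⊙ y))) ⟩
              card (λ y → F (δ ⁻¹ ⊙ y))         ≡⟨ ∑-undilate δ≢0 (λ y → 𝟙 (F y)) ⟩
              card F                            ∎
          ; aligned = λ {x₁} {x₂} {x₃} {x₄} x₁∈ x₂∈ x₃∈ x₄∈ x₃≢x₄ →
              let δ₁ = x₁ ⊝ x₂
                  δ₂ = x₃ ⊝ x₄
                  δ₂≢0 = ⊝-nonzero x₃≢x₄
              in δ₂ ⁻¹ ⊙ δ₁ ,
                 ratio-intro X₁ (scaled x₃∈ x₄∈) (⊙-nonzero (⁻¹-nonzero ξ₀≢0) δ₂≢0)
                   (subst (_∈ diff X₁ X₁) (sym (trans (e₂ (δ₂ ⁻¹) δ₁ (ξ₀ ⁻¹) δ₂) (cong (ξ₀ ⁻¹ ⊙_) (⁻¹⊙-cancel δ₂≢0 δ₁)))) (scaled x₁∈ x₂∈)) ,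
                 sym (trans (e₃ (δ₂ ⁻¹) δ₁ δ₂) (⁻¹⊙-cancel δ₂≢0 δ₁))
          }
          where
          open ≤-Reasoning
          F : FinSet q
          F = ratios X₁
          δ : Fin q
          δ = y₁ ⊝ y₂
          δ≢0 : δ ≢ 0F
          δ≢0 = ⊝-nonzero y₁≢y₂
          inside : ∀ y → y ∈ X₁ → (δ ⁻¹ ⊙ (y ⊝ y₂)) ∈ F
          inside y y∈ = ratio-intro X₁ (diff-intro X₁ X₁ y₁∈ y₂∈) δ≢0
            (subst (_∈ diff X₁ X₁) (sym (trans (e₃ (δ ⁻¹) (y ⊝ y₂) δ) (⁻¹⊙-cancel δ≢0 (y ⊝ y₂)))) (diff-intro X₁ X₁ y∈ y₂∈))
            where
            e₃ : ∀ i a d → i ⊙ a ⊙ d ≡ i ⊙ (d ⊙ a)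
            e₃ = solve 3 (λ i a d → i :* a :* d := i :* (d :* a)) refl
          e₂ : ∀ i a j d → i ⊙ a ⊙ (j ⊙ d) ≡ j ⊙ (i ⊙ (d ⊙ a))
          e₂ = solve 4 (λ i a j d → i :* a :* (j :* d) := j :* (i :* (d :* a))) refl
          e₃ : ∀ i a d → i ⊙ a ⊙ d ≡ i ⊙ (d ⊙ a)
          e₃ = solve 3 (λ i a d → i :* a :* d := i :* (d :* a)) refl
          e₄ : ∀ i a b → i ⊙ a ⊝ i ⊙ b ≡ i ⊙ (a ⊝ b)
          e₄ = solve 3 (λ i a b → i :* a :- i :* b := i :* (a :- b)) refl
          scaled : ∀ {a b} → a ∈ X′ → b ∈ X′ → (ξ₀ ⁻¹ ⊙ (a ⊝ b)) ∈ diff X₁ X₁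
          scaled {a} {b} a∈ b∈ = subst (_∈ diff X₁ X₁) (e₄ (ξ₀ ⁻¹) a b)
            (diff-intro X₁ X₁ (subst (_∈ X′) (sym (⊙⁻¹-cancel ξ₀≢0 a)) a∈) (subst (_∈ X′) (sym (⊙⁻¹-cancel ξ₀≢0 b)) b∈))
          -- If F were the whole field, every z would be a ratio over X₁ and therefore good with
          -- exponent 112.
          proper : Dec (∃ λ e → ¬ (e ∈ F)) → ∃ λ e → ¬ (e ∈ F)
          proper (yes p) = p
          proper (no none) = ⊥-elim (not-all-good (λ {z} _ → weaken {112} below (good-ratio (stable (F z) λ ∉ → none (z , ∉)))))

      outcome : Outcome A X K
      outcome =
        let y₁ , y₂ , y₁∈ , y₂∈ , y₁≢y₂ = two-members {S = X₁} (subst (1 <_) (sym |X₁|) 1<x)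
        in conclude y₁∈ y₂∈ y₁≢y₂ (subfield-or-pivot X₁ X₁∌0 y₁∈ y₂∈ y₁≢y₂)
        where
        conclude : ∀ {y₁ y₂} → y₁ ∈ X₁ → y₂ ∈ X₁ → y₁ ≢ y₂ →
                   Subfield (ratios X₁) ⊎ (∃ λ r → Step X₁ r × ¬ (r ∈ ratios X₁)) → Outcome A X K
        conclude y₁∈ y₂∈ y₁≢y₂ (inj₁ F-field)         = outcome-field F-field y₁∈ y₂∈ y₁≢y₂
        conclude _   _   _     (inj₂ (r , step , r∉)) = ⊥-elim (not-all-good (pivot step r∉))

  -- Cauchy-Schwarz for energies: passing to differences and to ratios.

  module Averaging {q : ℕ} (𝔽 : FieldOn q) where

    open FieldOn 𝔽
    open Additive 𝔽
    open Refining 𝔽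
    open Extraction 𝔽
    open Calculus 𝔽
    open Quotients 𝔽
    open Energies 𝔽

    weighted-cauchy : ∀ {n} (w f : Fin n → ℕ) →
      ∑ (λ x → w x * f x) * ∑ (λ x → w x * f x) ≤ ∑ w * ∑ (λ x → w x * (f x * f x))
    weighted-cauchy w f = *-cancelˡ-≤ 2 (begin
      2 * (∑ wf * ∑ wf)                             ≡⟨ cong (2 *_) (∑-*-∑ wf wf) ⟩
      2 * ∑ (λ x → ∑ λ y → wf x * wf y)             ≡⟨ ∑-*ˡ 2 (λ x → ∑ λ y → wf x * wf y) ⟨
      ∑ (λ x → 2 * ∑ λ y → wf x * wf y)             ≤⟨ ∑-mono (λ x → ≤-trans (≤-reflexive (sym (∑-*ˡ 2 (λ y → wf x * wf y)))) (∑-mono (pt x))) ⟩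
      ∑ (λ x → ∑ λ y → w x * wff y + wff x * w y)   ≡⟨ ∑-cong (λ x → ∑-+ (λ y → w x * wff y) (λ y → wff x * w y)) ⟩
      ∑ (λ x → ∑ (λ y → w x * wff y) + ∑ (λ y → wff x * w y))
        ≡⟨ ∑-+ (λ x → ∑ (λ y → w x * wff y)) (λ x → ∑ (λ y → wff x * w y)) ⟩
      ∑ (λ x → ∑ (λ y → w x * wff y)) + ∑ (λ x → ∑ (λ y → wff x * w y))
        ≡⟨ cong₂ _+_ (sym (∑-*-∑ w wff)) (trans (sym (∑-*-∑ wff w)) (*-comm (∑ wff) (∑ w))) ⟩
      ∑ w * ∑ wff + ∑ w * ∑ wff                     ≡⟨ cong (∑ w * ∑ wff +_) (+-identityʳ (∑ w * ∑ wff)) ⟨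
      2 * (∑ w * ∑ wff)                             ∎)
      where
      open ≤-Reasoning
      wf wff : Fin _ → ℕ
      wf x = w x * f x
      wff x = w x * (f x * f x)
      e₁ : ∀ a b c d → 2 * (a * b * (c * d)) ≡ a * c * (2 * (b * d))
      e₁ = solve-∀
      e₂ : ∀ a b c d → a * c * (b * b + d * d) ≡ a * (c * (d * d)) + a * (b * b) * c
      e₂ = solve-∀
      pt : ∀ x y → 2 * (wf x * wf y) ≤ w x * wff y + wff x * w y
      pt x y = subst₂ _≤_ (sym (e₁ (w x) (f x) (w y) (f y))) (e₂ (w x) (f x) (w y) (f y))
                 (*-monoʳ-≤ (w x * w y) (2ab≤a²+b² (f x) (f y)))

    solutions-0 : ∀ A → solutions A 0F ≡ card A * card A * card A
    solutions-0 A = trans (∑-cong (λ d → cong (corr A d *_) (trans (cong (corr A) (⊙-zeroˡ d)) (corr-0 A))))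
      (trans (∑-*ʳ (card A) (corr A)) (cong (_* card A) (∑-corr A)))

    solutions≤ : ∀ A z → solutions A z ≤ card A * card A * card A
    solutions≤ A z = ≤-trans (∑-mono (λ d → *-monoʳ-≤ (corr A d) (corr≤card A (z ⊙ d))))
      (≤-reflexive (trans (∑-*ʳ (card A) (corr A)) (cong (_* card A) (∑-corr A))))

    ∑-split : ∀ (f g : Fin q → ℕ) → ∑ (λ u → f u * g u) ≡ f 0F * g 0F + ∑ (λ u → 𝟙 (not ⌊ u Fin.≟ 0F ⌋) * f u * g u)
    ∑-split f g = begin
      ∑ (λ u → f u * g u)      ≡⟨ ∑-cong pt ⟩
      ∑ (λ u → 𝟙 ⌊ u Fin.≟ 0F ⌋ * (f u * g u) + 𝟙 (not ⌊ u Fin.≟ 0F ⌋) * f u * g u)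
        ≡⟨ ∑-+ (λ u → 𝟙 ⌊ u Fin.≟ 0F ⌋ * (f u * g u)) (λ u → 𝟙 (not ⌊ u Fin.≟ 0F ⌋) * f u * g u) ⟩
      ∑ (λ u → 𝟙 ⌊ u Fin.≟ 0F ⌋ * (f u * g u)) + ∑ (λ u → 𝟙 (not ⌊ u Fin.≟ 0F ⌋) * f u * g u)
        ≡⟨ cong (_+ ∑ (λ u → 𝟙 (not ⌊ u Fin.≟ 0F ⌋) * f u * g u)) (∑-≟ 0F (λ u → f u * g u)) ⟩
      f 0F * g 0F + ∑ (λ u → 𝟙 (not ⌊ u Fin.≟ 0F ⌋) * f u * g u) ∎
      where
      open ≡-Reasoning
      e : ∀ b c x y → b + c ≡ 1 → x * y ≡ b * (x * y) + c * x * y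
      e b c x y b+c≡1 = trans (sym (*-identityˡ (x * y))) (trans (cong (_* (x * y)) (sym b+c≡1)) (e′ b c x y))
        where e′ : ∀ b c x y → (b + c) * (x * y) ≡ b * (x * y) + c * x * y
              e′ = solve-∀
      pt : ∀ u → f u * g u ≡ 𝟙 ⌊ u Fin.≟ 0F ⌋ * (f u * g u) + 𝟙 (not ⌊ u Fin.≟ 0F ⌋) * f u * g u
      pt u = e (𝟙 ⌊ u Fin.≟ 0F ⌋) _ (f u) (g u) (𝟙-split ⌊ u Fin.≟ 0F ⌋)

    -- Cauchy-Schwarz over the n³ configurations (d , b) in the count of b + ξd ∈ A.
    differences-energy : ∀ A Y →
      ∑ (λ ξ → 𝟙 (Y ξ) * solutions A ξ) * ∑ (λ ξ → 𝟙 (Y ξ) * solutions A ξ) ≤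
      card A * card A * card A * ∑ (λ u → corr Y u * solutions A u)
    differences-energy A Y = begin
      ∑ (λ ξ → 𝟙 (Y ξ) * solutions A ξ) * ∑ (λ ξ → 𝟙 (Y ξ) * solutions A ξ)  ≡⟨ cong₂ _*_ total total ⟩
      ∑ (λ d → corr A d * B d) * ∑ (λ d → corr A d * B d)      ≤⟨ weighted-cauchy (corr A) B ⟩
      ∑ (corr A) * ∑ (λ d → corr A d * (B d * B d))            ≡⟨ cong (_* ∑ (λ d → corr A d * (B d * B d))) (∑-corr A) ⟩
      n * n * ∑ (λ d → corr A d * (B d * B d))                 ≤⟨ *-monoʳ-≤ (n * n) (∑-mono (λ d → *-monoʳ-≤ (corr A d) (inner d))) ⟩
      n * n * ∑ (λ d → corr A d * (n * G d))                   ≡⟨ cong (n * n *_) (trans (∑-cong (λ d → e₁ (corr A d) n (G d))) (∑-*ˡ n (λ d → corr A d * G d))) ⟩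
      n * n * (n * ∑ (λ d → corr A d * G d))                   ≡⟨ *-assoc (n * n) n _ ⟨
      n * n * n * ∑ (λ d → corr A d * G d)                     ≡⟨ cong (n * n * n *_) exchange ⟩
      n * n * n * ∑ (λ u → corr Y u * solutions A u)           ∎
      where
      open ≤-Reasoning
      n : ℕ
      n = card A
      e₁ : ∀ a b c → a * (b * c) ≡ b * (a * c)
      e₁ = solve-∀
      c : Fin q → Fin q → ℕ
      c d b = ∑ λ ξ → 𝟙 (Y ξ) * 𝟙 (A (b ⊕ ξ ⊙ d))
      B G : Fin q → ℕ
      B d = ∑ λ b → 𝟙 (A b) * c d b
      G d = ∑ λ u → corr Y u * corr A (u ⊙ d)
      total : ∑ (λ ξ → 𝟙 (Y ξ) * solutions A ξ) ≡ ∑ (λ d → corr A d * B d)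
      total = begin-equality
        ∑ (λ ξ → 𝟙 (Y ξ) * ∑ λ d → corr A d * corr A (ξ ⊙ d))
          ≡⟨ ∑-cong (λ ξ → trans (sym (∑-*ˡ (𝟙 (Y ξ)) (λ d → corr A d * corr A (ξ ⊙ d)))) (∑-cong (λ d → e₁ (𝟙 (Y ξ)) (corr A d) (corr A (ξ ⊙ d))))) ⟩
        ∑ (λ ξ → ∑ λ d → corr A d * (𝟙 (Y ξ) * corr A (ξ ⊙ d)))
          ≡⟨ ∑-swap (λ ξ d → corr A d * (𝟙 (Y ξ) * corr A (ξ ⊙ d))) ⟩
        ∑ (λ d → ∑ λ ξ → corr A d * (𝟙 (Y ξ) * corr A (ξ ⊙ d)))
          ≡⟨ ∑-cong (λ d → trans (∑-*ˡ (corr A d) (λ ξ → 𝟙 (Y ξ) * corr A (ξ ⊙ d))) (cong (corr A d *_) (fibre d))) ⟩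
        ∑ (λ d → corr A d * B d) ∎
        where
        fibre : ∀ d → ∑ (λ ξ → 𝟙 (Y ξ) * corr A (ξ ⊙ d)) ≡ B d
        fibre d = begin-equality
          ∑ (λ ξ → 𝟙 (Y ξ) * ∑ λ b → 𝟙 (A b) * 𝟙 (A (b ⊕ ξ ⊙ d)))
            ≡⟨ ∑-cong (λ ξ → trans (sym (∑-*ˡ (𝟙 (Y ξ)) (λ b → 𝟙 (A b) * 𝟙 (A (b ⊕ ξ ⊙ d))))) (∑-cong (λ b → e₁ (𝟙 (Y ξ)) (𝟙 (A b)) _))) ⟩
          ∑ (λ ξ → ∑ λ b → 𝟙 (A b) * (𝟙 (Y ξ) * 𝟙 (A (b ⊕ ξ ⊙ d))))
            ≡⟨ ∑-swap (λ ξ b → 𝟙 (A b) * (𝟙 (Y ξ) * 𝟙 (A (b ⊕ ξ ⊙ d)))) ⟩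
          ∑ (λ b → ∑ λ ξ → 𝟙 (A b) * (𝟙 (Y ξ) * 𝟙 (A (b ⊕ ξ ⊙ d))))
            ≡⟨ ∑-cong (λ b → ∑-*ˡ (𝟙 (A b)) (λ ξ → 𝟙 (Y ξ) * 𝟙 (A (b ⊕ ξ ⊙ d)))) ⟩
          B d ∎
      -- Dropping the condition b ∈ A from the sum of squares makes it translation invariant in b,
      -- so that a pair ξ, ζ of Y matters only through ξ - ζ.
      inner : ∀ d → B d * B d ≤ n * G d
      inner d = begin
        B d * B d                                   ≤⟨ weighted-cauchy (λ b → 𝟙 (A b)) (c d) ⟩
        n * ∑ (λ b → 𝟙 (A b) * (c d b * c d b))     ≤⟨ *-monoʳ-≤ n (∑-mono (λ b → 𝟙*≤ (A b) (c d b * c d b))) ⟩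
        n * ∑ (λ b → c d b * c d b)                 ≡⟨ cong (n *_) squares ⟩
        n * G d                                     ∎
        where
        y : Fin q → Fin q → ℕ
        y b ξ = 𝟙 (Y ξ) * 𝟙 (A (b ⊕ ξ ⊙ d))
        e₂ : ∀ a b c d → a * b * (c * d) ≡ a * (c * (b * d))
        e₂ = solve-∀
        e₃ : ∀ b ξ ζ d → b ⊝ ζ ⊙ d ⊕ ξ ⊙ d ≡ b ⊕ (ξ ⊝ ζ) ⊙ d
        e₃ = solve 4 (λ b ξ ζ d → b :- ζ :* d :+ ξ :* d := b :+ (ξ :- ζ) :* d) refl
        pair : ∀ ξ ζ → ∑ (λ b → 𝟙 (A (b ⊕ ξ ⊙ d)) * 𝟙 (A (b ⊕ ζ ⊙ d))) ≡ corr A ((ξ ⊝ ζ) ⊙ d)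
        pair ξ ζ = trans (sym (∑-untranslate (ζ ⊙ d) (λ b → 𝟙 (A (b ⊕ ξ ⊙ d)) * 𝟙 (A (b ⊕ ζ ⊙ d)))))
          (∑-cong (λ b → trans (*-comm (𝟙 (A (b ⊝ ζ ⊙ d ⊕ ξ ⊙ d))) _)
            (cong₂ (λ s t → 𝟙 (A s) * 𝟙 (A t)) (⊝⊕-cancel b (ζ ⊙ d)) (e₃ b ξ ζ d))))
        squares : ∑ (λ b → c d b * c d b) ≡ G d
        squares = begin-equality
          ∑ (λ b → c d b * c d b)                                       ≡⟨ ∑-cong (λ b → ∑-*-∑ (y b) (y b)) ⟩
          ∑ (λ b → ∑ λ ξ → ∑ λ ζ → y b ξ * y b ζ)                       ≡⟨ ∑-swap (λ b ξ → ∑ λ ζ → y b ξ * y b ζ) ⟩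
          ∑ (λ ξ → ∑ λ b → ∑ λ ζ → y b ξ * y b ζ)                       ≡⟨ ∑-cong (λ ξ → ∑-swap (λ b ζ → y b ξ * y b ζ)) ⟩
          ∑ (λ ξ → ∑ λ ζ → ∑ λ b → y b ξ * y b ζ)                       ≡⟨ ∑-cong (λ ξ → ∑-cong (λ ζ → one ξ ζ)) ⟩
          ∑ (λ ξ → ∑ λ ζ → 𝟙 (Y ξ) * (𝟙 (Y ζ) * corr A ((ξ ⊝ ζ) ⊙ d)))  ≡⟨ ∑-pairs Y (λ u → corr A (u ⊙ d)) ⟩
          G d                                                           ∎
          where
          one : ∀ ξ ζ → ∑ (λ b → y b ξ * y b ζ) ≡ 𝟙 (Y ξ) * (𝟙 (Y ζ) * corr A ((ξ ⊝ ζ) ⊙ d))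
          one ξ ζ = begin-equality
            ∑ (λ b → y b ξ * y b ζ)
              ≡⟨ ∑-cong (λ b → e₂ (𝟙 (Y ξ)) _ (𝟙 (Y ζ)) _) ⟩
            ∑ (λ b → 𝟙 (Y ξ) * (𝟙 (Y ζ) * (𝟙 (A (b ⊕ ξ ⊙ d)) * 𝟙 (A (b ⊕ ζ ⊙ d)))))
              ≡⟨ ∑-*ˡ (𝟙 (Y ξ)) (λ b → 𝟙 (Y ζ) * (𝟙 (A (b ⊕ ξ ⊙ d)) * 𝟙 (A (b ⊕ ζ ⊙ d)))) ⟩
            𝟙 (Y ξ) * ∑ (λ b → 𝟙 (Y ζ) * (𝟙 (A (b ⊕ ξ ⊙ d)) * 𝟙 (A (b ⊕ ζ ⊙ d))))
              ≡⟨ cong (𝟙 (Y ξ) *_) (trans (∑-*ˡ (𝟙 (Y ζ)) (λ b → 𝟙 (A (b ⊕ ξ ⊙ d)) * 𝟙 (A (b ⊕ ζ ⊙ d)))) (cong (𝟙 (Y ζ) *_) (pair ξ ζ))) ⟩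
            𝟙 (Y ξ) * (𝟙 (Y ζ) * corr A ((ξ ⊝ ζ) ⊙ d)) ∎
      exchange : ∑ (λ d → corr A d * G d) ≡ ∑ (λ u → corr Y u * solutions A u)
      exchange = begin-equality
        ∑ (λ d → corr A d * G d)
          ≡⟨ ∑-cong (λ d → trans (sym (∑-*ˡ (corr A d) (λ u → corr Y u * corr A (u ⊙ d)))) (∑-cong (λ u → e₁ (corr A d) (corr Y u) (corr A (u ⊙ d))))) ⟩
        ∑ (λ d → ∑ λ u → corr Y u * (corr A d * corr A (u ⊙ d)))   ≡⟨ ∑-swap (λ d u → corr Y u * (corr A d * corr A (u ⊙ d))) ⟩
        ∑ (λ u → ∑ λ d → corr Y u * (corr A d * corr A (u ⊙ d)))   ≡⟨ ∑-cong (λ u → ∑-*ˡ (corr Y u) (λ d → corr A d * corr A (u ⊙ d))) ⟩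
        ∑ (λ u → corr Y u * solutions A u)                         ∎

    -- Cauchy-Schwarz again, over the differences e = ud of A, for a weight ρ with ρ(0) = 0.
    quotients-energy : ∀ A (ρ : Fin q → ℕ) → ρ 0F ≡ 0 →
      ∑ (λ u → ρ u * solutions A u) * ∑ (λ u → ρ u * solutions A u) ≤
      card A * card A * card A * ∑ (λ z → solutions A z * ∑ λ v → ρ v * ρ (v ⊙ z))
    quotients-energy A ρ ρ0 = begin
      ∑ (λ u → ρ u * solutions A u) * ∑ (λ u → ρ u * solutions A u)   ≡⟨ cong₂ _*_ total total ⟩
      ∑ (λ e → corr A e * R e) * ∑ (λ e → corr A e * R e)             ≤⟨ cauchy (corr A) R ⟩
      ∑ (λ e → corr A e * corr A e) * ∑ (λ e → R e * R e)             ≤⟨ *-mono-≤ corr² (≤-reflexive squares) ⟩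
      n * n * n * ∑ (λ z → solutions A z * ∑ λ v → ρ v * ρ (v ⊙ z))   ∎
      where
      open ≤-Reasoning
      n : ℕ
      n = card A
      R : Fin q → ℕ
      R e = ∑ λ u → ρ u * corr A (u ⁻¹ ⊙ e)
      e₁ : ∀ a b c → a * (b * c) ≡ b * (a * c)
      e₁ = solve-∀
      corr² : ∑ (λ e → corr A e * corr A e) ≤ n * n * n
      corr² = ≤-trans (∑-mono (λ e → *-monoʳ-≤ (corr A e) (corr≤card A e)))
        (≤-reflexive (trans (∑-*ʳ n (corr A)) (cong (_* n) (∑-corr A))))
      -- u⁻¹ has no meaning at u = 0; the weight ρ(0) = 0 hides that term.
      off-zero : ∀ u {a b} → (u ≢ 0F → a ≡ b) → ρ u * a ≡ ρ u * b
      off-zero u {a} {b} h with u Fin.≟ 0F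
      ... | yes refl = trans (cong (_* a) ρ0) (cong (_* b) (sym ρ0))
      ... | no u≢0   = cong (ρ u *_) (h u≢0)
      total : ∑ (λ u → ρ u * solutions A u) ≡ ∑ (λ e → corr A e * R e)
      total = begin-equality
        ∑ (λ u → ρ u * ∑ λ d → corr A d * corr A (u ⊙ d))
          ≡⟨ ∑-cong (λ u → off-zero u (λ u≢0 → turn u≢0)) ⟩
        ∑ (λ u → ρ u * ∑ λ e → corr A e * corr A (u ⁻¹ ⊙ e))
          ≡⟨ ∑-cong (λ u → trans (sym (∑-*ˡ (ρ u) (λ e → corr A e * corr A (u ⁻¹ ⊙ e)))) (∑-cong (λ e → e₁ (ρ u) (corr A e) _))) ⟩
        ∑ (λ u → ∑ λ e → corr A e * (ρ u * corr A (u ⁻¹ ⊙ e)))   ≡⟨ ∑-swap (λ u e → corr A e * (ρ u * corr A (u ⁻¹ ⊙ e))) ⟩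
        ∑ (λ e → ∑ λ u → corr A e * (ρ u * corr A (u ⁻¹ ⊙ e)))   ≡⟨ ∑-cong (λ e → ∑-*ˡ (corr A e) (λ u → ρ u * corr A (u ⁻¹ ⊙ e))) ⟩
        ∑ (λ e → corr A e * R e)                                 ∎
        where
        turn : ∀ {u} → u ≢ 0F → solutions A u ≡ ∑ (λ e → corr A e * corr A (u ⁻¹ ⊙ e))
        turn u≢0 = sym (solutions-⁻¹ u≢0 A)
      -- The substitution u = vz sorts the pairs u, v by their ratio z.
      squares : ∑ (λ e → R e * R e) ≡ ∑ (λ z → solutions A z * ∑ λ v → ρ v * ρ (v ⊙ z))
      squares = begin-equality
        ∑ (λ e → R e * R e)
          ≡⟨ ∑-cong (λ e → ∑-*-∑ (λ u → ρ u * corr A (u ⁻¹ ⊙ e)) (λ v → ρ v * corr A (v ⁻¹ ⊙ e))) ⟩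
        ∑ (λ e → ∑ λ u → ∑ λ v → T e u v)     ≡⟨ ∑-swap (λ e u → ∑ λ v → T e u v) ⟩
        ∑ (λ u → ∑ λ e → ∑ λ v → T e u v)     ≡⟨ ∑-cong (λ u → ∑-swap (λ e v → T e u v)) ⟩
        ∑ (λ u → ∑ λ v → ∑ λ e → T e u v)     ≡⟨ ∑-cong (λ u → ∑-cong (λ v → one u v)) ⟩
        ∑ (λ u → ∑ λ v → ρ v * (ρ u * solutions A (v ⁻¹ ⊙ u)))  ≡⟨ ∑-swap (λ u v → ρ v * (ρ u * solutions A (v ⁻¹ ⊙ u))) ⟩
        ∑ (λ v → ∑ λ u → ρ v * (ρ u * solutions A (v ⁻¹ ⊙ u)))  ≡⟨ ∑-cong (λ v → trans (∑-*ˡ (ρ v) (λ u → ρ u * solutions A (v ⁻¹ ⊙ u))) (trans (off-zero v (λ v≢0 → ratio v≢0)) (sym (∑-*ˡ (ρ v) (λ z → ρ (v ⊙ z) * solutions A z))))) ⟩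
        ∑ (λ v → ∑ λ z → ρ v * (ρ (v ⊙ z) * solutions A z))     ≡⟨ ∑-swap (λ v z → ρ v * (ρ (v ⊙ z) * solutions A z)) ⟩
        ∑ (λ z → ∑ λ v → ρ v * (ρ (v ⊙ z) * solutions A z))     ≡⟨ ∑-cong (λ z → trans (∑-cong (λ v → e₃ (ρ v) (ρ (v ⊙ z)) (solutions A z))) (∑-*ˡ (solutions A z) (λ v → ρ v * ρ (v ⊙ z)))) ⟩
        ∑ (λ z → solutions A z * ∑ λ v → ρ v * ρ (v ⊙ z))       ∎
        where
        T : Fin q → Fin q → Fin q → ℕ
        T e u v = ρ u * corr A (u ⁻¹ ⊙ e) * (ρ v * corr A (v ⁻¹ ⊙ e))
        e₂ : ∀ a b c d → a * b * (c * d) ≡ c * (a * (b * d))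
        e₂ = solve-∀
        e₃ : ∀ a b c → a * (b * c) ≡ c * (a * b)
        e₃ = solve-∀
        ratio : ∀ {v} → v ≢ 0F → ∑ (λ u → ρ u * solutions A (v ⁻¹ ⊙ u)) ≡ ∑ (λ z → ρ (v ⊙ z) * solutions A z)
        ratio {v} v≢0 = trans (sym (∑-dilate v≢0 (λ u → ρ u * solutions A (v ⁻¹ ⊙ u))))
          (∑-cong (λ z → cong (λ t → ρ (v ⊙ z) * solutions A t) (⁻¹⊙-cancel v≢0 z)))
        one : ∀ u v → ∑ (λ e → T e u v) ≡ ρ v * (ρ u * solutions A (v ⁻¹ ⊙ u))
        one u v = begin-equality
          ∑ (λ e → T e u v)   ≡⟨ ∑-cong (λ e → e₂ (ρ u) _ (ρ v) _) ⟩
          ∑ (λ e → ρ v * (ρ u * (corr A (u ⁻¹ ⊙ e) * corr A (v ⁻¹ ⊙ e))))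
            ≡⟨ trans (∑-*ˡ (ρ v) (λ e → ρ u * (corr A (u ⁻¹ ⊙ e) * corr A (v ⁻¹ ⊙ e)))) (cong (ρ v *_) (∑-*ˡ (ρ u) (λ e → corr A (u ⁻¹ ⊙ e) * corr A (v ⁻¹ ⊙ e)))) ⟩
          ρ v * (ρ u * ∑ (λ e → corr A (u ⁻¹ ⊙ e) * corr A (v ⁻¹ ⊙ e)))
            ≡⟨ cong (ρ v *_) (off-zero u λ u≢0 → trans (sym (∑-dilate u≢0 (λ e → corr A (u ⁻¹ ⊙ e) * corr A (v ⁻¹ ⊙ e))))
                 (∑-cong (λ d → cong₂ (λ s t → corr A s * corr A t) (⁻¹⊙-cancel u≢0 d) (sym (⊙-assoc (v ⁻¹) u d))))) ⟩
          ρ v * (ρ u * solutions A (v ⁻¹ ⊙ u)) ∎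

  -- From the weighted to the uniform average over F.

  module Smoothing {q : ℕ} (𝔽 : FieldOn q) where

    open FieldOn 𝔽
    open Additive 𝔽
    open Refining 𝔽
    open Extraction 𝔽
    open Calculus 𝔽
    open Quotients 𝔽
    open Energies 𝔽
    open Averaging 𝔽

    -- (b - a)(d - c) ≥ 0, multiplied out so that no subtraction occurs.
    rearrange : ∀ {a b c d} → a ≤ b → c ≤ d → b * c + a * d ≤ b * d + a * c
    rearrange {a} {b} {c} {d} a≤b c≤d with m≤n⇒∃[o]m+o≡n a≤b | m≤n⇒∃[o]m+o≡n c≤d
    ... | s , refl | t , refl = ≤-trans (m≤m+n _ (s * t)) (≤-reflexive (e a s c t))
      where
      e : ∀ a s c t → (a + s) * c + a * (c + t) + s * t ≡ (a + s) * (c + t) + a * c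
      e = solve-∀

    private
      -- Joins the two applications of Cauchy-Schwarz; U* omits from U the term of u = 0.
      combine : ∀ x N K S U U* V → 0 < N → x * N ≤ K * S → S * S ≤ N * U → U ≡ x * N + U* →
                2 * (K * K) ≤ x → U* * U* ≤ N * V →
                x * x * (x * x) * N ≤ 4 * (K * K * (K * K)) * V
      combine x N K S _ U* V 0<N xN≤KS S²≤NU refl 2K²≤x U*²≤NV = *-cancelʳ-≤ _ _ N (begin
        x * x * (x * x) * N * N                        ≡⟨ e₄ x N ⟩
        x * x * N * (x * x * N)                        ≤⟨ *-mono-≤ x²N≤ x²N≤ ⟩
        2 * (K * K) * U* * (2 * (K * K) * U*)          ≡⟨ e₅ 2 (K * K) U* ⟩
        2 * 2 * (K * K * (K * K)) * (U* * U*)          ≤⟨ *-monoʳ-≤ (2 * 2 * (K * K * (K * K))) U*²≤NV ⟩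
        2 * 2 * (K * K * (K * K)) * (N * V)            ≡⟨ e₆ (2 * 2) (K * K * (K * K)) N V ⟩
        2 * 2 * (K * K * (K * K)) * V * N              ∎)
        where
        open ≤-Reasoning
        instance
          N≢0 : NonZero N
          N≢0 = >-nonZero 0<N
        U : ℕ
        U = x * N + U*
        e₁ : ∀ x N → x * x * N * N ≡ x * N * (x * N)
        e₁ = solve-∀
        e₂ : ∀ k s → k * s * (k * s) ≡ k * k * (s * s)
        e₂ = solve-∀
        e₃ : ∀ k n u → k * (n * u) ≡ k * u * n
        e₃ = solve-∀
        e₄ : ∀ x N → x * x * (x * x) * N * N ≡ x * x * N * (x * x * N)
        e₄ = solve-∀
        e₅ : ∀ c k u → c * k * u * (c * k * u) ≡ c * c * (k * k) * (u * u)
        e₅ = solve-∀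
        e₆ : ∀ c k n v → c * k * (n * v) ≡ c * k * v * n
        e₆ = solve-∀
        e₇ : ∀ k y u → 2 * (k * (y + u)) ≡ 2 * k * y + 2 * k * u
        e₇ = solve-∀
        x²N≤K²U : x * x * N ≤ K * K * U
        x²N≤K²U = *-cancelʳ-≤ _ _ N (begin
          x * x * N * N            ≡⟨ e₁ x N ⟩
          x * N * (x * N)          ≤⟨ *-mono-≤ xN≤KS xN≤KS ⟩
          K * S * (K * S)          ≡⟨ e₂ K S ⟩
          K * K * (S * S)          ≤⟨ *-monoʳ-≤ (K * K) S²≤NU ⟩
          K * K * (N * U)          ≡⟨ e₃ (K * K) N U ⟩
          K * K * U * N            ∎)
        x²N≤ : x * x * N ≤ 2 * (K * K) * U*
        x²N≤ = +-cancelˡ-≤ (x * x * N) _ _ (begin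
          x * x * N + x * x * N                          ≡⟨ cong (x * x * N +_) (+-identityʳ (x * x * N)) ⟨
          2 * (x * x * N)                                ≤⟨ *-monoʳ-≤ 2 x²N≤K²U ⟩
          2 * (K * K * (x * N + U*))                     ≡⟨ e₇ (K * K) (x * N) U* ⟩
          2 * (K * K) * (x * N) + 2 * (K * K) * U*       ≤⟨ +-monoˡ-≤ (2 * (K * K) * U*) (*-monoˡ-≤ (x * N) 2K²≤x) ⟩
          x * (x * N) + 2 * (K * K) * U*                 ≡⟨ cong (_+ 2 * (K * K) * U*) (*-assoc x x N) ⟨
          x * x * N + 2 * (K * K) * U*                   ∎)

      -- W is the sum of solutions A z over F with the weights solutions Y z. These weights are at
      -- least x⁴ / f, and their total excess over x⁴ / f is at most fx². Since solutions A z ≤ N,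
      -- this gives W ≤ x⁴ΣA / f + Nfx², and 8kf ≤ x² makes the last term at most half of the lower
      -- bound x⁴N / 4k for W.
      finish : ∀ f x N k W ΣA ΣY → 0 < x → x * x * (x * x) * N ≤ 4 * k * W → 8 * k * f ≤ x * x →
               f * W + f * (x * x * (x * x) * N) ≤ f * (N * ΣY) + x * x * (x * x) * ΣA →
               ΣY ≤ f * (x * x) + x * x * (x * x) → f * N ≤ 8 * k * ΣA
      finish f x N k W ΣA ΣY 0<x x⁴N≤ 8kf≤ sum ΣY≤ = *-cancelʳ-≤ _ _ (x * x * (x * x)) (+-cancelˡ-≤ (f * (x⁴ * N)) _ _ (begin
        f * (x⁴ * N) + f * N * x⁴                         ≡⟨ cong (f * (x⁴ * N) +_) (e₁ f N x⁴) ⟩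
        f * (x⁴ * N) + f * (x⁴ * N)                       ≡⟨ cong (f * (x⁴ * N) +_) (+-identityʳ (f * (x⁴ * N))) ⟨
        2 * (f * (x⁴ * N))                                ≤⟨ *-monoʳ-≤ 2 (*-monoʳ-≤ f x⁴N≤) ⟩
        2 * (f * (4 * k * W))                             ≡⟨ e₂ 2 4 f k W ⟩
        2 * 4 * k * (f * W)                               ≤⟨ *-monoʳ-≤ (8 * k) fW≤ ⟩
        8 * k * (f * f * (x * x) * N + x⁴ * ΣA)           ≡⟨ e₃ (8 * k) f (x * x) N (x⁴ * ΣA) ⟩
        8 * k * f * (f * (x * x) * N) + 8 * k * (x⁴ * ΣA) ≤⟨ +-monoˡ-≤ (8 * k * (x⁴ * ΣA)) (*-monoˡ-≤ (f * (x * x) * N) 8kf≤) ⟩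
        x * x * (f * (x * x) * N) + 8 * k * (x⁴ * ΣA)     ≡⟨ cong₂ _+_ (e₄ (x * x) f N) (e₅ (8 * k) x⁴ ΣA) ⟩
        f * (x⁴ * N) + 8 * k * ΣA * x⁴                    ∎))
        where
        open ≤-Reasoning
        x⁴ : ℕ
        x⁴ = x * x * (x * x)
        instance
          x≢0 : NonZero x
          x≢0 = >-nonZero 0<x
          xx≢0 : NonZero (x * x)
          xx≢0 = m*n≢0 x x
          x⁴≢0 : NonZero (x * x * (x * x))
          x⁴≢0 = m*n≢0 (x * x) (x * x)
        e₁ : ∀ f n y → f * n * y ≡ f * (y * n)
        e₁ = solve-∀
        e₂ : ∀ a b f k w → a * (f * (b * k * w)) ≡ a * b * k * (f * w)
        e₂ = solve-∀
        e₃ : ∀ c f y n r → c * (f * f * y * n + r) ≡ c * f * (f * y * n) + c * r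
        e₃ = solve-∀
        e₄ : ∀ y f n → y * (f * y * n) ≡ f * (y * y * n)
        e₄ = solve-∀
        e₅ : ∀ c y a → c * (y * a) ≡ c * a * y
        e₅ = solve-∀
        e₆ : ∀ f n y z → f * (n * (f * y + z)) ≡ f * (z * n) + f * f * y * n
        e₆ = solve-∀
        fW≤ : f * W ≤ f * f * (x * x) * N + x⁴ * ΣA
        fW≤ = +-cancelˡ-≤ (f * (x⁴ * N)) _ _ (begin
          f * (x⁴ * N) + f * W                             ≡⟨ +-comm (f * (x⁴ * N)) (f * W) ⟩
          f * W + f * (x⁴ * N)                             ≤⟨ sum ⟩
          f * (N * ΣY) + x⁴ * ΣA                           ≤⟨ +-monoˡ-≤ (x⁴ * ΣA) (*-monoʳ-≤ f (*-monoʳ-≤ N ΣY≤)) ⟩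
          f * (N * (f * (x * x) + x⁴)) + x⁴ * ΣA           ≡⟨ cong (_+ x⁴ * ΣA) (e₆ f N (x * x) x⁴) ⟩
          f * (x⁴ * N) + f * f * (x * x) * N + x⁴ * ΣA     ≡⟨ +-assoc (f * (x⁴ * N)) _ _ ⟩
          f * (x⁴ * N) + (f * f * (x * x) * N + x⁴ * ΣA)   ∎)

    module _ (A Y F : FinSet q) (K : ℕ) (F-field : Subfield F) (F-large : card Y ≤ card F)
             (aligned : ∀ {x₁ x₂ x₃ x₄} → x₁ ∈ Y → x₂ ∈ Y → x₃ ∈ Y → x₄ ∈ Y → x₃ ≢ x₄ →
                        ∃ λ z → z ∈ F × x₁ ⊝ x₂ ≡ z ⊙ (x₃ ⊝ x₄)) where

      open Subfield F-field

      private
        x f : ℕ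
        x = card Y
        f = card F

        -- The trivial differences y - y are left out, since ratios are to be formed.
        ρ : Fin q → ℕ
        ρ u = 𝟙 (not ⌊ u Fin.≟ 0F ⌋) * corr Y u

        ρ0 : ρ 0F ≡ 0
        ρ0 = cong (λ b → 𝟙 (not b) * corr Y 0F) (decide (0F Fin.≟ 0F) refl)

        ρ≤corr : ∀ u → ρ u ≤ corr Y u
        ρ≤corr u = 𝟙*≤ (not ⌊ u Fin.≟ 0F ⌋) (corr Y u)

        positive-* : ∀ a {b} → 0 < a * b → 0 < a × 0 < b
        positive-* (suc a) {suc b} _ = s≤s z≤n , s≤s z≤n
        positive-* (suc a) {zero}  h = contradiction (subst (0 <_) (*-zeroʳ a) h) n≮0

        ρ-support : ∀ {u} → 0 < ρ u → u ≢ 0F × ∃₂ λ a b → a ∈ Y × b ∈ Y × u ≡ a ⊝ b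
        ρ-support {u} h =
          let u≢0 , c   = positive-* (𝟙 (not ⌊ u Fin.≟ 0F ⌋)) h
              b , p     = ∑-positive (λ b → 𝟙 (Y b) * 𝟙 (Y (b ⊕ u))) c
              b∈ , a∈   = positive-* (𝟙 (Y b)) p
          in undecided (u Fin.≟ 0F) (𝟙-positive u≢0) , b ⊕ u , b , 𝟙-positive a∈ , 𝟙-positive b∈ , e b u
          where
          e : ∀ b u → u ≡ b ⊕ u ⊝ b
          e = solve 2 (λ b u → u := b :+ u :- b) refl

        -- v and vz are both differences of Y and v ≠ 0, so that z is a ratio of differences, which
        -- `aligned` puts into F.
        ρρ-support : ∀ {v z} → 0 < ρ v * ρ (v ⊙ z) → z ∈ F
        ρρ-support {v} {z} h =
          let p , p′                   = positive-* (ρ v) h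
              v≢0 , a , b , a∈ , b∈ , v≡    = ρ-support p
              _ , a′ , b′ , a′∈ , b′∈ , vz≡ = ρ-support p′
              a≢b : a ≢ b
              a≢b a≡b = v≢0 (trans v≡ (trans (cong (_⊝ b) a≡b) (⊖-inverseʳ b)))
              z′ , z′∈ , eq            = aligned a′∈ b′∈ a∈ b∈ a≢b
          in subst (_∈ F) (trans (sym (⁻¹⊙-cancel v≢0 z′)) (trans (cong (v ⁻¹ ⊙_)
               (trans (⊙-comm v z′) (trans (cong (z′ ⊙_) v≡) (trans (sym eq) (sym vz≡))))) (⁻¹⊙-cancel v≢0 z))) z′∈

        inside-F : ∀ z → solutions A z * ∑ (λ v → ρ v * ρ (v ⊙ z)) ≤ 𝟙 (F z) * (solutions A z * solutions Y z)
        inside-F z = begin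
          solutions A z * ∑ (λ v → ρ v * ρ (v ⊙ z))       ≤⟨ *-monoʳ-≤ (solutions A z) (∑-mono pt) ⟩
          solutions A z * ∑ (λ v → 𝟙 (F z) * (corr Y v * corr Y (z ⊙ v)))  ≡⟨ cong (solutions A z *_) (∑-*ˡ (𝟙 (F z)) (λ v → corr Y v * corr Y (z ⊙ v))) ⟩
          solutions A z * (𝟙 (F z) * solutions Y z)       ≡⟨ e (solutions A z) (𝟙 (F z)) (solutions Y z) ⟩
          𝟙 (F z) * (solutions A z * solutions Y z)       ∎
          where
          open ≤-Reasoning
          e : ∀ a b c → a * (b * c) ≡ b * (a * c)
          e = solve-∀
          guard : ∀ {b m k} → (0 < m → b ≡ true) → m ≤ k → m ≤ 𝟙 b * k
          guard {m = zero}  _ _ = z≤n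
          guard {b} {suc m} {k} h m≤k rewrite h (s≤s z≤n) = ≤-trans m≤k (≤-reflexive (sym (*-identityˡ k)))
          pt : ∀ v → ρ v * ρ (v ⊙ z) ≤ 𝟙 (F z) * (corr Y v * corr Y (z ⊙ v))
          pt v = guard (ρρ-support {v}) (*-mono-≤ (ρ≤corr v) (≤-trans (ρ≤corr (v ⊙ z)) (≤-reflexive (cong (corr Y) (⊙-comm v z)))))

        -- As for the sum over all z, except that the term v = 0 now occurs for f values of z and
        -- not for q.
        ∑-F : ∑ (λ z → 𝟙 (F z) * solutions Y z) ≤ f * (x * x) + x * x * (x * x)
        ∑-F = begin
          ∑ (λ z → 𝟙 (F z) * ∑ λ v → corr Y v * corr Y (z ⊙ v))
            ≡⟨ ∑-cong (λ z → trans (sym (∑-*ˡ (𝟙 (F z)) (λ v → corr Y v * corr Y (z ⊙ v)))) (∑-cong (λ v → e (𝟙 (F z)) (corr Y v) (corr Y (z ⊙ v))))) ⟩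
          ∑ (λ z → ∑ λ v → corr Y v * (𝟙 (F z) * corr Y (z ⊙ v)))   ≡⟨ ∑-swap (λ z v → corr Y v * (𝟙 (F z) * corr Y (z ⊙ v))) ⟩
          ∑ (λ v → ∑ λ z → corr Y v * (𝟙 (F z) * corr Y (z ⊙ v)))   ≡⟨ ∑-cong (λ v → ∑-*ˡ (corr Y v) (λ z → 𝟙 (F z) * corr Y (z ⊙ v))) ⟩
          ∑ (λ v → corr Y v * ∑ λ z → 𝟙 (F z) * corr Y (z ⊙ v))     ≤⟨ ∑-mono pt ⟩
          ∑ (λ v → 𝟙 ⌊ v Fin.≟ 0F ⌋ * (f * (x * x)) + corr Y v * (x * x))
            ≡⟨ ∑-+ (λ v → 𝟙 ⌊ v Fin.≟ 0F ⌋ * (f * (x * x))) (λ v → corr Y v * (x * x)) ⟩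
          ∑ (λ v → 𝟙 ⌊ v Fin.≟ 0F ⌋ * (f * (x * x))) + ∑ (λ v → corr Y v * (x * x))
            ≡⟨ cong₂ _+_ (∑-≟ 0F (λ _ → f * (x * x))) (trans (∑-*ʳ (x * x) (corr Y)) (cong (_* (x * x)) (∑-corr Y))) ⟩
          f * (x * x) + x * x * (x * x)  ∎
          where
          open ≤-Reasoning
          e : ∀ a b c → a * (b * c) ≡ b * (a * c)
          e = solve-∀
          e′ : ∀ x f → x * (f * x) ≡ 1 * (f * (x * x))
          e′ = solve-∀
          pt : ∀ v → corr Y v * ∑ (λ z → 𝟙 (F z) * corr Y (z ⊙ v)) ≤ 𝟙 ⌊ v Fin.≟ 0F ⌋ * (f * (x * x)) + corr Y v * (x * x)
          pt v with v Fin.≟ 0F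
          ... | yes refl = begin
            corr Y 0F * ∑ (λ z → 𝟙 (F z) * corr Y (z ⊙ 0F))
              ≡⟨ cong₂ _*_ (corr-0 Y) (trans (∑-cong (λ z → cong (𝟙 (F z) *_) (trans (cong (corr Y) (⊙-zeroʳ z)) (corr-0 Y)))) (∑-*ʳ x (λ z → 𝟙 (F z)))) ⟩
            x * (f * x)                                ≡⟨ e′ x f ⟩
            1 * (f * (x * x))                          ≤⟨ m≤m+n _ _ ⟩
            1 * (f * (x * x)) + corr Y 0F * (x * x)    ∎
          ... | no v≢0 = *-monoʳ-≤ (corr Y v) (begin
            ∑ (λ z → 𝟙 (F z) * corr Y (z ⊙ v))   ≤⟨ ∑-mono (λ z → 𝟙*≤ (F z) (corr Y (z ⊙ v))) ⟩
            ∑ (λ z → corr Y (z ⊙ v))             ≡⟨ trans (∑-cong (λ z → cong (corr Y) (⊙-comm z v))) (∑-dilate v≢0 (corr Y)) ⟩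
            ∑ (corr Y)                           ≡⟨ ∑-corr Y ⟩
            x * x                                ∎)

        -- Y lies in a translate of a line tF, so the differences y₁ - z y₂ lie in another.
        spread : ∀ {y₀ y₁} → y₀ ∈ Y → y₁ ∈ Y → y₁ ≢ y₀ → ∀ z → z ∈ F → x * x * (x * x) ≤ f * solutions Y z
        spread {y₀} {y₁} y₀∈ y₁∈ y₁≢y₀ z z∈ with z Fin.≟ 0F
        ... | yes refl = begin
          x * x * (x * x)              ≡⟨ e x ⟩
          x * (x * x * x)              ≤⟨ *-monoˡ-≤ (x * x * x) F-large ⟩
          f * (x * x * x)              ≡⟨ cong (f *_) (solutions-0 Y) ⟨
          f * solutions Y 0F           ∎
          where
          open ≤-Reasoning
          e : ∀ x → x * x * (x * x) ≡ x * (x * x * x)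
          e = solve-∀
        ... | no z≢0 = begin
          x * x * (x * x)                              ≡⟨ cong (λ y → x * y * (x * y)) (card-dil z≢0 Y) ⟨
          x * card (dil z Y) * (x * card (dil z Y))    ≤⟨ energy-lower Y (dil z Y) ⟩
          card (diff Y (dil z Y)) * energy Y (dil z Y) ≤⟨ *-monoˡ-≤ (energy Y (dil z Y)) few ⟩
          f * energy Y (dil z Y)                       ≡⟨ cong (f *_) (trans (energy-dil z≢0 Y) (solutions-⁻¹ z≢0 Y)) ⟩
          f * solutions Y z                            ∎
          where
          open ≤-Reasoning
          t o : Fin q
          t = y₁ ⊝ y₀
          o = y₀ ⊝ z ⊙ y₀
          t≢0 : t ≢ 0F
          t≢0 = ⊝-nonzero y₁≢y₀
          line : ∀ {y} → y ∈ Y → ∃ λ c → c ∈ F × y ⊝ y₀ ≡ c ⊙ t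
          line y∈ = aligned y∈ y₀∈ y₁∈ y₀∈ y₁≢y₀
          e₁ : ∀ y w z y₀ → y ⊝ w ⊝ (y₀ ⊝ z ⊙ y₀) ≡ (y ⊝ y₀) ⊝ (w ⊝ z ⊙ y₀)
          e₁ = solve 4 (λ y w z y₀ → y :- w :- (y₀ :- z :* y₀) := (y :- y₀) :- (w :- z :* y₀)) refl
          e₂ : ∀ z w′ y₀ → z ⊙ w′ ⊝ z ⊙ y₀ ≡ z ⊙ (w′ ⊝ y₀)
          e₂ = solve 3 (λ z w′ y₀ → z :* w′ :- z :* y₀ := z :* (w′ :- y₀)) refl
          e₃ : ∀ c z c′ t → c ⊙ t ⊝ z ⊙ (c′ ⊙ t) ≡ t ⊙ (c ⊝ z ⊙ c′)
          e₃ = solve 4 (λ c z c′ t → c :* t :- z :* (c′ :* t) := t :* (c :- z :* c′)) refl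
          on-line : ∀ {y w} → y ∈ Y → w ∈ dil z Y → F (t ⁻¹ ⊙ (y ⊝ w ⊝ o)) ≡ true
          on-line {y} {w} y∈ w∈ =
            let c , c∈ , p   = line y∈
                c′ , c′∈ , p′ = line w∈
            in subst (_∈ F) (sym (trans (cong (t ⁻¹ ⊙_) (trans (e₁ y w z y₀)
                 (trans (cong₂ (λ a b → a ⊝ (b ⊝ z ⊙ y₀)) p (sym (⊙⁻¹-cancel z≢0 w)))
                   (trans (cong (c ⊙ t ⊝_) (trans (e₂ z (z ⁻¹ ⊙ w) y₀) (cong (z ⊙_) p′))) (e₃ c z c′ t)))))
                 (⁻¹⊙-cancel t≢0 (c ⊝ z ⊙ c′)))) (⊕-cl c∈ (⊖-cl (⊙-cl z∈ c′∈)))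
          few : card (diff Y (dil z Y)) ≤ f
          few = begin
            card (diff Y (dil z Y))                 ≤⟨ card-mono (diff-∀ Y (dil z Y) (λ e → F (t ⁻¹ ⊙ (e ⊝ o)) ≡ true) on-line) ⟩
            card (λ e → F (t ⁻¹ ⊙ (e ⊝ o)))         ≡⟨ ∑-untranslate o (λ e → 𝟙 (F (t ⁻¹ ⊙ e))) ⟩
            card (λ e → F (t ⁻¹ ⊙ e))               ≡⟨ ∑-undilate t≢0 (λ e → 𝟙 (F e)) ⟩
            f                                       ∎

      -- 2K² ≤ |Y| makes the term u = 0 of the first Cauchy-Schwarz step harmless; 8K⁴|F| ≤ |Y|²
      -- does the same for the excess of the weights.
      smooth : 0 < card A → 1 < card Y → 2 * (K * K) ≤ card Y → 8 * (K * K * (K * K)) * card F ≤ card Y * card Y →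
               (∀ {ξ} → ξ ∈ Y → card A * card A * card A ≤ K * solutions A ξ) →
               card F * (card A * card A * card A) ≤ 8 * (K * K * (K * K)) * ∑ (λ z → 𝟙 (F z) * solutions A z)
      smooth 0<n 1<x 2K²≤x 8K⁴f≤x² energies =
        finish f x N (K * K * (K * K)) W (∑ λ z → 𝟙 (F z) * solutions A z) (∑ λ z → 𝟙 (F z) * solutions Y z)
          (<-trans (s≤s z≤n) 1<x)
          (≤-trans (combine x N K S U U* V 0<N xN≤KS (differences-energy A Y)
                     (trans (∑-split (corr Y) (solutions A)) (cong (_+ U*) (cong₂ _*_ (corr-0 Y) (solutions-0 A))))
                     2K²≤x (quotients-energy A ρ ρ0))
            (*-monoʳ-≤ (4 * (K * K * (K * K))) (∑-mono inside-F)))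
          8K⁴f≤x² summed ∑-F
        where
        open ≤-Reasoning
        n N S U U* V W x⁴ : ℕ
        n = card A
        N = n * n * n
        S = ∑ λ ξ → 𝟙 (Y ξ) * solutions A ξ
        U = ∑ λ u → corr Y u * solutions A u
        U* = ∑ λ u → ρ u * solutions A u
        V = ∑ λ z → solutions A z * ∑ λ v → ρ v * ρ (v ⊙ z)
        W = ∑ λ z → 𝟙 (F z) * (solutions A z * solutions Y z)
        x⁴ = x * x * (x * x)
        0<N : 0 < N
        0<N = *-mono-≤ (*-mono-≤ 0<n 0<n) 0<n
        e₀ : ∀ a b c → a * (b * c) ≡ b * (a * c)
        e₀ = solve-∀
        xN≤KS : x * N ≤ K * S
        xN≤KS = begin
          x * N                                    ≡⟨ ∑-*ʳ N (λ ξ → 𝟙 (Y ξ)) ⟨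
          ∑ (λ ξ → 𝟙 (Y ξ) * N)                    ≤⟨ ∑-mono (λ ξ → 𝟙*-mono {Y ξ} energies) ⟩
          ∑ (λ ξ → 𝟙 (Y ξ) * (K * solutions A ξ))  ≡⟨ ∑-cong (λ ξ → e₀ (𝟙 (Y ξ)) K (solutions A ξ)) ⟩
          ∑ (λ ξ → K * (𝟙 (Y ξ) * solutions A ξ))  ≡⟨ ∑-*ˡ K (λ ξ → 𝟙 (Y ξ) * solutions A ξ) ⟩
          K * S                                    ∎
        pair : ∃₂ λ y₀ y₁ → y₀ ∈ Y × y₁ ∈ Y × y₀ ≢ y₁
        pair = two-members {S = Y} 1<x
        sY sA : Fin q → ℕ
        sY = solutions Y
        sA = solutions A
        -- (f · sY z - x⁴)(N - sA z) ≥ 0 for z in F, in additive form.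
        pt : ∀ z → 𝟙 (F z) * (f * (sA z * sY z) + x⁴ * N) ≤ 𝟙 (F z) * (f * (N * sY z) + x⁴ * sA z)
        pt z = 𝟙*-mono {F z} λ z∈ →
          let y₀ , y₁ , y₀∈ , y₁∈ , y₀≢y₁ = pair
          in subst₂ _≤_ (cong (_+ x⁴ * N) (e₁ f (sY z) (sA z))) (cong (_+ x⁴ * sA z) (e₁ f (sY z) N))
               (rearrange (spread y₀∈ y₁∈ (≢-sym y₀≢y₁) z z∈) (solutions≤ A z))
          where
          e₁ : ∀ a b c → a * b * c ≡ a * (c * b)
          e₁ = solve-∀
        summed : f * W + f * (x⁴ * N) ≤ f * (N * ∑ (λ z → 𝟙 (F z) * sY z)) + x⁴ * ∑ (λ z → 𝟙 (F z) * sA z)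
        summed = begin
          f * W + f * (x⁴ * N)
            ≡⟨ cong₂ _+_ (sym (∑-*ˡ f (λ z → 𝟙 (F z) * (sA z * sY z)))) (sym (∑-*ʳ (x⁴ * N) (λ z → 𝟙 (F z)))) ⟩
          ∑ (λ z → f * (𝟙 (F z) * (sA z * sY z))) + ∑ (λ z → 𝟙 (F z) * (x⁴ * N))
            ≡⟨ ∑-+ (λ z → f * (𝟙 (F z) * (sA z * sY z))) (λ z → 𝟙 (F z) * (x⁴ * N)) ⟨
          ∑ (λ z → f * (𝟙 (F z) * (sA z * sY z)) + 𝟙 (F z) * (x⁴ * N))
            ≡⟨ ∑-cong (λ z → e₂ f (𝟙 (F z)) (sA z * sY z) (x⁴ * N)) ⟩
          ∑ (λ z → 𝟙 (F z) * (f * (sA z * sY z) + x⁴ * N))    ≤⟨ ∑-mono pt ⟩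
          ∑ (λ z → 𝟙 (F z) * (f * (N * sY z) + x⁴ * sA z))
            ≡⟨ ∑-cong (λ z → e₃ (𝟙 (F z)) f N (sY z) x⁴ (sA z)) ⟩
          ∑ (λ z → f * N * (𝟙 (F z) * sY z) + x⁴ * (𝟙 (F z) * sA z))
            ≡⟨ trans (∑-+ (λ z → f * N * (𝟙 (F z) * sY z)) (λ z → x⁴ * (𝟙 (F z) * sA z)))
                 (cong₂ _+_ (trans (∑-*ˡ (f * N) (λ z → 𝟙 (F z) * sY z)) (*-assoc f N _)) (∑-*ˡ x⁴ (λ z → 𝟙 (F z) * sA z))) ⟩
          f * (N * ∑ (λ z → 𝟙 (F z) * sY z)) + x⁴ * ∑ (λ z → 𝟙 (F z) * sA z) ∎
          where
          e₂ : ∀ f b w m → f * (b * w) + b * m ≡ b * (f * w + m)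
          e₂ = solve-∀
          e₃ : ∀ b f n y z a → b * (f * (n * y) + z * a) ≡ f * n * (b * y) + z * (b * a)
          e₃ = solve-∀

  -- Second moment over the dilates of an F-hyperplane.

  module Hyperplanes {q : ℕ} (𝔽 : FieldOn q) where

    open FieldOn 𝔽
    open Additive 𝔽
    open Refining 𝔽
    open Calculus 𝔽
    open Quotients 𝔽
    open Energies 𝔽
    open Averaging 𝔽
    open Smoothing 𝔽 using (rearrange)

    record Subspace (F W : FinSet q) : Set where
      field
        0∈   : 0F ∈ W
        ⊕-cl : ∀ {x y} → x ∈ W → y ∈ W → (x ⊕ y) ∈ W
        ⊖-cl : ∀ {x} → x ∈ W → (⊖ x) ∈ W
        ⊙-cl : ∀ {c x} → c ∈ F → x ∈ W → (c ⊙ x) ∈ W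

    private
      -- The second moment of N, where N y ∈ [n²/f , M] for y ≠ 0, in a form without subtraction.
      second-moment : ∀ h g′ n M T S Q →
        let f = suc h ; g = f * g′ ; p = f * g ; n⁴ = n * n * (n * n) in
        0 < h → S + n * g ≡ n * n * g + n * p → g′ * n⁴ + g * T ≤ Q + g′ * T →
        f * Q + p * (n * n * M) + (f * (n * n) * M + n⁴) ≤ f * M * S + n * n * S + (f * n⁴ + n * n * M) →
        g * T ≤ M * n * p + g * (n * n * n) + n⁴
      second-moment h g′ n M T S Q 0<h S≡ Q≥ sum = *-cancelˡ-≤ h {{>-nonZero 0<h}}
        (≤-trans (m≤m+n (h * (g * T)) (h * (n * n * M))) (+-cancelˡ-≤ C _ _ (begin
          C + (h * (g * T) + h * (n * n * M))
            ≡⟨ e₁ h g′ n M T ⟩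
          f * (g′ * n⁴ + g * T) + p * (n * n * M) + (f * (n * n) * M + n⁴) + (f * M + n * n) * (n * g)
            ≤⟨ +-monoˡ-≤ ((f * M + n * n) * (n * g)) (+-monoˡ-≤ (f * (n * n) * M + n⁴) (+-monoˡ-≤ (p * (n * n * M)) (*-monoʳ-≤ f Q≥))) ⟩
          f * (Q + g′ * T) + p * (n * n * M) + (f * (n * n) * M + n⁴) + (f * M + n * n) * (n * g)
            ≡⟨ e₂ f Q g′ T (p * (n * n * M)) (f * (n * n) * M + n⁴) ((f * M + n * n) * (n * g)) ⟩
          f * Q + p * (n * n * M) + (f * (n * n) * M + n⁴) + (f * g′ * T + (f * M + n * n) * (n * g))
            ≤⟨ +-monoˡ-≤ (f * g′ * T + (f * M + n * n) * (n * g)) sum ⟩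
          f * M * S + n * n * S + (f * n⁴ + n * n * M) + (f * g′ * T + (f * M + n * n) * (n * g))
            ≡⟨ e₃ f M S (n * n) (f * n⁴ + n * n * M) (f * g′ * T) (n * g) ⟩
          (f * M + n * n) * (S + n * g) + (f * n⁴ + n * n * M) + f * g′ * T
            ≡⟨ cong (λ s → (f * M + n * n) * s + (f * n⁴ + n * n * M) + f * g′ * T) S≡ ⟩
          (f * M + n * n) * (n * n * g + n * p) + (f * n⁴ + n * n * M) + f * g′ * T
            ≡⟨ e₄ h g′ n M T ⟩
          C + h * (M * n * p + g * (n * n * n) + n⁴) ∎)))
        where
        open ≤-Reasoning
        f g p n⁴ C : ℕ
        f = suc h
        g = f * g′
        p = f * g
        n⁴ = n * n * (n * n)
        C = g * n⁴ + g * T + p * (n * n * M) + n * n * M + n⁴ + p * (n * M) + n * n * n * g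
        e₁ : ∀ h g′ n M T →
          let f = suc h ; g = f * g′ ; p = f * g ; n⁴ = n * n * (n * n) in
          g * n⁴ + g * T + p * (n * n * M) + n * n * M + n⁴ + p * (n * M) + n * n * n * g + (h * (g * T) + h * (n * n * M)) ≡
          f * (g′ * n⁴ + g * T) + p * (n * n * M) + (f * (n * n) * M + n⁴) + (f * M + n * n) * (n * g)
        e₁ = solve-∀
        e₂ : ∀ f Q g′ T a b c → f * (Q + g′ * T) + a + b + c ≡ f * Q + a + b + (f * g′ * T + c)
        e₂ = solve-∀
        e₃ : ∀ f M S n² a t m → f * M * S + n² * S + a + (t + (f * M + n²) * m) ≡ (f * M + n²) * (S + m) + a + t
        e₃ = solve-∀
        e₄ : ∀ h g′ n M T →
          let f = suc h ; g = f * g′ ; p = f * g ; n⁴ = n * n * (n * n) in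
          (f * M + n * n) * (n * n * g + n * p) + (f * n⁴ + n * n * M) + f * g′ * T ≡
          g * n⁴ + g * T + p * (n * n * M) + n * n * M + n⁴ + p * (n * M) + n * n * n * g + h * (M * n * p + g * (n * n * n) + n⁴)
        e₄ = solve-∀

      -- `big` gives pn³ ≤ cg(T + fn²). Multiplied by 4, with gT replaced by its supposed bound, the
      -- right side has four terms. By the four smallness conditions each is at most pn³, and the
      -- one with 4cn < p is strictly smaller.
      too-few : ∀ f g n c M T ΣA → let p = f * g in 0 < n → 4 * c * M ≤ n * n → 4 * c ≤ f → 4 * c * n < p → 4 * c ≤ n →
                f * (n * n * n) ≤ c * ΣA → ΣA ≤ T + f * (n * n) →
                ¬ (g * T ≤ M * n * p + g * (n * n * n) + n * n * (n * n))
      too-few f g n c M T ΣA 0<n 4cM≤ 4c≤f 4cn<q 4c≤n big ΣA≤ h = <-irrefl refl (begin-strict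
        4 * (p * n³)                                       ≡⟨ e₁ 4 f g n³ ⟩
        4 * (g * (f * n³))                                 ≤⟨ *-monoʳ-≤ 4 (*-monoʳ-≤ g (≤-trans big (*-monoʳ-≤ c ΣA≤))) ⟩
        4 * (g * (c * (T + f * (n * n))))                  ≡⟨ e₂ 4 g c T f (n * n) ⟩
        4 * c * (g * T) + 4 * c * (p * (n * n))            ≤⟨ +-monoˡ-≤ (4 * c * (p * (n * n))) (*-monoʳ-≤ (4 * c) h) ⟩
        4 * c * (M * n * p + g * n³ + n * n * (n * n)) + 4 * c * (p * (n * n))
                                                           ≡⟨ e₃ (4 * c) M n p g ⟩
        4 * c * M * (n * p) + 4 * c * (g * n³) + 4 * c * n * n³ + 4 * c * (p * (n * n))
          <⟨ +-mono-<-≤ (+-mono-≤-< (+-mono-≤ (*-monoˡ-≤ (n * p) 4cM≤) (*-monoˡ-≤ (g * n³) 4c≤f)) (*-monoˡ-< n³ 4cn<q)) (*-monoˡ-≤ (p * (n * n)) 4c≤n) ⟩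
        n * n * (n * p) + f * (g * n³) + p * n³ + n * (p * (n * n))  ≡⟨ e₄ n f g ⟩
        4 * (p * n³)                                       ∎)
        where
        open ≤-Reasoning
        p n³ : ℕ
        p = f * g
        n³ = n * n * n
        instance
          n≢0 : NonZero n
          n≢0 = >-nonZero 0<n
          nn≢0 : NonZero (n * n)
          nn≢0 = m*n≢0 n n
          n³≢0 : NonZero (n * n * n)
          n³≢0 = m*n≢0 (n * n) n
        e₁ : ∀ c f g n → c * (f * g * n) ≡ c * (g * (f * n))
        e₁ = solve-∀
        e₂ : ∀ d g c t f n → d * (g * (c * (t + f * n))) ≡ d * c * (g * t) + d * c * (f * g * n)
        e₂ = solve-∀
        e₃ : ∀ c M n p g → c * (M * n * p + g * (n * n * n) + n * n * (n * n)) + c * (p * (n * n)) ≡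
             c * M * (n * p) + c * (g * (n * n * n)) + c * n * (n * n * n) + c * (p * (n * n))
        e₃ = solve-∀
        e₄ : ∀ n f g → n * n * (n * (f * g)) + f * (g * (n * n * n)) + f * g * (n * n * n) + n * (f * g * (n * n)) ≡ 4 * (f * g * (n * n * n))
        e₄ = solve-∀

    module _ (A F W : FinSet q) (h g′ c : ℕ) (F-size : card F ≡ suc h) (0<h : 0 < h)
             (W-size : card W ≡ suc h * g′) (q-size : q ≡ suc h * (suc h * g′))
             (W-space : Subspace F W)
             (0<n : 0 < card A) (0<c : 0 < c) (4c≤f : 4 * c ≤ suc h) (4cn<q : 4 * c * card A < q) (4c≤n : 4 * c ≤ card A)
             (rich : suc h * (card A * card A * card A) ≤ c * ∑ (λ z → 𝟙 (F z) * solutions A z)) where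

      open Subspace W-space

      private
        n f g : ℕ
        n = card A
        f = suc h
        g = card W

        q≡fg : q ≡ f * g
        q≡fg = trans q-size (cong (f *_) (sym W-size))

        instance
          n≢0 : NonZero n
          n≢0 = >-nonZero 0<n
          c≢0 : NonZero c
          c≢0 = >-nonZero 0<c

        0<g : 0 < g
        0<g = card-positive {S = W} 0∈

        instance
          g≢0 : NonZero g
          g≢0 = >-nonZero 0<g
          gg≢0 : NonZero (g * g)
          gg≢0 = m*n≢0 g g

        0<q : 0 < q
        0<q = <-≤-trans (s≤s z≤n) 4cn<q

        -- The number of pairs (a , b) of A with y(a - b) in W, sorted by d = a - b.
        N : Fin q → ℕ
        N y = ∑ λ d → corr A d * 𝟙 (W (y ⊙ d))

        -- The hyperplane d⁻¹W if d ≠ 0, and everything if d = 0.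
        kernel : Fin q → Fin q → Bool
        kernel d y = W (y ⊙ d)

        card-kernel : ∀ {d} → d ≢ 0F → card (kernel d) ≡ g
        card-kernel {d} d≢0 = trans (∑-cong (λ y → cong (λ t → 𝟙 (W t)) (⊙-comm y d))) (∑-dilate d≢0 (λ x → 𝟙 (W x)))

        kernel-0 : ∀ y → y ∈ kernel 0F
        kernel-0 y = subst (_∈ W) (sym (⊙-zeroʳ y)) 0∈

        g≤kernel : ∀ d → g ≤ card (kernel d)
        g≤kernel d = cases (d Fin.≟ 0F)
          where
          cases : Dec (d ≡ 0F) → g ≤ card (kernel d)
          cases (no d≢0)   = ≤-reflexive (sym (card-kernel d≢0))
          cases (yes refl) = card-mono {S = W} {kernel 0F} (λ y _ → kernel-0 y)

        -- Two hyperplanes meet in codimension at most 2, because |U||V| ≤ q |U ∩ V|.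
        g′≤kernels : ∀ d e → g′ ≤ card (kernel d ∩ kernel e)
        g′≤kernels d e = *-cancelˡ-≤ q {{>-nonZero 0<q}} (begin
          q * g′                                            ≡⟨ trans (cong (_* g′) q≡fg) (trans (e₁ f g g′) (cong (g *_) (sym W-size))) ⟩
          g * g                                             ≤⟨ *-mono-≤ (g≤kernel d) (g≤kernel e) ⟩
          card (kernel d) * card (kernel e)                 ≡⟨ ∑-meet (kernel d) (kernel e) ⟨
          ∑ (meet (kernel d) (kernel e))                    ≤⟨ ∑-mono fibre ⟩
          ∑ {q} (λ _ → card (kernel d ∩ kernel e))          ≡⟨ ∑-const q _ ⟩
          q * card (kernel d ∩ kernel e)                    ∎)
          where
          open ≤-Reasoning
          e₁ : ∀ f g g′ → f * g * g′ ≡ g * (f * g′)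
          e₁ = solve-∀
          e₂ : ∀ x y d → (x ⊕ y) ⊙ d ⊝ y ⊙ d ≡ x ⊙ d
          e₂ = solve 3 (λ x y d → (x :+ y) :* d :- y :* d := x :* d) refl
          e₃ : ∀ x y s d → (x ⊕ y ⊝ s) ⊙ d ⊝ (y ⊝ s) ⊙ d ≡ x ⊙ d
          e₃ = solve 4 (λ x y s d → (x :+ y :- s) :* d :- (y :- s) :* d := x :* d) refl
          minus : ∀ {x y z} → x ∈ W → y ∈ W → x ⊝ y ≡ z → z ∈ W
          minus x∈ y∈ refl = ⊕-cl x∈ (⊖-cl y∈)
          fibre : ∀ s → meet (kernel d) (kernel e) s ≤ card (kernel d ∩ kernel e)
          fibre s with meet (kernel d) (kernel e) s in eq
          ... | zero  = z≤n
          ... | suc m =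
            let y , y∈   = card-∃ {S = shared (kernel d) (kernel e) s} (subst (0 <_) (sym eq) (s≤s z≤n))
                yd∈ , ye∈ = ∧-true {kernel d y} y∈
            in begin
              suc m                                           ≡⟨ eq ⟨
              card (shared (kernel d) (kernel e) s)           ≡⟨ ∑-translate y (λ x → 𝟙 (shared (kernel d) (kernel e) s x)) ⟨
              card (λ x → shared (kernel d) (kernel e) s (x ⊕ y))
                ≤⟨ card-mono {S = λ x → shared (kernel d) (kernel e) s (x ⊕ y)} (λ x p →
                     let p₁ , p₂ = ∧-true {kernel d (x ⊕ y)} p
                     in ∧-intro (minus p₁ yd∈ (e₂ x y d)) (minus p₂ ye∈ (e₃ x y s e))) ⟩
              card (kernel d ∩ kernel e)                      ∎

        -- e lies in Fd. Then `kernel d` is contained in `kernel e`, and the pair weighs at least g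
        -- in the second moment instead of g′.
        dependent : Fin q → Fin q → Bool
        dependent d e = some λ z → F z ∧ ⌊ z ⊙ d Fin.≟ e ⌋

        T : ℕ
        T = ∑ λ d → ∑ λ e → corr A d * corr A e * 𝟙 (dependent d e)

        g≤dependent : ∀ d e → dependent d e ≡ true → g ≤ card (kernel d ∩ kernel e)
        g≤dependent d e dep =
          let z , p   = some-elim {S = λ z → F z ∧ ⌊ z ⊙ d Fin.≟ e ⌋} dep
              z∈ , eq = ∧-true {F z} p
          in ≤-trans (g≤kernel d) (card-mono {S = kernel d} {kernel d ∩ kernel e} λ y yd∈ → ∧-intro yd∈
               (subst (_∈ W) (trans (e₁ z y d) (cong (y ⊙_) (decided (z ⊙ d Fin.≟ e) eq))) (⊙-cl z∈ yd∈)))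
          where
          e₁ : ∀ z y d → z ⊙ (y ⊙ d) ≡ y ⊙ (z ⊙ d)
          e₁ = solve 3 (λ z y d → z :* (y :* d) := y :* (z :* d)) refl

        -- For d ≠ 0 the kernel has g elements, for d = 0 it has q. The term n · g stands on the
        -- left to avoid n(q - g).
        first : ∑ N + n * g ≡ n * n * g + n * q
        first = begin
          ∑ (λ y → ∑ λ d → corr A d * 𝟙 (W (y ⊙ d))) + n * g
            ≡⟨ cong (_+ n * g) (trans (∑-swap (λ y d → corr A d * 𝟙 (W (y ⊙ d)))) (∑-cong (λ d → ∑-*ˡ (corr A d) (λ y → 𝟙 (W (y ⊙ d)))))) ⟩
          ∑ (λ d → corr A d * card (kernel d)) + n * g
            ≡⟨ cong₂ _+_ (∑-split (corr A) (λ d → card (kernel d))) refl ⟩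
          corr A 0F * card (kernel 0F) + ∑ (λ d → δ d * corr A d * card (kernel d)) + n * g
            ≡⟨ cong₂ (λ a b → a * b + ∑ (λ d → δ d * corr A d * card (kernel d)) + n * g) (corr-0 A) full ⟩
          n * q + ∑ (λ d → δ d * corr A d * card (kernel d)) + n * g
            ≡⟨ cong (λ s → n * q + s + n * g) (∑-cong pt) ⟩
          n * q + ∑ (λ d → δ d * corr A d * g) + n * g     ≡⟨ +-assoc (n * q) _ (n * g) ⟩
          n * q + (∑ (λ d → δ d * corr A d * g) + n * g)   ≡⟨ cong (n * q +_) (+-comm _ (n * g)) ⟩
          n * q + (n * g + ∑ (λ d → δ d * corr A d * g))   ≡⟨ cong (λ a → n * q + (a * g + ∑ (λ d → δ d * corr A d * g))) (corr-0 A) ⟨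
          n * q + (corr A 0F * g + ∑ (λ d → δ d * corr A d * g))
            ≡⟨ cong (n * q +_) (∑-split (corr A) (λ _ → g)) ⟨
          n * q + ∑ (λ d → corr A d * g)                   ≡⟨ cong (n * q +_) (trans (∑-*ʳ g (corr A)) (cong (_* g) (∑-corr A))) ⟩
          n * q + n * n * g                                ≡⟨ +-comm (n * q) _ ⟩
          n * n * g + n * q                                ∎
          where
          open ≡-Reasoning
          δ : Fin q → ℕ
          δ d = 𝟙 (not ⌊ d Fin.≟ 0F ⌋)
          full : card (kernel 0F) ≡ q
          full = trans (∑-cong (λ y → 𝟙-true (kernel-0 y))) (trans (∑-const q 1) (*-identityʳ q))
          pt : ∀ d → δ d * corr A d * card (kernel d) ≡ δ d * corr A d * g
          pt d with d Fin.≟ 0F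
          ... | yes _  = refl
          ... | no d≢0 = cong (1 * corr A d *_) (card-kernel d≢0)

        -- N² counts pairs d, e by |`kernel d` ∩ `kernel e`|, which is at least g′ always and at
        -- least g for dependent pairs. The term g′T stands on the right to avoid g - g′.
        second : g′ * (n * n * (n * n)) + g * T ≤ ∑ (λ y → N y * N y) + g′ * T
        second = begin
          g′ * (n * n * (n * n)) + g * T
            ≡⟨ cong₂ _+_ (trans (cong (g′ *_) (trans (cong₂ _*_ (sym (∑-corr A)) (sym (∑-corr A))) (∑-*-∑ (corr A) (corr A)))) (pull g′ (λ d e → corr A d * corr A e)))
                 (pull g (λ d e → corr A d * corr A e * 𝟙 (dependent d e))) ⟩
          ∑ (λ d → ∑ λ e → g′ * (corr A d * corr A e)) + ∑ (λ d → ∑ λ e → g * (corr A d * corr A e * 𝟙 (dependent d e)))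
            ≡⟨ add (λ d e → g′ * (corr A d * corr A e)) (λ d e → g * (corr A d * corr A e * 𝟙 (dependent d e))) ⟩
          ∑ (λ d → ∑ λ e → g′ * (corr A d * corr A e) + g * (corr A d * corr A e * 𝟙 (dependent d e)))
            ≤⟨ ∑-mono (λ d → ∑-mono (pt d)) ⟩
          ∑ (λ d → ∑ λ e → corr A d * corr A e * card (kernel d ∩ kernel e) + g′ * (corr A d * corr A e * 𝟙 (dependent d e)))
            ≡⟨ add (λ d e → corr A d * corr A e * card (kernel d ∩ kernel e)) (λ d e → g′ * (corr A d * corr A e * 𝟙 (dependent d e))) ⟨
          ∑ (λ d → ∑ λ e → corr A d * corr A e * card (kernel d ∩ kernel e)) + ∑ (λ d → ∑ λ e → g′ * (corr A d * corr A e * 𝟙 (dependent d e)))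
            ≡⟨ cong₂ _+_ squares (sym (pull g′ (λ d e → corr A d * corr A e * 𝟙 (dependent d e)))) ⟩
          ∑ (λ y → N y * N y) + g′ * T  ∎
          where
          open ≤-Reasoning
          pull : ∀ k (G : Fin q → Fin q → ℕ) → k * ∑ (λ d → ∑ λ e → G d e) ≡ ∑ (λ d → ∑ λ e → k * G d e)
          pull k G = trans (sym (∑-*ˡ k (λ d → ∑ λ e → G d e))) (∑-cong (λ d → sym (∑-*ˡ k (G d))))
          add : ∀ (G H : Fin q → Fin q → ℕ) → ∑ (λ d → ∑ (G d)) + ∑ (λ d → ∑ (H d)) ≡ ∑ (λ d → ∑ λ e → G d e + H d e)
          add G H = trans (sym (∑-+ (λ d → ∑ (G d)) (λ d → ∑ (H d)))) (∑-cong (λ d → sym (∑-+ (G d) (H d))))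
          e₁ : ∀ a w → a * w ≡ w * a
          e₁ = *-comm
          e₂ : ∀ a w b → a * w + a * (w * b) ≡ w * (a + a * b)
          e₂ = solve-∀
          pt : ∀ d e → g′ * (corr A d * corr A e) + g * (corr A d * corr A e * 𝟙 (dependent d e)) ≤
                       corr A d * corr A e * card (kernel d ∩ kernel e) + g′ * (corr A d * corr A e * 𝟙 (dependent d e))
          pt d e = begin
            g′ * w + g * (w * b)     ≡⟨ e₃ g′ w g b ⟩
            w * (g′ + g * b)         ≤⟨ *-monoʳ-≤ w (cases (dependent d e) refl) ⟩
            w * (k + g′ * b)         ≡⟨ e₄ w k g′ b ⟩
            w * k + g′ * (w * b)     ∎
            where
            w b k : ℕ
            w = corr A d * corr A e
            b = 𝟙 (dependent d e)
            k = card (kernel d ∩ kernel e)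
            e₃ : ∀ g′ w g b → g′ * w + g * (w * b) ≡ w * (g′ + g * b)
            e₃ = solve-∀
            e₄ : ∀ w k g′ b → w * (k + g′ * b) ≡ w * k + g′ * (w * b)
            e₄ = solve-∀
            cases : ∀ s → dependent d e ≡ s → g′ + g * 𝟙 s ≤ k + g′ * 𝟙 s
            cases true  eq = ≤-trans (≤-reflexive (trans (cong (g′ +_) (*-identityʳ g)) (+-comm g′ g)))
                               (+-mono-≤ (g≤dependent d e eq) (≤-reflexive (sym (*-identityʳ g′))))
            cases false _  = +-mono-≤ (g′≤kernels d e) (≤-trans (≤-reflexive (*-zeroʳ g)) z≤n)
          squares : ∑ (λ d → ∑ λ e → corr A d * corr A e * card (kernel d ∩ kernel e)) ≡ ∑ (λ y → N y * N y)
          squares = begin-equality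
            ∑ (λ d → ∑ λ e → corr A d * corr A e * card (kernel d ∩ kernel e))
              ≡⟨ ∑-cong (λ d → ∑-cong (λ e → trans (cong (corr A d * corr A e *_) (∑-cong (λ y → 𝟙-∧ (W (y ⊙ d)) (W (y ⊙ e)))))
                   (trans (sym (∑-*ˡ (corr A d * corr A e) (λ y → 𝟙 (W (y ⊙ d)) * 𝟙 (W (y ⊙ e))))) (∑-cong (λ y → e₅ (corr A d) (corr A e) _ _))))) ⟩
            ∑ (λ d → ∑ λ e → ∑ λ y → u y d * u y e)   ≡⟨ ∑-cong (λ d → ∑-swap (λ e y → u y d * u y e)) ⟩
            ∑ (λ d → ∑ λ y → ∑ λ e → u y d * u y e)   ≡⟨ ∑-swap (λ d y → ∑ λ e → u y d * u y e) ⟩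
            ∑ (λ y → ∑ λ d → ∑ λ e → u y d * u y e)   ≡⟨ ∑-cong (λ y → ∑-*-∑ (u y) (u y)) ⟨
            ∑ (λ y → N y * N y)                       ∎
            where
            u : Fin q → Fin q → ℕ
            u y d = corr A d * 𝟙 (W (y ⊙ d))
            e₅ : ∀ a b s t → a * b * (s * t) ≡ a * s * (b * t)
            e₅ = solve-∀

        -- For fixed d ≠ 0 the pairs (d , zd) with z in F are distinct and dependent; d = 0 accounts
        -- for fn².
        third : ∑ (λ z → 𝟙 (F z) * solutions A z) ≤ T + f * (n * n)
        third = begin
          ∑ (λ z → 𝟙 (F z) * ∑ λ d → corr A d * corr A (z ⊙ d))
            ≡⟨ ∑-cong (λ z → trans (sym (∑-*ˡ (𝟙 (F z)) (λ d → corr A d * corr A (z ⊙ d)))) (∑-cong (λ d → e₁ (𝟙 (F z)) (corr A d) (corr A (z ⊙ d))))) ⟩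
          ∑ (λ z → ∑ λ d → corr A d * (𝟙 (F z) * corr A (z ⊙ d)))   ≡⟨ ∑-swap (λ z d → corr A d * (𝟙 (F z) * corr A (z ⊙ d))) ⟩
          ∑ (λ d → ∑ λ z → corr A d * (𝟙 (F z) * corr A (z ⊙ d)))   ≡⟨ ∑-cong (λ d → ∑-*ˡ (corr A d) (λ z → 𝟙 (F z) * corr A (z ⊙ d))) ⟩
          ∑ (λ d → corr A d * ∑ λ z → 𝟙 (F z) * corr A (z ⊙ d))     ≤⟨ ∑-mono pt ⟩
          ∑ (λ d → ∑ (τ d) + 𝟙 ⌊ d Fin.≟ 0F ⌋ * (f * (n * n)))      ≡⟨ ∑-+ (λ d → ∑ (τ d)) (λ d → 𝟙 ⌊ d Fin.≟ 0F ⌋ * (f * (n * n))) ⟩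
          T + ∑ (λ d → 𝟙 ⌊ d Fin.≟ 0F ⌋ * (f * (n * n)))            ≡⟨ cong (T +_) (∑-≟ 0F (λ _ → f * (n * n))) ⟩
          T + f * (n * n)                                           ∎
          where
          open ≤-Reasoning
          τ : Fin q → Fin q → ℕ
          τ d e = corr A d * corr A e * 𝟙 (dependent d e)
          e₁ : ∀ a b c → a * (b * c) ≡ b * (a * c)
          e₁ = solve-∀
          e₂ : ∀ n f → n * (f * n) ≡ f * (n * n)
          e₂ = solve-∀
          pt : ∀ d → corr A d * ∑ (λ z → 𝟙 (F z) * corr A (z ⊙ d)) ≤ ∑ (τ d) + 𝟙 ⌊ d Fin.≟ 0F ⌋ * (f * (n * n))
          pt d with d Fin.≟ 0F
          ... | yes refl = begin
            corr A 0F * ∑ (λ z → 𝟙 (F z) * corr A (z ⊙ 0F))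
              ≡⟨ cong₂ _*_ (corr-0 A) (trans (∑-cong (λ z → cong (𝟙 (F z) *_) (trans (cong (corr A) (⊙-zeroʳ z)) (corr-0 A)))) (trans (∑-*ʳ n (λ z → 𝟙 (F z))) (cong (_* n) F-size))) ⟩
            n * (f * n)                           ≡⟨ trans (e₂ n f) (sym (*-identityˡ (f * (n * n)))) ⟩
            1 * (f * (n * n))                     ≤⟨ m≤n+m _ (∑ (τ 0F)) ⟩
            ∑ (τ 0F) + 1 * (f * (n * n))          ∎
          ... | no d≢0 = begin
            corr A d * ∑ (λ z → 𝟙 (F z) * corr A (z ⊙ d))     ≡⟨ ∑-*ˡ (corr A d) (λ z → 𝟙 (F z) * corr A (z ⊙ d)) ⟨
            ∑ (λ z → corr A d * (𝟙 (F z) * corr A (z ⊙ d)))   ≤⟨ ∑-mono one ⟩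
            ∑ (λ z → τ d (d ⊙ z))                             ≡⟨ ∑-dilate d≢0 (τ d) ⟩
            ∑ (τ d)                                           ≤⟨ m≤m+n _ _ ⟩
            ∑ (τ d) + 0 * (f * (n * n))                       ∎
            where
            e₃ : ∀ a b c → a * (b * c) ≡ a * c * b
            e₃ = solve-∀
            one : ∀ z → corr A d * (𝟙 (F z) * corr A (z ⊙ d)) ≤ τ d (d ⊙ z)
            one z = begin
              corr A d * (𝟙 (F z) * corr A (z ⊙ d))     ≡⟨ e₃ (corr A d) (𝟙 (F z)) (corr A (z ⊙ d)) ⟩
              corr A d * corr A (z ⊙ d) * 𝟙 (F z)       ≡⟨ cong (λ t → corr A d * corr A t * 𝟙 (F z)) (⊙-comm z d) ⟩
              corr A d * corr A (d ⊙ z) * 𝟙 (F z)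
                ≤⟨ *-monoʳ-≤ (corr A d * corr A (d ⊙ z)) (𝟙-mono {F z} λ z∈ → some-intro (λ z′ → F z′ ∧ ⌊ z′ ⊙ d Fin.≟ d ⊙ z ⌋) z
                     (∧-intro z∈ (decide (z ⊙ d Fin.≟ d ⊙ z) (⊙-comm z d)))) ⟩
              τ d (d ⊙ z)                               ∎

        N-0 : N 0F ≡ n * n
        N-0 = trans (∑-cong (λ d → trans (cong (corr A d *_) (𝟙-true (subst (_∈ W) (sym (⊙-zeroˡ d)) 0∈))) (*-identityʳ (corr A d)))) (∑-corr A)

        -- A is spread over the f cosets of V = y⁻¹W, and Cauchy-Schwarz bounds below the number of
        -- pairs in a common coset. Summing over all q shifts counts every coset g times, which
        -- cancels.
        N-lower : ∀ {y} → y ≢ 0F → n * n ≤ f * N y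
        N-lower {y} y≢0 = *-cancelʳ-≤ _ _ (g * g) (begin
          n * n * (g * g)                              ≡⟨ e₁ n g ⟩
          n * g * (n * g)                              ≡⟨ cong (λ w → n * w * (n * w)) |V| ⟨
          n * card V * (n * card V)                    ≡⟨ cong₂ _*_ (∑-meet A V) (∑-meet A V) ⟨
          ∑ (meet A V) * ∑ (meet A V)                  ≡⟨ cong₂ _*_ ones ones ⟨
          ∑ (λ s → 1 * meet A V s) * ∑ (λ s → 1 * meet A V s)  ≤⟨ cauchy (λ _ → 1) (meet A V) ⟩
          ∑ {q} (λ _ → 1) * energy A V                 ≡⟨ cong₂ _*_ (trans (∑-const q 1) (*-identityʳ q)) (energy≡ A V) ⟩
          q * ∑ (λ d → corr A d * corr V d)            ≡⟨ cong₂ _*_ q≡fg (trans (∑-cong (λ d → trans (cong (corr A d *_) (corr-V d)) (e₂ (corr A d) (𝟙 (V d)) g))) (∑-*ˡ g (λ d → corr A d * 𝟙 (V d)))) ⟩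
          f * g * (g * N y)                            ≡⟨ e₃ f g (N y) ⟩
          f * N y * (g * g)                            ∎)
          where
          open ≤-Reasoning
          V : FinSet q
          V d = W (y ⊙ d)
          e₁ : ∀ n g → n * n * (g * g) ≡ n * g * (n * g)
          e₁ = solve-∀
          e₂ : ∀ a b g → a * (b * g) ≡ g * (a * b)
          e₂ = solve-∀
          e₃ : ∀ f g N → f * g * (g * N) ≡ f * N * (g * g)
          e₃ = solve-∀
          e₄ : ∀ y b d → y ⊙ (b ⊕ d) ⊝ y ⊙ b ≡ y ⊙ d
          e₄ = solve 3 (λ y b d → y :* (b :+ d) :- y :* b := y :* d) refl
          |V| : card V ≡ g
          |V| = ∑-dilate y≢0 (λ x → 𝟙 (W x))
          ones : ∑ (λ s → 1 * meet A V s) ≡ ∑ (meet A V)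
          ones = ∑-cong (λ s → *-identityˡ (meet A V s))
          corr-V : ∀ d → corr V d ≡ 𝟙 (V d) * g
          corr-V d with V d in eq
          ... | true  = trans (∑-cong pt) (trans |V| (sym (*-identityˡ g)))
            where
            pt : ∀ b → 𝟙 (V b) * 𝟙 (V (b ⊕ d)) ≡ 𝟙 (V b)
            pt b = trans (𝟙*-cong {V b} {𝟙 (V (b ⊕ d))} {1} (λ b∈ → 𝟙-true (subst (_∈ W) (sym (⊙-distribˡ y b d)) (⊕-cl b∈ eq)))) (*-identityʳ (𝟙 (V b)))
          ... | false = ∑-zero _ (λ b → off (V b) (V (b ⊕ d)) refl refl)
            where
            off : ∀ {b} s t → V b ≡ s → V (b ⊕ d) ≡ t → 𝟙 s * 𝟙 t ≡ 0
            off false t     _ _ = refl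
            off true  false _ _ = refl
            off {b} true true p p′ = contradiction (trans (sym eq) (subst (_∈ W) (e₄ y b d) (⊕-cl p′ (⊖-cl p)))) λ ()

        bounded : ∀ M → (∀ {y} → y ≢ 0F → N y ≤ M) → g * T ≤ M * n * q + g * (n * n * n) + n * n * (n * n)
        bounded M N≤M = subst₂ (λ g q → g * T ≤ M * n * q + g * (n * n * n) + n * n * (n * n)) (sym W-size) (sym q-size)
          (second-moment h g′ n M T (∑ N) (∑ λ y → N y * N y) 0<h
            (subst₂ (λ g q → ∑ N + n * g ≡ n * n * g + n * q) W-size q-size first)
            (subst (λ g → g′ * (n * n * (n * n)) + g * T ≤ ∑ (λ y → N y * N y) + g′ * T) W-size second)
            (subst (λ q → f * ∑ (λ y → N y * N y) + q * (n * n * M) + (f * (n * n) * M + n * n * (n * n)) ≤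
                          f * M * ∑ N + n * n * ∑ N + (f * (n * n * (n * n)) + n * n * M)) q-size summed))
          where
          open ≤-Reasoning
          δ : Fin q → ℕ
          δ y = 𝟙 ⌊ y Fin.≟ 0F ⌋
          -- (fN - n²)(M - N) ≥ 0 for y ≠ 0. At y = 0, where N = n², the correction terms make both
          -- sides equal, so that the sum may run over all y.
          pt : ∀ y → f * (N y * N y) + n * n * M + δ y * (f * (n * n) * M + n * n * (n * n)) ≤
                     f * M * N y + n * n * N y + δ y * (f * (n * n * (n * n)) + n * n * M)
          pt y with y Fin.≟ 0F
          ... | yes refl = ≤-reflexive (trans (cong (λ N → f * (N * N) + n * n * M + 1 * (f * (n * n) * M + n * n * (n * n))) N-0)
                  (trans (e₁ f (n * n) M) (cong (λ N → f * M * N + n * n * N + 1 * (f * (n * n * (n * n)) + n * n * M)) (sym N-0))))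
            where
            e₁ : ∀ f n M → f * (n * n) + n * M + 1 * (f * n * M + n * n) ≡ f * M * n + n * n + 1 * (f * (n * n) + n * M)
            e₁ = solve-∀
          ... | no y≢0 = +-monoˡ-≤ 0 (subst₂ _≤_ (cong (_+ n * n * M) (*-assoc f (N y) (N y))) (cong (_+ n * n * N y) (e₂ f (N y) M))
                           (rearrange (N-lower y≢0) (N≤M y≢0)))
            where
            e₂ : ∀ f N M → f * N * M ≡ f * M * N
            e₂ = solve-∀
          summed : f * ∑ (λ y → N y * N y) + q * (n * n * M) + (f * (n * n) * M + n * n * (n * n)) ≤
                   f * M * ∑ N + n * n * ∑ N + (f * (n * n * (n * n)) + n * n * M)
          summed = begin
            f * ∑ (λ y → N y * N y) + q * (n * n * M) + a
              ≡⟨ cong₂ _+_ (cong₂ _+_ (sym (∑-*ˡ f (λ y → N y * N y))) (sym (∑-const q (n * n * M)))) (sym (∑-≟ 0F (λ _ → a))) ⟩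
            ∑ (λ y → f * (N y * N y)) + ∑ {q} (λ _ → n * n * M) + ∑ (λ y → δ y * a)
              ≡⟨ cong (_+ ∑ (λ y → δ y * a)) (∑-+ (λ y → f * (N y * N y)) (λ _ → n * n * M)) ⟨
            ∑ (λ y → f * (N y * N y) + n * n * M) + ∑ (λ y → δ y * a)
              ≡⟨ ∑-+ (λ y → f * (N y * N y) + n * n * M) (λ y → δ y * a) ⟨
            ∑ (λ y → f * (N y * N y) + n * n * M + δ y * a)   ≤⟨ ∑-mono pt ⟩
            ∑ (λ y → f * M * N y + n * n * N y + δ y * b)
              ≡⟨ ∑-+ (λ y → f * M * N y + n * n * N y) (λ y → δ y * b) ⟩
            ∑ (λ y → f * M * N y + n * n * N y) + ∑ (λ y → δ y * b)
              ≡⟨ cong₂ _+_ (trans (∑-+ (λ y → f * M * N y) (λ y → n * n * N y)) (cong₂ _+_ (∑-*ˡ (f * M) N) (∑-*ˡ (n * n) N))) (∑-≟ 0F (λ _ → b)) ⟩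
            f * M * ∑ N + n * n * ∑ N + b                     ∎
            where
            a b : ℕ
            a = f * (n * n) * M + n * n * (n * n)
            b = f * (n * n * (n * n)) + n * n * M

        -- If N y were at most M = ⌊n² / 4c⌋ for all y ≠ 0, then `bounded` would contradict
        -- `too-few`.
        direction : ∃ λ y → y ≢ 0F × n * n < 4 * c * N y
        direction with Fin.any? (λ y → ¬? (y Fin.≟ 0F) ×-dec (n * n <? 4 * c * N y))
        ... | yes found = found
        ... | no none = contradiction
          (bounded M (λ {y} y≢0 → *-cancel-÷ (≮⇒≥ (λ lt → none (y , y≢0 , lt)))))
          (subst (λ q → ¬ (g * T ≤ M * n * q + g * (n * n * n) + n * n * (n * n))) (sym q≡fg)
            (too-few f g n c M T _ 0<n (≤-trans (≤-reflexive (*-comm (4 * c) M)) (m/n*n≤m (n * n) (4 * c)))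
              4c≤f (subst (4 * c * n <_) q≡fg 4cn<q) 4c≤n rich third))
          where
          instance
            4c≢0 : NonZero (4 * c)
            4c≢0 = m*n≢0 4 c
          M : ℕ
          M = n * n / (4 * c)
          *-cancel-÷ : ∀ {m} → 4 * c * m ≤ n * n → m ≤ M
          *-cancel-÷ {m} le = subst (_≤ M) (trans (cong (_/ (4 * c)) (*-comm (4 * c) m)) (m*n/n≡m m (4 * c))) (/-monoˡ-≤ (4 * c) le)

      -- N y adds up, over b in A, the number of a in A ∩ (b + y⁻¹W); some b reaches the average.
      concentrate : ∃₂ λ y b → y ≢ 0F × b ∈ A × n < 4 * c * card (λ a → A a ∧ W (y ⊙ (a ⊝ b)))
      concentrate =
        let y , y≢0 , many = direction
            b , lt = ∑-< (λ b → 𝟙 (A b) * n) (λ b → 4 * c * (𝟙 (A b) * card (λ a → A a ∧ W (y ⊙ (a ⊝ b)))))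
                       (subst₂ _<_ (sym (∑-*ʳ n (λ b → 𝟙 (A b)))) (count y) many)
            b∈ = member (A b) n _ lt
        in y , b , y≢0 , b∈ , subst₂ _<_ (trans (cong (λ t → 𝟙 t * n) b∈) (*-identityˡ n))
             (cong (4 * c *_) (trans (cong (λ t → 𝟙 t * card (λ a → A a ∧ W (y ⊙ (a ⊝ b)))) b∈) (*-identityˡ _))) lt
        where
        member : ∀ s n k → 𝟙 s * n < 4 * c * (𝟙 s * k) → s ≡ true
        member true  n k _ = refl
        member false n k h = contradiction (subst (0 <_) (*-zeroʳ (4 * c)) h) n≮0
        count : ∀ y → 4 * c * N y ≡ ∑ (λ b → 4 * c * (𝟙 (A b) * card (λ a → A a ∧ W (y ⊙ (a ⊝ b)))))
        count y = trans (cong (4 * c *_) (begin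
          N y                                                            ≡⟨ ∑-pairs A (λ d → 𝟙 (W (y ⊙ d))) ⟨
          ∑ (λ a → ∑ λ b → 𝟙 (A a) * (𝟙 (A b) * 𝟙 (W (y ⊙ (a ⊝ b)))))    ≡⟨ ∑-swap (λ a b → 𝟙 (A a) * (𝟙 (A b) * 𝟙 (W (y ⊙ (a ⊝ b))))) ⟩
          ∑ (λ b → ∑ λ a → 𝟙 (A a) * (𝟙 (A b) * 𝟙 (W (y ⊙ (a ⊝ b)))))    ≡⟨ ∑-cong (λ b → trans (∑-cong (λ a → trans (e (𝟙 (A a)) (𝟙 (A b)) _) (cong (𝟙 (A b) *_) (sym (𝟙-∧ (A a) _))))) (∑-*ˡ (𝟙 (A b)) (λ a → 𝟙 (A a ∧ W (y ⊙ (a ⊝ b)))))) ⟩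
          ∑ (λ b → 𝟙 (A b) * card (λ a → A a ∧ W (y ⊙ (a ⊝ b))))         ∎))
          (sym (∑-*ˡ (4 * c) (λ b → 𝟙 (A b) * card (λ a → A a ∧ W (y ⊙ (a ⊝ b))))))
          where
          open ≡-Reasoning
          e : ∀ a b c → a * (b * c) ≡ b * (a * c)
          e = solve-∀

  -- The degree over F and the plane that concentrates A.

  module Planes {q : ℕ} (𝔽 : FieldOn q) where

    open FieldOn 𝔽
    open Additive 𝔽
    open Refining 𝔽
    open Extraction 𝔽
    open Calculus 𝔽
    open Quotients 𝔽
    open Energies 𝔽
    open Structure 𝔽
    open Averaging 𝔽
    open Smoothing 𝔽
    open Hyperplanes 𝔽

    module Extend (F : FinSet q) (F-field : Subfield F) where

      private module F = Subfield F-field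

      -- U + Fe
      extend : FinSet q → Fin q → FinSet q
      extend U e v = some λ c → F c ∧ U (v ⊝ c ⊙ e)

      extend-intro : ∀ U e {c u} → c ∈ F → u ∈ U → (u ⊕ c ⊙ e) ∈ extend U e
      extend-intro U e {c} {u} c∈ u∈ = some-intro (λ c′ → F c′ ∧ U (u ⊕ c ⊙ e ⊝ c′ ⊙ e)) c
        (∧-intro c∈ (subst (_∈ U) (sym (⊕⊝-cancel u (c ⊙ e))) u∈))

      extend-elim : ∀ U e {v} → v ∈ extend U e → ∃₂ λ u c → u ∈ U × c ∈ F × v ≡ u ⊕ c ⊙ e
      extend-elim U e {v} v∈ =
        let c , p   = some-elim {S = λ c → F c ∧ U (v ⊝ c ⊙ e)} v∈
            c∈ , u∈ = ∧-true {F c} p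
        in v ⊝ c ⊙ e , c , u∈ , c∈ , sym (⊝⊕-cancel v (c ⊙ e))

      itself : Subspace F F
      itself = record { 0∈ = F.0∈ ; ⊕-cl = F.⊕-cl ; ⊖-cl = F.⊖-cl ; ⊙-cl = F.⊙-cl }

      extend-space : ∀ {U} e → Subspace F U → Subspace F (extend U e)
      extend-space {U} e U-space = record
        { 0∈   = subst (_∈ extend U e) (e₀ e) (extend-intro U e F.0∈ U.0∈)
        ; ⊕-cl = λ v∈ w∈ →
            let u , c , u∈ , c∈ , p     = extend-elim U e v∈
                u′ , c′ , u′∈ , c′∈ , p′ = extend-elim U e w∈
            in subst (_∈ extend U e) (trans (e₁ u u′ c c′ e) (sym (cong₂ _⊕_ p p′)))
                 (extend-intro U e (F.⊕-cl c∈ c′∈) (U.⊕-cl u∈ u′∈))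
        ; ⊖-cl = λ v∈ →
            let u , c , u∈ , c∈ , p = extend-elim U e v∈
            in subst (_∈ extend U e) (trans (e₂ u c e) (sym (cong ⊖_ p))) (extend-intro U e (F.⊖-cl c∈) (U.⊖-cl u∈))
        ; ⊙-cl = λ {a} a∈ v∈ →
            let u , c , u∈ , c∈ , p = extend-elim U e v∈
            in subst (_∈ extend U e) (trans (e₃ a u c e) (sym (cong (a ⊙_) p)))
                 (extend-intro U e (F.⊙-cl a∈ c∈) (U.⊙-cl a∈ u∈))
        }
        where
        module U = Subspace U-space
        e₀ : ∀ e → 0F ⊕ 0F ⊙ e ≡ 0F
        e₀ e = trans (⊕-identityˡ (0F ⊙ e)) (⊙-zeroˡ e)
        e₁ : ∀ u u′ c c′ e → u ⊕ u′ ⊕ (c ⊕ c′) ⊙ e ≡ (u ⊕ c ⊙ e) ⊕ (u′ ⊕ c′ ⊙ e)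
        e₁ = solve 5 (λ u u′ c c′ e → u :+ u′ :+ (c :+ c′) :* e := (u :+ c :* e) :+ (u′ :+ c′ :* e)) refl
        e₂ : ∀ u c e → ⊖ u ⊕ ⊖ c ⊙ e ≡ ⊖ (u ⊕ c ⊙ e)
        e₂ = solve 3 (λ u c e → :- u :+ (:- c) :* e := :- (u :+ c :* e)) refl
        e₃ : ∀ a u c e → a ⊙ u ⊕ a ⊙ c ⊙ e ≡ a ⊙ (u ⊕ c ⊙ e)
        e₃ = solve 4 (λ a u c e → a :* u :+ a :* c :* e := a :* (u :+ c :* e)) refl

      -- v = u + ce determines c: from u + ce = u′ + c′e with c ≠ c′ would follow e = (c - c′)⁻¹(u′
      -- - u) ∈ U.
      card-extend : ∀ {U} e → Subspace F U → ¬ (e ∈ U) → card (extend U e) ≡ card F * card U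
      card-extend {U} e U-space e∉ = begin
        ∑ (λ v → 𝟙 (extend U e v))                    ≡⟨ ∑-cong (λ v → sym (trans (∑-cong (λ c → sym (𝟙-∧ (F c) _))) (once v))) ⟩
        ∑ (λ v → ∑ λ c → 𝟙 (F c) * 𝟙 (U (v ⊝ c ⊙ e))) ≡⟨ ∑-swap (λ v c → 𝟙 (F c) * 𝟙 (U (v ⊝ c ⊙ e))) ⟩
        ∑ (λ c → ∑ λ v → 𝟙 (F c) * 𝟙 (U (v ⊝ c ⊙ e))) ≡⟨ ∑-cong (λ c → trans (∑-*ˡ (𝟙 (F c)) (λ v → 𝟙 (U (v ⊝ c ⊙ e)))) (cong (𝟙 (F c) *_) (∑-untranslate (c ⊙ e) (λ x → 𝟙 (U x))))) ⟩
        ∑ (λ c → 𝟙 (F c) * card U)                    ≡⟨ ∑-*ʳ (card U) (λ c → 𝟙 (F c)) ⟩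
        card F * card U                               ∎
        where
        open ≡-Reasoning
        module U = Subspace U-space
        S : Fin q → FinSet q
        S v c = F c ∧ U (v ⊝ c ⊙ e)
        e₁ : ∀ v c c′ e → ⊖ (v ⊝ c ⊙ e ⊝ (v ⊝ c′ ⊙ e)) ≡ (c ⊝ c′) ⊙ e
        e₁ = solve 4 (λ v c c′ e → :- (v :- c :* e :- (v :- c′ :* e)) := (c :- c′) :* e) refl
        clash : ∀ v → 1 < card (S v) → e ∈ U
        clash v h =
          let c , c′ , p , p′ , c≢c′ = two-members {S = S v} h
              c∈ , u∈                = ∧-true {F c} p
              c′∈ , u′∈              = ∧-true {F c′} p′
              δ≢0                    = ⊝-nonzero c≢c′
          in subst (_∈ U) (trans (cong ((c ⊝ c′) ⁻¹ ⊙_) (e₁ v c c′ e)) (⁻¹⊙-cancel δ≢0 e))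
               (U.⊙-cl (F.⁻¹-cl δ≢0 (F.⊕-cl c∈ (F.⊖-cl c′∈))) (U.⊖-cl (U.⊕-cl u∈ (U.⊖-cl u′∈))))
        once : ∀ v → card (S v) ≡ 𝟙 (extend U e v)
        once v with extend U e v in eq
        ... | true  =
          let c , p = some-elim {S = S v} eq
          in ≤-antisym (≮⇒≥ (λ h → e∉ (clash v h))) (card-positive {S = S v} p)
        ... | false = n<1⇒n≡0 (≰⇒> λ h →
          let c , p = card-∃ {S = S v} h
          in contradiction (trans (sym eq) (some-intro (S v) c p)) λ ())

    everything : ∀ S → (¬ ∃ λ e → ¬ (e ∈ S)) → card S ≡ q
    everything S none = trans (∑-cong (λ v → 𝟙-true (stable (S v) (λ ∉ → none (v , ∉)))))
      (trans (∑-const q 1) (*-identityʳ q))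

    record Concentration (A : FinSet q) (K : ℕ) : Set where
      field
        F       : FinSet q
        F-field : Subfield F
        F-size  : card F * (card F * card F) ≡ q
        e       : Fin q
        e∉F     : ¬ (e ∈ F)
        y       : Fin q
        y≢0     : y ≢ 0F
        b       : Fin q
        b∈A     : b ∈ A
        many    : card A < 4 * (8 * (K * K * (K * K))) *
                    card (λ a → A a ∧ Extend.extend F F-field F e (y ⊙ (a ⊝ b)))

    private
      square-< : ∀ {a b} → a * a < b * b → a < b
      square-< h = ≰⇒> λ b≤a → <⇒≱ h (*-mono-≤ b≤a b≤a)

      opaque
        -- 8K⁴ is the constant c of `smooth`, and `concentrate` loses 4c = 32K⁴ ≤ (32K)⁴.
        5K⁴ : ∀ K {κ} → κ ≡ 32 * K → 0 < K → 4 * (8 * (K * K * (K * K))) ≤ κ ^ 4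
        5K⁴ K {κ} κ≡ 0<K = begin
          4 * (8 * (K * K * (K * K)))          ≤⟨ m≤m*n _ (32 * 32 * 32) ⟩
          4 * (8 * (K * K * (K * K))) * (32 * 32 * 32) ≡⟨ e 4 8 32 K ⟩
          4 * 8 * K * (32 * K) * (32 * K * (32 * K))   ≡⟨ cong (λ k → k * k * (k * k)) κ≡ ⟨
          κ * κ * (κ * κ)                      ≡⟨ e′ κ ⟩
          κ ^ 4                                ∎
          where
          open ≤-Reasoning
          e : ∀ a b c k → a * (b * (k * k * (k * k))) * (c * c * c) ≡ a * b * k * (c * k) * (c * k * (c * k))
          e = solve-∀
          e′ : ∀ k → k * k * (k * k) ≡ k * (k * (k * (k * 1)))
          e′ = solve-∀

    module _ (A X : FinSet q) (n K κ : ℕ) (κ≡ : κ ≡ 32 * K) (0<K : 0 < K) (|A|≡n : card A ≡ n)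
             (0∉X : ∀ {ξ} → ξ ∈ X → ξ ≢ 0F)
             (X-large : κ ^ 1504 ≤ card X)
             (X-large′ : q * κ ^ 16 < card X * card X * (card X * card X))
             (X-small : card X * card X < q)
             (A-large : q * κ ^ 170 < n * n)
             (A-small : n * n * n < 8 * (q * q))
             (energies : ∀ {ξ} → ξ ∈ X → n * n * n ≤ K * energy A (dil ξ A))
             (out : Outcome A X K)
             where

      open Outcome out
      open Extend F F-field

      private
        c f x : ℕ
        c = 8 * (K * K * (K * K))
        f = card F
        x = card X′

        0<κ : 0 < κ
        0<κ = subst (0 <_) (sym κ≡) (*-mono-≤ {1} {32} (s≤s z≤n) 0<K)

        instance
          κ≢0 : NonZero κ
          κ≢0 = >-nonZero 0<κ

        power≤q : ∀ {e} → e ≤ 3008 → κ ^ e ≤ q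
        power≤q {e} e≤ = begin
          κ ^ e                   ≤⟨ ^-monoʳ-≤ κ e≤ ⟩
          κ ^ (1504 + 1504)       ≡⟨ ^-distribˡ-+-* κ 1504 1504 ⟩
          κ ^ 1504 * κ ^ 1504     ≤⟨ *-mono-≤ X-large X-large ⟩
          card X * card X         <⟨ X-small ⟩
          q                       ∎
          where open ≤-Reasoning

        0<q : 0 < q
        0<q = ≤-trans (m^n>0 κ 0) (power≤q z≤n)

        0<c : 0 < c
        0<c = *-mono-≤ {1} {8} (s≤s z≤n) (*-mono-≤ (*-mono-≤ 0<K 0<K) (*-mono-≤ 0<K 0<K))

        4c≤κ⁴ : 4 * c ≤ κ ^ 4
        4c≤κ⁴ = 5K⁴ K κ≡ 0<K

        q<x⁴ : q < x * x * (x * x)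
        q<x⁴ = ≤-<-trans (m≤m*n q (64 * (K * K * (K * K) * (K * K * (K * K)))) {{>-nonZero (*-mono-≤ {1} {64} (s≤s z≤n)
                 (*-mono-≤ 0<K⁴ 0<K⁴))}}) X′-size
          where
          0<K⁴ : 0 < K * K * (K * K)
          0<K⁴ = *-mono-≤ (*-mono-≤ 0<K 0<K) (*-mono-≤ 0<K 0<K)

        fourth : κ ^ 4 * κ ^ 4 * (κ ^ 4 * κ ^ 4) ≡ κ ^ 16
        fourth = trans (cong₂ _*_ (sym (^-distribˡ-+-* κ 4 4)) (sym (^-distribˡ-+-* κ 4 4))) (sym (^-distribˡ-+-* κ 8 8))

        κ⁴≤x : κ ^ 4 ≤ x
        κ⁴≤x = ≮⇒≥ λ x<κ⁴ → <⇒≱ q<x⁴ (begin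
          x * x * (x * x)                              ≤⟨ *-mono-≤ (*-mono-≤ (<⇒≤ x<κ⁴) (<⇒≤ x<κ⁴)) (*-mono-≤ (<⇒≤ x<κ⁴) (<⇒≤ x<κ⁴)) ⟩
          κ ^ 4 * κ ^ 4 * (κ ^ 4 * κ ^ 4)              ≡⟨ fourth ⟩
          κ ^ 16                                       ≤⟨ power≤q (≤ᵇ⇒≤ 16 3008 _) ⟩
          q                                            ∎)
          where open ≤-Reasoning

        κ⁴≤n : κ ^ 4 ≤ n
        κ⁴≤n = ≮⇒≥ λ n<κ⁴ → <⇒≱ A-large (begin
          n * n                    ≤⟨ *-mono-≤ (<⇒≤ n<κ⁴) (<⇒≤ n<κ⁴) ⟩
          κ ^ 4 * κ ^ 4            ≡⟨ ^-distribˡ-+-* κ 4 4 ⟨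
          κ ^ 8                    ≤⟨ power≤q (≤ᵇ⇒≤ 8 3008 _) ⟩
          q                        ≤⟨ m≤m*n q (κ ^ 170) {{m^n≢0 κ 170}} ⟩
          q * κ ^ 170              ∎)
          where open ≤-Reasoning

        0<n : 0 < n
        0<n = ≤-trans (m^n>0 κ 4) κ⁴≤n

        -- Otherwise q ≤ κ⁴n, and cubing with n³ < 8q² would give q < κ¹³.
        4cn<q : 4 * c * n < q
        4cn<q = ≰⇒> λ q≤ → <⇒≱ (below q≤) (power≤q (≤ᵇ⇒≤ 13 3008 _))
          where
          open ≤-Reasoning
          e₁ : ∀ k n → k * n * (k * n) * (k * n) ≡ k * k * k * (n * n * n)
          e₁ = solve-∀
          e₂ : ∀ k q → k * (8 * (q * q)) ≡ 8 * k * (q * q)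
          e₂ = solve-∀
          8≤κ : 8 ≤ κ
          8≤κ = ≤-trans (≤ᵇ⇒≤ 8 32 _) (subst (32 ≤_) (sym κ≡) (m≤m*n 32 K {{>-nonZero 0<K}}))
          below : q ≤ 4 * c * n → q < κ ^ 13
          below q≤ = *-cancelʳ-< (q * q) q (κ ^ 13) (begin-strict
            q * (q * q)                             ≡⟨ *-comm q (q * q) ⟩
            q * q * q                               ≤⟨ *-mono-≤ (*-mono-≤ q≤′ q≤′) q≤′ ⟩
            κ ^ 4 * n * (κ ^ 4 * n) * (κ ^ 4 * n)   ≡⟨ e₁ (κ ^ 4) n ⟩
            κ ^ 4 * κ ^ 4 * κ ^ 4 * (n * n * n)     <⟨ *-monoʳ-< (κ ^ 4 * κ ^ 4 * κ ^ 4) {{k≢0}} A-small ⟩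
            κ ^ 4 * κ ^ 4 * κ ^ 4 * (8 * (q * q))   ≡⟨ e₂ (κ ^ 4 * κ ^ 4 * κ ^ 4) q ⟩
            8 * (κ ^ 4 * κ ^ 4 * κ ^ 4) * (q * q)   ≤⟨ *-monoˡ-≤ (q * q) (*-mono-≤ 8≤κ (≤-reflexive (trans (cong (_* κ ^ 4) (sym (^-distribˡ-+-* κ 4 4))) (sym (^-distribˡ-+-* κ 8 4))))) ⟩
            κ ^ 13 * (q * q)                        ∎)
            where
            q≤′ : q ≤ κ ^ 4 * n
            q≤′ = ≤-trans q≤ (*-monoˡ-≤ n 4c≤κ⁴)
            k≢0 : NonZero (κ ^ 4 * κ ^ 4 * κ ^ 4)
            k≢0 = >-nonZero (*-mono-≤ (*-mono-≤ (m^n>0 κ 4) (m^n>0 κ 4)) (m^n>0 κ 4))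

        4c≤f : 4 * c ≤ f
        4c≤f = ≤-trans 4c≤κ⁴ (≤-trans κ⁴≤x F-large)

        4≤4c : 4 ≤ 4 * c
        4≤4c = *-monoʳ-≤ 4 0<c

        1<f : 1 < f
        1<f = ≤-trans (≤ᵇ⇒≤ 2 4 _) (≤-trans 4≤4c 4c≤f)

        e₁ : Fin q
        e₁ = proj₁ proper

        e₁∉F : ¬ (e₁ ∈ F)
        e₁∉F = proj₂ proper

        W : FinSet q
        W = extend F e₁

        |W| : card W ≡ f * f
        |W| = card-extend e₁ itself e₁∉F

        -- F is proper, so F + Fe₁ with its f² elements fits into the field.
        ff≤q : f * f ≤ q
        ff≤q = subst (_≤ q) |W| (card≤n W)

        rich : f * (card A * card A * card A) ≤ c * ∑ (λ z → 𝟙 (F z) * solutions A z)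
        rich = smooth A X′ F K F-field F-large aligned (subst (0 <_) (sym |A|≡n) 0<n)
          (≤-trans (≤ᵇ⇒≤ 2 4 _) (≤-trans 4≤4c (≤-trans 4c≤κ⁴ κ⁴≤x)))
          (≤-trans 2K²≤4c (≤-trans 4c≤κ⁴ κ⁴≤x))
          -- 8K⁴f ≤ x² by comparing squares: 64K⁸f² ≤ 64K⁸q < x⁴.
          (<⇒≤ (square-< (begin-strict
            c * f * (c * f)                     ≡⟨ r₁ 8 (K * K * (K * K)) f ⟩
            f * f * (64 * (K * K * (K * K) * (K * K * (K * K))))  ≤⟨ *-monoˡ-≤ _ ff≤q ⟩
            q * (64 * (K * K * (K * K) * (K * K * (K * K))))      <⟨ X′-size ⟩
            x * x * (x * x)                     ∎)))
          λ {ξ} ξ∈ → subst (λ m → m * m * m ≤ K * solutions A ξ) (sym |A|≡n)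
            (≤-trans (energies (X′⊆X ξ ξ∈)) (≤-reflexive (cong (K *_)
              (trans (energy-dil (0∉X (X′⊆X ξ ξ∈)) A) (solutions-⁻¹ (0∉X (X′⊆X ξ ξ∈)) A)))))
          where
          open ≤-Reasoning
          r₁ : ∀ a k f → a * k * f * (a * k * f) ≡ f * f * (a * a * (k * k))
          r₁ = solve-∀
          K²≤K⁴ : K * K ≤ K * K * (K * K)
          K²≤K⁴ = m≤m*n (K * K) (K * K) {{>-nonZero (*-mono-≤ 0<K 0<K)}}
          2K²≤4c : 2 * (K * K) ≤ 4 * c
          2K²≤4c = ≤-trans (*-mono-≤ (≤ᵇ⇒≤ 2 8 _) K²≤K⁴) (m≤n*m c 4)

        h : ℕ
        h = pred f

        f≡ : f ≡ suc h
        f≡ = sym (suc-pred f {{>-nonZero (<-trans (s≤s z≤n) 1<f)}})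

        -- V has codimension 1 over F. This will be F itself under the assumption q = f², and F +
        -- Fe₁ when q = f³.
        conc : ∀ V g′ → card V ≡ f * g′ → q ≡ f * (f * g′) → Subspace F V →
               ∃₂ λ y b → y ≢ 0F × b ∈ A × card A < 4 * c * card (λ a → A a ∧ V (y ⊙ (a ⊝ b)))
        conc V g′ |V| q≡ V-space = concentrate A F V h g′ c f≡ (s≤s⁻¹ (subst (1 <_) f≡ 1<f))
          (subst (λ f → card V ≡ f * g′) f≡ |V|) (subst (λ f → q ≡ f * (f * g′)) f≡ q≡) V-space
          (subst (0 <_) (sym |A|≡n) 0<n) 0<c (subst (4 * c ≤_) f≡ 4c≤f)
          (subst (λ m → 4 * c * m < q) (sym |A|≡n) 4cn<q)
          (subst (4 * c ≤_) (sym |A|≡n) (≤-trans 4c≤κ⁴ κ⁴≤n))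
          (subst (λ f → f * (card A * card A * card A) ≤ c * ∑ (λ z → 𝟙 (F z) * solutions A z)) f≡ rich)

        -- If q = f², then A would be concentrated on a line of only q^(1/2) elements.
        not-square : ¬ (f * f ≡ q)
        not-square ff≡q =
          let y , b , y≢0 , b∈ , lt = conc F 1 (sym (*-identityʳ f)) (trans (sym ff≡q) (cong (f *_) (sym (*-identityʳ f)))) itself
              n<4cf = <-≤-trans (subst (_< 4 * c * card (λ a → A a ∧ F (y ⊙ (a ⊝ b)))) |A|≡n lt) (*-monoʳ-≤ (4 * c) (line y b y≢0))
          in <⇒≱ A-large (begin
            n * n                              ≤⟨ *-mono-≤ (<⇒≤ n<4cf) (<⇒≤ n<4cf) ⟩
            4 * c * f * (4 * c * f)            ≡⟨ r (4 * c) f ⟩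
            f * f * (4 * c * (4 * c))          ≤⟨ *-mono-≤ ff≤q (*-mono-≤ 4c≤κ⁴ 4c≤κ⁴) ⟩
            q * (κ ^ 4 * κ ^ 4)                ≡⟨ cong (q *_) (^-distribˡ-+-* κ 4 4) ⟨
            q * κ ^ 8                          ≤⟨ *-monoʳ-≤ q (^-monoʳ-≤ κ (≤ᵇ⇒≤ 8 170 _)) ⟩
            q * κ ^ 170                        ∎)
          where
          open ≤-Reasoning
          r : ∀ c f → c * f * (c * f) ≡ f * f * (c * c)
          r = solve-∀
          line : ∀ y b → y ≢ 0F → card (λ a → A a ∧ F (y ⊙ (a ⊝ b))) ≤ f
          line y b y≢0 = begin
            card (λ a → A a ∧ F (y ⊙ (a ⊝ b)))     ≤⟨ card-mono {S = λ a → A a ∧ F (y ⊙ (a ⊝ b))} {λ a → F (y ⊙ (a ⊝ b))} (λ a p → proj₂ (∧-true {A a} p)) ⟩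
            card (λ a → F (y ⊙ (a ⊝ b)))           ≡⟨ ∑-untranslate b (λ a → 𝟙 (F (y ⊙ a))) ⟩
            card (λ a → F (y ⊙ a))                 ≡⟨ ∑-dilate y≢0 (λ a → 𝟙 (F a)) ⟩
            f                                      ∎

        -- Adjoining an element outside multiplies the cardinality by f. The field is not exhausted
        -- at f², by `not-square`, and a space with f⁴ ≥ x⁴ > q elements does not fit.
        cube : f * (f * f) ≡ q
        cube = second-step (Fin.any? λ e → ¬? (W e Bool.≟ true))
          where
          third-step : ∀ e₂ → ¬ (e₂ ∈ W) → Dec (∃ λ e → ¬ (e ∈ extend W e₂)) → f * (f * f) ≡ q
          third-step e₂ e₂∉ (no none) = trans (sym |W₃|) (everything (extend W e₂) none)
            where
            |W₃| : card (extend W e₂) ≡ f * (f * f)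
            |W₃| = trans (card-extend e₂ (extend-space e₁ itself) e₂∉) (cong (f *_) |W|)
          third-step e₂ e₂∉ (yes (e₃ , e₃∉)) = contradiction (≤-trans (≤-reflexive (sym |W₄|)) (card≤n (extend (extend W e₂) e₃)))
            (<⇒≱ (<-≤-trans q<x⁴ (≤-trans (*-mono-≤ (*-mono-≤ F-large F-large) (*-mono-≤ F-large F-large)) (≤-reflexive (r f)))))
            where
            r : ∀ f → f * f * (f * f) ≡ f * (f * (f * f))
            r = solve-∀
            |W₄| : card (extend (extend W e₂) e₃) ≡ f * (f * (f * f))
            |W₄| = trans (card-extend e₃ (extend-space e₂ (extend-space e₁ itself)) e₃∉)
                     (cong (f *_) (trans (card-extend e₂ (extend-space e₁ itself) e₂∉) (cong (f *_) |W|)))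
          second-step : Dec (∃ λ e → ¬ (e ∈ W)) → f * (f * f) ≡ q
          second-step (no none)        = contradiction (trans (sym |W|) (everything W none)) not-square
          second-step (yes (e₂ , e₂∉)) = third-step e₂ e₂∉ (Fin.any? λ e → ¬? (extend W e₂ e Bool.≟ true))

      concentration : Concentration A K
      concentration =
        let y , b , y≢0 , b∈ , lt = conc W f |W| (sym cube) (extend-space e₁ itself)
        in record { F = F ; F-field = F-field ; F-size = cube ; e = e₁ ; e∉F = e₁∉F
                  ; y = y ; y≢0 = y≢0 ; b = b ; b∈A = b∈ ; many = lt }

  open import Data.Fin.Subset as Sub using (Subset; ∣_∣)
  import Data.Fin.Subset.Properties as Sub
  open import Data.List.Base as List using (List; []; _∷_; _++_; length; filter; map; cartesianProduct; allFin)
  open import Data.List.Membership.Propositional using () renaming (_∈_ to _∈ᴸ_)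
  open import Data.List.Membership.Propositional.Properties using (∈-map⁺; ∈-filter⁺; ∈-allFin)
  open import Data.List.Relation.Unary.Any using (here; there)
  open import Data.Vec.Base using (lookup; tabulate; []; _∷_)
  open import Data.Vec.Properties using ([]=⇒lookup; lookup⇒[]=; lookup∘tabulate)
  open import Defs using (FiniteField; module Subsets)
  open import Function.Bundles using (Inverse)
  open import Relation.Nullary.Decidable using (dec-true; dec-false)

  -- Counting in lists and in subsets.

  module Lists where

    total : ∀ {X : Set} → List X → (X → ℕ) → ℕ
    total []       g = 0
    total (x ∷ xs) g = g x + total xs g

    total-cong : ∀ {X : Set} (xs : List X) {g h : X → ℕ} → (∀ x → g x ≡ h x) → total xs g ≡ total xs h
    total-cong []       eq = refl
    total-cong (x ∷ xs) eq = cong₂ _+_ (eq x) (total-cong xs eq)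

    total-++ : ∀ {X : Set} (xs ys : List X) g → total (xs ++ ys) g ≡ total xs g + total ys g
    total-++ []       ys g = refl
    total-++ (x ∷ xs) ys g = trans (cong (g x +_) (total-++ xs ys g)) (sym (+-assoc (g x) _ _))

    total-map : ∀ {X Y : Set} (f : X → Y) xs g → total (map f xs) g ≡ total xs (λ x → g (f x))
    total-map f []       g = refl
    total-map f (x ∷ xs) g = cong (g (f x) +_) (total-map f xs g)

    total-× : ∀ {X Y : Set} (xs : List X) (ys : List Y) (g : X × Y → ℕ) →
              total (cartesianProduct xs ys) g ≡ total xs (λ x → total ys (λ y → g (x , y)))
    total-× []       ys g = refl
    total-× (x ∷ xs) ys g = trans (total-++ (map (x ,_) ys) (cartesianProduct xs ys) g)
      (cong₂ _+_ (total-map (x ,_) ys g) (total-× xs ys g))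

    total-filter : ∀ {X : Set} {P : X → Set} (P? : ∀ x → Dec (P x)) xs g →
                   total (filter P? xs) g ≡ total xs (λ x → 𝟙 (does (P? x)) * g x)
    total-filter P? []       g = refl
    total-filter P? (x ∷ xs) g with does (P? x)
    ... | true  = cong₂ _+_ (sym (+-identityʳ (g x))) (total-filter P? xs g)
    ... | false = total-filter P? xs g

    length≡total : ∀ {X : Set} (xs : List X) → length xs ≡ total xs (λ _ → 1)
    length≡total []       = refl
    length≡total (x ∷ xs) = cong suc (length≡total xs)

    total-allFin : ∀ n (g : Fin n → ℕ) → total (allFin n) g ≡ ∑ g
    total-allFin n = go id
      where
      go : ∀ {m} {X : Set} (f : Fin m → X) (g : X → ℕ) → total (List.tabulate f) g ≡ ∑ (λ i → g (f i))
      go {zero}  f g = sym (∑-nil (λ i → g (f i)))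
      go {suc m} f g = trans (cong (g (f zero) +_) (go (f ∘ suc) g)) (sym (∑-suc (λ i → g (f i))))

    ∣∣≡card : ∀ {n} (S : Subset n) → ∣ S ∣ ≡ card (lookup S)
    ∣∣≡card []          = sym (∑-nil _)
    ∣∣≡card (true  ∷ S) = trans (cong suc (∣∣≡card S)) (sym (∑-suc (λ x → 𝟙 (lookup (true ∷ S) x))))
    ∣∣≡card (false ∷ S) = trans (∣∣≡card S) (sym (∑-suc (λ x → 𝟙 (lookup (false ∷ S) x))))

    ∈⋃ : ∀ {n x} {S : Subset n} (Ss : List (Subset n)) → S ∈ᴸ Ss → x Sub.∈ S → x Sub.∈ Sub.⋃ Ss
    ∈⋃ (S ∷ Ss) (here refl) x∈S = Sub.p⊆p∪q (Sub.⋃ Ss) x∈S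
    ∈⋃ (S ∷ Ss) (there S∈)  x∈S = Sub.q⊆p∪q S (Sub.⋃ Ss) (∈⋃ Ss S∈ x∈S)

  -- Transport between the given field and `Fin q`.

  module Transport {q : ℕ} (𝔽 : FiniteField q) where

    open Subsets 𝔽 using (IsSubfield; HasDimension; ExcludesZero; elements) renaming (_∈_ to _∈ᶠ_; _⊖_ to _⊖ˢ_; energy to energyˢ)
    open Lists

    private
      module 𝕂 = FiniteField 𝔽
      open 𝕂 using (Carrier; to; from; from-to; to-cong) renaming (_≈_ to _≈ᶠ_)

      to-from : ∀ x → to (from x) ≡ x
      to-from = Inverse.strictlyInverseˡ 𝕂.enumeration

      raw : RawRing 0ℓ 0ℓ
      raw = record
        { Carrier = Fin q
        ; _≈_     = _≡_
        ; _+_     = λ x y → to (from x 𝕂.+ from y)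
        ; _*_     = λ x y → to (from x 𝕂.· from y)
        ; -_      = λ x → to (𝕂.- from x)
        ; 0#      = to 𝕂.0#
        ; 1#      = to 𝕂.1#
        }

      open RingMorphisms raw (CommutativeRing.rawRing 𝕂.commutativeRing)

      -- The operations on `Fin q` are conjugated by the enumeration, so the ring laws carry over
      -- along `from`, now for propositional equality.
      monomorphism : IsRingMonomorphism from
      monomorphism = record
        { isRingHomomorphism = record
          { isSemiringHomomorphism = record
            { isNearSemiringHomomorphism = record
              { +-isMonoidHomomorphism = record
                { isMagmaHomomorphism = record
                  { isRelHomomorphism = record { cong = λ { refl → 𝕂.refl } }
                  ; homo = λ x y → from-to _
                  }
                ; ε-homo = from-to _
                }
              ; *-homo = λ x y → from-to _
              }
            ; 1#-homo = from-to _
            }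
          ; -‿homo = λ x → from-to _
          }
        ; injective = λ {x} {y} eq → trans (sym (to-from x)) (trans (to-cong eq) (to-from y))
        }

      -- Inverses are given only for nonzero elements; 0 is sent to itself by convention.
      reciprocal : ∀ x → Dec (x ≡ to 𝕂.0#) → Fin q
      reciprocal x (yes _)  = x
      reciprocal x (no x≢0) = to (proj₁ (𝕂.inverse (from x) (λ eq → x≢0 (trans (sym (to-from x)) (to-cong eq)))))

      reciprocal-inverse : ∀ x d → x ≢ to 𝕂.0# → to (from x 𝕂.· from (reciprocal x d)) ≡ to 𝕂.1#
      reciprocal-inverse x (yes x≡0) x≢0 = contradiction x≡0 x≢0
      reciprocal-inverse x (no x≢0)  _   = to-cong (𝕂.≈-trans (𝕂.*-cong 𝕂.refl (from-to _)) (proj₂ (𝕂.inverse (from x) _)))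

    fieldOn : FieldOn q
    fieldOn = record
      { isCommutativeRing = Algebra.Morphism.RingMonomorphism.isCommutativeRing monomorphism
                              (CommutativeRing.isCommutativeRing 𝕂.commutativeRing)
      ; _⁻¹ = λ x → reciprocal x (x Fin.≟ to 𝕂.0#)
      ; 0≢1 = λ eq → 𝕂.0≉1 (𝕂.≈-trans (𝕂.≈-sym (from-to _)) (𝕂.≈-trans (𝕂.reflexive (cong from eq)) (from-to _)))
      ; *-inverseʳ = λ {x} → reciprocal-inverse x (x Fin.≟ to 𝕂.0#)
      }

    open FieldOn fieldOn
    open Additive fieldOn
    open Refining fieldOn
    open Extraction fieldOn
    open Calculus fieldOn
    open Quotients fieldOn
    open Energies fieldOn
    open Structure fieldOn
    open Hyperplanes fieldOn
    open Planes fieldOn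

    private
      to-+ : ∀ x y → to (x 𝕂.+ y) ≡ to x ⊕ to y
      to-+ x y = to-cong (𝕂.+-cong (𝕂.≈-sym (from-to x)) (𝕂.≈-sym (from-to y)))

      to-· : ∀ x y → to (x 𝕂.· y) ≡ to x ⊙ to y
      to-· x y = to-cong (𝕂.*-cong (𝕂.≈-sym (from-to x)) (𝕂.≈-sym (from-to y)))

      to-neg : ∀ x → to (𝕂.- x) ≡ ⊖ to x
      to-neg x = to-cong (𝕂.-‿cong (𝕂.≈-sym (from-to x)))

      to-minus : ∀ x y → to (x 𝕂.- y) ≡ to x ⊝ to y
      to-minus x y = trans (to-+ x (𝕂.- y)) (cong (to x ⊕_) (to-neg y))

      to-injective : ∀ {x y} → to x ≡ to y → x ≈ᶠ y
      to-injective {x} {y} eq = 𝕂.≈-trans (𝕂.≈-sym (from-to x)) (𝕂.≈-trans (𝕂.reflexive (cong from eq)) (from-to y))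

      infix 4 _∈ˢ_

      _∈ˢ_ : Fin q → Subset q → Set
      x ∈ˢ S = x ∈ lookup S

      ∈⇒ : ∀ {S x} → x Sub.∈ S → x ∈ˢ S
      ∈⇒ = []=⇒lookup

      ∈⇐ : ∀ {S x} → x ∈ˢ S → x Sub.∈ S
      ∈⇐ {S} {x} = lookup⇒[]= x S

      ∈-tab : ∀ {S : FinSet q} {x} → x ∈ S → x Sub.∈ tabulate S
      ∈-tab {S} {x} x∈ = ∈⇐ (trans (lookup∘tabulate S x) x∈)

      ∈-untab : ∀ {S : FinSet q} {x} → x Sub.∈ tabulate S → x ∈ S
      ∈-untab {S} {x} x∈ = trans (sym (lookup∘tabulate S x)) (∈⇒ x∈)

      ∣tabulate∣ : ∀ (S : FinSet q) → ∣ tabulate S ∣ ≡ card S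
      ∣tabulate∣ S = trans (∣∣≡card (tabulate S)) (∑-cong (λ x → cong 𝟙 (lookup∘tabulate S x)))

      total-elements : ∀ S (g : Carrier → ℕ) → total (elements S) g ≡ ∑ (λ x → 𝟙 (lookup S x) * g (from x))
      total-elements S g = trans (total-map from (filter (Sub._∈? S) (allFin q)) g)
        (trans (total-filter (Sub._∈? S) (allFin q) (λ x → g (from x)))
          (trans (total-allFin q (λ x → 𝟙 (does (x Sub.∈? S)) * g (from x)))
            (∑-cong (λ x → cong (λ b → 𝟙 b * g (from x)) (member x)))))
        where
        member : ∀ x → does (x Sub.∈? S) ≡ lookup S x
        member x with lookup S x in eq
        ... | true  = dec-true (x Sub.∈? S) (∈⇐ {S} eq)
        ... | false = dec-false (x Sub.∈? S) (λ x∈ → contradiction (trans (sym eq) (∈⇒ x∈)) λ ())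

      count-quadruples : ∀ {P : Carrier × Carrier × Carrier × Carrier → Set} (P? : ∀ t → Dec (P t)) (as : List Carrier) →
        length (filter P? (cartesianProduct as (cartesianProduct as (cartesianProduct as as)))) ≡
        total as (λ a₁ → total as λ a₂ → total as λ a₃ → total as λ a₄ → 𝟙 (does (P? (a₁ , a₂ , a₃ , a₄))) * 1)
      count-quadruples P? as = trans (length≡total (filter P? quads)) (trans (total-filter P? quads (λ _ → 1))
        (trans (total-× as _ g) (total-cong as λ a₁ → trans (total-× as _ (λ t → g (a₁ , t)))
          (total-cong as λ a₂ → total-× as as (λ t → g (a₁ , a₂ , t))))))
        where
        quads = cartesianProduct as (cartesianProduct as (cartesianProduct as as))
        g = λ t → 𝟙 (does (P? t)) * 1

    -- With d = a₃ - a₄ the equation reads a₁ = a₂ + ξd. Hence a₁ is determined by a₂ and d, and the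
    -- fourfold count collapses to the sum of corr(d) corr(ξd).
    energy-transport : ∀ A ξ → to ξ ≢ 0F → energyˢ A ξ ≡ energy (lookup A) (dil (to ξ) (lookup A))
    energy-transport A ξ ξ≢0 = begin
      energyˢ A ξ
        ≡⟨ count-quadruples _ (elements A) ⟩
      total as (λ a₁ → total as λ a₂ → total as λ a₃ → total as λ a₄ → G a₁ a₂ a₃ a₄)
        ≡⟨ elems (λ a₁ → total as λ a₂ → total as λ a₃ → total as λ a₄ → G a₁ a₂ a₃ a₄) ⟩
      ∑ (λ x₁ → 𝟙 (S x₁) * total as (λ a₂ → total as λ a₃ → total as λ a₄ → G (from x₁) a₂ a₃ a₄))
        ≡⟨ ∑-cong (λ x₁ → cong (𝟙 (S x₁) *_) (trans (elems (λ a₂ → total as λ a₃ → total as λ a₄ → G (from x₁) a₂ a₃ a₄))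
             (∑-cong λ x₂ → cong (𝟙 (S x₂) *_) (trans (elems (λ a₃ → total as λ a₄ → G (from x₁) (from x₂) a₃ a₄))
               (∑-cong λ x₃ → cong (𝟙 (S x₃) *_) (trans (elems (λ a₄ → G (from x₁) (from x₂) (from x₃) a₄))
                 (∑-cong λ x₄ → cong (𝟙 (S x₄) *_) (equation x₁ x₂ x₃ x₄)))))))) ⟩
      ∑ (λ x₁ → 𝟙 (S x₁) * ∑ λ x₂ → 𝟙 (S x₂) * ∑ λ x₃ → 𝟙 (S x₃) * ∑ λ x₄ → 𝟙 (S x₄) * E x₁ x₂ x₃ x₄)
        ≡⟨ ∑-cong (λ x₁ → cong (𝟙 (S x₁) *_) (∑-cong λ x₂ → cong (𝟙 (S x₂) *_) (∑-cong λ x₃ → sym (∑-*ˡ (𝟙 (S x₃)) (λ x₄ → 𝟙 (S x₄) * E x₁ x₂ x₃ x₄))))) ⟩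
      ∑ (λ x₁ → 𝟙 (S x₁) * ∑ λ x₂ → 𝟙 (S x₂) * ∑ λ x₃ → ∑ λ x₄ → 𝟙 (S x₃) * (𝟙 (S x₄) * E x₁ x₂ x₃ x₄))
        ≡⟨ ∑-cong (λ x₁ → cong (𝟙 (S x₁) *_) (∑-cong λ x₂ → cong (𝟙 (S x₂) *_) (∑-pairs S (λ d → 𝟙 ⌊ x₁ Fin.≟ x₂ ⊕ to ξ ⊙ d ⌋)))) ⟩
      ∑ (λ x₁ → 𝟙 (S x₁) * ∑ λ x₂ → 𝟙 (S x₂) * ∑ λ d → corr S d * 𝟙 ⌊ x₁ Fin.≟ x₂ ⊕ to ξ ⊙ d ⌋)
        ≡⟨ ∑-cong (λ x₁ → trans (sym (∑-*ˡ (𝟙 (S x₁)) (λ x₂ → 𝟙 (S x₂) * ∑ λ d → corr S d * δ x₁ x₂ d)))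
             (∑-cong λ x₂ → trans (cong (𝟙 (S x₁) *_) (sym (∑-*ˡ (𝟙 (S x₂)) (λ d → corr S d * δ x₁ x₂ d)))) (trans (sym (∑-*ˡ (𝟙 (S x₁)) (λ d → 𝟙 (S x₂) * (corr S d * δ x₁ x₂ d)))) (∑-cong λ d → e₁ (𝟙 (S x₁)) (𝟙 (S x₂)) (corr S d) (δ x₁ x₂ d))))) ⟩
      ∑ (λ x₁ → ∑ λ x₂ → ∑ λ d → H x₁ x₂ d)      ≡⟨ ∑-swap (λ x₁ x₂ → ∑ λ d → H x₁ x₂ d) ⟩
      ∑ (λ x₂ → ∑ λ x₁ → ∑ λ d → H x₁ x₂ d)      ≡⟨ ∑-cong (λ x₂ → ∑-swap (λ x₁ d → H x₁ x₂ d)) ⟩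
      ∑ (λ x₂ → ∑ λ d → ∑ λ x₁ → H x₁ x₂ d)      ≡⟨ ∑-swap (λ x₂ d → ∑ λ x₁ → H x₁ x₂ d) ⟩
      ∑ (λ d → ∑ λ x₂ → ∑ λ x₁ → H x₁ x₂ d)      ≡⟨ ∑-cong (λ d → trans (∑-cong (λ x₂ → collapse x₂ d)) (∑-*ˡ (corr S d) (λ x₂ → 𝟙 (S x₂) * 𝟙 (S (x₂ ⊕ to ξ ⊙ d))))) ⟩
      solutions S (to ξ)                         ≡⟨ solutions-⁻¹ ξ≢0 S ⟨
      solutions S ((to ξ) ⁻¹)                    ≡⟨ energy-dil ξ≢0 S ⟨
      energy S (dil (to ξ) S)                    ∎
      where
      open ≡-Reasoning
      S : FinSet q
      S = lookup A
      as : List Carrier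
      as = elements A
      G : Carrier → Carrier → Carrier → Carrier → ℕ
      G a₁ a₂ a₃ a₄ = 𝟙 (does (to (a₁ 𝕂.- a₂) Fin.≟ to (ξ 𝕂.· (a₃ 𝕂.- a₄)))) * 1
      δ : Fin q → Fin q → Fin q → ℕ
      δ x₁ x₂ d = 𝟙 ⌊ x₁ Fin.≟ x₂ ⊕ to ξ ⊙ d ⌋
      E : Fin q → Fin q → Fin q → Fin q → ℕ
      E x₁ x₂ x₃ x₄ = δ x₁ x₂ (x₃ ⊝ x₄)
      H : Fin q → Fin q → Fin q → ℕ
      H x₁ x₂ d = δ x₁ x₂ d * (𝟙 (S x₁) * (corr S d * 𝟙 (S x₂)))
      elems : ∀ g → total as g ≡ ∑ (λ x → 𝟙 (S x) * g (from x))
      elems = total-elements A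
      e₁ : ∀ a b c d → a * (b * (c * d)) ≡ d * (a * (c * b))
      e₁ = solve-∀
      e₂ : ∀ a b c → a * (c * b) ≡ c * (b * a)
      e₂ = solve-∀
      collapse : ∀ x₂ d → ∑ (λ x₁ → H x₁ x₂ d) ≡ corr S d * (𝟙 (S x₂) * 𝟙 (S (x₂ ⊕ to ξ ⊙ d)))
      collapse x₂ d = trans (∑-≟ (x₂ ⊕ to ξ ⊙ d) (λ x₁ → 𝟙 (S x₁) * (corr S d * 𝟙 (S x₂))))
        (e₂ (𝟙 (S (x₂ ⊕ to ξ ⊙ d))) (𝟙 (S x₂)) (corr S d))
      same : ∀ {P Q : Set} (P? : Dec P) (Q? : Dec Q) → (P → Q) → (Q → P) → 𝟙 (does P?) * 1 ≡ 𝟙 ⌊ Q? ⌋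
      same (yes p) (yes q) _ _ = refl
      same (yes p) (no ¬q) f _ = contradiction (f p) ¬q
      same (no ¬p) (yes q) _ g = contradiction (g q) ¬p
      same (no ¬p) (no ¬q) _ _ = refl
      equation : ∀ x₁ x₂ x₃ x₄ → G (from x₁) (from x₂) (from x₃) (from x₄) ≡ E x₁ x₂ x₃ x₄
      equation x₁ x₂ x₃ x₄ = same (to (from x₁ 𝕂.- from x₂) Fin.≟ to (ξ 𝕂.· (from x₃ 𝕂.- from x₄))) (x₁ Fin.≟ x₂ ⊕ to ξ ⊙ (x₃ ⊝ x₄))
        (λ p → trans (sym (⊝⊕-cancel x₁ x₂)) (trans (cong (_⊕ x₂) (trans (sym lhs) (trans p rhs))) (⊕-comm _ x₂)))
        (λ p → trans lhs (trans (trans (cong (_⊝ x₂) p) (e x₂ (to ξ ⊙ (x₃ ⊝ x₄)))) (sym rhs)))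
        where
        e : ∀ x w → x ⊕ w ⊝ x ≡ w
        e = solve 2 (λ x w → x :+ w :- x := w) refl
        lhs : to (from x₁ 𝕂.- from x₂) ≡ x₁ ⊝ x₂
        lhs = trans (to-minus (from x₁) (from x₂)) (cong₂ _⊝_ (to-from x₁) (to-from x₂))
        rhs : to (ξ 𝕂.· (from x₃ 𝕂.- from x₄)) ≡ to ξ ⊙ (x₃ ⊝ x₄)
        rhs = trans (to-· ξ _) (cong (to ξ ⊙_) (trans (to-minus (from x₃) (from x₄)) (cong₂ _⊝_ (to-from x₃) (to-from x₄))))

    -- Together with E(A, ξA) ≥ |A|³ / K this will show that the upper bound used for K is at least
    -- 1.
    energy≤ : ∀ A ξ → to ξ ≢ 0F → energyˢ A ξ ≤ ∣ A ∣ * ∣ A ∣ * ∣ A ∣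
    energy≤ A ξ ξ≢0 = subst₂ (λ e n → e ≤ n * n * n)
      (sym (trans (energy-transport A ξ ξ≢0) (trans (energy-dil ξ≢0 (lookup A)) (solutions-⁻¹ ξ≢0 (lookup A)))))
      (sym (∣∣≡card A)) (Averaging.solutions≤ fieldOn (lookup A) (to ξ))

    nonzero : ∀ {X ξ} → ExcludesZero X → ξ ∈ᶠ X → to ξ ≢ 0F
    nonzero {X} 0∉X ξ∈ eq = 0∉X (subst (Sub._∈ X) eq ξ∈)

    record Plane (A : Subset q) (c : ℕ) : Set where
      field
        F            : Subset q
        isSubfield   : IsSubfield F
        ∣F∣³≡q       : ∣ F ∣ * (∣ F ∣ * ∣ F ∣) ≡ q
        ā            : Carrier
        ā∈A          : ā ∈ᶠ A
        V            : Subset q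
        hasDimension : HasDimension F V 2
        many         : ∣ A ∣ < c * ∣ (A ⊖ˢ ā) Sub.∩ V ∣

    module _ (A : Subset q) (K : ℕ) (conc : Concentration (lookup A) K) where

      open Concentration conc
      open Extend F F-field
      private
        module F = Subfield F-field

        Fˢ Vˢ : Subset q
        Fˢ = tabulate F
        Vˢ = tabulate (λ v → extend F e (y ⊙ v))

        V-space : Subspace F (extend F e)
        V-space = extend-space e itself

        module V = Subspace V-space

        pull : ∀ {S : FinSet q} {x y} → x ≡ y → y ∈ S → x ∈ S
        pull refl y∈ = y∈

      subfieldˢ : IsSubfield Fˢ
      subfieldˢ = record
        { 0∈F = ∈-tab F.0∈
        ; 1∈F = ∈-tab F.1∈
        ; +-closed = λ {x} {y} x∈ y∈ → ∈-tab (pull {F} (to-+ x y) (F.⊕-cl (∈-untab x∈) (∈-untab y∈)))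
        ; neg-closed = λ {x} x∈ → ∈-tab (pull {F} (to-neg x) (F.⊖-cl (∈-untab x∈)))
        ; ·-closed = λ {x} {y} x∈ y∈ → ∈-tab (pull {F} (to-· x y) (F.⊙-cl (∈-untab x∈) (∈-untab y∈)))
        ; inverse-closed = λ {x} {y} x∈ xy≈1 →
            let xy≡1 = trans (sym (to-· x y)) (to-cong xy≈1)
                x≢0  = λ x≡0 → 0≢1 (trans (sym (⊙-zeroˡ (to y))) (trans (cong (_⊙ to y) (sym x≡0)) xy≡1))
            in ∈-tab (pull {F} (⁻¹-unique x≢0 xy≡1) (F.⁻¹-cl x≢0 (∈-untab x∈)))
        }

      private
        -- V is y⁻¹(F + Fe), so its basis is that of F + Fe divided by y.
        basis : Fin 2 → Carrier
        basis zero       = from (y ⁻¹)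
        basis (suc zero) = from (y ⁻¹ ⊙ e)

        e₁ : ∀ y i e c₀ c₁ → y ⊙ (c₀ ⊙ i ⊕ c₁ ⊙ (i ⊙ e)) ≡ y ⊙ (i ⊙ (c₀ ⊕ c₁ ⊙ e))
        e₁ = solve 5 (λ y i e c₀ c₁ → y :* (c₀ :* i :+ c₁ :* (i :* e)) := y :* (i :* (c₀ :+ c₁ :* e))) refl

        open import Algebra.Definitions.RawMonoid 𝕂.+-rawMonoid using (sum)

        -- Multiplication by y leads back to F + Fe, where independence and spanning are read off
        -- the coefficients of 1 and e.
        to-sum : ∀ (c : Fin 2 → Carrier) → y ⊙ to (sum (λ i → c i 𝕂.· basis i)) ≡ to (c zero) ⊕ to (c (suc zero)) ⊙ e
        to-sum c = begin
          y ⊙ to (sum (λ i → c i 𝕂.· basis i))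
            ≡⟨ cong (y ⊙_) (trans (to-+ _ _) (cong₂ _⊕_ (first c) (trans (to-+ _ _) (trans (⊕-identityʳ _) (second c))))) ⟩
          y ⊙ (to (c zero) ⊙ y ⁻¹ ⊕ to (c (suc zero)) ⊙ (y ⁻¹ ⊙ e))     ≡⟨ e₁ y (y ⁻¹) e (to (c zero)) (to (c (suc zero))) ⟩
          y ⊙ (y ⁻¹ ⊙ (to (c zero) ⊕ to (c (suc zero)) ⊙ e))             ≡⟨ ⊙⁻¹-cancel y≢0 _ ⟩
          to (c zero) ⊕ to (c (suc zero)) ⊙ e                            ∎
          where
          open ≡-Reasoning
          first : ∀ c → to (c zero 𝕂.· basis zero) ≡ to (c zero) ⊙ y ⁻¹
          first c = trans (to-· (c zero) (basis zero)) (cong (to (c zero) ⊙_) (to-from (y ⁻¹)))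
          second : ∀ c → to (c (suc zero) 𝕂.· basis (suc zero)) ≡ to (c (suc zero)) ⊙ (y ⁻¹ ⊙ e)
          second c = trans (to-· (c (suc zero)) (basis (suc zero))) (cong (to (c (suc zero)) ⊙_) (to-from (y ⁻¹ ⊙ e)))

        -- e ∉ F makes 1 and e independent.
        coefficients-vanish : ∀ {c₀ c₁} → c₀ ∈ F → c₁ ∈ F → c₀ ⊕ c₁ ⊙ e ≡ 0F → c₀ ≡ 0F × c₁ ≡ 0F
        coefficients-vanish {c₀} {c₁} c₀∈ c₁∈ eq with c₁ Fin.≟ 0F
        ... | yes refl = trans (sym (trans (cong (c₀ ⊕_) (⊙-zeroˡ e)) (⊕-identityʳ c₀))) eq , refl
        ... | no c₁≢0  = contradiction
          (subst (_∈ F) (trans (cong (c₁ ⁻¹ ⊙_) (sym solved)) (⁻¹⊙-cancel c₁≢0 e)) (F.⊙-cl (F.⁻¹-cl c₁≢0 c₁∈) (F.⊖-cl c₀∈))) e∉F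
          where
          e₂ : ∀ a b → b ≡ a ⊕ b ⊕ ⊖ a
          e₂ = solve 2 (λ a b → b := a :+ b :+ :- a) refl
          solved : c₁ ⊙ e ≡ ⊖ c₀
          solved = trans (e₂ c₀ (c₁ ⊙ e)) (trans (cong (_⊕ ⊖ c₀) eq) (⊕-identityˡ (⊖ c₀)))

      dimensionˢ : HasDimension Fˢ Vˢ 2
      dimensionˢ = record
        { isSubspace = record
          { 0∈V = ∈-tab (pull {extend F e} (⊙-zeroʳ y) V.0∈)
          ; +-closed = λ {v} {w} v∈ w∈ → ∈-tab (pull {extend F e} (trans (cong (y ⊙_) (to-+ v w)) (⊙-distribˡ y (to v) (to w)))
                         (V.⊕-cl (∈-untab v∈) (∈-untab w∈)))
          ; ·-closed = λ {c} {v} c∈ v∈ → ∈-tab (pull {extend F e} (trans (cong (y ⊙_) (to-· c v)) (e₃ y (to c) (to v)))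
                         (V.⊙-cl (∈-untab c∈) (∈-untab v∈)))
          }
        ; basis = basis
        ; isBasis = record
          { e∈V = λ { zero → ∈-tab (pull {extend F e} (trans (cong (y ⊙_) (to-from (y ⁻¹))) (trans (*-inverseʳ y≢0) (sym (trans (cong (1F ⊕_) (⊙-zeroˡ e)) (⊕-identityʳ 1F)))))
                               (extend-intro F e F.0∈ F.1∈))
                    ; (suc zero) → ∈-tab (pull {extend F e} (trans (cong (y ⊙_) (to-from (y ⁻¹ ⊙ e))) (trans (⊙⁻¹-cancel y≢0 e) (sym (trans (⊕-identityˡ (1F ⊙ e)) (⊙-identityˡ e)))))
                               (extend-intro F e F.1∈ F.0∈)) }
          ; independent = λ c c∈ sum≈0 →
              let p₀ , p₁ = coefficients-vanish (∈-untab (c∈ zero)) (∈-untab (c∈ (suc zero)))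
                              (trans (sym (to-sum c)) (trans (cong (y ⊙_) (to-cong sum≈0)) (⊙-zeroʳ y)))
              in λ { zero → to-injective p₀ ; (suc zero) → to-injective p₁ }
          ; spanning = λ {v} v∈ →
              let u , c , u∈ , c∈ , eq = extend-elim F e (∈-untab v∈)
                  coeff : Fin 2 → Carrier
                  coeff = λ { zero → from u ; (suc zero) → from c }
              in coeff , (λ { zero → ∈-tab (pull {F} (to-from u) u∈) ; (suc zero) → ∈-tab (pull {F} (to-from c) c∈) }) ,
                 to-injective (trans (sym (⁻¹⊙-cancel y≢0 (to v))) (trans (cong (y ⁻¹ ⊙_)
                   (trans eq (sym (trans (to-sum coeff) (cong₂ (λ a b → a ⊕ b ⊙ e) (to-from u) (to-from c))))))
                   (⁻¹⊙-cancel y≢0 _)))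
          }
        }
        where
        e₃ : ∀ y c v → y ⊙ (c ⊙ v) ≡ c ⊙ (y ⊙ v)
        e₃ = solve 3 (λ y c v → y :* (c :* v) := c :* (y :* v)) refl

      plane : Plane A (4 * (8 * (K * K * (K * K))))
      plane = record
        { F = Fˢ
        ; isSubfield = subfieldˢ
        ; ∣F∣³≡q = trans (cong (λ f → f * (f * f)) (∣tabulate∣ F)) F-size
        ; ā = from b
        ; ā∈A = ∈⇐ {A} (pull {lookup A} (to-from b) b∈A)
        ; V = Vˢ
        ; hasDimension = dimensionˢ
        ; many = <-≤-trans (subst (_< c * card T) (sym (∣∣≡card A)) many) (*-monoʳ-≤ c (begin
            -- a ↦ a - b carries `T`, the part of A in b + V, into (A - b) ∩ V.
            card T                                             ≤⟨ card-mono {S = T} {λ a → lookup S (a ⊝ b)} inside ⟩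
            card (λ a → lookup S (a ⊝ b))                      ≡⟨ ∑-untranslate b (λ x → 𝟙 (lookup S x)) ⟩
            card (lookup S)                                    ≡⟨ ∣∣≡card S ⟨
            ∣ S ∣                                              ∎))
        }
        where
        open ≤-Reasoning
        c : ℕ
        c = 4 * (8 * (K * K * (K * K)))
        S : Subset q
        S = (A ⊖ˢ from b) Sub.∩ Vˢ
        T : FinSet q
        T a = lookup A a ∧ extend F e (y ⊙ (a ⊝ b))
        inside : ∀ a → a ∈ T → (a ⊝ b) ∈ˢ S
        inside a a∈T =
          let a∈ , v∈ = ∧-true {lookup A a} a∈T
          in ∈⇒ {S} (Sub.x∈p∩q⁺ (shifted a∈ , ∈-tab v∈))
          where
          shifted : a ∈ˢ A → (a ⊝ b) Sub.∈ (A ⊖ˢ from b)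
          shifted a∈ = ∈⋃ (map (λ x → Sub.⁅ to (x 𝕂.- from b) ⁆) (elements A))
            (∈-map⁺ (λ x → Sub.⁅ to (x 𝕂.- from b) ⁆) (∈-map⁺ from (∈-filter⁺ (Sub._∈? A) (∈-allFin a) (∈⇐ {A} a∈))))
            (subst (λ t → (a ⊝ b) Sub.∈ Sub.⁅ t ⁆) (sym (trans (to-minus (from a) (from b)) (cong₂ _⊝_ (to-from a) (to-from b)))) (Sub.x∈⁅x⁆ (a ⊝ b)))

    -- All the logarithmic factors and absolute constants are absorbed by κ = 32 𝕂.
    concentrated-plane : ∀ (A X : Subset q) (K : ℕ) → 0 < K → ExcludesZero X →
      (32 * K) ^ 1504 ≤ ∣ X ∣ →
      q * (32 * K) ^ 16 < ∣ X ∣ * ∣ X ∣ * (∣ X ∣ * ∣ X ∣) →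
      ∣ X ∣ * ∣ X ∣ < q →
      q * (32 * K) ^ 170 < ∣ A ∣ * ∣ A ∣ →
      ∣ A ∣ * ∣ A ∣ * ∣ A ∣ < 8 * (q * q) →
      (∀ ξ → ξ ∈ᶠ X → ∣ A ∣ * ∣ A ∣ * ∣ A ∣ ≤ K * energyˢ A ξ) →
      Plane A (4 * (8 * (K * K * (K * K))))
    concentrated-plane A X K 0<K 0∉X h₁ h₂ h₃ h₄ h₅ h₆ = plane A K
      (concentration (lookup A) (lookup X) ∣ A ∣ K κ refl 0<K |A|≡ X≢0 h₁′ h₂′ h₃′ h₄ h₅ energies
        (outcome (lookup A) (lookup X) ∣ A ∣ K κ refl 0<K |A|≡ X≢0 h₁′ h₂′ h₃′ h₄ h₅ energies))
      where
      κ : ℕ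
      κ = 32 * K
      |A|≡ : card (lookup A) ≡ ∣ A ∣
      |A|≡ = sym (∣∣≡card A)
      X≢0 : ∀ {ξ} → ξ ∈ lookup X → ξ ≢ 0F
      X≢0 ξ∈ refl = 0∉X (∈⇐ {X} ξ∈)
      h₁′ : κ ^ 1504 ≤ card (lookup X)
      h₁′ = subst (κ ^ 1504 ≤_) (∣∣≡card X) h₁
      h₂′ : q * κ ^ 16 < card (lookup X) * card (lookup X) * (card (lookup X) * card (lookup X))
      h₂′ = subst (λ N → q * κ ^ 16 < N * N * (N * N)) (∣∣≡card X) h₂
      h₃′ : card (lookup X) * card (lookup X) < q
      h₃′ = subst (λ N → N * N < q) (∣∣≡card X) h₃
      energies : ∀ {ξ} → ξ ∈ lookup X → ∣ A ∣ * ∣ A ∣ * ∣ A ∣ ≤ K * energy (lookup A) (dil ξ (lookup A))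
      energies {ξ} ξ∈ = ≤-trans (h₆ (from ξ) (∈⇐ {X} (pull′ (to-from ξ) ξ∈)))
        (≤-reflexive (cong (K *_) (trans (energy-transport A (from ξ) (λ eq → X≢0 ξ∈ (trans (sym (to-from ξ)) eq)))
          (cong (λ t → energy (lookup A) (dil t (lookup A))) (to-from ξ)))))
        where
        pull′ : ∀ {x y} → x ≡ y → y ∈ lookup X → x ∈ lookup X
        pull′ refl y∈ = y∈

open Combinatorics
open import Defs
open import Data.Fin.Subset using (Subset; ∣_∣; _∩_)
open import Data.Nat.Base as ℕ using (ℕ)
open import Data.Product.Base using (Σ; _×_)

import Algebra.Solver.CommutativeMonoid
import Data.Fin.Subset as Sub
import Data.Fin.Subset.Properties as Sub
import Data.Nat.Properties as ℕ
open import Data.Nat.Base using (zero; suc; s≤s; z≤n)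
open import Data.Nat.Tactic.RingSolver using (solve-∀)
open import Data.Product.Base using (∃; _,_)
open import Data.Rational.Base as ℚ using (ℚ; 0ℚ; 1ℚ; ½)
import Data.Rational.Properties as ℚ
open import Function.Bundles using (Inverse)
open import Relation.Binary.PropositionalEquality using (_≡_; refl; sym; trans; cong; cong₂; subst; subst₂)
open import Relation.Nullary using (¬_; yes; no; contradiction)

open ℝ≥0
open ℚ-Order
open Fromℕᵠ
open HarmonicLemmas
open PrimePowerLemmas
open RootLemmas

-- Rational bounds for powers, roots and logarithms.

module RationalLemmas where

  open Algebra.Solver.CommutativeMonoid ℚ.*-1-commutativeMonoid public using (solve; _⊕_; _⊜_)

  fromℕᵠ-cancel-≤ : ∀ {m n} → fromℕᵠ m ℚ.≤ fromℕᵠ n → m ℕ.≤ n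
  fromℕᵠ-cancel-≤ {m} {n} m≤n = ℕ.≮⇒≥ λ n<m → ℚ.<-irrefl refl (begin-strict
    fromℕᵠ n             ≡⟨ ℚ.+-identityˡ (fromℕᵠ n) ⟨
    0ℚ ℚ.+ fromℕᵠ n      <⟨ ℚ.+-monoˡ-< (fromℕᵠ n) 0<1 ⟩
    1ℚ ℚ.+ fromℕᵠ n      ≡⟨ fromℕᵠ-suc n ⟨
    fromℕᵠ (suc n)       ≤⟨ fromℕᵠ-mono n<m ⟩
    fromℕᵠ m             ≤⟨ m≤n ⟩
    fromℕᵠ n             ∎)
    where open ℚ.≤-Reasoning

  fromℕᵠ-cancel-< : ∀ {m n} → fromℕᵠ m ℚ.< fromℕᵠ n → m ℕ.< n
  fromℕᵠ-cancel-< m<n = ℕ.≰⇒> λ n≤m → ℚ.<-irrefl refl (ℚ.<-≤-trans m<n (fromℕᵠ-mono n≤m))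

  fromℕᵠ-^ : ∀ m n → fromℕᵠ (m ℕ.^ n) ≡ fromℕᵠ m ^ᵠ n
  fromℕᵠ-^ m zero    = refl
  fromℕᵠ-^ m (suc n) = trans (fromℕᵠ-* m (m ℕ.^ n)) (cong (fromℕᵠ m ℚ.*_) (fromℕᵠ-^ m n))

  *-^ᵠ : ∀ p r n → (p ℚ.* r) ^ᵠ n ≡ p ^ᵠ n ℚ.* r ^ᵠ n
  *-^ᵠ p r zero    = refl
  *-^ᵠ p r (suc n) = trans (cong (p ℚ.* r ℚ.*_) (*-^ᵠ p r n))
    (solve 4 (λ a b c d → (a ⊕ b) ⊕ (c ⊕ d) ⊜ (a ⊕ c) ⊕ (b ⊕ d)) refl p r (p ^ᵠ n) (r ^ᵠ n))

  1^ᵠ : ∀ n → 1ℚ ^ᵠ n ≡ 1ℚ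
  1^ᵠ zero    = refl
  1^ᵠ (suc n) = trans (ℚ.*-identityˡ (1ℚ ^ᵠ n)) (1^ᵠ n)

  Lower-^ : ∀ x {a} n → Lower x a → Lower (x ^ n) (a ^ᵠ n)
  Lower-^ x     zero    la = refl
  Lower-^ x {a} (suc n) la = a , a ^ᵠ n , la , Lower-^ x n la , refl

  -- A lower bound of xⁿ may be a product of n different lower bounds of x, so one B has to bound
  -- them all.
  lower-^-≤ : ∀ x B → (∀ {a} → Lower x a → a ℚ.≤ B) → ∀ n {a} → Lower (x ^ n) a → a ℚ.≤ B ^ᵠ n
  lower-^-≤ x B h zero    refl = ℚ.≤-refl
  lower-^-≤ x B h (suc n) (a , b , la , lb , refl) =
    *-mono (nonNeg x la) (ℚ.≤-trans (nonNeg (x ^ n) lb) (lower-^-≤ x B h n lb)) (h la) (lower-^-≤ x B h n lb)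

  *-cancelˡ : ∀ {r p q} → 0ℚ ℚ.< r → r ℚ.* p ℚ.≤ r ℚ.* q → p ℚ.≤ q
  *-cancelˡ {r} {p} {q} 0<r h = *-cancelʳ 0<r (subst₂ ℚ._≤_ (ℚ.*-comm r p) (ℚ.*-comm r q) h)

  2*n≰n : ∀ {n} → 0 ℕ.< n → ¬ (2 ℕ.* n ℕ.≤ n)
  2*n≰n {n} 0<n h = ℕ.<⇒≱ (ℕ.m<m+n n (ℕ.≤-trans 0<n (ℕ.m≤m+n n 0))) h

  -- If 2 t q^(1/s) ≤ N, then q tˢ < Nˢ: otherwise N / t ≤ q^(1/s).
  root-bound : ∀ s N t q → 0 ℕ.< N → 0 ℕ.< t →
               (∀ a → 0ℚ ℚ.≤ a → a ^ᵠ s ℚ.≤ fromℕᵠ q → fromℕᵠ (2 ℕ.* t) ℚ.* a ℚ.≤ fromℕᵠ N) →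
               q ℕ.* t ℕ.^ s ℕ.< N ℕ.^ s
  root-bound s N t@(suc t′) q 0<N _ h = ℕ.≰⇒> λ Nˢ≤qtˢ →
    let r , 0<r , rt≡1 = recip (fromℕᵠ t) (0<fromℕᵠ t′)
        a = fromℕᵠ N ℚ.* r
        tʳ : fromℕᵠ t ^ᵠ s ℚ.* r ^ᵠ s ≡ 1ℚ
        tʳ = trans (sym (*-^ᵠ (fromℕᵠ t) r s)) (trans (cong (_^ᵠ s) (trans (ℚ.*-comm (fromℕᵠ t) r) rt≡1)) (1^ᵠ s))
        aˢ≤q : a ^ᵠ s ℚ.≤ fromℕᵠ q
        aˢ≤q = begin
          (fromℕᵠ N ℚ.* r) ^ᵠ s                             ≡⟨ *-^ᵠ (fromℕᵠ N) r s ⟩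
          fromℕᵠ N ^ᵠ s ℚ.* r ^ᵠ s                          ≡⟨ cong (ℚ._* r ^ᵠ s) (fromℕᵠ-^ N s) ⟨
          fromℕᵠ (N ℕ.^ s) ℚ.* r ^ᵠ s                       ≤⟨ *-monoʳ (0≤^ s (ℚ.<⇒≤ 0<r)) (fromℕᵠ-mono Nˢ≤qtˢ) ⟩
          fromℕᵠ (q ℕ.* t ℕ.^ s) ℚ.* r ^ᵠ s                 ≡⟨ cong (ℚ._* r ^ᵠ s) (trans (fromℕᵠ-* q (t ℕ.^ s)) (cong (fromℕᵠ q ℚ.*_) (fromℕᵠ-^ t s))) ⟩
          fromℕᵠ q ℚ.* fromℕᵠ t ^ᵠ s ℚ.* r ^ᵠ s             ≡⟨ ℚ.*-assoc (fromℕᵠ q) (fromℕᵠ t ^ᵠ s) (r ^ᵠ s) ⟩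
          fromℕᵠ q ℚ.* (fromℕᵠ t ^ᵠ s ℚ.* r ^ᵠ s)           ≡⟨ trans (cong (fromℕᵠ q ℚ.*_) tʳ) (ℚ.*-identityʳ (fromℕᵠ q)) ⟩
          fromℕᵠ q                                          ∎
    in 2*n≰n 0<N (fromℕᵠ-cancel-≤ (begin
      fromℕᵠ (2 ℕ.* N)                                      ≡⟨ fromℕᵠ-* 2 N ⟩
      fromℕᵠ 2 ℚ.* fromℕᵠ N                                 ≡⟨ ℚ.*-identityʳ _ ⟨
      fromℕᵠ 2 ℚ.* fromℕᵠ N ℚ.* 1ℚ                          ≡⟨ cong (fromℕᵠ 2 ℚ.* fromℕᵠ N ℚ.*_) rt≡1 ⟨
      fromℕᵠ 2 ℚ.* fromℕᵠ N ℚ.* (r ℚ.* fromℕᵠ t)            ≡⟨ solve 4 (λ w n r t → (w ⊕ n) ⊕ (r ⊕ t) ⊜ (w ⊕ t) ⊕ (n ⊕ r)) refl (fromℕᵠ 2) (fromℕᵠ N) r (fromℕᵠ t) ⟩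
      fromℕᵠ 2 ℚ.* fromℕᵠ t ℚ.* (fromℕᵠ N ℚ.* r)            ≡⟨ cong (ℚ._* (fromℕᵠ N ℚ.* r)) (fromℕᵠ-* 2 t) ⟨
      fromℕᵠ (2 ℕ.* t) ℚ.* a                                ≤⟨ h a (0≤* (0≤fromℕᵠ N) (ℚ.<⇒≤ 0<r)) aˢ≤q ⟩
      fromℕᵠ N                                              ∎))
    where open ℚ.≤-Reasoning

  ceiling : ∀ u → 0ℚ ℚ.< u → ∃ λ k → fromℕᵠ k ℚ.< u × u ℚ.≤ fromℕᵠ (suc k)
  ceiling u 0<u =
    let J , u≤J          = ≤fromℕᵠ u
        j , j<u , ¬j+1<u = search (λ j → fromℕᵠ j ℚ.<? u) 0<u J (λ J<u → ℚ.<-irrefl refl (ℚ.<-≤-trans J<u u≤J))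
    in j , j<u , ℚ.≮⇒≥ ¬j+1<u

  -- 1/2 is the first term of the lower Riemann sum with intervals of length 1.
  ½≤log : ∀ {q} → 1 ℕ.< q → ½ ℚ.≤ harmonic 1 (ℕ.pred q ℕ.* 1)
  ½≤log {suc (suc q)} _ = p≤p+q (0≤harmonic 2 (q ℕ.* 1))
  ½≤log {suc zero} (s≤s ())

  nonempty : ∀ {m} (S : Subset m) → 0 ℕ.< ∣ S ∣ → Sub.Nonempty S
  nonempty {m} S 0<S with Sub.nonempty? S
  ... | yes ne = ne
  ... | no ¬ne = contradiction (subst (0 ℕ.<_) (trans (cong ∣_∣ (Sub.Empty-unique ¬ne)) (Sub.∣⊥∣≡0 m)) 0<S) λ ()

  square<q : ∀ {q} N → ι N < q ^[ 1 / 2 ] → N ℕ.* N ℕ.< q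
  square<q {q} N (.(fromℕᵠ N) , a , refl , (0≤a , a²≤q) , N<a) = fromℕᵠ-cancel-< (begin-strict
    fromℕᵠ (N ℕ.* N)             ≡⟨ cong (λ t → fromℕᵠ (N ℕ.* t)) (ℕ.*-identityʳ N) ⟨
    fromℕᵠ (N ℕ.^ 2)             ≡⟨ fromℕᵠ-^ N 2 ⟩
    fromℕᵠ N ^ᵠ 2                <⟨ ^-mono-< 1 (0≤fromℕᵠ N) N<a ⟩
    a ^ᵠ 2                       ≤⟨ a²≤q ⟩
    fromℕᵠ (q ℕ.^ 1)             ≡⟨ cong fromℕᵠ (ℕ.*-identityʳ q) ⟩
    fromℕᵠ q                     ∎)
    where open ℚ.≤-Reasoning

  cube-root : ∀ {q} f → f ℕ.* (f ℕ.* f) ≡ q → ι f ≃ q ^[ 1 / 3 ]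
  cube-root {q} f f³≡q = (λ { refl (0≤b , q≤b³) → ^-cancel-≤ 2 0≤b (subst (ℚ._≤ _) f³ q≤b³) })
                   , (λ { (0≤a , a³≤q) refl → ^-cancel-≤ 2 (0≤fromℕᵠ f) (subst (_ ℚ.≤_) f³ a³≤q) })
    where
    e : ∀ f → f ℕ.* (f ℕ.* f) ≡ f ℕ.* (f ℕ.* (f ℕ.* 1))
    e = solve-∀
    f³ : fromℕᵠ (q ℕ.^ 1) ≡ fromℕᵠ f ^ᵠ 3
    f³ = trans (cong fromℕᵠ (trans (ℕ.*-identityʳ q) (trans (sym f³≡q) (e f)))) (fromℕᵠ-^ f 3)

  -- Meant for a lower bound x of 1 / log q and an upper bound b of log q.
  x≤2 : ∀ {x b} → 0ℚ ℚ.≤ x → ½ ℚ.≤ b → x ℚ.* b ℚ.≤ 1ℚ → x ℚ.≤ fromℕᵠ 2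
  x≤2 0≤x ½≤b xb≤1 = *-cancelʳ {½} (ℚ.positive⁻¹ ½) (ℚ.≤-trans (*-monoˡ 0≤x ½≤b) xb≤1)

open RationalLemmas

-- l and u enclose K, and K′ rounds u up. The comparison of K′ with l is conditional, since for
-- small K the bound l may be 0 while K′ is at least 1.
record RoundedUp (K : ℝ≥0) : Set where
  field
    l u   : ℚ
    K′    : ℕ
    l∈K   : Lower K l
    u∈K   : Upper K u
    0<u   : 0ℚ ℚ.< u
    0<K′  : 0 ℕ.< K′
    u≤K′  : u ℚ.≤ fromℕᵠ K′
    K′≤4l : 1ℚ ℚ.≤ u → fromℕᵠ K′ ℚ.≤ fromℕᵠ 4 ℚ.* l

roundUp : ∀ K {{_ : Positive K}} → RoundedUp K
roundUp K {{K>0}} =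
  let l , u , l∈K , u∈K , u≤l+½ = close K ½ (ℚ.positive⁻¹ ½)
      0<u = ℚ.<-≤-trans (Positive.0<bound K>0) (ordered K (Positive.isLower K>0) u∈K)
      k , k<u , u≤1+k = ceiling u 0<u
  in record
    { l = l ; u = u ; K′ = suc k ; l∈K = l∈K ; u∈K = u∈K ; 0<u = 0<u ; 0<K′ = s≤s z≤n ; u≤K′ = u≤1+k
    ; K′≤4l = 1+k≤4l l u k u≤l+½ k<u }
  where
  open ℚ.≤-Reasoning
  ½≤ : ∀ l u → u ℚ.≤ l ℚ.+ ½ → 1ℚ ℚ.≤ u → ½ ℚ.≤ l
  ½≤ l u u≤l+½ 1≤u = subst (½ ℚ.≤_) (trans (ℚ.+-assoc l ½ (ℚ.- ½)) (ℚ.+-identityʳ l))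
    (ℚ.+-monoˡ-≤ (ℚ.- ½) (ℚ.≤-trans 1≤u u≤l+½))
  double : ∀ l → l ℚ.+ l ≡ fromℕᵠ 2 ℚ.* l
  double l = trans (sym (cong₂ ℚ._+_ (ℚ.*-identityˡ l) (ℚ.*-identityˡ l))) (sym (ℚ.*-distribʳ-+ l 1ℚ 1ℚ))
  -- From 1 ≤ u ≤ l + 1/2 follows l ≥ 1/2; hence 1 ≤ 2l and u ≤ 2l.
  1+k≤4l : ∀ l u k → u ℚ.≤ l ℚ.+ ½ → fromℕᵠ k ℚ.< u → 1ℚ ℚ.≤ u → fromℕᵠ (suc k) ℚ.≤ fromℕᵠ 4 ℚ.* l
  1+k≤4l l u k u≤l+½ k<u 1≤u = begin
    fromℕᵠ (suc k)                            ≡⟨ fromℕᵠ-suc k ⟩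
    1ℚ ℚ.+ fromℕᵠ k                           ≤⟨ ℚ.+-mono-≤ (*-monoˡ {fromℕᵠ 2} (0≤fromℕᵠ 2) (½≤ l u u≤l+½ 1≤u)) (ℚ.<⇒≤ k<u) ⟩
    fromℕᵠ 2 ℚ.* l ℚ.+ u                      ≤⟨ ℚ.+-monoʳ-≤ (fromℕᵠ 2 ℚ.* l) (ℚ.≤-trans u≤l+½ (ℚ.+-monoʳ-≤ l (½≤ l u u≤l+½ 1≤u))) ⟩
    fromℕᵠ 2 ℚ.* l ℚ.+ (l ℚ.+ l)              ≡⟨ cong (fromℕᵠ 2 ℚ.* l ℚ.+_) (double l) ⟩
    fromℕᵠ 2 ℚ.* l ℚ.+ fromℕᵠ 2 ℚ.* l         ≡⟨ ℚ.*-distribʳ-+ l (fromℕᵠ 2) (fromℕᵠ 2) ⟨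
    fromℕᵠ 4 ℚ.* l                            ∎

-- Here Γ stands for C log q.
module LowerBounds (Γ K : ℝ≥0) {e l : ℚ} (e∈Γ : Lower Γ e) (l∈K : Lower K l) where

  product-≤ : ∀ m M → Γ * K ^ m ≤ ι M → e ℚ.* l ^ᵠ m ℚ.≤ fromℕᵠ M
  product-≤ m M h = h {e ℚ.* l ^ᵠ m} {fromℕᵠ M} (e , l ^ᵠ m , e∈Γ , Lower-^ K m l∈K , refl) refl

  root-product-≤ : ∀ q s m M {a} → Γ * q ^[ 1 / suc s ] * K ^ m ≤ ι M →
                   0ℚ ℚ.≤ a → a ^ᵠ suc s ℚ.≤ fromℕᵠ (q ℕ.^ 1) → e ℚ.* a ℚ.* l ^ᵠ m ℚ.≤ fromℕᵠ M
  root-product-≤ q s m M {a} h 0≤a aˢ≤q = h {e ℚ.* a ℚ.* l ^ᵠ m} {fromℕᵠ M}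
    (e ℚ.* a , l ^ᵠ m , (e , a , e∈Γ , (0≤a , aˢ≤q) , refl) , Lower-^ K m l∈K , refl) refl

  module _ (0<e : 0ℚ ℚ.< e) (0<l : 0ℚ ℚ.< l) where

    product-positive : ∀ m M → Γ * K ^ m ≤ ι M → 0 ℕ.< M
    product-positive m M h = fromℕᵠ-cancel-< (ℚ.<-≤-trans (0<* 0<e (0<^ m 0<l)) (product-≤ m M h))

    -- 1 is a lower bound of the root, as q ≥ 1.
    root-product-positive : ∀ q s m M → 0 ℕ.< q → Γ * q ^[ 1 / suc s ] * K ^ m ≤ ι M → 0 ℕ.< M
    root-product-positive q s m M 0<q h = fromℕᵠ-cancel-< (ℚ.<-≤-trans (0<* (0<* 0<e 0<1) (0<^ m 0<l))
      (root-product-≤ q s m M h (ℚ.<⇒≤ 0<1) (subst (ℚ._≤ fromℕᵠ (q ℕ.^ 1)) (sym (1^ᵠ (suc s)))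
        (fromℕᵠ-mono {1} {q ℕ.^ 1} (subst (1 ℕ.≤_) (sym (ℕ.*-identityʳ q)) 0<q)))))

  module _ {b D κ : ℕ} (D≤e : fromℕᵠ D ℚ.≤ e) (κ≤bl : fromℕᵠ κ ℚ.≤ fromℕᵠ b ℚ.* l) where

    private
      open ℚ.≤-Reasoning

      0≤lᵐ : ∀ m → 0ℚ ℚ.≤ l ^ᵠ m
      0≤lᵐ m = 0≤^ m (nonNeg K l∈K)

      -- κᵐ ≤ bᵐlᵐ, and the factor abᵐ is paid for by D ≤ e, that is, by the size of C.
      aκᵐ≤elᵐ : ∀ a m → a ℕ.* b ℕ.^ m ℕ.≤ D → fromℕᵠ (a ℕ.* κ ℕ.^ m) ℚ.≤ e ℚ.* l ^ᵠ m
      aκᵐ≤elᵐ a m abᵐ≤D = begin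
        fromℕᵠ (a ℕ.* κ ℕ.^ m)                        ≡⟨ trans (fromℕᵠ-* a (κ ℕ.^ m)) (cong (fromℕᵠ a ℚ.*_) (fromℕᵠ-^ κ m)) ⟩
        fromℕᵠ a ℚ.* fromℕᵠ κ ^ᵠ m                    ≤⟨ *-monoˡ {fromℕᵠ a} (0≤fromℕᵠ a) (^-mono m (0≤fromℕᵠ κ) κ≤bl) ⟩
        fromℕᵠ a ℚ.* (fromℕᵠ b ℚ.* l) ^ᵠ m            ≡⟨ cong (fromℕᵠ a ℚ.*_) (*-^ᵠ (fromℕᵠ b) l m) ⟩
        fromℕᵠ a ℚ.* (fromℕᵠ b ^ᵠ m ℚ.* l ^ᵠ m)       ≡⟨ ℚ.*-assoc (fromℕᵠ a) (fromℕᵠ b ^ᵠ m) (l ^ᵠ m) ⟨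
        fromℕᵠ a ℚ.* fromℕᵠ b ^ᵠ m ℚ.* l ^ᵠ m         ≡⟨ cong (ℚ._* l ^ᵠ m) (trans (fromℕᵠ-* a (b ℕ.^ m)) (cong (fromℕᵠ a ℚ.*_) (fromℕᵠ-^ b m))) ⟨
        fromℕᵠ (a ℕ.* b ℕ.^ m) ℚ.* l ^ᵠ m             ≤⟨ *-monoʳ {l ^ᵠ m} (0≤lᵐ m) (ℚ.≤-trans (fromℕᵠ-mono abᵐ≤D) D≤e) ⟩
        e ℚ.* l ^ᵠ m                                  ∎

    power-≤ : ∀ m M → b ℕ.^ m ℕ.≤ D → Γ * K ^ m ≤ ι M → κ ℕ.^ m ℕ.≤ M
    power-≤ m M bᵐ≤D h = subst (ℕ._≤ M) (ℕ.*-identityˡ (κ ℕ.^ m)) (fromℕᵠ-cancel-≤ (ℚ.≤-trans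
      (aκᵐ≤elᵐ 1 m (subst (ℕ._≤ D) (sym (ℕ.*-identityˡ (b ℕ.^ m))) bᵐ≤D)) (product-≤ m M h)))

    -- The 2 in the condition on D is consumed by `root-bound`, where it makes the conclusion
    -- strict.
    root-power-< : ∀ q s m M → 0 ℕ.< κ → 2 ℕ.* b ℕ.^ m ℕ.≤ D → 0 ℕ.< M →
                   Γ * q ^[ 1 / suc s ] * K ^ m ≤ ι M → q ℕ.* κ ℕ.^ (m ℕ.* suc s) ℕ.< M ℕ.^ suc s
    root-power-< q s m M 0<κ 2bᵐ≤D 0<M h =
      subst (ℕ._< M ℕ.^ suc s) (cong₂ ℕ._*_ (ℕ.*-identityʳ q) (ℕ.^-*-assoc κ m (suc s)))
        (root-bound (suc s) M (κ ℕ.^ m) (q ℕ.^ 1) 0<M 0<κᵐ λ a 0≤a aˢ≤q → begin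
          fromℕᵠ (2 ℕ.* κ ℕ.^ m) ℚ.* a     ≤⟨ *-monoʳ {a} 0≤a (aκᵐ≤elᵐ 2 m 2bᵐ≤D) ⟩
          e ℚ.* l ^ᵠ m ℚ.* a               ≡⟨ solve 3 (λ e p a → (e ⊕ p) ⊕ a ⊜ (e ⊕ a) ⊕ p) refl e (l ^ᵠ m) a ⟩
          e ℚ.* a ℚ.* l ^ᵠ m               ≤⟨ root-product-≤ q s m M h 0≤a aˢ≤q ⟩
          fromℕᵠ M                         ∎)
      where
      0<κᵐ : 0 ℕ.< κ ℕ.^ m
      0<κᵐ = ℕ.m^n>0 κ {{ℕ.>-nonZero 0<κ}} m

-- Rounding errors and the constant in the density bound.

module RationalBounds where

  open ℚ.≤-Reasoning

  inverse-≤ : ∀ K {{_ : Positive K}} {b l K′ r a} → Lower K l → fromℕᵠ K′ ℚ.≤ fromℕᵠ b ℚ.* l → 0ℚ ℚ.≤ r →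
              r ℚ.* fromℕᵠ K′ ≡ 1ℚ → Lower (K ⁻¹) a → a ℚ.≤ fromℕᵠ b ℚ.* r
  inverse-≤ K {b} {l} {K′} {r} {a} l∈K K′≤4l 0≤r rK≡1 (0≤a , v , v∈ , av≤1) = begin
    a                                    ≡⟨ ℚ.*-identityʳ a ⟨
    a ℚ.* 1ℚ                             ≡⟨ cong (a ℚ.*_) rK≡1 ⟨
    a ℚ.* (r ℚ.* fromℕᵠ K′)              ≤⟨ *-monoˡ {a} 0≤a (*-monoˡ {r} 0≤r
                                              (ℚ.≤-trans K′≤4l (*-monoˡ {fromℕᵠ b} (0≤fromℕᵠ b) (ordered K l∈K v∈)))) ⟩
    a ℚ.* (r ℚ.* (fromℕᵠ b ℚ.* v))       ≡⟨ solve 4 (λ a r f v → a ⊕ (r ⊕ (f ⊕ v)) ⊜ (a ⊕ v) ⊕ (f ⊕ r)) refl a r (fromℕᵠ b) v ⟩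
    a ℚ.* v ℚ.* (fromℕᵠ b ℚ.* r)         ≤⟨ *-monoʳ {fromℕᵠ b ℚ.* r} (0≤* (0≤fromℕᵠ b) 0≤r) av≤1 ⟩
    1ℚ ℚ.* (fromℕᵠ b ℚ.* r)              ≡⟨ ℚ.*-identityˡ (fromℕᵠ b ℚ.* r) ⟩
    fromℕᵠ b ℚ.* r                       ∎

  reciprocal≤1 : ∀ {r K′} → 0 ℕ.< K′ → 0ℚ ℚ.≤ r → r ℚ.* fromℕᵠ K′ ≡ 1ℚ → r ℚ.≤ 1ℚ
  reciprocal≤1 {r} {K′} 0<K′ 0≤r rK≡1 = begin
    r                        ≡⟨ ℚ.*-identityʳ r ⟨
    r ℚ.* 1ℚ                 ≤⟨ *-monoˡ {r} 0≤r (fromℕᵠ-mono {1} {K′} 0<K′) ⟩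
    r ℚ.* fromℕᵠ K′          ≡⟨ rK≡1 ⟩
    1ℚ                       ∎

  -- The combinatorial part loses only K⁴; this relaxes r⁸⁵ to r⁴ for r = 1 / K′ ≤ 1.
  ^-shrink : ∀ {r} → 0ℚ ℚ.≤ r → r ℚ.≤ 1ℚ → ∀ m n → r ^ᵠ (m ℕ.+ n) ℚ.≤ r ^ᵠ n
  ^-shrink         0≤r r≤1 zero    n = ℚ.≤-refl
  ^-shrink {r} 0≤r r≤1 (suc m) n = begin
    r ℚ.* r ^ᵠ (m ℕ.+ n)     ≤⟨ *-mono {r} {1ℚ} 0≤r (0≤^ n 0≤r) r≤1 (^-shrink {r} 0≤r r≤1 m n) ⟩
    1ℚ ℚ.* r ^ᵠ n            ≡⟨ ℚ.*-identityˡ (r ^ᵠ n) ⟩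
    r ^ᵠ n                   ∎

  inverse-power-≤ : ∀ K {{_ : Positive K}} {b l K′ r k} s t → Lower K l → fromℕᵠ K′ ℚ.≤ fromℕᵠ b ℚ.* l → 0ℚ ℚ.≤ r →
                    r ℚ.* fromℕᵠ K′ ≡ 1ℚ → r ^ᵠ s ℚ.≤ r ^ᵠ t → Lower (K ⁻¹ ^ s) k → k ℚ.≤ fromℕᵠ (b ℕ.^ s) ℚ.* r ^ᵠ t
  inverse-power-≤ K {b} {l} {K′} {r} {k} s t l∈K K′≤bl 0≤r rK≡1 rˢ≤rᵗ k∈ = begin
    k                                   ≤⟨ lower-^-≤ (K ⁻¹) (fromℕᵠ b ℚ.* r) (λ {a} → inverse-≤ K {b} {l} {K′} {r} {a} l∈K K′≤bl 0≤r rK≡1) s k∈ ⟩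
    (fromℕᵠ b ℚ.* r) ^ᵠ s               ≡⟨ *-^ᵠ (fromℕᵠ b) r s ⟩
    fromℕᵠ b ^ᵠ s ℚ.* r ^ᵠ s            ≡⟨ cong (ℚ._* r ^ᵠ s) (fromℕᵠ-^ b s) ⟨
    fromℕᵠ (b ℕ.^ s) ℚ.* r ^ᵠ s         ≤⟨ *-monoˡ {fromℕᵠ (b ℕ.^ s)} {r ^ᵠ s} {r ^ᵠ t} (0≤fromℕᵠ (b ℕ.^ s)) rˢ≤rᵗ ⟩
    fromℕᵠ (b ℕ.^ s) ℚ.* r ^ᵠ t         ∎

  -- x, y and k are lower bounds of 1 / C, 1 / log q and K⁻⁸⁵. In 64 = 2 · 32 the 2 bounds y and the
  -- 32 is the constant of the plane; P will be 4⁸⁵, from K′ ≤ 4l.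
  density-≤ : ∀ {x y k r : ℚ} {c P K′ n M : ℕ} → 0ℚ ℚ.≤ x → 0ℚ ℚ.≤ y → 0ℚ ℚ.≤ k → 0ℚ ℚ.≤ r →
              x ℚ.* fromℕᵠ c ℚ.≤ 1ℚ → y ℚ.≤ fromℕᵠ 2 → k ℚ.≤ fromℕᵠ P ℚ.* r ^ᵠ 4 → r ℚ.* fromℕᵠ K′ ≡ 1ℚ →
              64 ℕ.* P ℕ.≤ c → n ℕ.< 4 ℕ.* (8 ℕ.* (K′ ℕ.* K′ ℕ.* (K′ ℕ.* K′))) ℕ.* M →
              x ℚ.* (y ℚ.* 1ℚ) ℚ.* k ℚ.* fromℕᵠ n ℚ.≤ fromℕᵠ M
  density-≤ {x} {y} {k} {r} {c} {P} {K′} {n} {M} 0≤x 0≤y 0≤k 0≤r xc≤1 y≤2 k≤ rK≡1 64P≤c n<M = begin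
    x ℚ.* (y ℚ.* 1ℚ) ℚ.* k ℚ.* fromℕᵠ n
      ≡⟨ cong (λ t → x ℚ.* t ℚ.* k ℚ.* fromℕᵠ n) (ℚ.*-identityʳ y) ⟩
    x ℚ.* y ℚ.* k ℚ.* fromℕᵠ n
      ≤⟨ *-mono (0≤* (0≤* 0≤x 0≤y) 0≤k) (0≤fromℕᵠ m)
           (*-mono (0≤* 0≤x 0≤y) (0≤* (0≤fromℕᵠ P) (0≤^ 4 0≤r)) (*-monoˡ {x} 0≤x y≤2) k≤) (fromℕᵠ-mono (ℕ.<⇒≤ n<M)) ⟩
    x ℚ.* t ℚ.* (p ℚ.* r⁴) ℚ.* fromℕᵠ m
      ≡⟨ cong (x ℚ.* t ℚ.* (p ℚ.* r⁴) ℚ.*_) expand ⟩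
    x ℚ.* t ℚ.* (p ℚ.* r⁴) ℚ.* (fromℕᵠ 32 ℚ.* K⁴ ℚ.* fromℕᵠ M)
      ≡⟨ solve 7 (λ x t p r th k m → (((x ⊕ t) ⊕ (p ⊕ r)) ⊕ ((th ⊕ k) ⊕ m)) ⊜ ((x ⊕ ((t ⊕ th) ⊕ p)) ⊕ (r ⊕ k)) ⊕ m) refl
           x t p r⁴ (fromℕᵠ 32) K⁴ (fromℕᵠ M) ⟩
    x ℚ.* (t ℚ.* fromℕᵠ 32 ℚ.* p) ℚ.* (r⁴ ℚ.* K⁴) ℚ.* fromℕᵠ M
      ≡⟨ cong₂ (λ a b → x ℚ.* a ℚ.* b ℚ.* fromℕᵠ M) (sym (fromℕᵠ-* 64 P)) r⁴K⁴ ⟩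
    x ℚ.* fromℕᵠ (64 ℕ.* P) ℚ.* 1ℚ ℚ.* fromℕᵠ M
      ≡⟨ cong (ℚ._* fromℕᵠ M) (ℚ.*-identityʳ (x ℚ.* fromℕᵠ (64 ℕ.* P))) ⟩
    x ℚ.* fromℕᵠ (64 ℕ.* P) ℚ.* fromℕᵠ M
      ≤⟨ *-monoʳ {fromℕᵠ M} (0≤fromℕᵠ M) (ℚ.≤-trans (*-monoˡ {x} 0≤x (fromℕᵠ-mono 64P≤c)) xc≤1) ⟩
    1ℚ ℚ.* fromℕᵠ M  ≡⟨ ℚ.*-identityˡ (fromℕᵠ M) ⟩
    fromℕᵠ M         ∎
    where
    m : ℕ
    m = 4 ℕ.* (8 ℕ.* (K′ ℕ.* K′ ℕ.* (K′ ℕ.* K′))) ℕ.* M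
    t p r⁴ K⁴ : ℚ
    t = fromℕᵠ 2
    p = fromℕᵠ P
    r⁴ = r ^ᵠ 4
    K⁴ = fromℕᵠ K′ ^ᵠ 4
    r⁴K⁴ : r⁴ ℚ.* K⁴ ≡ 1ℚ
    r⁴K⁴ = trans (sym (*-^ᵠ r (fromℕᵠ K′) 4)) (trans (cong (_^ᵠ 4) rK≡1) (1^ᵠ 4))
    e : ∀ k m → 4 ℕ.* (8 ℕ.* (k ℕ.* k ℕ.* (k ℕ.* k))) ℕ.* m ≡ 32 ℕ.* (k ℕ.* (k ℕ.* (k ℕ.* (k ℕ.* 1)))) ℕ.* m
    e = solve-∀
    expand : fromℕᵠ m ≡ fromℕᵠ 32 ℚ.* K⁴ ℚ.* fromℕᵠ M
    expand = trans (cong fromℕᵠ (e K′ M)) (trans (fromℕᵠ-* (32 ℕ.* K′ ℕ.^ 4) M)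
      (cong (ℚ._* fromℕᵠ M) (trans (fromℕᵠ-* 32 (K′ ℕ.^ 4)) (cong (fromℕᵠ 32 ℚ.*_) (fromℕᵠ-^ K′ 4)))))

  -- If 8 q² ≤ n³, then n / 2 is an upper bound of q^(2/3), hence of n.
  cube< : ∀ {q} n → 0 ℕ.< n → ι n ≤ q ^[ 2 / 3 ] → n ℕ.* n ℕ.* n ℕ.< 8 ℕ.* (q ℕ.* q)
  cube< {q} n 0<n h = ℕ.≰⇒> λ 8q²≤n³ → 2*n≰n 0<n (fromℕᵠ-cancel-≤ (begin
    fromℕᵠ (2 ℕ.* n)                     ≡⟨ fromℕᵠ-* 2 n ⟩
    fromℕᵠ 2 ℚ.* fromℕᵠ n                ≤⟨ *-monoˡ {fromℕᵠ 2} (0≤fromℕᵠ 2) (h {fromℕᵠ n} {½ ℚ.* fromℕᵠ n} refl (0≤b , half 8q²≤n³)) ⟩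
    fromℕᵠ 2 ℚ.* (½ ℚ.* fromℕᵠ n)        ≡⟨ ℚ.*-assoc (fromℕᵠ 2) ½ (fromℕᵠ n) ⟨
    1ℚ ℚ.* fromℕᵠ n                      ≡⟨ ℚ.*-identityˡ (fromℕᵠ n) ⟩
    fromℕᵠ n                             ∎))
    where
    0≤b : 0ℚ ℚ.≤ ½ ℚ.* fromℕᵠ n
    0≤b = 0≤* (ℚ.nonNegative⁻¹ ½) (0≤fromℕᵠ n)
    e₁ : ∀ q → 8 ℕ.* (q ℕ.* q) ≡ 8 ℕ.* (q ℕ.* (q ℕ.* 1))
    e₁ = solve-∀
    e₂ : ∀ n → n ℕ.* n ℕ.* n ≡ n ℕ.* (n ℕ.* (n ℕ.* 1))
    e₂ = solve-∀
    half : 8 ℕ.* (q ℕ.* q) ℕ.≤ n ℕ.* n ℕ.* n → fromℕᵠ (q ℕ.^ 2) ℚ.≤ (½ ℚ.* fromℕᵠ n) ^ᵠ 3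
    half 8q²≤n³ = *-cancelˡ {fromℕᵠ 8} (0<fromℕᵠ 7) (begin
      fromℕᵠ 8 ℚ.* fromℕᵠ (q ℕ.^ 2)           ≡⟨ fromℕᵠ-* 8 (q ℕ.^ 2) ⟨
      fromℕᵠ (8 ℕ.* q ℕ.^ 2)                  ≡⟨ cong fromℕᵠ (e₁ q) ⟨
      fromℕᵠ (8 ℕ.* (q ℕ.* q))                ≤⟨ fromℕᵠ-mono 8q²≤n³ ⟩
      fromℕᵠ (n ℕ.* n ℕ.* n)                  ≡⟨ trans (cong fromℕᵠ (e₂ n)) (fromℕᵠ-^ n 3) ⟩
      fromℕᵠ n ^ᵠ 3                           ≡⟨ ℚ.*-identityˡ (fromℕᵠ n ^ᵠ 3) ⟨
      fromℕᵠ 8 ℚ.* ½ ^ᵠ 3 ℚ.* fromℕᵠ n ^ᵠ 3   ≡⟨ ℚ.*-assoc (fromℕᵠ 8) (½ ^ᵠ 3) (fromℕᵠ n ^ᵠ 3) ⟩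
      fromℕᵠ 8 ℚ.* (½ ^ᵠ 3 ℚ.* fromℕᵠ n ^ᵠ 3) ≡⟨ cong (fromℕᵠ 8 ℚ.*_) (*-^ᵠ ½ (fromℕᵠ n) 3) ⟨
      fromℕᵠ 8 ℚ.* (½ ℚ.* fromℕᵠ n) ^ᵠ 3      ∎)

  -- 1 / u is a lower bound of 1 / K.
  cube/≤ : ∀ K {{_ : Positive K}} {u} n E → Upper K u → 0ℚ ℚ.< u → ι n ^ 3 / K ≤ ι E →
           fromℕᵠ (n ℕ.* n ℕ.* n) ℚ.≤ u ℚ.* fromℕᵠ E
  cube/≤ K {u} n E u∈K 0<u h =
    let r , 0<r , ru≡1 = recip u 0<u
    in begin
      fromℕᵠ (n ℕ.* n ℕ.* n)                   ≡⟨ cong fromℕᵠ (e n) ⟩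
      fromℕᵠ (n ℕ.^ 3)                         ≡⟨ fromℕᵠ-^ n 3 ⟩
      fromℕᵠ n ^ᵠ 3                            ≡⟨ trans (cong (fromℕᵠ n ^ᵠ 3 ℚ.*_) ru≡1) (ℚ.*-identityʳ (fromℕᵠ n ^ᵠ 3)) ⟨
      fromℕᵠ n ^ᵠ 3 ℚ.* (r ℚ.* u)              ≡⟨ solve 3 (λ a b c → a ⊕ (b ⊕ c) ⊜ c ⊕ (a ⊕ b)) refl (fromℕᵠ n ^ᵠ 3) r u ⟩
      u ℚ.* (fromℕᵠ n ^ᵠ 3 ℚ.* r)              ≤⟨ *-monoˡ {u} (ℚ.<⇒≤ 0<u) (h {fromℕᵠ n ^ᵠ 3 ℚ.* r}
                                                    (fromℕᵠ n ^ᵠ 3 , r , Lower-^ (ι n) 3 refl , (ℚ.<⇒≤ 0<r , u , u∈K , ℚ.≤-reflexive ru≡1) , refl) refl) ⟩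
      u ℚ.* fromℕᵠ E                           ∎
    where
    e : ∀ n → n ℕ.* n ℕ.* n ≡ n ℕ.* (n ℕ.* (n ℕ.* 1))
    e = solve-∀

  1≤factor : ∀ {u m E} → 0ℚ ℚ.< u → 0 ℕ.< m → E ℕ.≤ m → fromℕᵠ m ℚ.≤ u ℚ.* fromℕᵠ E → 1ℚ ℚ.≤ u
  1≤factor {u} {m} {E} 0<u 0<m E≤m m≤uE = *-cancelʳ {fromℕᵠ m} {1ℚ} {u} (ℚ.<-≤-trans (0<fromℕᵠ 0) (fromℕᵠ-mono {1} {m} 0<m)) (begin
    1ℚ ℚ.* fromℕᵠ m        ≡⟨ ℚ.*-identityˡ (fromℕᵠ m) ⟩
    fromℕᵠ m               ≤⟨ m≤uE ⟩
    u ℚ.* fromℕᵠ E         ≤⟨ *-monoˡ {u} (ℚ.<⇒≤ 0<u) (fromℕᵠ-mono {E} {m} E≤m) ⟩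
    u ℚ.* fromℕᵠ m         ∎)

  round-factor : ∀ {u m K′ E} → u ℚ.≤ fromℕᵠ K′ → fromℕᵠ m ℚ.≤ u ℚ.* fromℕᵠ E → m ℕ.≤ K′ ℕ.* E
  round-factor {u} {m} {K′} {E} u≤K′ m≤uE = fromℕᵠ-cancel-≤ (begin
    fromℕᵠ m                          ≤⟨ m≤uE ⟩
    u ℚ.* fromℕᵠ E                    ≤⟨ *-monoʳ {fromℕᵠ E} (0≤fromℕᵠ E) u≤K′ ⟩
    fromℕᵠ K′ ℚ.* fromℕᵠ E            ≡⟨ fromℕᵠ-* K′ E ⟨
    fromℕᵠ (K′ ℕ.* E)                 ∎)

  32K′≤128l : ∀ {K′ l} → fromℕᵠ K′ ℚ.≤ fromℕᵠ 4 ℚ.* l → fromℕᵠ (32 ℕ.* K′) ℚ.≤ fromℕᵠ 128 ℚ.* l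
  32K′≤128l {K′} {l} K′≤4l = begin
    fromℕᵠ (32 ℕ.* K′)                      ≡⟨ fromℕᵠ-* 32 K′ ⟩
    fromℕᵠ 32 ℚ.* fromℕᵠ K′                 ≤⟨ *-monoˡ {fromℕᵠ 32} (0≤fromℕᵠ 32) K′≤4l ⟩
    fromℕᵠ 32 ℚ.* (fromℕᵠ 4 ℚ.* l)          ≡⟨ ℚ.*-assoc (fromℕᵠ 32) (fromℕᵠ 4) l ⟨
    fromℕᵠ 128 ℚ.* l                        ∎

  half-≤ : ∀ {c d g} → c ≡ 2 ℕ.* d → ½ ℚ.≤ g → fromℕᵠ d ℚ.≤ fromℕᵠ c ℚ.* (g ℚ.* 1ℚ)
  half-≤ {c} {d} {g} c≡2d ½≤g = begin
    fromℕᵠ d                                 ≡⟨ ℚ.*-identityˡ (fromℕᵠ d) ⟨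
    fromℕᵠ 2 ℚ.* ½ ℚ.* fromℕᵠ d              ≡⟨ solve 3 (λ a b c → (a ⊕ b) ⊕ c ⊜ (a ⊕ c) ⊕ b) refl (fromℕᵠ 2) ½ (fromℕᵠ d) ⟩
    fromℕᵠ 2 ℚ.* fromℕᵠ d ℚ.* ½              ≡⟨ cong (ℚ._* ½) (fromℕᵠ-* 2 d) ⟨
    fromℕᵠ (2 ℕ.* d) ℚ.* ½                   ≡⟨ cong (λ t → fromℕᵠ t ℚ.* ½) c≡2d ⟨
    fromℕᵠ c ℚ.* ½                           ≤⟨ *-monoˡ {fromℕᵠ c} (0≤fromℕᵠ c) ½≤g ⟩
    fromℕᵠ c ℚ.* g                           ≡⟨ cong (fromℕᵠ c ℚ.*_) (ℚ.*-identityʳ g) ⟨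
    fromℕᵠ c ℚ.* (g ℚ.* 1ℚ)                  ∎

opaque

  -- The constant is C = 2 d: it has to absorb log q ≥ 1/2 and, for a natural number
  -- K′ ≤ 4 K, the powers of 32 K′.
  d : ℕ
  d = 128 ℕ.^ 1504

  c : ℕ
  c = 2 ℕ.* d

  0<c : 0 ℕ.< c
  0<c = ℕ.<ᵇ⇒< 0 c _

  c≡2d : c ≡ 2 ℕ.* d
  c≡2d = refl

  128^1504≤d : 128 ℕ.^ 1504 ℕ.≤ d
  128^1504≤d = ℕ.≤-refl

  2*128^4≤d : 2 ℕ.* 128 ℕ.^ 4 ℕ.≤ d
  2*128^4≤d = ℕ.≤ᵇ⇒≤ (2 ℕ.* 128 ℕ.^ 4) d _

  2*128^85≤d : 2 ℕ.* 128 ℕ.^ 85 ℕ.≤ d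
  2*128^85≤d = ℕ.≤ᵇ⇒≤ (2 ℕ.* 128 ℕ.^ 85) d _

  64*4^85≤c : 64 ℕ.* 4 ℕ.^ 85 ℕ.≤ c
  64*4^85≤c = ℕ.≤ᵇ⇒≤ (64 ℕ.* 4 ℕ.^ 85) c _

open RationalBounds

C : ℝ≥0
C = ι c

C-positive : Positive C
C-positive = mkPositive {bound = fromℕᵠ c} refl (ℚ.<-≤-trans (0<fromℕᵠ 0) (fromℕᵠ-mono 0<c))

log-lower : ∀ {q} → 1 ℕ.< q → ∃ λ g → Lower (log q) g × ½ ℚ.≤ g
log-lower {q} 1<q = harmonic 1 (ℕ.pred q ℕ.* 1) , (0 , refl) , ½≤log 1<q

factor-lower : ∀ {q} → 1 ℕ.< q → ∃ λ e → Lower (C * log q ^ 1) e × fromℕᵠ d ℚ.≤ e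
factor-lower 1<q =
  let g , g∈ , ½≤g = log-lower 1<q
  in fromℕᵠ c ℚ.* (g ℚ.* 1ℚ) , (fromℕᵠ c , g ℚ.* 1ℚ , refl , (g , 1ℚ , g∈ , refl , refl) , refl)
     , half-≤ {c} {d} c≡2d ½≤g

0<d : 0ℚ ℚ.< fromℕᵠ d
0<d = ℚ.<-≤-trans (0<fromℕᵠ 0) (fromℕᵠ-mono (ℕ.≤-trans (ℕ.m^n>0 128 1504) 128^1504≤d))

density : ∀ {q n K′ M} {{_ : PrimePower q}} K {{_ : Positive K}} {l} → Lower K l → fromℕᵠ K′ ℚ.≤ fromℕᵠ 4 ℚ.* l →
          0 ℕ.< K′ → n ℕ.< 4 ℕ.* (8 ℕ.* (K′ ℕ.* K′ ℕ.* (K′ ℕ.* K′))) ℕ.* M →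
          (let instance _ = C-positive in C ⁻¹ * log q ⁻¹ ^ 1 * K ⁻¹ ^ 85 * ι n ≤ ι M)
density {q} {n} {suc K′} {M} {{pp}} K l∈K K′≤4l 0<K′ n<M
  (_ , _ , (_ , k , (x , _ , (0≤x , _ , refl , xc≤1) , (y , _ , (0≤y , v , v∈ , yv≤1) , refl , refl) , refl) , k∈ , refl) , refl , refl) refl =
  let r , 0<r , rK≡1 = recip (fromℕᵠ (suc K′)) (0<fromℕᵠ K′)
      g , g∈ , ½≤g   = log-lower (1<primePower pp)
  in density-≤ {x} {y} {k} {r} {c} {4 ℕ.^ 85} {suc K′} {n} {M} 0≤x 0≤y (nonNeg (K ⁻¹ ^ 85) k∈) (ℚ.<⇒≤ 0<r) xc≤1
       (x≤2 0≤y (ℚ.≤-trans ½≤g (ordered (log q) g∈ v∈)) yv≤1)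
       (inverse-power-≤ K {b = 4} {K′ = suc K′} 85 4 l∈K K′≤4l (ℚ.<⇒≤ 0<r) rK≡1
         (^-shrink (ℚ.<⇒≤ 0<r) (reciprocal≤1 {K′ = suc K′} 0<K′ (ℚ.<⇒≤ 0<r) rK≡1) 81 4) k∈) rK≡1 64*4^85≤c n<M

-- Reduction of the real hypotheses to inequalities of natural numbers.

module Reduction
  (q : ℕ) {{pp : PrimePower q}} (𝔽 : FiniteField q) (A X : Subset q)
  (0∉X : Subsets.ExcludesZero 𝔽 X) (K : ℝ≥0) {{K>0 : Positive K}} (rounded : RoundedUp K)
  {e : ℚ} (e∈ : Lower (C * log q ^ 1) e) (d≤e : fromℕᵠ d ℚ.≤ e)
  (h₁ : C * log q ^ 1 * K ^ 1504 ≤ ι ∣ X ∣)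
  (h₂ : C * log q ^ 1 * q ^[ 1 / 4 ] * K ^ 4 ≤ ι ∣ X ∣)
  (h₃ : ι ∣ X ∣ < q ^[ 1 / 2 ])
  (h₄ : C * log q ^ 1 * q ^[ 1 / 2 ] * K ^ 85 ≤ ι ∣ A ∣)
  (h₅ : ι ∣ A ∣ ≤ q ^[ 2 / 3 ])
  (h₆ : (ξ : FiniteField.Carrier 𝔽) → Subsets._∈_ 𝔽 ξ X → ι ∣ A ∣ ^ 3 / K ≤ ι (Subsets.energy 𝔽 A ξ))
  where

  open RoundedUp rounded public
  open Transport 𝔽 using (Plane; concentrated-plane; energy≤; nonzero)
  open FiniteField 𝔽 using (from; enumeration)
  open Subsets 𝔽 using (_∈_; energy)

  private
    n N : ℕ
    n = ∣ A ∣
    N = ∣ X ∣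

    1<q : 1 ℕ.< q
    1<q = 1<primePower pp

    -- Two lower bounds of K are in use. The one that comes with `Positive K` is nonzero and shows
    -- that A and X are nonempty; l is close to K but may still be 0 at this point.
    module L₀ = LowerBounds (C * log q ^ 1) K e∈ (Positive.isLower K>0)
    module L = LowerBounds (C * log q ^ 1) K e∈ l∈K

    0<e : 0ℚ ℚ.< e
    0<e = ℚ.<-≤-trans 0<d d≤e

    0<N : 0 ℕ.< N
    0<N = L₀.product-positive 0<e (Positive.0<bound K>0) 1504 N h₁

    0<n : 0 ℕ.< n
    0<n = L₀.root-product-positive 0<e (Positive.0<bound K>0) q 1 85 n (ℕ.<⇒≤ 1<q) h₄

    n³≤uE : ∀ ξ → ξ ∈ X → fromℕᵠ (n ℕ.* n ℕ.* n) ℚ.≤ u ℚ.* fromℕᵠ (energy A ξ)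
    n³≤uE ξ ξ∈ = cube/≤ K n (energy A ξ) u∈K 0<u (h₆ ξ ξ∈)

    0<n³ : 0 ℕ.< n ℕ.* n ℕ.* n
    0<n³ = ℕ.*-mono-≤ (ℕ.*-mono-≤ 0<n 0<n) 0<n

    member : ∃ λ ξ → ξ ∈ X
    member =
      let x , x∈ = nonempty X 0<N
      in from x , subst (Sub._∈ X) (sym (Inverse.strictlyInverseˡ enumeration x)) x∈

    -- X has an element ξ, and n³ ≤ u E(A, ξA) ≤ u n³.
    1≤u : 1ℚ ℚ.≤ u
    1≤u =
      let ξ , ξ∈ = member
      in 1≤factor {E = energy A ξ} 0<u 0<n³ (energy≤ A ξ (nonzero 0∉X ξ∈)) (n³≤uE ξ ξ∈)

  rounded-≤ : fromℕᵠ K′ ℚ.≤ fromℕᵠ 4 ℚ.* l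
  rounded-≤ = K′≤4l 1≤u

  private
    κ≤ : fromℕᵠ (32 ℕ.* K′) ℚ.≤ fromℕᵠ 128 ℚ.* l
    κ≤ = 32K′≤128l {K′} {l} rounded-≤

    0<κ : 0 ℕ.< 32 ℕ.* K′
    0<κ = ℕ.≤-trans 0<K′ (ℕ.m≤m+n K′ _)

    large : (32 ℕ.* K′) ℕ.^ 1504 ℕ.≤ N
    large = L.power-≤ {128} {d} {32 ℕ.* K′} d≤e κ≤ 1504 N 128^1504≤d h₁

    -- Raising to the fourth power removes the root q^(1/4) and turns K⁴ into K¹⁶; in the same way
    -- K⁸⁵ becomes K¹⁷⁰ in `large″`.
    large′ : q ℕ.* (32 ℕ.* K′) ℕ.^ 16 ℕ.< N ℕ.* N ℕ.* (N ℕ.* N)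
    large′ = subst (q ℕ.* (32 ℕ.* K′) ℕ.^ 16 ℕ.<_) (e₄ N)
      (L.root-power-< {128} {d} {32 ℕ.* K′} d≤e κ≤ q 3 4 N 0<κ 2*128^4≤d 0<N h₂)
      where
      e₄ : ∀ n → n ℕ.* (n ℕ.* (n ℕ.* (n ℕ.* 1))) ≡ n ℕ.* n ℕ.* (n ℕ.* n)
      e₄ = solve-∀

    large″ : q ℕ.* (32 ℕ.* K′) ℕ.^ 170 ℕ.< n ℕ.* n
    large″ = subst (q ℕ.* (32 ℕ.* K′) ℕ.^ 170 ℕ.<_) (cong (n ℕ.*_) (ℕ.*-identityʳ n))
      (L.root-power-< {128} {d} {32 ℕ.* K′} d≤e κ≤ q 1 85 n 0<κ 2*128^85≤d 0<n h₄)

    energies : ∀ ξ → ξ ∈ X → n ℕ.* n ℕ.* n ℕ.≤ K′ ℕ.* energy A ξ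
    energies ξ ξ∈ = round-factor {K′ = K′} u≤K′ (n³≤uE ξ ξ∈)

  plane : Plane A (4 ℕ.* (8 ℕ.* (K′ ℕ.* K′ ℕ.* (K′ ℕ.* K′))))
  plane = concentrated-plane A X K′ 0<K′ 0∉X large large′ (square<q N h₃) large″ (cube< {q} n 0<n h₅) energies

corollary1 :
    Σ ℝ≥0 λ C → Σ (Positive C) λ 0<C → Σ ℕ λ k → 0 ℕ.< k ×
    let instance _ = 0<C in
    ((q : ℕ) {{_ : PrimePower q}} (𝔽 : FiniteField q) →
     let open FiniteField 𝔽 using (Carrier)
         open Subsets 𝔽 in
     (A X : Subset q) → ExcludesZero A → ExcludesZero X →
     (K : ℝ≥0) {{_ : Positive K}} →
     C * log q ^ k * K ^ 1504 ≤ ι ∣ X ∣ →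
     C * log q ^ k * q ^[ 1 / 4 ] * K ^ 4 ≤ ι ∣ X ∣ →
     ι ∣ X ∣ < q ^[ 1 / 2 ] →
     C * log q ^ k * q ^[ 1 / 2 ] * K ^ 85 ≤ ι ∣ A ∣ →
     ι ∣ A ∣ ≤ q ^[ 2 / 3 ] →
     ((ξ : Carrier) → ξ ∈ X → ι ∣ A ∣ ^ 3 / K ≤ ι (energy A ξ)) →
     Σ (Subset q) λ F → IsSubfield F × ι ∣ F ∣ ≃ q ^[ 1 / 3 ] ×
     Σ Carrier λ ā → ā ∈ A ×
     Σ (Subset q) λ V → HasDimension F V 2 ×
     C ⁻¹ * log q ⁻¹ ^ k * K ⁻¹ ^ 85 * ι ∣ A ∣ ≤ ι ∣ (A ⊖ ā) ∩ V ∣)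
-- k = 1: the logarithm enters through log q ≥ 1/2, which the factor 2 in C = 2d compensates.
corollary1 = C , C-positive , 1 , s≤s z≤n , λ q {{pp}} 𝔽 A X _ 0∉X K h₁ h₂ h₃ h₄ h₅ h₆ →
  let e , e∈ , d≤e = factor-lower (1<primePower pp)
      open Reduction q 𝔽 A X 0∉X K (roundUp K) e∈ d≤e h₁ h₂ h₃ h₄ h₅ h₆
      open Transport.Plane plane
  in F , isSubfield , cube-root ∣ F ∣ ∣F∣³≡q , ā , ā∈A , V , hasDimension ,
     density {K′ = K′} {M = ∣ Subsets._⊖_ 𝔽 A ā ∩ V ∣} K l∈K rounded-≤ 0<K′ many
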